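{- Let $G=(V,E)$ be a finite directed graph with $n=|V|$ vertices and $m=|E|$ edges, capacities $c:E\to\mathbb{R}_{>0}$, edge lengths $\ell:E\to\mathbb{Z}_{\ge1}$, distinct vertices $s,t\in V$, and a positive integer $L$, such that $\mathcal{P}^\ell_L\neq\emptyset$. For every $0<\varepsilon\le 1$ there is an algorithm that computes a feasible $L$-bounded flow (with respect to $\ell$) of value at least $\mathrm{OPT}/(1+\varepsilon)$, where $\mathrm{OPT}$ is the maximum value of such a flow. Its running time is $\mathcal{O}\!\left(\frac{m^2n}{\varepsilon^2}\log L\,(\log\log n+\frac1\varepsilon)\right)$.
   Context: $\mathcal{P}^\ell_L$ denotes the set of directed simple $s$-$t$ paths $P$ with $\ell(P)=\sum_{e\in P}\ell(e)\le L$. An $L$-bounded flow (with respect to $\ell$) is a function $x:\mathcal{P}^\ell_L\to\mathbb{R}_{\ge0}$, with value $\sum_P x(P)$. It is feasible if $\sum_{P\ni e}x(P)\le c(e)$ for every $e\in E$. -}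

module Defs where

open import Algebra.Structures using (IsCommutativeRing)
open import Data.Bool using (Bool; true; false; if_then_else_; not; _∧_)
open import Data.Fin using (Fin; toℕ)
import Data.Fin.Properties as Fin
open import Data.Irrelevant using ([_])
open import Data.List using (List; []; _∷_; map; foldr; filter; mapMaybe; cartesianProductWith;
                             allFin; applyUpTo; upTo)
import Data.List as List
import Data.Nat.ListAction as ℕ
open import Data.List.Membership.Propositional using (_∈_)
open import Data.List.Membership.Propositional.Properties
  using (∈-cartesianProductWith⁺; ∈-cartesianProductWith⁻; ∈-allFin)
import Data.List.Membership.DecPropositional as DecMembership
import Data.List.Properties as List
open import Data.List.Relation.Unary.All using (All; []; _∷_)
import Data.List.Relation.Unary.All as All
open import Data.List.Relation.Unary.Any using (here; there)
open import Data.List.Relation.Unary.AllPairs using ([]; _∷_)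
open import Data.List.Relation.Unary.Unique.Propositional using (Unique)
import Data.List.Relation.Unary.Unique.Propositional.Properties as Unique
import Data.List.Relation.Unary.Unique.DecPropositional as DecUnique
open import Data.Maybe using (Maybe; just; nothing)
open import Data.Nat using (ℕ; zero; suc; z≤n; s≤s)
import Data.Nat as ℕ
import Data.Nat.Properties as ℕ
open import Data.Nat.Logarithm using (⌈log₂_⌉)
open import Data.Product using (∃; ∃-syntax; _×_; _,_; proj₂)
open import Data.Refinement using (Refinement-syntax; _,_; value)
open import Relation.Binary.PropositionalEquality using (_≡_; _≢_; refl; cong)
open import Relation.Binary.Structures using (IsDecTotalOrder)
open import Relation.Nullary using (¬_; Dec; yes; no; contradiction; recompute; does; _×-dec_)

-- The classical real numbers: a Dedekind-complete ordered field with decidable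
-- order.  Classically ℝ is, up to isomorphism, the only instance.
record RealNumbers : Set₁ where
  infix  4 _≈_ _≤_ _<_
  infixl 6 _+_ _-_
  infixl 7 _*_
  infix  8 -_
  infix  9 _⁻¹
  field
    ℝ     : Set
    _≈_   : ℝ → ℝ → Set
    _≤_   : ℝ → ℝ → Set
    _+_   : ℝ → ℝ → ℝ
    _*_   : ℝ → ℝ → ℝ
    -_    : ℝ → ℝ
    0#    : ℝ
    1#    : ℝ
    _⁻¹   : ℝ → ℝ

    isCommutativeRing : IsCommutativeRing _≈_ _+_ _*_ -_ 0# 1#
    isDecTotalOrder   : IsDecTotalOrder _≈_ _≤_

    1≉0        : ¬ (1# ≈ 0#)
    ⁻¹-inverse : ∀ x → ¬ (x ≈ 0#) → x * x ⁻¹ ≈ 1#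
    -- Junk value, only so that the total operation _⁻¹ respects _≈_.
    ⁻¹-zero    : ∀ x → x ≈ 0# → x ⁻¹ ≈ 0#

    +-monoʳ-≤ : ∀ z {x y} → x ≤ y → z + x ≤ z + y
    *-nonNeg  : ∀ {x y} → 0# ≤ x → 0# ≤ y → 0# ≤ x * y

    sup : (S : ℝ → Set) → ∃ S → (∃[ b ] ∀ x → S x → x ≤ b) →
          ∃[ u ] (∀ x → S x → x ≤ u) × (∀ b → (∀ x → S x → x ≤ b) → u ≤ b)

  open IsDecTotalOrder isDecTotalOrder public using (_≤?_)

  _<_ : ℝ → ℝ → Set
  x < y = x ≤ y × ¬ (x ≈ y)

  _-_ : ℝ → ℝ → ℝ
  x - y = x + - y

  fromℕ : ℕ → ℝ
  fromℕ zero    = 0#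
  fromℕ (suc n) = 1# + fromℕ n

  0<_≤1 : ℝ → Set
  0< x ≤1 = 0# < x × x ≤ 1#

  sum : {A : Set} → List A → (A → ℝ) → ℝ
  sum xs f = foldr _+_ 0# (map f xs)


module _ (R : RealNumbers) where
  open RealNumbers R

  -- A length-bounded flow instance.  The graph is simple: E ⊆ V × V.
  record Network : Set where
    field
      n m : ℕ

    V = Fin n
    E = Fin m

    field
      src tgt       : E → V
      edge-distinct : ∀ {e f} → src e ≡ src f → tgt e ≡ tgt f → e ≡ f
      c             : E → ℝ
      c-positive    : ∀ e → 0# < c e
      ℓ             : E → ℕ
      ℓ-positive    : ∀ e → 1 ℕ.≤ ℓ e
      s t           : V
      s≢t           : s ≢ t
      L             : ℕ
      L-positive    : 1 ℕ.≤ L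


module Flows {R : RealNumbers} (N : Network R) where
  open RealNumbers R
  open Network N

  IsWalk : V → V → List E → Set
  IsWalk u v []      = u ≡ v
  IsWalk u v (e ∷ P) = src e ≡ u × IsWalk (tgt e) v P

  -- s ∷ map tgt P is the sequence of vertices visited by a walk P from s.
  IsSimplePath : List E → Set
  IsSimplePath P = IsWalk s t P × Unique (s ∷ map tgt P)

  len : List E → ℕ
  len P = ℕ.sum (map ℓ P)

  IsBoundedPath : List E → Set
  IsBoundedPath P = IsSimplePath P × len P ℕ.≤ L

  -- The membership proof is irrelevant, so two elements with the same edge sequence
  -- are equal.
  𝒫 : Set
  𝒫 = [ P ∈ List E ∣ IsBoundedPath P ]

  edges : 𝒫 → List E
  edges = value

  isWalk? : ∀ u v P → Dec (IsWalk u v P)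
  isWalk? u v []      = u Fin.≟ v
  isWalk? u v (e ∷ P) = src e Fin.≟ u ×-dec isWalk? (tgt e) v P

  isBoundedPath? : ∀ P → Dec (IsBoundedPath P)
  isBoundedPath? P =
    (isWalk? s t P ×-dec DecUnique.unique? Fin._≟_ (s ∷ map tgt P)) ×-dec (len P ℕ.≤? L)

  edgeLists : ℕ → List (List E)
  edgeLists zero    = [] ∷ []
  edgeLists (suc k) = [] ∷ cartesianProductWith _∷_ (allFin m) (edgeLists k)

  toPath? : List E → Maybe 𝒫
  toPath? P with isBoundedPath? P
  ... | yes p = just (P , [ p ])
  ... | no  _ = nothing

  -- The elements of 𝒫, each listed exactly once (allPaths-complete,
  -- allPaths-unique).  Edge lists with at most L edges suffice as ℓ ≥ 1.
  allPaths : List 𝒫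
  allPaths = mapMaybe toPath? (edgeLists L)

  _∋?_ : (P : 𝒫) (e : E) → Dec (e ∈ edges P)
  P ∋? e = DecMembership._∈?_ Fin._≟_ e (edges P)

  through : E → List 𝒫
  through e = filter (_∋? e) allPaths

  record Flow : Set where
    field
      amount      : 𝒫 → ℝ
      nonNegative : ∀ P → 0# ≤ amount P

  open Flow public

  flowValue : Flow → ℝ
  flowValue x = sum allPaths (amount x)

  Feasible : Flow → Set
  Feasible x = ∀ e → sum (through e) (amount x) ≤ c e

  IsMaximumValue : ℝ → Set
  IsMaximumValue opt =
    (∃[ x ] Feasible x × flowValue x ≈ opt) ×
    (∀ x → Feasible x → flowValue x ≤ opt)

  ValueAtLeastOPT/1+ : ℝ → Flow → Set
  ValueAtLeastOPT/1+ ε x =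
    ∀ opt → IsMaximumValue opt → opt * (1# + ε) ⁻¹ ≤ flowValue x

  private
    ∈-edgeLists : ∀ k P → List.length P ℕ.≤ k → P ∈ edgeLists k
    ∈-edgeLists zero    []      _       = here refl
    ∈-edgeLists (suc k) []      _       = here refl
    ∈-edgeLists (suc k) (e ∷ P) (s≤s p) =
      there (∈-cartesianProductWith⁺ _∷_ (∈-allFin e) (∈-edgeLists k P p))

    edgeLists-unique : ∀ k → Unique (edgeLists k)
    edgeLists-unique zero    = [] ∷ []
    edgeLists-unique (suc k) =
      All.tabulate nonempty ∷
      Unique.cartesianProductWith⁺ _∷_ List.∷-injective
        (Unique.allFin⁺ m) (edgeLists-unique k)
      where
      nonempty : ∀ {P} → P ∈ cartesianProductWith _∷_ (allFin m) (edgeLists k) → [] ≢ P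
      nonempty P∈ refl with ∈-cartesianProductWith⁻ _∷_ (allFin m) (edgeLists k) P∈
      ... | _ , _ , _ , _ , ()

    length≤len : ∀ P → List.length P ℕ.≤ len P
    length≤len []      = z≤n
    length≤len (e ∷ P) = ℕ.+-mono-≤ (ℓ-positive e) (length≤len P)

    ∈-mapMaybe : ∀ (P : 𝒫) {Ps} → edges P ∈ Ps → P ∈ mapMaybe toPath? Ps
    ∈-mapMaybe (P , [ p ]) (here {xs = Ps} refl) with isBoundedPath? P
    ... | yes _ = here refl
    ... | no ¬p = contradiction (recompute (isBoundedPath? P) p) ¬p
    ∈-mapMaybe P {Q ∷ Ps} (there P∈) with isBoundedPath? Q
    ... | yes _ = there (∈-mapMaybe P P∈)
    ... | no  _ = ∈-mapMaybe P P∈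

    fresh : ∀ (P : 𝒫) Qs → All (edges P ≢_) Qs → All (P ≢_) (mapMaybe toPath? Qs)
    fresh P []       []          = []
    fresh P (Q ∷ Qs) (P≢Q ∷ all) with isBoundedPath? Q
    ... | yes _ = (λ eq → P≢Q (cong edges eq)) ∷ fresh P Qs all
    ... | no  _ = fresh P Qs all

    mapMaybe-unique : ∀ Ps → Unique Ps → Unique (mapMaybe toPath? Ps)
    mapMaybe-unique []       []            = []
    mapMaybe-unique (P ∷ Ps) (P≢ ∷ unique) with isBoundedPath? P
    ... | yes p = fresh (P , [ p ]) Ps P≢ ∷ mapMaybe-unique Ps unique
    ... | no  _ = mapMaybe-unique Ps unique

  allPaths-complete : ∀ P → P ∈ allPaths
  allPaths-complete (P , [ p ]) = ∈-mapMaybe (P , [ p ])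
    (∈-edgeLists L P (ℕ.≤-trans (length≤len P)
      (proj₂ (recompute (isBoundedPath? P) p))))

  allPaths-unique : Unique allPaths
  allPaths-unique = mapMaybe-unique (edgeLists L) (edgeLists-unique L)


-- Real RAM programs.  A store has arrays of natural numbers and arrays of reals,
-- addressed as (name , index).  Array names are fixed in the program text, indices
-- are computed.  There is no conversion of reals to integers, and integers have only
-- addition and truncated subtraction, so unit-cost arithmetic gives no extra power
-- through rounding or through repeated squaring of integers.
infix  6 _[_]ⁿ _[_]ʳ
infixl 5 _⊕_ _⊖_ _+ʳ_ _-ʳ_
infixl 6 _*ʳ_ _/ʳ_
infix  4 _<ⁿ_ _≤ʳ_
infix  3 _[_]≔ⁿ_ _[_]≔ʳ_
infixr 2 _⨾_

data NatExp : Set where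
  lit   : ℕ → NatExp
  _[_]ⁿ : ℕ → NatExp → NatExp
  _⊕_   : NatExp → NatExp → NatExp
  _⊖_   : NatExp → NatExp → NatExp

data RealExp : Set where
  int   : NatExp → RealExp
  _[_]ʳ : ℕ → NatExp → RealExp
  _+ʳ_  : RealExp → RealExp → RealExp
  _-ʳ_  : RealExp → RealExp → RealExp
  _*ʳ_  : RealExp → RealExp → RealExp
  _/ʳ_  : RealExp → RealExp → RealExp

data Cond : Set where
  _<ⁿ_ : NatExp → NatExp → Cond
  _≤ʳ_ : RealExp → RealExp → Cond
  notᶜ  : Cond → Cond
  _and_ : Cond → Cond → Cond

data Program : Set where
  skip    : Program
  _[_]≔ⁿ_ : ℕ → NatExp → NatExp → Program
  _[_]≔ʳ_ : ℕ → NatExp → RealExp → Program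
  _⨾_     : Program → Program → Program
  ifᶜ     : Cond → Program → Program → Program
  while   : Cond → Program → Program

update : {A : Set} → (ℕ → ℕ → A) → ℕ → ℕ → A → ℕ → ℕ → A
update f a i v b j = if (b ℕ.≡ᵇ a) ∧ (j ℕ.≡ᵇ i) then v else f b j

module Execution (R : RealNumbers) where
  open RealNumbers R

  record Store : Set where
    constructor store
    field
      nats  : ℕ → ℕ → ℕ
      reals : ℕ → ℕ → ℝ
  open Store public

  evalⁿ : Store → NatExp → ℕ
  evalⁿ σ (lit k)    = k
  evalⁿ σ (a [ i ]ⁿ) = nats σ a (evalⁿ σ i)
  evalⁿ σ (i ⊕ j)    = evalⁿ σ i ℕ.+ evalⁿ σ j
  evalⁿ σ (i ⊖ j)    = evalⁿ σ i ℕ.∸ evalⁿ σ j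

  evalʳ : Store → RealExp → ℝ
  evalʳ σ (int i)    = fromℕ (evalⁿ σ i)
  evalʳ σ (a [ i ]ʳ) = reals σ a (evalⁿ σ i)
  evalʳ σ (x +ʳ y)   = evalʳ σ x + evalʳ σ y
  evalʳ σ (x -ʳ y)   = evalʳ σ x - evalʳ σ y
  evalʳ σ (x *ʳ y)   = evalʳ σ x * evalʳ σ y
  evalʳ σ (x /ʳ y)   = evalʳ σ x * evalʳ σ y ⁻¹

  evalᶜ : Store → Cond → Bool
  evalᶜ σ (i <ⁿ j)  = evalⁿ σ i ℕ.<ᵇ evalⁿ σ j
  evalᶜ σ (x ≤ʳ y)  = does (evalʳ σ x ≤? evalʳ σ y)
  evalᶜ σ (notᶜ b)  = not (evalᶜ σ b)
  evalᶜ σ (b and d) = evalᶜ σ b ∧ evalᶜ σ d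

  -- Run p σ T σ′: started in σ, the program p halts in σ′ after T steps.  A step is
  -- one assignment or one evaluation of a condition; the expressions of a fixed
  -- program have constant size, so this counts elementary operations up to a
  -- constant factor.
  data Run : Program → Store → ℕ → Store → Set where
    skip : ∀ {σ} → Run skip σ 1 σ

    assignⁿ : ∀ {σ a i v} →
      Run (a [ i ]≔ⁿ v) σ 1 (store (update (nats σ) a (evalⁿ σ i) (evalⁿ σ v)) (reals σ))

    assignʳ : ∀ {σ a i v} →
      Run (a [ i ]≔ʳ v) σ 1 (store (nats σ) (update (reals σ) a (evalⁿ σ i) (evalʳ σ v)))

    seq : ∀ {p q σ σ′ σ″ T U} →
      Run p σ T σ′ → Run q σ′ U σ″ → Run (p ⨾ q) σ (T ℕ.+ U) σ″

    if-true : ∀ {b p q σ σ′ T} →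
      evalᶜ σ b ≡ true → Run p σ T σ′ → Run (ifᶜ b p q) σ (suc T) σ′

    if-false : ∀ {b p q σ σ′ T} →
      evalᶜ σ b ≡ false → Run q σ T σ′ → Run (ifᶜ b p q) σ (suc T) σ′

    while-true : ∀ {b p σ σ′ σ″ T U} →
      evalᶜ σ b ≡ true → Run p σ T σ′ → Run (while b p) σ′ U σ″ →
      Run (while b p) σ (suc (T ℕ.+ U)) σ″

    while-false : ∀ {b p σ} →
      evalᶜ σ b ≡ false → Run (while b p) σ 1 σ


module InputOutput {R : RealNumbers} (N : Network R) where
  open RealNumbers R
  open Network N
  open Flows N
  open Execution R

  at : {A : Set} → A → List A → ℕ → A
  at d []       _       = d
  at d (x ∷ _)  zero    = x
  at d (_ ∷ xs) (suc i) = at d xs i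

  -- Integer array 0 is n, m, s, t, L; integer arrays 1, 2, 3 are src, tgt, ℓ; real
  -- array 0 is ε and real array 1 is c.  All other cells are 0.
  inputStore : ℝ → Store
  inputStore ε = store inNats inReals
    where
    inNats : ℕ → ℕ → ℕ
    inNats 0 = at 0 (n ∷ m ∷ toℕ s ∷ toℕ t ∷ L ∷ [])
    inNats 1 = at 0 (map (λ e → toℕ (src e)) (allFin m))
    inNats 2 = at 0 (map (λ e → toℕ (tgt e)) (allFin m))
    inNats 3 = at 0 (map ℓ (allFin m))
    inNats _ = λ _ → 0

    inReals : ℕ → ℕ → ℝ
    inReals 0 = at 0# (ε ∷ [])
    inReals 1 = at 0# (map c (allFin m))
    inReals _ = λ _ → 0#

  -- A flow is output as a list of paths with amounts, x(P) being the sum of the amounts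
  -- listed with P (hence 0 if P is not listed).  Cell 0 of integer array 4 is the
  -- number of entries; the edges of the j-th path are the cells of integer array 6
  -- from position start(j) up to but excluding start(j + 1), where start is integer
  -- array 5; its amount is cell j of real array 2.
  entryCount : Store → ℕ
  entryCount σ = nats σ 4 0

  entryPath : Store → ℕ → List ℕ
  entryPath σ j =
    applyUpTo (λ i → nats σ 6 (start j ℕ.+ i)) (start (suc j) ℕ.∸ start j)
    where
    start : ℕ → ℕ
    start = nats σ 5

  entryAmount : Store → ℕ → ℝ
  entryAmount σ = reals σ 2

  edgeNumbers : 𝒫 → List ℕ
  edgeNumbers P = map toℕ (edges P)

  entriesOf : Store → 𝒫 → List ℕ
  entriesOf σ P =
    filter (λ j → List.≡-dec ℕ._≟_ (entryPath σ j) (edgeNumbers P)) (upTo (entryCount σ))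

  Outputs : Store → Flow → Set
  Outputs σ x =
    (∀ j → j ℕ.< entryCount σ → ∃[ P ] entryPath σ j ≡ edgeNumbers P) ×
    (∀ P → amount x P ≈ sum (entriesOf σ P) (entryAmount σ))

  -- (m² n / ε²) · log L · (log log n + 1/ε).  Logarithms are to base 2, rounded up,
  -- which changes log log n + 1/ε only by a constant factor since 1/ε ≥ 1.  log L is
  -- read as log (1 + L): the same up to a constant factor for L ≥ 2, and it does not
  -- degenerate to a bound of zero steps at L = 1.
  runningTimeBound : ℝ → ℝ
  runningTimeBound ε =
    fromℕ m * fromℕ m * fromℕ n * (ε * ε) ⁻¹
      * fromℕ ⌈log₂ (1 ℕ.+ L) ⌉
      * (fromℕ ⌈log₂ ⌈log₂ n ⌉ ⌉ + ε ⁻¹)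

  StepsWithin : ℕ → ℝ → ℕ → Set
  StepsWithin C ε T = fromℕ T ≤ fromℕ C * runningTimeBound ε

{-# OPTIONS --safe #-}
-- The approximation is a width-reduced multiplicative-weights algorithm in the style of Garg and
-- Könemann. Every edge e has a weight y_e, initially 1, and α is a lower bound (up to rounding) on the
-- weight of the lightest s-t path of length at most L. As long as such a path has weight about α, flow is
-- sent along it, and an edge becomes heavier by the factor 1 + 1/q whenever it has received c_e units;
-- otherwise α grows by the same factor. Comparing Σ_e y_e c_e with α by weak duality bounds the optimum.
-- Light paths of bounded length are found by dynamic programming over weights rounded to the integers
-- 1, …, O(nq), where the table entry is the least length.
--
-- The algorithm needs a natural number q with q ε ≥ 8. Constructively, completeness only yields that the
-- multiples of ε are not bounded, so a search for q cannot be shown to halt by itself. It is therefore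
-- dovetailed with an exact algorithm, whose loops tick a clock and stop once clock · ε ≥ 8. If
-- the clock expires, its value is q. Otherwise the exact algorithm has finished in time O(1/ε) and its
-- output is optimal.
--
-- The exact algorithm enumerates certificates: a flow whose amounts are rational combinations of the
-- capacities, together with an integral dual solution of the same value. Strong duality, proved by
-- Fourier–Motzkin elimination, which is constructive because the order is decidable, provides one.
module Submission where

import Data.Nat as ℕ
open import Data.Nat using (ℕ)
open import Defs
open import Data.Bool using (Bool; false; if_then_else_; not; true; _∧_; _∨_)
open import Data.Bool.Properties using (T-≡)
open import Data.Fin using (Fin; fromℕ<; suc; toℕ; zero)
import Data.Fin.Properties as Fin
open import Data.Irrelevant using ([_])
open import Data.List
  using (_++_; List; []; allFin; applyUpTo; cartesianProductWith; filter; length; lookup; map; tabulate; upTo; _∷_)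
import Data.List.Membership.DecPropositional as DecMembership
open import Data.List.Membership.Propositional using (_∈_; _∉_)
open import Data.List.Membership.Propositional.Properties
  using (∈-++⁺ʳ; ∈-++⁺ˡ; ∈-++⁻; ∈-allFin; ∈-cartesianProductWith⁺; ∈-cartesianProductWith⁻; ∈-filter⁺; ∈-filter⁻; ∈-lookup; ∈-map⁺)
import Data.List.Properties as List
open import Data.List.Relation.Unary.All as All using (All; []; _∷_)
open import Data.List.Relation.Unary.AllPairs using ([]; _∷_)
open import Data.List.Relation.Unary.Any using (here; there)
open import Data.List.Relation.Unary.Unique.Propositional using (Unique)
import Data.List.Relation.Unary.Unique.Propositional.Properties as Unique
open import Data.Maybe using (Maybe; just; nothing)
open import Data.Nat.Induction using (<-wellFounded)
import Data.Nat.ListAction as ℕ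
open import Data.Nat.Logarithm using (⌈log₂_⌉; ⌈log₂⌉-mono-≤)
open import Data.Nat.Logarithm.Core using (⌈log2⌉)
open import Data.Nat.Solver using (module +-*-Solver)
open import Data.Nat.Tactic.RingSolver using (solve-∀)
open import Data.Product using (_,_; proj₁; proj₂; _×_; ∃-syntax)
open import Data.Refinement using (_,_; value)
open import Data.Sum using (inj₁; inj₂; _⊎_)
open import Data.Unit using (tt; ⊤)
open import Function using (Equivalence; id; _∘_)
open import Induction.WellFounded using (Acc; acc)
open import Level using (0ℓ)
open import Relation.Binary.Definitions using (DecidableEquality; tri<; tri>; tri≈)
open import Relation.Binary.PropositionalEquality
  using (cong; cong₂; refl; subst; subst₂; sym; trans; _≡_; _≢_)
open import Relation.Binary.Structures using (IsDecTotalOrder)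
open import Relation.Nullary using (Dec; contradiction; does; no; recompute; yes; ¬_)
open import Relation.Nullary.Decidable using (map′)
open import Relation.Unary using (Decidable; Pred)

module RealArithmetic (R : RealNumbers) where
  open import Algebra.Bundles using (CommutativeRing; RawRing)
  import Algebra.Properties.Ring
  import Algebra.Solver.Ring
  open import Algebra.Solver.Ring.AlmostCommutativeRing using (fromCommutativeRing; _-Raw-AlmostCommutative⟶_)
  import Algebra.Solver.Ring.NaturalCoefficients.Default
  open import Data.Nat as ℕ using (ℕ; zero; suc)
  import Data.Nat.Properties as ℕ

  open RealNumbers R public

  commutativeRing : CommutativeRing 0ℓ 0ℓ
  commutativeRing = record { isCommutativeRing = isCommutativeRing }

  open CommutativeRing commutativeRing public
    using ( +-cong; *-cong; -‿cong; +-assoc; +-comm; *-assoc; *-comm; +-identityˡ; +-identityʳ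
          ; *-identityˡ; *-identityʳ; distribˡ; distribʳ; zeroˡ; zeroʳ; -‿inverseˡ; -‿inverseʳ
          ; setoid; +-congˡ; +-congʳ; *-congˡ; *-congʳ )
    renaming (refl to ≈-refl; sym to ≈-sym; trans to ≈-trans; reflexive to ≈-reflexive)
  open IsDecTotalOrder isDecTotalOrder public
    using ()
    renaming (refl to ≤-refl; trans to ≤-trans; antisym to ≤-antisym; total to ≤-total;
              reflexive to ≤-reflexive; ≤-respˡ-≈ to ≤-respˡ; ≤-respʳ-≈ to ≤-respʳ)

  private
    module SR = CommutativeRing commutativeRing
    open Algebra.Properties.Ring SR.ring using (-‿distribˡ-*; -‿distribʳ-*; -‿+-comm; -‿involutive; -0#≈0#)
    open import Relation.Binary.Reasoning.Setoid setoid

  fromℕ-+ : ∀ a b → fromℕ (a ℕ.+ b) ≈ fromℕ a + fromℕ b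
  fromℕ-+ zero b = ≈-sym (+-identityˡ _)
  fromℕ-+ (suc a) b = ≈-trans (+-congˡ (fromℕ-+ a b)) (≈-sym (+-assoc _ _ _))

  fromℕ-* : ∀ a b → fromℕ (a ℕ.* b) ≈ fromℕ a * fromℕ b
  fromℕ-* zero b = ≈-sym (zeroˡ _)
  fromℕ-* (suc a) b = begin
    fromℕ (b ℕ.+ a ℕ.* b)           ≈⟨ fromℕ-+ b (a ℕ.* b) ⟩
    fromℕ b + fromℕ (a ℕ.* b)       ≈⟨ +-cong (≈-sym (*-identityˡ _)) (fromℕ-* a b) ⟩
    1# * fromℕ b + fromℕ a * fromℕ b ≈⟨ distribʳ _ _ _ ⟨
    (1# + fromℕ a) * fromℕ b ∎

  -- Ring normalisation with integer coefficients, the pair (a , b) standing for a − b.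
  reduce : ℕ × ℕ → ℕ × ℕ
  reduce (a , b) = a ℕ.∸ b , b ℕ.∸ a

  private
    module NC = Algebra.Solver.Ring.NaturalCoefficients.Default SR.commutativeSemiring

    coefficients : RawRing 0ℓ 0ℓ
    coefficients = record
      { Carrier = ℕ × ℕ
      ; _≈_ = _≡_
      ; _+_ = λ (a , b) (a′ , b′) → reduce (a ℕ.+ a′ , b ℕ.+ b′)
      ; _*_ = λ (a , b) (a′ , b′) → reduce (a ℕ.* a′ ℕ.+ b ℕ.* b′ , a ℕ.* b′ ℕ.+ b ℕ.* a′)
      ; -_ = λ (a , b) → b , a
      ; 0# = 0 , 0
      ; 1# = 1 , 0 }

    difference : ℕ × ℕ → ℝ
    difference (a , b) = fromℕ a - fromℕ b

    interchange : ∀ a b c d → (a + b) + (c + d) ≈ (a + c) + (b + d)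
    interchange = NC.solve 4 (λ a b c d → ((a NC.:+ b) NC.:+ (c NC.:+ d)) NC.:= ((a NC.:+ c) NC.:+ (b NC.:+ d))) ≈-refl

    sub-mul : ∀ a b c d → (a * c + b * d) - (a * d + b * c) ≈ (a - b) * (c - d)
    sub-mul a b c d = ≈-sym (begin
      (a - b) * (c - d)                               ≈⟨ distribʳ _ _ _ ⟩
      a * (c - d) + - b * (c - d)                     ≈⟨ +-cong (distribˡ _ _ _) (distribˡ _ _ _) ⟩
      (a * c + a * - d) + (- b * c + - b * - d)       ≈⟨ +-cong (+-congˡ (≈-sym (-‿distribʳ-* a d)))
                                                          (+-cong (≈-sym (-‿distribˡ-* b c)) neg-neg) ⟩
      (a * c + - (a * d)) + (- (b * c) + b * d)       ≈⟨ +-congˡ (+-comm _ _) ⟩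
      (a * c + - (a * d)) + (b * d + - (b * c))       ≈⟨ interchange _ _ _ _ ⟩
      (a * c + b * d) + (- (a * d) + - (b * c))       ≈⟨ +-congˡ (-‿+-comm _ _) ⟩
      (a * c + b * d) - (a * d + b * c) ∎)
      where
      neg-neg : - b * - d ≈ b * d
      neg-neg = ≈-trans (≈-sym (-‿distribˡ-* b (- d))) (≈-trans (-‿cong (≈-sym (-‿distribʳ-* b d))) (-‿involutive _))

    -- Chosen so that the constants 0 and 1 of the solver are 0# and 1# on the nose.
    ⟦_⟧ᶜ : ℕ × ℕ → ℝ
    ⟦ 0 , 0 ⟧ᶜ           = 0#
    ⟦ 1 , 0 ⟧ᶜ           = 1#
    ⟦ suc (suc a) , 0 ⟧ᶜ = fromℕ (suc (suc a))
    ⟦ p ⟧ᶜ               = difference p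

    minus-0 : ∀ x → x ≈ x - 0#
    minus-0 x = ≈-sym (≈-trans (+-congˡ -0#≈0#) (+-identityʳ x))

    ⟦⟧ᶜ-difference : ∀ p → ⟦ p ⟧ᶜ ≈ difference p
    ⟦⟧ᶜ-difference (0 , 0)           = minus-0 _
    ⟦⟧ᶜ-difference (1 , 0)           = ≈-trans (≈-sym (+-identityʳ _)) (minus-0 _)
    ⟦⟧ᶜ-difference (suc (suc a) , 0) = minus-0 _
    ⟦⟧ᶜ-difference (0 , suc b)           = ≈-refl
    ⟦⟧ᶜ-difference (1 , suc b)           = ≈-refl
    ⟦⟧ᶜ-difference (suc (suc a) , suc b) = ≈-refl

    same-difference : ∀ x y x′ y′ → x + y′ ≈ x′ + y → x - y ≈ x′ - y′
    same-difference x y x′ y′ eq = begin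
      x + - y                    ≈⟨ +-identityʳ _ ⟨
      (x + - y) + 0#             ≈⟨ +-congˡ (-‿inverseʳ y′) ⟨
      (x + - y) + (y′ + - y′)    ≈⟨ interchange _ _ _ _ ⟩
      (x + y′) + (- y + - y′)    ≈⟨ +-congʳ eq ⟩
      (x′ + y) + (- y + - y′)    ≈⟨ +-congˡ (+-comm _ _) ⟩
      (x′ + y) + (- y′ + - y)    ≈⟨ interchange _ _ _ _ ⟩
      (x′ + - y′) + (y + - y)    ≈⟨ +-congˡ (-‿inverseʳ y) ⟩
      (x′ + - y′) + 0#           ≈⟨ +-identityʳ _ ⟩
      x′ + - y′ ∎

    difference-reduce : ∀ p → ⟦ reduce p ⟧ᶜ ≈ difference p
    difference-reduce (a , b) = ≈-trans (⟦⟧ᶜ-difference (reduce (a , b))) (same-difference _ _ _ _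
      (≈-trans (≈-sym (fromℕ-+ (a ℕ.∸ b) b)) (≈-trans (≈-reflexive (cong fromℕ sums)) (fromℕ-+ a (b ℕ.∸ a)))))
      where
      sums : a ℕ.∸ b ℕ.+ b ≡ a ℕ.+ (b ℕ.∸ a)
      sums with ℕ.≤-total a b
      ... | inj₁ a≤b = trans (cong (ℕ._+ b) (ℕ.m≤n⇒m∸n≡0 a≤b)) (sym (ℕ.m+[n∸m]≡n a≤b))
      ... | inj₂ b≤a = trans (ℕ.m∸n+n≡m b≤a) (sym (trans (cong (a ℕ.+_) (ℕ.m≤n⇒m∸n≡0 b≤a)) (ℕ.+-identityʳ a)))

    homomorphism : coefficients -Raw-AlmostCommutative⟶ fromCommutativeRing commutativeRing
    homomorphism = record
      { ⟦_⟧ = ⟦_⟧ᶜ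
      ; +-homo = λ { p@(a , b) p′@(a′ , b′) → begin
          ⟦ reduce (a ℕ.+ a′ , b ℕ.+ b′) ⟧ᶜ                     ≈⟨ difference-reduce (a ℕ.+ a′ , b ℕ.+ b′) ⟩
          fromℕ (a ℕ.+ a′) - fromℕ (b ℕ.+ b′)                   ≈⟨ +-cong (fromℕ-+ a a′) (-‿cong (fromℕ-+ b b′)) ⟩
          (fromℕ a + fromℕ a′) - (fromℕ b + fromℕ b′)           ≈⟨ +-congˡ (-‿+-comm _ _) ⟨
          (fromℕ a + fromℕ a′) + (- fromℕ b + - fromℕ b′)       ≈⟨ interchange _ _ _ _ ⟩
          (fromℕ a - fromℕ b) + (fromℕ a′ - fromℕ b′)           ≈⟨ +-cong (⟦⟧ᶜ-difference p) (⟦⟧ᶜ-difference p′) ⟨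
          ⟦ p ⟧ᶜ + ⟦ p′ ⟧ᶜ ∎ }
      ; *-homo = λ { p@(a , b) p′@(a′ , b′) → begin
          ⟦ reduce (a ℕ.* a′ ℕ.+ b ℕ.* b′ , a ℕ.* b′ ℕ.+ b ℕ.* a′) ⟧ᶜ
            ≈⟨ difference-reduce (a ℕ.* a′ ℕ.+ b ℕ.* b′ , a ℕ.* b′ ℕ.+ b ℕ.* a′) ⟩
          fromℕ (a ℕ.* a′ ℕ.+ b ℕ.* b′) - fromℕ (a ℕ.* b′ ℕ.+ b ℕ.* a′)
            ≈⟨ +-cong (two a a′ b b′) (-‿cong (two a b′ b a′)) ⟩
          (fromℕ a * fromℕ a′ + fromℕ b * fromℕ b′) - (fromℕ a * fromℕ b′ + fromℕ b * fromℕ a′)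
            ≈⟨ sub-mul _ _ _ _ ⟩
          (fromℕ a - fromℕ b) * (fromℕ a′ - fromℕ b′)
            ≈⟨ *-cong (⟦⟧ᶜ-difference p) (⟦⟧ᶜ-difference p′) ⟨
          ⟦ p ⟧ᶜ * ⟦ p′ ⟧ᶜ ∎ }
      ; -‿homo = λ { p@(a , b) → begin
          ⟦ b , a ⟧ᶜ              ≈⟨ ⟦⟧ᶜ-difference (b , a) ⟩
          fromℕ b - fromℕ a       ≈⟨ +-comm _ _ ⟩
          - fromℕ a + fromℕ b     ≈⟨ +-congˡ (-‿involutive _) ⟨
          - fromℕ a + - - fromℕ b ≈⟨ -‿+-comm _ _ ⟩
          - (fromℕ a - fromℕ b)   ≈⟨ -‿cong (⟦⟧ᶜ-difference p) ⟨
          - ⟦ p ⟧ᶜ ∎ }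
      ; 0-homo = ≈-refl
      ; 1-homo = ≈-refl }
      where
      two : ∀ a b c d → fromℕ (a ℕ.* b ℕ.+ c ℕ.* d) ≈ fromℕ a * fromℕ b + fromℕ c * fromℕ d
      two a b c d = ≈-trans (fromℕ-+ (a ℕ.* b) _) (+-cong (fromℕ-* a b) (fromℕ-* c d))

    coefficient-test : ∀ p p′ → Maybe (⟦ p ⟧ᶜ ≈ ⟦ p′ ⟧ᶜ)
    coefficient-test p@(a , b) p′@(a′ , b′) with a ℕ.+ b′ ℕ.≟ a′ ℕ.+ b
    ... | yes eq = just (≈-trans (⟦⟧ᶜ-difference p) (≈-trans (same-difference _ _ _ _ sums) (≈-sym (⟦⟧ᶜ-difference p′))))
      where
      sums : fromℕ a + fromℕ b′ ≈ fromℕ a′ + fromℕ b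
      sums = ≈-trans (≈-sym (fromℕ-+ a b′)) (≈-trans (≈-reflexive (cong fromℕ eq)) (fromℕ-+ a′ b))
    ... | no _ = nothing

  module Ring-Solver = Algebra.Solver.Ring coefficients (fromCommutativeRing commutativeRing) homomorphism coefficient-test
  open Ring-Solver public using (solve; _:=_; _:+_; _:*_; _:-_; :-_; con; Polynomial)

  infix 9 :#_
  :#_ : ∀ {k} → ℕ → Polynomial k
  :# n = con (n , 0)

  -- x ≤ y is proved by exhibiting the nonnegative difference d; the equation is left to the solver.
  ≤-by : ∀ {x y} d → 0# ≤ d → y ≈ x + d → x ≤ y
  ≤-by {x} {y} d 0≤d eq =
    ≤-respʳ (≈-sym eq) (≤-respˡ (+-identityʳ x) (+-monoʳ-≤ x 0≤d))

  x≤y⇒0≤y-x : ∀ {x y} → x ≤ y → 0# ≤ y - x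
  x≤y⇒0≤y-x {x} {y} x≤y =
    ≤-respˡ (-‿inverseˡ x) (≤-respʳ (+-comm (- x) y) (+-monoʳ-≤ (- x) x≤y))

  +-mono-≤ : ∀ {x y u v} → x ≤ y → u ≤ v → x + u ≤ y + v
  +-mono-≤ {x} {y} {u} {v} x≤y u≤v = ≤-trans (+-monoʳ-≤ x u≤v)
    (≤-respˡ (+-comm v x) (≤-respʳ (+-comm v y) (+-monoʳ-≤ v x≤y)))

  0≤+ : ∀ {x y} → 0# ≤ x → 0# ≤ y → 0# ≤ x + y
  0≤+ 0≤x 0≤y = ≤-respˡ (+-identityʳ 0#) (+-mono-≤ 0≤x 0≤y)

  *-monoʳ-≤ : ∀ z {x y} → 0# ≤ z → x ≤ y → z * x ≤ z * y
  *-monoʳ-≤ z {x} {y} 0≤z x≤y = ≤-by (z * (y - x)) (*-nonNeg 0≤z (x≤y⇒0≤y-x x≤y))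
    (solve 3 (λ x y z → z :* y := z :* x :+ z :* (y :- x)) ≈-refl x y z)

  *-mono-≤ : ∀ {x y u v} → 0# ≤ x → 0# ≤ u → x ≤ y → u ≤ v → x * u ≤ y * v
  *-mono-≤ {x} {y} {u} {v} 0≤x 0≤u x≤y u≤v = ≤-trans (*-monoʳ-≤ x 0≤x u≤v)
    (≤-respˡ (*-comm v x) (≤-respʳ (*-comm v y) (*-monoʳ-≤ v (≤-trans 0≤u u≤v) x≤y)))

  0≤1 : 0# ≤ 1#
  0≤1 with ≤-total 0# 1#
  ... | inj₁ 0≤1 = 0≤1
  ... | inj₂ 1≤0 = ≤-respʳ (solve 0 ((:# 0 :- :# 1) :* (:# 0 :- :# 1) := :# 1) ≈-refl)
                     (*-nonNeg (x≤y⇒0≤y-x 1≤0) (x≤y⇒0≤y-x 1≤0))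

  0<1 : 0# < 1#
  0<1 = 0≤1 , λ eq → 1≉0 (≈-sym eq)

  <-irrefl : ∀ {x} → ¬ (x < x)
  <-irrefl (_ , x≉x) = x≉x ≈-refl

  ≰⇒≥ : ∀ {x y} → ¬ (x ≤ y) → y ≤ x
  ≰⇒≥ {x} {y} x≰y with ≤-total x y
  ... | inj₁ x≤y = contradiction x≤y x≰y
  ... | inj₂ y≤x = y≤x

  <⇒≱ : ∀ {x y} → x < y → ¬ (y ≤ x)
  <⇒≱ (x≤y , x≉y) y≤x = x≉y (≤-antisym x≤y y≤x)

  ≰⇒> : ∀ {x y} → ¬ (x ≤ y) → y < x
  ≰⇒> x≰y = ≰⇒≥ x≰y , λ y≈x → x≰y (≤-reflexive (≈-sym y≈x))

  <-≤-trans : ∀ {x y z} → x < y → y ≤ z → x < z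
  <-≤-trans x<y y≤z = ≤-trans (proj₁ x<y) y≤z , λ x≈z → <⇒≱ x<y (≤-respʳ (≈-sym x≈z) y≤z)

  <-+-nonNeg : ∀ {x y} → 0# < x → 0# ≤ y → 0# < x + y
  <-+-nonNeg {x} {y} 0<x 0≤y = <-≤-trans 0<x (≤-by y 0≤y ≈-refl)

  0<* : ∀ {x y} → 0# < x → 0# < y → 0# < x * y
  0<* {x} {y} 0<x 0<y = *-nonNeg (proj₁ 0<x) (proj₁ 0<y) , λ eq → proj₂ 0<y (≈-sym (≈-trans (≈-sym y-formula) (≈-trans (*-congʳ (≈-sym eq)) (zeroˡ _))))
    where
    y-formula : (x * y) * x ⁻¹ ≈ y
    y-formula = ≈-trans (solve 3 (λ x y z → (x :* y) :* z := y :* (x :* z)) ≈-refl x y (x ⁻¹))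
      (≈-trans (*-congˡ (⁻¹-inverse x (λ x≈0 → proj₂ 0<x (≈-sym x≈0)))) (*-identityʳ y))

  *-cancelˡ-≤ : ∀ z {x y} → 0# < z → z * x ≤ z * y → x ≤ y
  *-cancelˡ-≤ z {x} {y} 0<z zx≤zy with x ≤? y
  ... | yes x≤y = x≤y
  ... | no x≰y = contradiction zx≤zy (<⇒≱ (proj₁ zy<zx , λ eq → proj₂ zy<zx eq))
    where
    0<x-y : 0# < x - y
    0<x-y = x≤y⇒0≤y-x (≰⇒≥ x≰y) , λ eq → x≰y (≤-by 0# ≤-refl
      (≈-trans (≈-trans (≈-sym (+-identityʳ y)) (≈-trans (+-congˡ eq) (solve 2 (λ x y → y :+ (x :- y) := x) ≈-refl x y)))
        (≈-sym (+-identityʳ x))))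
    zy<zx : z * y < z * x
    zy<zx = <-shift
      where
      p : 0# < z * (x - y)
      p = 0<* 0<z 0<x-y
      eq′ : z * x ≈ z * y + z * (x - y)
      eq′ = solve 3 (λ x y z → z :* x := z :* y :+ z :* (x :- y)) ≈-refl x y z
      <-shift : z * y < z * x
      <-shift = ≤-by _ (proj₁ p) eq′ , λ e → proj₂ p (≈-sym (≈-trans
        (solve 3 (λ x y z → z :* (x :- y) := z :* x :- z :* y) ≈-refl x y z)
        (≈-trans (+-congʳ (≈-sym e)) (-‿inverseʳ _))))

  ⁻¹-inverseˡ : ∀ {x} → 0# < x → x ⁻¹ * x ≈ 1#
  ⁻¹-inverseˡ {x} 0<x = ≈-trans (*-comm _ _) (⁻¹-inverse x (λ x≈0 → proj₂ 0<x (≈-sym x≈0)))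

  ⁻¹-inverseʳ : ∀ {x} → 0# < x → x * x ⁻¹ ≈ 1#
  ⁻¹-inverseʳ {x} 0<x = ⁻¹-inverse x (λ x≈0 → proj₂ 0<x (≈-sym x≈0))

  ⁻¹-nonNeg : ∀ {x} → 0# < x → 0# ≤ x ⁻¹
  ⁻¹-nonNeg {x} 0<x = *-cancelˡ-≤ x 0<x
    (≤-respˡ (≈-sym (zeroʳ x)) (≤-respʳ (≈-sym (⁻¹-inverseʳ 0<x)) 0≤1))

  fromℕ-nonNeg : ∀ k → 0# ≤ fromℕ k
  fromℕ-nonNeg zero = ≤-refl
  fromℕ-nonNeg (suc k) = 0≤+ 0≤1 (fromℕ-nonNeg k)

  fromℕ-mono : ∀ {j k} → j ℕ.≤ k → fromℕ j ≤ fromℕ k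
  fromℕ-mono {k = k} ℕ.z≤n = fromℕ-nonNeg k
  fromℕ-mono (ℕ.s≤s j≤k) = +-monoʳ-≤ 1# (fromℕ-mono j≤k)

  fromℕ-pos : ∀ {k} → 1 ℕ.≤ k → 0# < fromℕ k
  fromℕ-pos {suc k} _ = <-+-nonNeg 0<1 (fromℕ-nonNeg k)

  fromℕ-cancel-≤ : ∀ {j k} → fromℕ j ≤ fromℕ k → j ℕ.≤ k
  fromℕ-cancel-≤ {j} {k} le with j ℕ.≤? k
  ... | yes j≤k = j≤k
  ... | no j≰k = contradiction (≤-trans (fromℕ-mono (ℕ.≰⇒> j≰k)) le)
                   (<⇒≱ (≤-by 1# 0≤1 (+-comm _ _) , λ eq → 1≉0 (1≈0 eq)))
    where
    1≈0 : fromℕ k ≈ 1# + fromℕ k → 1# ≈ 0#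
    1≈0 eq = ≈-trans (solve 1 (λ x → :# 1 := (:# 1 :+ x) :- x) ≈-refl (fromℕ k))
      (≈-trans (+-congʳ (≈-sym eq)) (-‿inverseʳ _))

  fromℕ-cong : ∀ {j k} → j ≡ k → fromℕ j ≈ fromℕ k
  fromℕ-cong eq = ≈-reflexive (cong fromℕ eq)

  x≤x+y : ∀ {x y} → 0# ≤ y → x ≤ x + y
  x≤x+y {y = y} 0≤y = ≤-by y 0≤y ≈-refl

module Sums (R : RealNumbers) where
  open import Data.Nat using (ℕ)
  open RealArithmetic R
  open import Relation.Binary.Reasoning.Setoid setoid

  private variable
    A B : Set

  when : ∀ {a} {P : Set a} → Dec P → ℝ → ℝ
  when (yes _) v = v
  when (no _)  v = 0#

  when-cong : ∀ {P Q : Set} (P? : Dec P) (Q? : Dec Q) → (P → Q) → (Q → P) → ∀ {v} → when P? v ≈ when Q? v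
  when-cong (yes p) (yes q) _ _ = ≈-refl
  when-cong (yes p) (no ¬q) f g = contradiction (f p) ¬q
  when-cong (no ¬p) (yes q) f g = contradiction (g q) ¬p
  when-cong (no ¬p) (no ¬q) _ _ = ≈-refl

  when-value : ∀ {P : Set} (P? : Dec P) {u v} → (P → u ≈ v) → when P? u ≈ when P? v
  when-value (yes p) eq = eq p
  when-value (no _)  _  = ≈-refl

  when-nonNeg : ∀ {P : Set} (P? : Dec P) {v} → 0# ≤ v → 0# ≤ when P? v
  when-nonNeg (yes _) 0≤v = 0≤v
  when-nonNeg (no _)  _   = ≤-refl

  *-when : ∀ {P : Set} (P? : Dec P) u v → u * when P? v ≈ when P? (u * v)
  *-when (yes _) u v = ≈-refl
  *-when (no _)  u v = zeroʳ u

  sum-cong : ∀ (xs : List A) {f g} → (∀ x → x ∈ xs → f x ≈ g x) → sum xs f ≈ sum xs g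
  sum-cong []       eq = ≈-refl
  sum-cong (x ∷ xs) eq = +-cong (eq x (here refl)) (sum-cong xs (λ y y∈ → eq y (there y∈)))

  sum-mono : ∀ (xs : List A) {f g} → (∀ x → x ∈ xs → f x ≤ g x) → sum xs f ≤ sum xs g
  sum-mono []       le = ≤-refl
  sum-mono (x ∷ xs) le = +-mono-≤ (le x (here refl)) (sum-mono xs (λ y y∈ → le y (there y∈)))

  sum-zero : ∀ (xs : List A) → sum xs (λ _ → 0#) ≈ 0#
  sum-zero []       = ≈-refl
  sum-zero (x ∷ xs) = ≈-trans (+-identityˡ _) (sum-zero xs)

  sum-nonNeg : ∀ (xs : List A) {f} → (∀ x → x ∈ xs → 0# ≤ f x) → 0# ≤ sum xs f
  sum-nonNeg xs 0≤f = ≤-respˡ (sum-zero xs) (sum-mono xs 0≤f)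

  sum-+ : ∀ (xs : List A) f g → sum xs (λ x → f x + g x) ≈ sum xs f + sum xs g
  sum-+ []       f g = ≈-sym (+-identityˡ 0#)
  sum-+ (x ∷ xs) f g = ≈-trans (+-congˡ (sum-+ xs f g))
    (solve 4 (λ a b c d → (a :+ b) :+ (c :+ d) := (a :+ c) :+ (b :+ d)) ≈-refl (f x) (g x) (sum xs f) (sum xs g))

  sum-* : ∀ (xs : List A) v f → sum xs (λ x → v * f x) ≈ v * sum xs f
  sum-* []       v f = ≈-sym (zeroʳ v)
  sum-* (x ∷ xs) v f = ≈-trans (+-congˡ (sum-* xs v f)) (≈-sym (distribˡ v _ _))

  sum-++ : ∀ (xs ys : List A) f → sum (xs ++ ys) f ≈ sum xs f + sum ys f
  sum-++ []       ys f = ≈-sym (+-identityˡ _)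
  sum-++ (x ∷ xs) ys f = ≈-trans (+-congˡ (sum-++ xs ys f)) (≈-sym (+-assoc _ _ _))

  sum-swap : ∀ (xs : List A) (ys : List B) (f : A → B → ℝ) →
    sum xs (λ x → sum ys (f x)) ≈ sum ys (λ y → sum xs (λ x → f x y))
  sum-swap []       ys f = ≈-sym (sum-zero ys)
  sum-swap (x ∷ xs) ys f = ≈-trans (+-congˡ (sum-swap xs ys f)) (≈-sym (sum-+ ys (f x) (λ y → sum xs (λ x → f x y))))

  sum-filter : ∀ {P : Pred A 0ℓ} (P? : Decidable P) xs f →
    sum (filter P? xs) f ≈ sum xs (λ x → when (P? x) (f x))
  sum-filter P? []       f = ≈-refl
  sum-filter P? (x ∷ xs) f with P? x
  ... | yes _ = +-congˡ (sum-filter P? xs f)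
  ... | no  _ = ≈-trans (sum-filter P? xs f) (≈-sym (+-identityˡ _))

  module _ (_≟_ : DecidableEquality A) where
    open DecMembership _≟_ using (_∈?_)

    sum-point-∉ : ∀ {xs y v} → y ∉ xs → sum xs (λ x → when (x ≟ y) v) ≈ 0#
    sum-point-∉ {xs} {y} y∉ = ≈-trans (sum-cong xs off) (sum-zero xs)
      where
      off : ∀ x → x ∈ xs → when (x ≟ y) _ ≈ 0#
      off x x∈ with x ≟ y
      ... | yes refl = contradiction x∈ y∉
      ... | no _ = ≈-refl

    sum-point-∈ : ∀ {xs y v} → Unique xs → y ∈ xs → sum xs (λ x → when (x ≟ y) v) ≈ v
    sum-point-∈ {x ∷ xs} {y} {v} (x≢ ∷ unique) y∈ with x ≟ y
    ... | yes refl = ≈-trans (+-congˡ (sum-point-∉ {xs} (λ x∈ → All.lookup x≢ x∈ refl))) (+-identityʳ v)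
    ... | no x≢y with y∈
    ...   | here y≡x = contradiction (sym y≡x) x≢y
    ...   | there y∈xs = ≈-trans (+-identityˡ _) (sum-point-∈ unique y∈xs)

    sum-point : ∀ {xs} y v → Unique xs → sum xs (λ x → when (x ≟ y) v) ≈ when (y ∈? xs) v
    sum-point {xs} y v unique with y ∈? xs
    ... | yes y∈ = sum-point-∈ unique y∈
    ... | no y∉ = sum-point-∉ {xs} y∉

    sum-restrict : ∀ {xs ys} h → Unique xs → Unique ys → (∀ x → x ∈ xs → x ∈ ys) →
      sum ys (λ y → when (y ∈? xs) (h y)) ≈ sum xs h
    sum-restrict {xs} {ys} h unique-xs unique-ys xs⊆ys = ≈-sym (begin
      sum xs h                                                   ≈⟨ sum-cong xs (λ x x∈ → ≈-sym (sum-point-∈ unique-ys (xs⊆ys x x∈))) ⟩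
      sum xs (λ x → sum ys (λ y → when (y ≟ x) (h x)))           ≈⟨ sum-swap xs ys _ ⟩
      sum ys (λ y → sum xs (λ x → when (y ≟ x) (h x)))           ≈⟨ sum-cong ys (λ y _ → sum-cong xs (λ x _ → flip y x)) ⟩
      sum ys (λ y → sum xs (λ x → when (x ≟ y) (h y)))           ≈⟨ sum-cong ys (λ y _ → sum-point y (h y) unique-xs) ⟩
      sum ys (λ y → when (y ∈? xs) (h y)) ∎)
      where
      flip : ∀ y x → when (y ≟ x) (h x) ≈ when (x ≟ y) (h y)
      flip y x = ≈-trans (when-value (y ≟ x) (λ eq → ≈-reflexive (cong h (sym eq))))
        (when-cong (y ≟ x) (x ≟ y) sym sym)

  sum-fromℕ : ∀ (xs : List A) (f : A → ℕ) → fromℕ (ℕ.sum (map f xs)) ≈ sum xs (fromℕ ∘ f)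
  sum-fromℕ []       f = ≈-refl
  sum-fromℕ (x ∷ xs) f = ≈-trans (fromℕ-+ (f x) _) (+-congˡ (sum-fromℕ xs f))

module FlowTheory {R : RealNumbers} (N : Network R) where
  open import Data.Nat as ℕ using (ℕ; zero; suc; z≤n; s≤s)
  import Data.Nat.Properties as ℕ

  open RealArithmetic R
  open Sums R
  open Network N
  open Flows N
  import Relation.Binary.Reasoning.Setoid as SetoidReasoning

  bounded : (P : 𝒫) → IsBoundedPath (edges P)
  bounded (P , [ p ]) = recompute (isBoundedPath? P) p

  _≟ᴾ_ : DecidableEquality 𝒫
  (P , p) ≟ᴾ (Q , q) = map′ (λ { refl → refl }) (cong edges) (List.≡-dec Fin._≟_ P Q)

  simple⇒unique : ∀ {v P} → Unique (v ∷ map tgt P) → Unique P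
  simple⇒unique (_ ∷ unique) = Unique.map⁻ unique

  edges-unique : ∀ P → Unique (edges P)
  edges-unique P = simple⇒unique {s} (proj₂ (proj₁ (bounded P)))

  length≤len : ∀ P → length P ℕ.≤ len P
  length≤len []      = z≤n
  length≤len (e ∷ P) = ℕ.+-mono-≤ (ℓ-positive e) (length≤len P)

  length≤L : ∀ P → length (edges P) ℕ.≤ L
  length≤L P = ℕ.≤-trans (length≤len (edges P)) (proj₂ (bounded P))

  lookup-injective : ∀ {A : Set} {xs : List A} → Unique xs → ∀ i j → lookup xs i ≡ lookup xs j → i ≡ j
  lookup-injective (x∉ ∷ _) zero    zero    eq = refl
  lookup-injective (x∉ ∷ _) zero    (suc j) eq = contradiction eq (All.lookup x∉ (∈-lookup j))
  lookup-injective (x∉ ∷ _) (suc i) zero    eq = contradiction (sym eq) (All.lookup x∉ (∈-lookup i))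
  lookup-injective (_ ∷ unique) (suc i) (suc j) eq = cong suc (lookup-injective unique i j eq)

  unique⇒length≤ : ∀ {k} (xs : List (Fin k)) → Unique xs → length xs ℕ.≤ k
  unique⇒length≤ xs unique = Fin.injective⇒≤ {f = lookup xs} (lookup-injective unique _ _)

  length<n : ∀ P → length (edges P) ℕ.< n
  length<n P = subst (λ k → suc k ℕ.≤ n) (List.length-map tgt (edges P))
    (unique⇒length≤ _ (proj₂ (proj₁ (bounded P))))

  edges-nonempty : ∀ P → 1 ℕ.≤ length (edges P)
  edges-nonempty P with edges P | bounded P
  ... | []    | (s≡t , _) , _ = contradiction s≡t s≢t
  ... | _ ∷ _ | _ = s≤s z≤n

  pathWeight : (E → ℝ) → 𝒫 → ℝ
  pathWeight z P = sum (edges P) z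

  module _ (P : 𝒫) where
    open DecMembership (Fin._≟_ {m}) using (_∈?_)

    pathWeight-restrict : ∀ z → pathWeight z P ≈ sum (allFin m) (λ e → when (P ∋? e) (z e))
    pathWeight-restrict z =
      ≈-sym (sum-restrict Fin._≟_ z (edges-unique P) (Unique.allFin⁺ m) (λ e _ → ∈-allFin e))

  totalCapacity : (E → ℝ) → ℝ
  totalCapacity z = sum (allFin m) (λ e → c e * z e)

  weak-duality : ∀ x → Feasible x → ∀ z → (∀ e → 0# ≤ z e) →
    sum allPaths (λ P → amount x P * pathWeight z P) ≤ totalCapacity z
  weak-duality x feasible z 0≤z = ≤-trans (≤-reflexive (begin
    sum allPaths (λ P → amount x P * pathWeight z P)
      ≈⟨ sum-cong allPaths (λ P _ → ≈-trans (*-congˡ (pathWeight-restrict P z)) (≈-sym (sum-* (allFin m) _ _))) ⟩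
    sum allPaths (λ P → sum (allFin m) (λ e → amount x P * when (P ∋? e) (z e)))
      ≈⟨ sum-cong allPaths (λ P _ → sum-cong (allFin m) (λ e _ → switch P e)) ⟩
    sum allPaths (λ P → sum (allFin m) (λ e → z e * when (P ∋? e) (amount x P)))
      ≈⟨ sum-swap allPaths (allFin m) _ ⟩
    sum (allFin m) (λ e → sum allPaths (λ P → z e * when (P ∋? e) (amount x P)))
      ≈⟨ sum-cong (allFin m) (λ e _ → ≈-trans (sum-* allPaths (z e) _)
           (*-congˡ (≈-sym (sum-filter (_∋? e) allPaths (amount x))))) ⟩
    sum (allFin m) (λ e → z e * sum (through e) (amount x)) ∎))
    (sum-mono (allFin m) (λ e _ → ≤-respʳ (*-comm _ _) (*-monoʳ-≤ (z e) (0≤z e) (feasible e))))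
    where
    open SetoidReasoning setoid
    switch : ∀ P e → amount x P * when (P ∋? e) (z e) ≈ z e * when (P ∋? e) (amount x P)
    switch P e with P ∋? e
    ... | yes _ = *-comm _ _
    ... | no _  = ≈-trans (zeroʳ _) (≈-sym (zeroʳ _))

  flowValue-nonNeg : ∀ x → 0# ≤ flowValue x
  flowValue-nonNeg x = sum-nonNeg allPaths (λ P _ → nonNegative x P)

  -- Lists of paths with amounts

  Entries : Set
  Entries = List (𝒫 × ℝ)

  load : Entries → E → ℝ
  load es e = sum es (λ (P , a) → when (P ∋? e) a)

  total : Entries → ℝ
  total es = sum es proj₂

  AmountsNonNegative : Entries → Set
  AmountsNonNegative = All (λ (_ , a) → 0# ≤ a)

  load-nonNeg : ∀ es e → AmountsNonNegative es → 0# ≤ load es e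
  load-nonNeg []             e []          = ≤-refl
  load-nonNeg ((P , a) ∷ es) e (0≤a ∷ 0≤es) = 0≤+ (when-nonNeg (P ∋? e) 0≤a) (load-nonNeg es e 0≤es)

  amountOf : Entries → 𝒫 → ℝ
  amountOf es P = sum es (λ (Q , a) → when (Q ≟ᴾ P) a)

  private
    sum-amountOf : ∀ Ps es → Unique Ps →
      sum Ps (amountOf es) ≈ sum es (λ (Q , a) → when (DecMembership._∈?_ _≟ᴾ_ Q Ps) a)
    sum-amountOf Ps es unique = begin
      sum Ps (λ P → sum es (λ (Q , a) → when (Q ≟ᴾ P) a))
        ≈⟨ sum-swap Ps es _ ⟩
      sum es (λ (Q , a) → sum Ps (λ P → when (Q ≟ᴾ P) a))
        ≈⟨ sum-cong es (λ (Q , a) _ → ≈-trans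
             (sum-cong Ps (λ P _ → when-cong (Q ≟ᴾ P) (P ≟ᴾ Q) sym sym))
             (sum-point _≟ᴾ_ Q a unique)) ⟩
      sum es (λ (Q , a) → when (DecMembership._∈?_ _≟ᴾ_ Q Ps) a) ∎
      where open SetoidReasoning setoid

  module _ {x : Flow} {es : Entries} (collects : ∀ P → amount x P ≈ amountOf es P) where

    load-correct : ∀ e → sum (through e) (amount x) ≈ load es e
    load-correct e = ≈-trans (sum-cong (through e) (λ P _ → collects P))
      (≈-trans (sum-amountOf (through e) es (Unique.filter⁺ (_∋? e) allPaths-unique))
        (sum-cong es (λ (Q , a) _ → when-cong (DecMembership._∈?_ _≟ᴾ_ Q (through e)) (Q ∋? e)
          (λ Q∈ → proj₂ (∈-filter⁻ (_∋? e) {xs = allPaths} Q∈))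
          (λ e∈Q → ∈-filter⁺ (_∋? e) (allPaths-complete Q) e∈Q))))

    total-correct : flowValue x ≈ total es
    total-correct = ≈-trans (sum-cong allPaths (λ P _ → collects P))
      (≈-trans (sum-amountOf allPaths es allPaths-unique)
        (sum-cong es (λ (Q , a) _ → inside Q (DecMembership._∈?_ _≟ᴾ_ Q allPaths))))
      where
      inside : ∀ Q (Q∈? : Dec (Q ∈ allPaths)) {a} → when Q∈? a ≈ a
      inside Q (yes _) = ≈-refl
      inside Q (no Q∉) = contradiction (allPaths-complete Q) Q∉

module StrongDuality {R : RealNumbers} (N : Network R) where
  open import Data.Nat as ℕ using (ℕ; suc; z≤n; s≤s)
  import Data.Nat.Properties as ℕ

  open RealArithmetic R
  open Sums R
  open FlowTheory N
  open Network N
  open Flows N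
  import Relation.Binary.Reasoning.Setoid as SetoidReasoning

  -- Rational linear combinations of the capacities

  record Term : Set where
    constructor term
    field
      edge : E
      plus minus denominator-1 : ℕ

  termValue : Term → ℝ
  termValue (term e a b d) = (fromℕ a - fromℕ b) * fromℕ (suc d) ⁻¹ * c e

  Rational : ℝ → Set
  Rational v = ∃[ ts ] v ≈ sum ts termValue

  rational-cong : ∀ {u v} → u ≈ v → Rational u → Rational v
  rational-cong eq (ts , u≈) = ts , ≈-trans (≈-sym eq) u≈

  rational-0 : Rational 0#
  rational-0 = [] , ≈-refl

  rational-+ : ∀ {u v} → Rational u → Rational v → Rational (u + v)
  rational-+ (ts , u≈) (ts′ , v≈) = ts ++ ts′ , ≈-trans (+-cong u≈ v≈) (≈-sym (sum-++ ts ts′ termValue))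

  suc⁻¹ : ∀ d → fromℕ (suc d) * fromℕ (suc d) ⁻¹ ≈ 1#
  suc⁻¹ d = ⁻¹-inverseʳ (fromℕ-pos {suc d} (s≤s z≤n))

  suc⁻¹-* : ∀ d d′ → fromℕ (suc (d ℕ.+ d′ ℕ.* suc d)) ⁻¹ ≈ fromℕ (suc d) ⁻¹ * fromℕ (suc d′) ⁻¹
  suc⁻¹-* d d′ = begin
    p ⁻¹                                         ≈⟨ solve 1 (λ p → p := (p :* :# 1) :* :# 1) ≈-refl (p ⁻¹) ⟩
    (p ⁻¹ * 1#) * 1#                             ≈⟨ *-cong (*-congˡ (≈-sym (suc⁻¹ d))) (≈-sym (suc⁻¹ d′)) ⟩
    (p ⁻¹ * (x * x ⁻¹)) * (x′ * x′ ⁻¹)           ≈⟨ solve 5 (λ p x y x′ y′ → (p :* (x :* y)) :* (x′ :* y′) := ((x′ :* x) :* p) :* (y :* y′))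
                                                     ≈-refl (p ⁻¹) x (x ⁻¹) x′ (x′ ⁻¹) ⟩
    ((x′ * x) * p ⁻¹) * (x ⁻¹ * x′ ⁻¹)           ≈⟨ *-congʳ (≈-trans (*-congʳ (≈-sym (fromℕ-* (suc d′) (suc d)))) (suc⁻¹ (d ℕ.+ d′ ℕ.* suc d))) ⟩
    1# * (x ⁻¹ * x′ ⁻¹)                          ≈⟨ *-identityˡ _ ⟩
    x ⁻¹ * x′ ⁻¹ ∎
    where
    open SetoidReasoning setoid
    p = fromℕ (suc (d ℕ.+ d′ ℕ.* suc d))
    x = fromℕ (suc d)
    x′ = fromℕ (suc d′)

  rational-scale : ∀ a b d {v} → Rational v → Rational ((fromℕ a - fromℕ b) * fromℕ (suc d) ⁻¹ * v)
  rational-scale a b d (ts , v≈) = map scale ts , ≈-trans (*-congˡ v≈) (≈-sym (scaled ts))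
    where
    open SetoidReasoning setoid
    scale : Term → Term
    scale (term e a′ b′ d′) = term e (a ℕ.* a′ ℕ.+ b ℕ.* b′) (a ℕ.* b′ ℕ.+ b ℕ.* a′) (d ℕ.+ d′ ℕ.* suc d)
    k = (fromℕ a - fromℕ b) * fromℕ (suc d) ⁻¹
    two : ∀ a b c d → fromℕ (a ℕ.* b ℕ.+ c ℕ.* d) ≈ fromℕ a * fromℕ b + fromℕ c * fromℕ d
    two a b c d = ≈-trans (fromℕ-+ (a ℕ.* b) _) (+-cong (fromℕ-* a b) (fromℕ-* c d))
    scale-value : ∀ τ → termValue (scale τ) ≈ k * termValue τ
    scale-value (term e a′ b′ d′) = ≈-trans
      (*-congʳ (*-cong (+-cong (two a a′ b b′) (-‿cong (two a b′ b a′))) (suc⁻¹-* d d′)))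
      (solve 7 (λ a b a′ b′ x y v →
          ((a :* a′ :+ b :* b′) :- (a :* b′ :+ b :* a′)) :* (x :* y) :* v := (a :- b) :* x :* ((a′ :- b′) :* y :* v))
        ≈-refl (fromℕ a) (fromℕ b) (fromℕ a′) (fromℕ b′) (fromℕ (suc d) ⁻¹) (fromℕ (suc d′) ⁻¹) (c e))
    scaled : ∀ ts → sum (map scale ts) termValue ≈ k * sum ts termValue
    scaled []       = ≈-sym (zeroʳ k)
    scaled (τ ∷ ts) = ≈-trans (+-cong (scale-value τ) (scaled ts)) (≈-sym (distribˡ k _ _))

  rational-fromℕ* : ∀ a {v} → Rational v → Rational (fromℕ a * v)
  rational-fromℕ* a {v} r = rational-cong
    (*-congʳ (≈-trans (*-congˡ (≈-trans (≈-sym (*-identityˡ _)) (≈-trans (*-congʳ (≈-sym (+-identityʳ 1#))) (suc⁻¹ 0))))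
      (solve 1 (λ a → (a :- :# 0) :* :# 1 := a) ≈-refl (fromℕ a))))
    (rational-scale a 0 0 r)

  rational-suc⁻¹* : ∀ d {v} → Rational v → Rational (fromℕ (suc d) ⁻¹ * v)
  rational-suc⁻¹* d r = rational-cong
    (*-congʳ (solve 1 (λ x → ((:# 1 :+ :# 0) :- :# 0) :* x := x) ≈-refl (fromℕ (suc d) ⁻¹)))
    (rational-scale 1 0 d r)

  rational-neg : ∀ {v} → Rational v → Rational (- v)
  rational-neg {v} r = rational-cong
    (≈-trans (*-congʳ (*-congˡ (≈-trans (≈-sym (*-identityˡ _)) (≈-trans (*-congʳ (≈-sym (+-identityʳ 1#))) (suc⁻¹ 0)))))
      (solve 1 (λ v → (:# 0 :- (:# 1 :+ :# 0)) :* :# 1 :* v := :- v) ≈-refl v))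
    (rational-scale 0 1 0 r)

  rational-capacity : ∀ e → Rational (c e)
  rational-capacity e = term e 1 0 0 ∷ [] , ≈-sym (≈-trans (+-identityʳ _)
    (≈-trans (*-congʳ (≈-trans (*-congʳ (solve 1 (λ x → x :- :# 0 := x) ≈-refl (fromℕ 1))) (suc⁻¹ 0))) (*-identityˡ _)))

  rational-sum : ∀ {A : Set} (xs : List A) {f} → (∀ x → x ∈ xs → Rational (f x)) → Rational (sum xs f)
  rational-sum []       r = rational-0
  rational-sum (x ∷ xs) r = rational-+ (r x (here refl)) (rational-sum xs (λ y y∈ → r y (there y∈)))

  rational-totalCapacity : ∀ y → Rational (totalCapacity (fromℕ ∘ y))
  rational-totalCapacity y = rational-sum (allFin m)
    (λ e _ → rational-cong (*-comm _ _) (rational-fromℕ* (y e) (rational-capacity e)))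

  -- Fourier–Motzkin elimination

  -- The inequality  Σ_P (y(P) − σ P − α) x_P + α z ≤ Σ_e y e c_e  in the variables x_P and z.
  -- Nonnegative combinations keep this shape, and once all coefficients of the x_P vanish,
  -- y(P) = σ P + α ≥ α says that y / α is a feasible dual solution.
  record Constraint : Set where
    constructor constraint
    field
      y : E → ℕ
      σ : 𝒫 → ℕ
      α : ℕ

  open Constraint

  pos neg : Constraint → 𝒫 → ℕ
  pos C P = ℕ.sum (map (y C) (edges P))
  neg C P = σ C P ℕ.+ α C

  Vanishes : Constraint → 𝒫 → Set
  Vanishes C P = pos C P ≡ neg C P

  lhs : ℝ → Entries → Constraint → ℝ
  lhs z es C = sum es (λ (P , x) → fromℕ (pos C P) * x) + fromℕ (α C) * z

  rhs : Entries → Constraint → ℝ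
  rhs es C = sum es (λ (P , x) → fromℕ (neg C P) * x) + totalCapacity (fromℕ ∘ y C)

  Satisfies : ℝ → Entries → Constraint → Set
  Satisfies z es C = lhs z es C ≤ rhs es C

  combination : ℕ → Constraint → ℕ → Constraint → Constraint
  combination r C p C′ = constraint
    (λ e → r ℕ.* y C e ℕ.+ p ℕ.* y C′ e)
    (λ P → r ℕ.* σ C P ℕ.+ p ℕ.* σ C′ P)
    (r ℕ.* α C ℕ.+ p ℕ.* α C′)

  module _ (r : ℕ) (C : Constraint) (p : ℕ) (C′ : Constraint) where
    private
      D = combination r C p C′

      sum-combination : ∀ es → ℕ.sum (map (y D) es) ≡ r ℕ.* ℕ.sum (map (y C) es) ℕ.+ p ℕ.* ℕ.sum (map (y C′) es)
      sum-combination [] = sym (cong₂ ℕ._+_ (ℕ.*-zeroʳ r) (ℕ.*-zeroʳ p))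
      sum-combination (e ∷ es) = trans (cong (y D e ℕ.+_) (sum-combination es))
        (+-*-Solver.solve 6 (λ r p a b s t → (r :*′ a :+′ p :*′ b) :+′ (r :*′ s :+′ p :*′ t) :=′ r :*′ (a :+′ s) :+′ p :*′ (b :+′ t))
          refl r p (y C e) (y C′ e) _ _)
        where open +-*-Solver renaming (_:*_ to _:*′_; _:+_ to _:+′_; _:=_ to _:=′_)

    pos-combination : ∀ P → pos D P ≡ r ℕ.* pos C P ℕ.+ p ℕ.* pos C′ P
    pos-combination P = sum-combination (edges P)

    neg-combination : ∀ P → neg D P ≡ r ℕ.* neg C P ℕ.+ p ℕ.* neg C′ P
    neg-combination P =
      +-*-Solver.solve 6 (λ r p a b s t → (r :*′ a :+′ p :*′ b) :+′ (r :*′ s :+′ p :*′ t) :=′ r :*′ (a :+′ s) :+′ p :*′ (b :+′ t))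
          refl r p (σ C P) (σ C′ P) (α C) (α C′)
        where open +-*-Solver renaming (_:*_ to _:*′_; _:+_ to _:+′_; _:=_ to _:=′_)

    private
      linear : ∀ {A : Set} (xs : List A) (f g h : A → ℝ) → (∀ x → h x ≈ fromℕ r * f x + fromℕ p * g x) →
        sum xs h ≈ fromℕ r * sum xs f + fromℕ p * sum xs g
      linear xs f g h eq = ≈-trans (sum-cong xs (λ x _ → eq x)) (≈-trans (sum-+ xs _ _) (+-cong (sum-* xs _ f) (sum-* xs _ g)))

      two : ∀ {k} a b → k ≡ r ℕ.* a ℕ.+ p ℕ.* b → fromℕ k ≈ fromℕ r * fromℕ a + fromℕ p * fromℕ b
      two a b eq = ≈-trans (fromℕ-cong eq) (≈-trans (fromℕ-+ (r ℕ.* a) (p ℕ.* b)) (+-cong (fromℕ-* r a) (fromℕ-* p b)))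

      times : ∀ a b x {k} → k ≡ r ℕ.* a ℕ.+ p ℕ.* b → fromℕ k * x ≈ fromℕ r * (fromℕ a * x) + fromℕ p * (fromℕ b * x)
      times a b x eq = ≈-trans (*-congʳ (two a b eq))
        (solve 5 (λ r p a b x → (r :* a :+ p :* b) :* x := r :* (a :* x) :+ p :* (b :* x)) ≈-refl (fromℕ r) (fromℕ p) (fromℕ a) (fromℕ b) x)

      regroup : ∀ s t u v → (fromℕ r * s + fromℕ p * t) + (fromℕ r * u + fromℕ p * v) ≈ fromℕ r * (s + u) + fromℕ p * (t + v)
      regroup = solve 6 (λ r p s t u v → (r :* s :+ p :* t) :+ (r :* u :+ p :* v) := r :* (s :+ u) :+ p :* (t :+ v)) ≈-refl (fromℕ r) (fromℕ p)

    lhs-combination : ∀ z es → lhs z es D ≈ fromℕ r * lhs z es C + fromℕ p * lhs z es C′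
    lhs-combination z es = ≈-trans
      (+-cong (linear es _ _ _ (λ (P , x) → times (pos C P) (pos C′ P) x (pos-combination P))) (times (α C) (α C′) z refl))
      (regroup _ _ _ _)

    rhs-combination : ∀ es → rhs es D ≈ fromℕ r * rhs es C + fromℕ p * rhs es C′
    rhs-combination es = ≈-trans
      (+-cong (linear es _ _ _ (λ (P , x) → times (neg C P) (neg C′ P) x (neg-combination P)))
              (linear (allFin m) _ _ _ (λ e → ≈-trans (*-congˡ (two (y C e) (y C′ e) refl))
                 (solve 5 (λ r p a b x → x :* (r :* a :+ p :* b) := r :* (x :* a) :+ p :* (x :* b)) ≈-refl (fromℕ r) (fromℕ p) (fromℕ (y C e)) (fromℕ (y C′ e)) (c e)))))
      (regroup _ _ _ _)

    vanishes-combination : ∀ P → Vanishes C P → Vanishes C′ P → Vanishes D P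
    vanishes-combination P eq eq′ = trans (pos-combination P)
      (trans (cong₂ (λ a b → r ℕ.* a ℕ.+ p ℕ.* b) eq eq′) (sym (neg-combination P)))

  indicator : ∀ {P : Set} → Dec P → ℕ
  indicator (yes _) = 1
  indicator (no _)  = 0

  nonNegativity : 𝒫 → Constraint
  nonNegativity P = constraint (λ _ → 0) (λ Q → indicator (Q ≟ᴾ P)) 0

  pos-nonNegativity : ∀ P Q → pos (nonNegativity P) Q ≡ 0
  pos-nonNegativity P Q = zeros (edges Q)
    where
    zeros : ∀ es → ℕ.sum (map (λ _ → 0) es) ≡ 0
    zeros []       = refl
    zeros (e ∷ es) = zeros es

  neg-nonNegativity-same : ∀ P → neg (nonNegativity P) P ≡ 1
  neg-nonNegativity-same P with P ≟ᴾ P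
  ... | yes _  = refl
  ... | no P≢P = contradiction refl P≢P

  neg-nonNegativity-other : ∀ {P Q} → Q ≢ P → neg (nonNegativity P) Q ≡ 0
  neg-nonNegativity-other {P} {Q} Q≢P with Q ≟ᴾ P
  ... | yes Q≡P = contradiction Q≡P Q≢P
  ... | no _    = refl

  module _ (P : 𝒫) where

    upper? = λ C → neg C P ℕ.<? pos C P
    lower? = λ C → pos C P ℕ.<? neg C P
    vanishes? = λ C → pos C P ℕ.≟ neg C P

    upperGap lowerGap : Constraint → ℕ
    upperGap U = pos U P ℕ.∸ suc (neg U P)
    lowerGap C = neg C P ℕ.∸ suc (pos C P)

    resolve : Constraint → Constraint → Constraint
    resolve U C = combination (suc (lowerGap C)) U (suc (upperGap U)) C

    lowers : List Constraint → List Constraint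
    lowers S = nonNegativity P ∷ filter lower? S

    eliminate : List Constraint → List Constraint
    eliminate S = filter vanishes? S ++ cartesianProductWith resolve (filter upper? S) (lowers S)

    private
      gap : ∀ {j k} → j ℕ.< k → k ≡ suc (k ℕ.∸ suc j) ℕ.+ j
      gap {j} {k} j<k = trans (sym (ℕ.m∸n+n≡m j<k)) (ℕ.+-suc (k ℕ.∸ suc j) j)

    lower-nonNegativity : pos (nonNegativity P) P ℕ.< neg (nonNegativity P) P
    lower-nonNegativity = subst₂ ℕ._<_ (sym (pos-nonNegativity P P)) (sym (neg-nonNegativity-same P)) (s≤s z≤n)

    ∈-lowers : ∀ {S C} → C ∈ lowers S → pos C P ℕ.< neg C P
    ∈-lowers (here refl) = lower-nonNegativity
    ∈-lowers {S} (there C∈) = proj₂ (∈-filter⁻ lower? {xs = S} C∈)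

    vanishes-resolve : ∀ {U C} → neg U P ℕ.< pos U P → pos C P ℕ.< neg C P → Vanishes (resolve U C) P
    vanishes-resolve {U} {C} u l = trans (pos-combination r U p C P) (trans
      (trans (cong (λ k → r ℕ.* k ℕ.+ p ℕ.* pos C P) (gap u))
        (trans (solve′ r p (neg U P) (pos C P)) (cong (λ k → r ℕ.* neg U P ℕ.+ p ℕ.* k) (sym (gap l)))))
      (sym (neg-combination r U p C P)))
      where
      r = suc (lowerGap C)
      p = suc (upperGap U)
      solve′ : ∀ r p a b → r ℕ.* (p ℕ.+ a) ℕ.+ p ℕ.* b ≡ r ℕ.* a ℕ.+ p ℕ.* (r ℕ.+ b)
      solve′ = +-*-Solver.solve 4 (λ r p a b → r :*′ (p :+′ a) :+′ p :*′ b :=′ r :*′ a :+′ p :*′ (r :+′ b)) refl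
        where open +-*-Solver renaming (_:*_ to _:*′_; _:+_ to _:+′_; _:=_ to _:=′_)

    eliminate-vanishes : ∀ S C → C ∈ eliminate S → Vanishes C P
    eliminate-vanishes S C C∈ with ∈-++⁻ (filter vanishes? S) C∈
    ... | inj₁ C∈S = proj₂ (∈-filter⁻ vanishes? {xs = S} C∈S)
    ... | inj₂ C∈× with ∈-cartesianProductWith⁻ resolve (filter upper? S) (lowers S) C∈×
    ...   | U , C′ , U∈ , C′∈ , refl = vanishes-resolve {U} {C′} (proj₂ (∈-filter⁻ upper? {xs = S} U∈)) (∈-lowers {S} C′∈)

    eliminate-preserves : ∀ S {Q} → Q ≢ P → (∀ C → C ∈ S → Vanishes C Q) → ∀ C → C ∈ eliminate S → Vanishes C Q
    eliminate-preserves S {Q} Q≢P vanishes C C∈ with ∈-++⁻ (filter vanishes? S) C∈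
    ... | inj₁ C∈S = vanishes C (proj₁ (∈-filter⁻ vanishes? C∈S))
    ... | inj₂ C∈× with ∈-cartesianProductWith⁻ resolve (filter upper? S) (lowers S) C∈×
    ...   | U , C′ , U∈ , here refl , refl = vanishes-combination (suc (lowerGap C′)) U (suc (upperGap U)) C′ Q
              (vanishes U (proj₁ (∈-filter⁻ upper? U∈)))
              (trans (pos-nonNegativity P Q) (sym (neg-nonNegativity-other Q≢P)))
    ...   | U , C′ , U∈ , there C′∈ , refl = vanishes-combination (suc (lowerGap C′)) U (suc (upperGap U)) C′ Q
              (vanishes U (proj₁ (∈-filter⁻ upper? U∈))) (vanishes C′ (proj₁ (∈-filter⁻ lower? C′∈)))

    eliminate-keeps : ∀ S {C} → Vanishes C P → C ∈ S → C ∈ eliminate S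
    eliminate-keeps S v C∈ = ∈-++⁺ˡ (∈-filter⁺ vanishes? C∈ v)

    module _ (z : ℝ) (es : Entries) where

      lowerBound : Constraint → ℝ
      lowerBound C = fromℕ (suc (lowerGap C)) ⁻¹ * (lhs z es C - rhs es C)

      private
        r*lowerBound : ∀ C → fromℕ (suc (lowerGap C)) * lowerBound C ≈ lhs z es C - rhs es C
        r*lowerBound C = ≈-trans (≈-sym (*-assoc _ _ _)) (≈-trans (*-congʳ (suc⁻¹ (lowerGap C))) (*-identityˡ _))

        split : ∀ {j k} → j ℕ.< k → fromℕ k ≈ fromℕ (suc (k ℕ.∸ suc j)) + fromℕ j
        split {j} {k} j<k = ≈-trans (fromℕ-cong (gap j<k)) (fromℕ-+ (suc (k ℕ.∸ suc j)) j)

      extend-lower : ∀ {v C} → pos C P ℕ.< neg C P → lowerBound C ≤ v → Satisfies z ((P , v) ∷ es) C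
      extend-lower {v} {C} l le = ≤-by (r * (v - lowerBound C)) (*-nonNeg (fromℕ-nonNeg (suc (lowerGap C))) (x≤y⇒0≤y-x le))
        (≈-trans (+-congʳ (+-congʳ (*-congʳ (split l))))
          (≈-trans (solve 7 (λ r b v f g h l → ((r :+ b) :* v :+ g) :+ h :=
               ((b :* v :+ f) :+ l) :+ (r :* v :- ((f :+ l) :- (g :+ h))))
             ≈-refl r (fromℕ (pos C P)) v _ (sum es (λ (P , x) → fromℕ (neg C P) * x)) (totalCapacity (fromℕ ∘ y C)) _)
           (+-congˡ (≈-trans (+-congˡ (-‿cong (≈-sym (r*lowerBound C))))
             (solve 3 (λ r v w → r :* v :- r :* w := r :* (v :- w)) ≈-refl r v (lowerBound C))))))
        where r = fromℕ (suc (lowerGap C))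

      extend-upper : ∀ {U C} → neg U P ℕ.< pos U P → Satisfies z es (resolve U C) → Satisfies z ((P , lowerBound C) ∷ es) U
      extend-upper {U} {C} u sat = ≤-by (rhs es U - lhs z es U - p * v) 0≤d
        (≈-trans (solve 7 (λ p b v f g h l → (b :* v :+ g) :+ h := (((p :+ b) :* v :+ f) :+ l) :+ (((g :+ h) :- (f :+ l)) :- p :* v))
             ≈-refl p (fromℕ (neg U P)) v _ (sum es (λ (P , x) → fromℕ (neg U P) * x)) (totalCapacity (fromℕ ∘ y U)) _)
           (+-congʳ (+-congʳ (+-congʳ (*-congʳ (≈-sym (split u)))))))
        where
        v = lowerBound C
        p = fromℕ (suc (upperGap U))
        r = fromℕ (suc (lowerGap C))
        0≤d : 0# ≤ rhs es U - lhs z es U - p * v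
        0≤d = *-cancelˡ-≤ r (fromℕ-pos {suc (lowerGap C)} (s≤s z≤n)) (≤-respˡ (≈-sym (zeroʳ r))
          (≤-respʳ (≈-trans
            (+-cong (rhs-combination (suc (lowerGap C)) U (suc (upperGap U)) C es)
                    (-‿cong (lhs-combination (suc (lowerGap C)) U (suc (upperGap U)) C z es)))
            (≈-trans (solve 6 (λ r p a b s t → (r :* b :+ p :* t) :- (r :* a :+ p :* s) := r :* (b :- a) :- p :* (s :- t))
                ≈-refl r p (lhs z es U) (rhs es U) (lhs z es C) (rhs es C))
              (≈-trans (+-congˡ (-‿cong (*-congˡ (≈-sym (r*lowerBound C)))))
                (solve 5 (λ r p a b v → r :* (b :- a) :- p :* (r :* v) := r :* ((b :- a) :- p :* v))
                  ≈-refl r p (lhs z es U) (rhs es U) v))))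
            (x≤y⇒0≤y-x sat)))

      extend-vanishing : ∀ {v C} → Vanishes C P → Satisfies z es C → Satisfies z ((P , v) ∷ es) C
      extend-vanishing {v} {C} eq sat = ≤-respˡ (≈-sym (+-assoc _ _ _))
        (≤-respʳ (≈-trans (+-congʳ (*-congʳ (fromℕ-cong eq))) (≈-sym (+-assoc _ _ _))) (+-monoʳ-≤ _ sat))

      lowerBound-nonNegativity : All (λ (Q , _) → Q ≢ P) es → lowerBound (nonNegativity P) ≈ 0#
      lowerBound-nonNegativity fresh = ≈-trans (*-congˡ (≈-trans (+-cong l (-‿cong r)) (-‿inverseʳ 0#))) (zeroʳ _)
        where
        zeros : ∀ es {f : 𝒫 → ℕ} → All (λ (Q , _) → f Q ≡ 0) es → sum es (λ (Q , x) → fromℕ (f Q) * x) ≈ 0#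
        zeros []             []         = ≈-refl
        zeros ((Q , x) ∷ es) (eq ∷ eqs) = ≈-trans (+-cong (≈-trans (*-congʳ (fromℕ-cong eq)) (zeroˡ x)) (zeros es eqs)) (+-identityˡ 0#)
        l : lhs z es (nonNegativity P) ≈ 0#
        l = ≈-trans (+-cong (zeros es (All.universal (λ (Q , _) → pos-nonNegativity P Q) es)) (zeroˡ z)) (+-identityˡ 0#)
        r : rhs es (nonNegativity P) ≈ 0#
        r = ≈-trans (+-cong (zeros es (All.map neg-nonNegativity-other fresh))
              (≈-trans (sum-cong (allFin m) (λ e _ → zeroʳ (c e))) (sum-zero (allFin m)))) (+-identityˡ 0#)

  argmax : ∀ {A : Set} (f : A → ℝ) x xs → ∃[ y ] y ∈ x ∷ xs × (∀ w → w ∈ x ∷ xs → f w ≤ f y)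
  argmax f x [] = x , here refl , λ { w (here refl) → ≤-refl }
  argmax f x (x′ ∷ xs) with argmax f x′ xs
  ... | y , y∈ , max with f x ≤? f y
  ...   | yes fx≤fy = y , there y∈ , λ { w (here refl) → fx≤fy ; w (there w∈) → max w w∈ }
  ...   | no fx≰fy = x , here refl , λ { w (here refl) → ≤-refl ; w (there w∈) → ≤-trans (max w w∈) (≰⇒≥ fx≰fy) }

  eliminateAll : List 𝒫 → List Constraint → List Constraint
  eliminateAll []       S = S
  eliminateAll (P ∷ Ps) S = eliminateAll Ps (eliminate P S)

  eliminateAll-preserves : ∀ Ps S {Q} → All (Q ≢_) Ps → (∀ C → C ∈ S → Vanishes C Q) →
    ∀ C → C ∈ eliminateAll Ps S → Vanishes C Q
  eliminateAll-preserves []       S []          v = v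
  eliminateAll-preserves (P ∷ Ps) S (Q≢P ∷ Q≢) v = eliminateAll-preserves Ps _ Q≢ (eliminate-preserves P S Q≢P v)

  eliminateAll-vanishes : ∀ Ps S → Unique Ps → ∀ C → C ∈ eliminateAll Ps S → ∀ P → P ∈ Ps → Vanishes C P
  eliminateAll-vanishes (P ∷ Ps) S (P≢ ∷ _) C C∈ _ (here refl) =
    eliminateAll-preserves Ps _ P≢ (eliminate-vanishes P S) C C∈
  eliminateAll-vanishes (P ∷ Ps) S (_ ∷ unique) C C∈ Q (there Q∈) = eliminateAll-vanishes Ps _ unique C C∈ Q Q∈

  eliminateAll-keeps : ∀ Ps S {C} → (∀ P → Vanishes C P) → C ∈ S → C ∈ eliminateAll Ps S
  eliminateAll-keeps []       S v C∈ = C∈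
  eliminateAll-keeps (P ∷ Ps) S v C∈ = eliminateAll-keeps Ps _ v (eliminate-keeps P S (v P) C∈)

  RationalAmounts : Entries → Set
  RationalAmounts = All (λ (_ , x) → Rational x)

  rational-lowerBound : ∀ P {z} es C → Rational z → RationalAmounts es → Rational (lowerBound P z es C)
  rational-lowerBound P es C rz res = rational-suc⁻¹* (lowerGap P C) (rational-+
    (rational-+ (rational-sum es (λ (Q , _) ∈es → rational-fromℕ* (pos C Q) (All.lookup res ∈es))) (rational-fromℕ* (α C) rz))
    (rational-neg (rational-+ (rational-sum es (λ (Q , _) ∈es → rational-fromℕ* (neg C Q) (All.lookup res ∈es)))
      (rational-totalCapacity (y C)))))

  back-substitute : ∀ Ps S z → Unique Ps → Rational z → (∀ C → C ∈ eliminateAll Ps S → Satisfies z [] C) →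
    ∃[ es ] map proj₁ es ≡ Ps × RationalAmounts es × AmountsNonNegative es × (∀ C → C ∈ S → Satisfies z es C)
  back-substitute [] S z _ _ sat = [] , refl , [] , [] , sat
  back-substitute (P ∷ Ps) S z (P≢ ∷ unique) rz sat
    with back-substitute Ps (eliminate P S) z unique rz sat
  ... | es , refl , res , 0≤es , sat′
    with argmax (lowerBound P z es) (nonNegativity P) (filter (lower? P) S)
  ... | C* , C*∈ , max =
    (P , v) ∷ es , refl , rational-lowerBound P es C* rz res ∷ res ,
    ≤-respˡ (lowerBound-nonNegativity P z es (fresh es P≢)) (max (nonNegativity P) (here refl)) ∷ 0≤es , sat″
    where
    v = lowerBound P z es C*
    fresh : ∀ es → All (P ≢_) (map proj₁ es) → All (λ (Q , _) → Q ≢ P) es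
    fresh []       []       = []
    fresh (_ ∷ es) (P≢ ∷ P≢s) = (λ eq → P≢ (sym eq)) ∷ fresh es P≢s
    sat″ : ∀ C → C ∈ S → Satisfies z ((P , v) ∷ es) C
    sat″ C C∈ with ℕ.<-cmp (pos C P) (neg C P)
    ... | tri< l _ _ = extend-lower P z es {v} {C} l (max C (there (∈-filter⁺ (lower? P) C∈ l)))
    ... | tri≈ _ eq _ = extend-vanishing P z es {v} {C} eq (sat′ C (eliminate-keeps P S eq C∈))
    ... | tri> _ _ u = extend-upper P z es {U = C} {C = C*} u (sat′ (resolve P C C*) (∈-++⁺ʳ (filter (vanishes? P) S)
                         (∈-cartesianProductWith⁺ (resolve P) (∈-filter⁺ (upper? P) C∈ u) C*∈)))

  -- Strong duality

  edgeCapacity : E → Constraint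
  edgeCapacity e = constraint (λ e′ → indicator (e′ Fin.≟ e)) (λ _ → 0) 0

  objective : Constraint
  objective = constraint (λ _ → 0) (λ _ → 0) 1

  -- z ≤ Σ_e c_e; guarantees that some eliminated constraint bounds z.
  crudeBound : Constraint
  crudeBound = constraint (λ _ → 1) (λ P → length (edges P) ℕ.∸ 1) 1

  system : List Constraint
  system = objective ∷ crudeBound ∷ map edgeCapacity (allFin m)

  crudeBound-vanishes : ∀ P → Vanishes crudeBound P
  crudeBound-vanishes P = trans (ones (edges P)) (sym (ℕ.m∸n+n≡m (edges-nonempty P)))
    where
    ones : ∀ es → ℕ.sum (map (λ _ → 1) es) ≡ length es
    ones []       = refl
    ones (_ ∷ es) = cong suc (ones es)

  record Optimum : Set where
    field
      entries        : Entries
      rational       : RationalAmounts entries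
      amounts≥0      : AmountsNonNegative entries
      feasible       : ∀ e → load entries e ≤ c e
      dual           : E → ℕ
      scale-1        : ℕ
      dual-feasible  : ∀ P → suc scale-1 ℕ.≤ ℕ.sum (map dual (edges P))
      no-gap         : totalCapacity (fromℕ ∘ dual) ≤ fromℕ (suc scale-1) * total entries

  optimum : Optimum
  optimum = record
    { entries = es ; rational = res ; amounts≥0 = 0≤es ; feasible = feasible
    ; dual = y best ; scale-1 = ℕ.pred (α best)
    ; dual-feasible = λ P → subst (ℕ._≤ pos best P) (sym α≡)
        (subst (α best ℕ.≤_) (sym (eliminateAll-vanishes allPaths system allPaths-unique best
           (proj₁ (∈-filter⁻ bounding? best∈)) P (allPaths-complete P))) (ℕ.m≤n+m (α best) (σ best P)))
    ; no-gap = ≤-respˡ (ratio-spec best (proj₂ (∈-filter⁻ bounding? {xs = S} best∈)))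
        (≤-respʳ (*-congʳ (fromℕ-cong (sym α≡))) (*-monoʳ-≤ _ (fromℕ-nonNeg (α best)) z≤total)) }
    where
    S = eliminateAll allPaths system
    bounding? = λ C → 0 ℕ.<? α C

    -- The bound on z implied by C; a junk value if α C = 0.
    ratio : Constraint → ℝ
    ratio C = fromℕ (suc (ℕ.pred (α C))) ⁻¹ * totalCapacity (fromℕ ∘ y C)

    ratio-spec : ∀ C → 0 ℕ.< α C → fromℕ (α C) * ratio C ≈ totalCapacity (fromℕ ∘ y C)
    ratio-spec C 0<α with suc d ← α C =
      ≈-trans (≈-sym (*-assoc _ _ _)) (≈-trans (*-congʳ (suc⁻¹ d)) (*-identityˡ _))

    crude∈ : crudeBound ∈ filter bounding? S
    crude∈ = ∈-filter⁺ bounding? (eliminateAll-keeps allPaths system crudeBound-vanishes (there (here refl))) (s≤s z≤n)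

    chosen : ∃[ C ] C ∈ filter bounding? S × (∀ C′ → C′ ∈ filter bounding? S → - ratio C′ ≤ - ratio C)
    chosen with argmax (λ C → - ratio C) crudeBound (filter bounding? S)
    ... | C , here refl , max = C , crude∈ , λ C′ C′∈ → max C′ (there C′∈)
    ... | C , there C∈ , max = C , C∈ , λ C′ C′∈ → max C′ (there C′∈)

    best = proj₁ chosen
    best∈ = proj₁ (proj₂ chosen)
    z = ratio best

    α≡ : suc (ℕ.pred (α best)) ≡ α best
    α≡ = positive (proj₂ (∈-filter⁻ bounding? {xs = S} best∈))
      where
      positive : ∀ {k} → 0 ℕ.< k → suc (ℕ.pred k) ≡ k
      positive {suc k} _ = refl

    z≤ratio : ∀ {C} → C ∈ filter bounding? S → z ≤ ratio C
    z≤ratio {C} C∈ = ≤-by (- z - - ratio C) (x≤y⇒0≤y-x (proj₂ (proj₂ chosen) C C∈))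
      (solve 2 (λ x z → x := z :+ (:- z :- :- x)) ≈-refl (ratio C) z)

    residual-satisfied : ∀ C → C ∈ S → Satisfies z [] C
    residual-satisfied C C∈ with 0 ℕ.<? α C
    ... | yes 0<α = ≤-respˡ (≈-sym (+-identityˡ _)) (≤-respʳ (≈-trans (ratio-spec C 0<α) (≈-sym (+-identityˡ _)))
                      (*-monoʳ-≤ (fromℕ (α C)) (fromℕ-nonNeg (α C)) (z≤ratio (∈-filter⁺ bounding? C∈ 0<α))))
    ... | no α≯0 = ≤-respˡ (≈-sym (≈-trans (+-identityˡ _) (≈-trans (*-congʳ (fromℕ-cong (ℕ.n≤0⇒n≡0 (ℕ.≮⇒≥ α≯0)))) (zeroˡ z))))
        (0≤+ ≤-refl (sum-nonNeg (allFin m) (λ e _ → *-nonNeg (proj₁ (c-positive e)) (fromℕ-nonNeg (y C e)))))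

    rational-z : Rational z
    rational-z = rational-suc⁻¹* (ℕ.pred (α best)) (rational-totalCapacity (y best))

    solution = back-substitute allPaths system z allPaths-unique rational-z residual-satisfied
    es = proj₁ solution
    res = proj₁ (proj₂ (proj₂ solution))
    0≤es = proj₁ (proj₂ (proj₂ (proj₂ solution)))
    sat = proj₂ (proj₂ (proj₂ (proj₂ solution)))

    zero-sum : ∀ {A : Set} (xs : List A) (f : A → ℕ) (g : A → ℝ) → (∀ x → f x ≡ 0) → sum xs (λ x → fromℕ (f x) * g x) ≈ 0#
    zero-sum xs f g eq = ≈-trans (sum-cong xs (λ x _ → ≈-trans (*-congʳ (fromℕ-cong (eq x))) (zeroˡ _))) (sum-zero xs)

    z≤total : z ≤ total es
    z≤total = ≤-respˡ (≈-trans (+-cong (zero-sum es (λ (P , _) → pos objective P) proj₂ (λ (P , _) → pos-nonNegativity P P)) (≈-trans (*-congʳ (+-identityʳ 1#)) (*-identityˡ z))) (+-identityˡ z))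
      (≤-respʳ (≈-trans (+-cong (sum-cong es (λ _ _ → ≈-trans (*-congʳ (+-identityʳ 1#)) (*-identityˡ _)))
                 (≈-trans (sum-cong (allFin m) (λ e _ → zeroʳ (c e))) (sum-zero (allFin m)))) (+-identityʳ _))
        (sat objective (here refl)))

    crossing : ∀ e P → fromℕ (pos (edgeCapacity e) P) ≈ when (P ∋? e) 1#
    crossing e P = ≈-trans (sum-fromℕ (edges P) _)
      (≈-trans (sum-cong (edges P) (λ e′ _ → as-when (e′ Fin.≟ e))) (sum-point Fin._≟_ e 1# (edges-unique P)))
      where
      as-when : ∀ {A : Set} (A? : Dec A) → fromℕ (indicator A?) ≈ when A? 1#
      as-when (yes _) = +-identityʳ 1#
      as-when (no _)  = ≈-refl

    feasible : ∀ e → load es e ≤ c e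
    feasible e = ≤-respˡ (≈-trans (+-cong (sum-cong es (λ (P , x) _ → ≈-trans (*-congʳ (crossing e P)) (≈-trans (*-comm _ _)
                            (≈-trans (*-when (P ∋? e) x 1#) (when-value (P ∋? e) (λ _ → *-identityʳ x)))))) (zeroˡ z)) (+-identityʳ _))
      (≤-respʳ (≈-trans (+-cong (zero-sum es (λ (P , _) → neg (edgeCapacity e) P) proj₂ (λ _ → refl)) single) (+-identityˡ _))
        (sat (edgeCapacity e) (there (there (∈-map⁺ edgeCapacity (∈-allFin e))))))
      where
      import Data.List.Relation.Unary.Unique.Propositional.Properties as Unique
      at-e : ∀ e′ (d : Dec (e′ ≡ e)) → c e′ * fromℕ (indicator d) ≈ when d (c e)
      at-e e′ (yes refl) = ≈-trans (*-congˡ (+-identityʳ 1#)) (*-identityʳ _)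
      at-e e′ (no _)       = zeroʳ _
      single : totalCapacity (fromℕ ∘ y (edgeCapacity e)) ≈ c e
      single = ≈-trans (sum-cong (allFin m) (λ e′ _ → at-e e′ (e′ Fin.≟ e)))
        (sum-point-∈ Fin._≟_ (Unique.allFin⁺ m) (∈-allFin e))

  abstract
    strong-duality : Optimum
    strong-duality = optimum

module Potential {R : RealNumbers} (N : Network R) where
  open import Data.Nat as ℕ using (ℕ; zero; suc; z≤n; s≤s)
  import Data.Nat.Properties as ℕ
  open RealArithmetic R
  open Sums R
  open FlowTheory N
  open Network N hiding (V)
  open Flows N

  capacitySum : ℝ
  capacitySum = sum (allFin m) c

  -- q is the number of weight increases by the factor 1 + 1/q that double a weight (roughly).
  module _ (q : ℝ) (0<q : 0# < q) where

    q+1 = q + 1#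

    0<q+1 : 0# < q+1
    0<q+1 = <-+-nonNeg 0<q 0≤1

    scaleUp : ℝ → ℝ
    scaleUp x = x + x * q ⁻¹

    scaleUp-q : ∀ x → q * scaleUp x ≈ q+1 * x
    scaleUp-q x = ≈-trans (solve 3 (λ q x i → q :* (x :+ x :* i) := q :* x :+ (q :* i) :* x) ≈-refl q x (q ⁻¹))
      (≈-trans (+-congˡ (*-congʳ (⁻¹-inverseʳ 0<q))) (solve 2 (λ q x → q :* x :+ :# 1 :* x := (q :+ :# 1) :* x) ≈-refl q x))

    scaleUp-cong : ∀ {x y} → x ≈ y → scaleUp x ≈ scaleUp y
    scaleUp-cong eq = +-cong eq (*-congʳ eq)

    0≤q⁻¹ : 0# ≤ q ⁻¹
    0≤q⁻¹ = ⁻¹-nonNeg 0<q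

    scaleUp-increases : ∀ {x} → 0# ≤ x → x ≤ scaleUp x
    scaleUp-increases 0≤x = x≤x+y (*-nonNeg 0≤x 0≤q⁻¹)

    pow : ℕ → ℝ
    pow zero    = 1#
    pow (suc k) = scaleUp (pow k)

    pow≥1 : ∀ k → 1# ≤ pow k
    pow≥1 zero    = ≤-refl
    pow≥1 (suc k) = ≤-trans (pow≥1 k) (scaleUp-increases (≤-trans 0≤1 (pow≥1 k)))

    pow-nonNeg : ∀ k → 0# ≤ pow k
    pow-nonNeg k = ≤-trans 0≤1 (pow≥1 k)

    pow-+ : ∀ j k → pow (j ℕ.+ k) ≈ pow j * pow k
    pow-+ zero    k = ≈-sym (*-identityˡ _)
    pow-+ (suc j) k = ≈-trans (scaleUp-cong (pow-+ j k))
      (solve 3 (λ a b i → a :* b :+ a :* b :* i := (a :+ a :* i) :* b) ≈-refl (pow j) (pow k) (q ⁻¹))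

    pow-mono : ∀ {j k} → j ℕ.≤ k → pow j ≤ pow k
    pow-mono {k = k} z≤n = pow≥1 k
    pow-mono (s≤s j≤k) = +-mono-≤ (pow-mono j≤k) (≤-respˡ (*-comm _ _) (≤-respʳ (*-comm _ _) (*-monoʳ-≤ (q ⁻¹) 0≤q⁻¹ (pow-mono j≤k))))

    pow-cancel : ∀ {j k} → pow j ≤ pow k → j ℕ.≤ k
    pow-cancel {j} {k} le with j ℕ.≤? k
    ... | yes j≤k = j≤k
    ... | no j≰k = contradiction (≤-trans (pow-mono (ℕ.≰⇒> j≰k)) le) (<⇒≱ strict)
      where
      strict : pow k < scaleUp (pow k)
      strict = scaleUp-increases (pow-nonNeg k) , λ eq →
        proj₂ (0<* (<-≤-trans 0<1 (pow≥1 k)) (0≤q⁻¹ , λ 0≈ → 1≉0 (≈-trans (≈-sym (⁻¹-inverseʳ 0<q)) (≈-trans (*-congˡ (≈-sym 0≈)) (zeroʳ q)))))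
          (≈-sym (≈-trans (solve 2 (λ x y → y := (x :+ y) :- x) ≈-refl (pow k) (pow k * q ⁻¹))
            (≈-trans (+-congʳ (≈-sym eq)) (-‿inverseʳ _))))

    bernoulli : ∀ k → 1# + fromℕ k * q ⁻¹ ≤ pow k
    bernoulli zero    = ≤-reflexive (solve 1 (λ i → :# 1 :+ :# 0 :* i := :# 1) ≈-refl (q ⁻¹))
    bernoulli (suc k) = ≤-trans
      (≤-by (fromℕ k * q ⁻¹ * q ⁻¹) (*-nonNeg (*-nonNeg (fromℕ-nonNeg k) 0≤q⁻¹) 0≤q⁻¹)
        (solve 2 (λ k i → (:# 1 :+ k :* i) :+ (:# 1 :+ k :* i) :* i := (:# 1 :+ (:# 1 :+ k) :* i) :+ k :* i :* i) ≈-refl (fromℕ k) (q ⁻¹)))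
      (+-mono-≤ (bernoulli k) (≤-respˡ (*-comm _ _) (≤-respʳ (*-comm _ _) (*-monoʳ-≤ (q ⁻¹) 0≤q⁻¹ (bernoulli k)))))

    doubling : ∀ k → q ≈ fromℕ k → ∀ j → fromℕ (2 ℕ.^ j) ≤ pow (j ℕ.* k)
    doubling k q≈ zero    = ≤-reflexive (+-identityʳ 1#)
    doubling k q≈ (suc j) = ≤-respˡ (≈-sym (fromℕ-* 2 (2 ℕ.^ j))) (≤-respʳ (≈-sym (pow-+ k (j ℕ.* k)))
      (*-mono-≤ (fromℕ-nonNeg 2) (fromℕ-nonNeg (2 ℕ.^ j)) two (doubling k q≈ j)))
      where
      two : fromℕ 2 ≤ pow k
      two = ≤-trans (≤-reflexive (≈-trans (+-congˡ (+-identityʳ 1#))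
        (+-congˡ (≈-sym (≈-trans (*-congʳ (≈-sym q≈)) (⁻¹-inverseʳ 0<q)))))) (bernoulli k)

    -- Σ_e y_e (q c_e + used_e): every unit of flow sent along P increases it by y(P).
    dualValue : (E → ℝ) → (E → ℝ) → ℝ
    dualValue y used = sum (allFin m) (λ e → y e * (q * c e + used e))

    dualValue-route : ∀ P u {y used y′ used′} →
      (∀ e → y′ e * (q * c e + used′ e) ≈ y e * (q * c e + used e) + when (P ∋? e) (y e * u)) →
      dualValue y′ used′ ≈ dualValue y used + u * pathWeight y P
    dualValue-route P u {y} step = ≈-trans (sum-cong (allFin m) (λ e _ → step e))
      (≈-trans (sum-+ (allFin m) _ _) (+-congˡ (≈-trans (sum-cong (allFin m) (λ e _ → ≈-trans (when-value (P ∋? e) (λ _ → *-comm (y e) u)) (≈-sym (*-when (P ∋? e) u (y e)))))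
        (≈-trans (sum-* (allFin m) u _) (*-congˡ (≈-sym (pathWeight-restrict P y)))))))

    dualValue≥ : ∀ {y used} → (∀ e → 1# ≤ y e) → (∀ e → 0# ≤ used e) → q * capacitySum ≤ dualValue y used
    dualValue≥ {y} {used} y≥1 used≥0 = ≤-respˡ (sum-* (allFin m) q c) (sum-mono (allFin m) (λ e _ →
      ≤-by ((y e - 1#) * (q * c e + used e) + used e)
        (0≤+ (*-nonNeg (x≤y⇒0≤y-x (y≥1 e)) (0≤+ (*-nonNeg (proj₁ 0<q) (proj₁ (c-positive e))) (used≥0 e))) (used≥0 e))
        (solve 4 (λ y q c u → y :* (q :* c :+ u) := q :* c :+ ((y :- :# 1) :* (q :* c :+ u) :+ u)) ≈-refl (y e) q (c e) (used e))))

    -- Weak duality for the increase y − 1 of the weights.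
    duality : ∀ {y used α} → (∀ e → 1# ≤ y e) → (∀ e → 0# ≤ used e) → (∀ P → α ≤ pathWeight y P) →
      ∀ x → Feasible x → q * flowValue x * α + q * capacitySum ≤ dualValue y used + q * flowValue x * fromℕ L
    duality {y} {used} {α} y≥1 used≥0 short x feasible = ≤-trans
      (≤-respˡ (solve 4 (λ q v α C → q :* (v :* α :+ C) := q :* v :* α :+ q :* C) ≈-refl q V α C)
        (≤-respʳ (distribˡ q _ _) (*-monoʳ-≤ q (proj₁ 0<q) (+-mono-≤ routed ≤-refl))))
      (≤-trans (≤-reflexive (solve 5 (λ q v l z C → q :* (v :* l :+ z) :+ q :* C := (q :* (C :+ z)) :+ q :* v :* l) ≈-refl q V (fromℕ L) (totalCapacity z) C))
        (+-mono-≤ (≤-respˡ (≈-trans (sum-* (allFin m) q _) (*-congˡ (sum-+ (allFin m) _ _))) (sum-mono (allFin m) (λ e _ →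
          ≤-by (y e * used e) (*-nonNeg (≤-trans 0≤1 (y≥1 e)) (used≥0 e))
            (solve 4 (λ y q c u → y :* (q :* c :+ u) := q :* (c :+ c :* (y :- :# 1)) :+ y :* u) ≈-refl (y e) q (c e) (used e))))) ≤-refl))
      where
      V = flowValue x
      C = capacitySum
      z : E → ℝ
      z e = y e - 1#
      z≥0 : ∀ e → 0# ≤ z e
      z≥0 e = x≤y⇒0≤y-x (y≥1 e)
      split : ∀ es → sum es y ≈ fromℕ (length es) + sum es z
      split []       = ≈-sym (+-identityʳ 0#)
      split (e ∷ es) = ≈-trans (+-congˡ (split es))
        (solve 3 (λ y n s → y :+ (n :+ s) := (:# 1 :+ n) :+ ((y :- :# 1) :+ s)) ≈-refl (y e) (fromℕ (length es)) (sum es z))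
      α≤ : ∀ P → α ≤ fromℕ L + pathWeight z P
      α≤ P = ≤-trans (short P) (≤-respˡ (≈-sym (split (edges P))) (+-mono-≤ (fromℕ-mono (length≤L P)) ≤-refl))
      routed : V * α ≤ V * fromℕ L + totalCapacity z
      routed = ≤-trans (≤-respˡ (≈-trans (sum-cong allPaths (λ P _ → *-comm (amount x P) α)) (≈-trans (sum-* allPaths α _) (*-comm α V)))
          (sum-mono allPaths (λ P _ → *-monoʳ-≤ (amount x P) (nonNegative x P) (α≤ P))))
        (≤-trans (≤-reflexive (≈-trans (sum-cong allPaths (λ P _ → ≈-trans (distribˡ _ _ _) (+-congʳ (*-comm _ _))))
            (≈-trans (sum-+ allPaths _ _) (+-congʳ (≈-trans (sum-* allPaths (fromℕ L) _) (*-comm _ V))))))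
          (+-mono-≤ ≤-refl (weak-duality x feasible z z≥0)))

    -- With D the dual value, F the flow value routed so far and V the value of any feasible flow, the
    -- bound  F − q (D − q C) / ((q+1) α) ≥ (q/(q+1))² V (a − (q+1)(1 − L/α)),  cleared of denominators and subtractions.
    Potential : (D F α a V : ℝ) → Set
    Potential D F α a V =
      q * q+1 * D + q * q * V * (a * α + q+1 * fromℕ L) ≤
      q+1 * q+1 * α * F + q * q * q+1 * capacitySum + q * q * q+1 * V * α

    potential-cong : ∀ {D D′ F F′ α α′ a a′ V} → D ≈ D′ → F ≈ F′ → α ≈ α′ → a ≈ a′ →
      Potential D F α a V → Potential D′ F′ α′ a′ V
    potential-cong D≈ F≈ α≈ a≈ p =
      ≤-respˡ (+-cong (*-congˡ D≈) (*-congˡ (+-congʳ (*-cong a≈ α≈))))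
        (≤-respʳ (+-cong (+-congʳ (*-cong (*-congˡ α≈) F≈)) (*-congˡ α≈)) p)

    potential-initial : ∀ V → Potential (q * capacitySum) 0# (fromℕ L) 0# V
    potential-initial V = ≤-reflexive (solve 4 (λ q C V l →
      q :* (q :+ :# 1) :* (q :* C) :+ q :* q :* V :* (:# 0 :* l :+ (q :+ :# 1) :* l) :=
      (q :+ :# 1) :* (q :+ :# 1) :* l :* :# 0 :+ q :* q :* (q :+ :# 1) :* C :+ q :* q :* (q :+ :# 1) :* V :* l) ≈-refl q capacitySum V (fromℕ L))

    potential-route : ∀ {D F α a V} u Y → 0# ≤ u → q * Y ≤ q+1 * α → Potential D F α a V → Potential (D + u * Y) (F + u) α a V
    potential-route {D} {F} {α} {a} {V} u Y 0≤u cheap p = ≤-respˡ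
      (solve 7 (λ q D u Y V a′ l → (q :* (q :+ :# 1) :* D :+ q :* q :* V :* a′) :+ (q :+ :# 1) :* u :* (q :* Y) :=
          q :* (q :+ :# 1) :* (D :+ u :* Y) :+ q :* q :* V :* a′) ≈-refl q D u Y V (a * α + q+1 * fromℕ L) (fromℕ L))
      (≤-respʳ (solve 6 (λ q F u α C V → ((q :+ :# 1) :* (q :+ :# 1) :* α :* F :+ q :* q :* (q :+ :# 1) :* C :+ q :* q :* (q :+ :# 1) :* V :* α) :+ (q :+ :# 1) :* u :* ((q :+ :# 1) :* α) :=
          (q :+ :# 1) :* (q :+ :# 1) :* α :* (F :+ u) :+ q :* q :* (q :+ :# 1) :* C :+ q :* q :* (q :+ :# 1) :* V :* α) ≈-refl q F u α capacitySum V)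
        (+-mono-≤ p (*-monoʳ-≤ (q+1 * u) (*-nonNeg (proj₁ 0<q+1) 0≤u) cheap)))

    potential-advance : ∀ {D F α a V} → q * V * α + q * capacitySum ≤ D + q * V * fromℕ L →
      Potential D F α a V → Potential D F (scaleUp α) (1# + a) V
    potential-advance {D} {F} {α} {a} {V} dual p = potential-cong ≈-refl ≈-refl (≈-sym α′≈) ≈-refl
      (*-cancelˡ-≤ q 0<q (≤-by (q+1 * d₁ + q+1 * (q * d₂))
        (0≤+ (*-nonNeg (proj₁ 0<q+1) (x≤y⇒0≤y-x p′)) (*-nonNeg (proj₁ 0<q+1) (*-nonNeg (proj₁ 0<q) (x≤y⇒0≤y-x dual′))))
        (solve 8 (λ q D F β a V C l →
           q :* ((q :+ :# 1) :* (q :+ :# 1) :* ((q :+ :# 1) :* β) :* F :+ q :* q :* (q :+ :# 1) :* C :+ q :* q :* (q :+ :# 1) :* V :* ((q :+ :# 1) :* β)) :=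
           q :* (q :* (q :+ :# 1) :* D :+ q :* q :* V :* ((:# 1 :+ a) :* ((q :+ :# 1) :* β) :+ (q :+ :# 1) :* l)) :+
           ((q :+ :# 1) :* (((q :+ :# 1) :* (q :+ :# 1) :* (q :* β) :* F :+ q :* q :* (q :+ :# 1) :* C :+ q :* q :* (q :+ :# 1) :* V :* (q :* β))
                            :- (q :* (q :+ :# 1) :* D :+ q :* q :* V :* (a :* (q :* β) :+ (q :+ :# 1) :* l)))
            :+ (q :+ :# 1) :* (q :* ((D :+ q :* V :* l) :- (q :* V :* (q :* β) :+ q :* C)))))
          ≈-refl q D F β a V capacitySum (fromℕ L))))
      where
      β = α * q ⁻¹
      α≈ : α ≈ q * β
      α≈ = ≈-trans (≈-sym (*-identityʳ α)) (≈-trans (*-congˡ (≈-sym (⁻¹-inverseʳ 0<q)))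
        (solve 3 (λ α q i → α :* (q :* i) := q :* (α :* i)) ≈-refl α q (q ⁻¹)))
      α′≈ : scaleUp α ≈ q+1 * β
      α′≈ = ≈-trans (+-congʳ α≈) (solve 2 (λ q b → q :* b :+ b := (q :+ :# 1) :* b) ≈-refl q β)
      p′ = potential-cong {V = V} (≈-refl {D}) (≈-refl {F}) α≈ (≈-refl {a}) p
      dual′ : q * V * (q * β) + q * capacitySum ≤ D + q * V * fromℕ L
      dual′ = ≤-respˡ (+-congʳ (*-congˡ α≈)) dual
      d₁ = (q+1 * q+1 * (q * β) * F + q * q * q+1 * capacitySum + q * q * q+1 * V * (q * β))
           - (q * q+1 * D + q * q * V * (a * (q * β) + q+1 * fromℕ L))
      d₂ = (D + q * V * fromℕ L) - (q * V * (q * β) + q * capacitySum)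

    potential-final : ∀ {D F α V} k → 0# < α → 0# ≤ V → q * capacitySum ≤ D →
      Potential D F α (k + q+1) V → q * q * k * V ≤ q+1 * q+1 * F
    potential-final {D} {F} {α} {V} k 0<α 0≤V qC≤D p = *-cancelˡ-≤ α 0<α (≤-by (d₁ + (q * q+1 * d₂ + q * q * V * (q+1 * fromℕ L)))
      (0≤+ (x≤y⇒0≤y-x p) (0≤+ (*-nonNeg (*-nonNeg (proj₁ 0<q) (proj₁ 0<q+1)) (x≤y⇒0≤y-x qC≤D))
        (*-nonNeg (*-nonNeg (*-nonNeg (proj₁ 0<q) (proj₁ 0<q)) 0≤V) (*-nonNeg (proj₁ 0<q+1) (fromℕ-nonNeg L)))))
      (solve 8 (λ q D F α k V C l → α :* ((q :+ :# 1) :* (q :+ :# 1) :* F) := α :* (q :* q :* k :* V) :+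
         ((((q :+ :# 1) :* (q :+ :# 1) :* α :* F :+ q :* q :* (q :+ :# 1) :* C :+ q :* q :* (q :+ :# 1) :* V :* α)
           :- (q :* (q :+ :# 1) :* D :+ q :* q :* V :* ((k :+ (q :+ :# 1)) :* α :+ (q :+ :# 1) :* l)))
          :+ (q :* (q :+ :# 1) :* (D :- q :* C) :+ q :* q :* V :* ((q :+ :# 1) :* l))))
        ≈-refl q D F α k V capacitySum (fromℕ L)))
      where
      d₁ = (q+1 * q+1 * α * F + q * q * q+1 * capacitySum + q * q * q+1 * V * α)
           - (q * q+1 * D + q * q * V * ((k + q+1) * α + q+1 * fromℕ L))
      d₂ = D - q * capacitySum

-- The parameters of the approximation: q is about 8/ε and 2^log exceeds L.
module Iteration {R : RealNumbers} (N : Network R) (q : ℕ) (1≤q : 1 ℕ.≤ q) (log : ℕ) (L<2^log : Network.L N ℕ.< 2 ℕ.^ log) where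
  open import Data.Nat as ℕ using (ℕ; suc; z≤n; s≤s)
  import Data.Nat.Properties as ℕ
  open RealArithmetic R
  open Sums R
  open FlowTheory N
  open Potential N
  open Network N
  open Flows N

  qʳ = fromℕ q

  0<qʳ : 0# < qʳ
  0<qʳ = fromℕ-pos 1≤q

  ρ : ℕ → ℝ
  ρ = pow qʳ 0<qʳ

  up : ℝ → ℝ
  up = scaleUp qʳ 0<qʳ

  ql phases weightBound congestion : ℕ
  ql          = log ℕ.* q
  phases      = q ℕ.* ql ℕ.+ suc q
  weightBound = suc q ℕ.* n
  congestion  = ql ℕ.+ phases ℕ.+ 2

  1≤n : 1 ℕ.≤ n
  1≤n = ℕ.≤-trans (s≤s z≤n) (Data.Fin.Properties.toℕ<n s) where import Data.Fin.Properties

  0<L : 0# < fromℕ L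
  0<L = fromℕ-pos L-positive

  0<congestion : 0# < fromℕ congestion
  0<congestion = fromℕ-pos (ℕ.≤-trans (s≤s z≤n) (ℕ.m≤n+m 2 (ql ℕ.+ phases)))

  record Ghost : Set where
    constructor ghost
    field
      level   : ℕ
      raises  : E → ℕ
      y used  : E → ℝ
      α       : ℝ
      entries : Entries

  record Good (G : Ghost) : Set where
    open Ghost G
    field
      level≤    : level ℕ.≤ phases
      y≈        : ∀ e → y e ≈ ρ (raises e)
      used≥0    : ∀ e → 0# ≤ used e
      used≤c    : ∀ e → used e ≤ c e
      α≈        : α ≈ fromℕ L * ρ level
      congested : ∀ e → fromℕ congestion * load entries e ≈ fromℕ (raises e) * c e + used e
      raises<   : ∀ e → raises e ℕ.< congestion
      amounts≥0 : AmountsNonNegative entries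
      potential : ∀ x → Feasible x →
        Potential qʳ 0<qʳ (dualValue qʳ 0<qʳ y used) (fromℕ congestion * total entries) α (fromℕ level) (flowValue x)

  module _ {G : Ghost} (g : Good G) where
    open Ghost G
    open Good g

    y≥1 : ∀ e → 1# ≤ y e
    y≥1 e = ≤-respʳ (≈-sym (y≈ e)) (pow≥1 qʳ 0<qʳ (raises e))

    0<α : 0# < α
    0<α = <-≤-trans 0<L (≤-respʳ (≈-sym α≈) (≤-respˡ (*-identityʳ _) (*-monoʳ-≤ (fromℕ L) (proj₁ 0<L) (pow≥1 qʳ 0<qʳ level))))

    good-feasible : ∀ e → load entries e ≤ c e
    good-feasible e = *-cancelˡ-≤ (fromℕ congestion) 0<congestion (≤-respˡ (≈-sym (congested e))
      (≤-trans (+-mono-≤ ≤-refl (used≤c e)) (≤-respˡ (solve 2 (λ r c → (:# 1 :+ r) :* c := r :* c :+ c) ≈-refl (fromℕ (raises e)) (c e))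
        (≤-respˡ (*-comm _ _) (≤-respʳ (*-comm _ _) (*-monoʳ-≤ (c e) (proj₁ (c-positive e)) (fromℕ-mono (raises< e))))))))

    good-value : level ≡ phases → ∀ x → Feasible x →
      qʳ * qʳ * fromℕ (q ℕ.* ql) * flowValue x ≤ (qʳ + 1#) * (qʳ + 1#) * (fromℕ congestion * total entries)
    good-value level≡ x feasible = potential-final qʳ 0<qʳ {D} {F} {α} {flowValue x} (fromℕ (q ℕ.* ql)) 0<α
      (flowValue-nonNeg x) (dualValue≥ qʳ 0<qʳ y≥1 used≥0)
      (potential-cong qʳ 0<qʳ {D} {D} {F} {F} {α} {α} {fromℕ level} {fromℕ (q ℕ.* ql) + (qʳ + 1#)} {flowValue x} ≈-refl ≈-refl ≈-refl
        (≈-trans (fromℕ-cong level≡) (≈-trans (fromℕ-+ (q ℕ.* ql) (suc q)) (+-congˡ (+-comm 1# qʳ))))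
        (potential x feasible))
      where
      D = dualValue qʳ 0<qʳ y used
      F = fromℕ congestion * total entries

  record Rounds (α y : ℝ) (w : ℕ) : Set where
    field
      w≥1   : 1 ℕ.≤ w
      upper : fromℕ w * α ≤ y * fromℕ n * qʳ + α
      lower : w ℕ.≤ weightBound → y * fromℕ n * qʳ ≤ fromℕ w * α

  module _ {α : ℝ} {y : E → ℝ} {w : E → ℕ} (0<α : 0# < α) (rounds : ∀ e → Rounds α (y e) (w e)) where
    private
      module Rd e = Rounds (rounds e)

      weight : List E → ℕ
      weight P = ℕ.sum (map w P)

      w≤weight : ∀ {e} P → e ∈ P → w e ℕ.≤ weight P
      w≤weight (e ∷ P) (here refl) = ℕ.m≤m+n (w e) _
      w≤weight (e ∷ P) (there e∈)    = ℕ.≤-trans (w≤weight P e∈) (ℕ.m≤n+m _ (w e))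

      scaled : ∀ P → sum P (λ e → y e * fromℕ n * qʳ) ≈ fromℕ n * qʳ * sum P y
      scaled P = ≈-trans (sum-cong P (λ e _ → solve 3 (λ y n q → y :* n :* q := n :* q :* y) ≈-refl (y e) (fromℕ n) qʳ))
        (sum-* P (fromℕ n * qʳ) y)

      weighted : ∀ P → sum P (λ e → fromℕ (w e) * α) ≈ fromℕ (weight P) * α
      weighted P = ≈-trans (sum-cong P (λ e _ → *-comm _ α)) (≈-trans (sum-* P α _) (≈-trans (*-comm α _) (*-congʳ (≈-sym (sum-fromℕ P w)))))

    cheap : ∀ P → weight (edges P) ℕ.≤ weightBound → qʳ * pathWeight y P ≤ (qʳ + 1#) * α
    cheap P W≤ = *-cancelˡ-≤ (fromℕ n) (fromℕ-pos 1≤n) (≤-respˡ (≈-trans (scaled (edges P)) (*-assoc _ _ _))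
      (≤-trans (sum-mono (edges P) (λ e e∈ → Rd.lower e (ℕ.≤-trans (w≤weight (edges P) e∈) W≤)))
        (≤-respˡ (≈-sym (weighted (edges P))) (≤-respʳ bound
          (≤-respˡ (*-comm _ _) (≤-respʳ (*-comm _ _) (*-monoʳ-≤ α (proj₁ 0<α) (fromℕ-mono W≤))))))))
      where
      bound : fromℕ weightBound * α ≈ fromℕ n * ((qʳ + 1#) * α)
      bound = ≈-trans (*-congʳ (fromℕ-* (suc q) n)) (solve 3 (λ n q a → (:# 1 :+ q) :* n :* a := n :* ((q :+ :# 1) :* a)) ≈-refl (fromℕ n) qʳ α)

    expensive : ∀ P → weightBound ℕ.< weight (edges P) → α ≤ pathWeight y P
    expensive P W> with pathWeight y P ≤? α
    ... | no y≰α = ≰⇒≥ y≰α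
    ... | yes y≤α = contradiction (fromℕ-cancel-≤ (*-cancelˡ-≤ α 0<α (≤-respˡ (*-comm _ _) (≤-respʳ (*-comm _ _) bounded′)))) (ℕ.<⇒≱ W>)
      where
      P′ = edges P
      bounded′ : fromℕ (weight P′) * α ≤ fromℕ weightBound * α
      bounded′ = ≤-respˡ (weighted P′) (≤-trans (sum-mono P′ (λ e _ → Rd.upper e))
        (≤-respˡ (≈-sym (≈-trans (sum-+ P′ _ _) (+-cong (scaled P′) (count P′))))
          (≤-trans (+-mono-≤ (*-monoʳ-≤ (fromℕ n * qʳ) (*-nonNeg (fromℕ-nonNeg n) (proj₁ 0<qʳ)) y≤α)
              (≤-respˡ (*-comm _ _) (≤-respʳ (*-comm _ _) (*-monoʳ-≤ α (proj₁ 0<α) (fromℕ-mono (ℕ.<⇒≤ (length<n P)))))))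
            (≤-reflexive (≈-trans (solve 3 (λ n q a → n :* q :* a :+ n :* a := (:# 1 :+ q) :* n :* a) ≈-refl (fromℕ n) qʳ α)
              (*-congʳ (≈-sym (fromℕ-* (suc q) n))))))))
        where
        count : ∀ P → sum P (λ _ → α) ≈ fromℕ (length P) * α
        count []      = ≈-sym (zeroˡ α)
        count (e ∷ P) = ≈-trans (+-congˡ (count P)) (solve 2 (λ n a → a :+ n :* a := (:# 1 :+ n) :* a) ≈-refl (fromℕ (length P)) α)

  advance : Ghost → Ghost
  advance (ghost level raises y used α entries) = ghost (suc level) raises y used (up α) entries

  good-advance : ∀ {G} → Good G → Ghost.level G ℕ.< phases → (∀ P → Ghost.α G ≤ pathWeight (Ghost.y G) P) → Good (advance G)
  good-advance {G} g level< short = record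
    { level≤ = level< ; y≈ = y≈ ; used≥0 = used≥0 ; used≤c = used≤c
    ; α≈ = ≈-trans (scaleUp-cong qʳ 0<qʳ α≈) (solve 3 (λ l r i → l :* r :+ l :* r :* i := l :* (r :+ r :* i)) ≈-refl (fromℕ L) (ρ level) (qʳ ⁻¹))
    ; congested = congested ; raises< = raises< ; amounts≥0 = amounts≥0
    ; potential = λ x feasible → potential-advance qʳ 0<qʳ {dualValue qʳ 0<qʳ y used} {fromℕ congestion * total entries} {α} {fromℕ level} {flowValue x}
        (duality qʳ 0<qʳ {y} {used} {α} (y≥1 g) used≥0 short x feasible) (potential x feasible) }
    where
    open Ghost G
    open Good g

  data Step (u capacity y used : ℝ) (raises : ℕ) : ℝ → ℝ → ℕ → Set where
    partial : ¬ (capacity ≤ used + u) → Step u capacity y used raises y (used + u) raises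
    full    : capacity ≤ used + u → Step u capacity y used raises (up y) 0# (raises ℕ.+ 1)

  module Route {G : Ghost} (g : Good G) (level< : Ghost.level G ℕ.< phases)
    (P : 𝒫) (cheap : qʳ * pathWeight (Ghost.y G) P ≤ (qʳ + 1#) * Ghost.α G)
    {u a : ℝ} (0≤u : 0# ≤ u) (u≤ : ∀ e → e ∈ edges P → u ≤ c e - Ghost.used G e)
    (a-def : fromℕ congestion * a ≈ u) (0≤a : 0# ≤ a)
    {raises′ : E → ℕ} {y′ used′ : E → ℝ}
    (stepped : ∀ e → e ∈ edges P → Step u (c e) (Ghost.y G e) (Ghost.used G e) (Ghost.raises G e) (y′ e) (used′ e) (raises′ e))
    (unchanged : ∀ e → e ∉ edges P → y′ e ≡ Ghost.y G e × used′ e ≡ Ghost.used G e × raises′ e ≡ Ghost.raises G e)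
    where
    open Ghost G
    open Good g

    private
      y≥0 : ∀ e → 0# ≤ y e
      y≥0 e = ≤-trans 0≤1 (y≥1 g e)

      y≤sum : ∀ {e} P → e ∈ P → y e ≤ sum P y
      y≤sum (e ∷ P) (here refl) = x≤x+y (sum-nonNeg P (λ e _ → y≥0 e))
      y≤sum (e ∷ P) (there e∈) = ≤-trans (y≤sum P e∈) (≤-respʳ (+-comm _ _) (x≤x+y (y≥0 e)))

      raises-bound : ∀ e → e ∈ edges P → raises e ℕ.≤ ql ℕ.+ suc level
      raises-bound e e∈ = pow-cancel qʳ 0<qʳ (≤-trans (≤-respˡ (y≈ e) y≤upα)
        (≤-trans (≤-reflexive (≈-trans (scaleUp-cong qʳ 0<qʳ α≈) (solve 3 (λ l r i → l :* r :+ l :* r :* i := l :* (r :+ r :* i)) ≈-refl (fromℕ L) (ρ level) (qʳ ⁻¹))))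
          (≤-respʳ (≈-sym (pow-+ qʳ 0<qʳ ql (suc level)))
            (*-mono-≤ (proj₁ 0<L) (pow-nonNeg qʳ 0<qʳ (suc level)) (≤-trans (fromℕ-mono (ℕ.<⇒≤ L<2^log)) (doubling qʳ 0<qʳ q ≈-refl log)) ≤-refl))))
        where
        y≤upα : y e ≤ up α
        y≤upα = *-cancelˡ-≤ qʳ 0<qʳ (≤-trans (*-monoʳ-≤ qʳ (proj₁ 0<qʳ) (y≤sum (edges P) e∈)) (≤-respʳ (≈-sym (scaleUp-q qʳ 0<qʳ α)) cheap))

      saturated : ∀ {e} → e ∈ edges P → c e ≤ used e + u → used e + u ≈ c e
      saturated {e} e∈ c≤ = ≤-antisym (≤-respʳ (solve 2 (λ c s → s :+ (c :- s) := c) ≈-refl (c e) (used e)) (+-monoʳ-≤ (used e) (u≤ e e∈))) c≤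

    routed : Ghost
    routed = ghost level raises′ y′ used′ α ((P , a) ∷ entries)

    private
      record Facts (e : E) (through? : Dec (e ∈ edges P)) (Y U : ℝ) (r : ℕ) : Set where
        field
          fact-y    : Y ≈ ρ (r)
          fact-0    : 0# ≤ U
          fact-c    : U ≤ c e
          fact-cap  : fromℕ congestion * (when through? a + load entries e) ≈ fromℕ (r) * c e + U
          fact-M    : r ℕ.< congestion
          fact-D    : Y * (qʳ * c e + U) ≈ y e * (qʳ * c e + used e) + when through? (y e * u)
          fact-mono : raises e ℕ.≤ r

      facts : ∀ e → Facts e (P ∋? e) (y′ e) (used′ e) (raises′ e)
      facts e with P ∋? e
      facts e | no e∉ with y′ e | used′ e | raises′ e | unchanged e e∉
      ... | _ | _ | _ | refl , refl , refl = record
        { fact-y = y≈ e ; fact-0 = used≥0 e ; fact-c = used≤c e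
        ; fact-cap = ≈-trans (*-congˡ (+-identityˡ _)) (congested e)
        ; fact-M = raises< e ; fact-D = ≈-sym (+-identityʳ _) ; fact-mono = ℕ.≤-refl }
      facts e | yes e∈ with y′ e | used′ e | raises′ e | stepped e e∈
      ... | _ | _ | _ | partial c≰ = record
        { fact-y = y≈ e ; fact-0 = 0≤+ (used≥0 e) 0≤u ; fact-c = ≰⇒≥ c≰
        ; fact-cap = ≈-trans (distribˡ _ _ _) (≈-trans (+-cong a-def (congested e))
            (solve 3 (λ u r s → u :+ (r :+ s) := r :+ (s :+ u)) ≈-refl u (fromℕ (raises e) * c e) (used e)))
        ; fact-M = raises< e
        ; fact-D = solve 5 (λ y q c s u → y :* (q :* c :+ (s :+ u)) := y :* (q :* c :+ s) :+ y :* u) ≈-refl (y e) qʳ (c e) (used e) u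
        ; fact-mono = ℕ.≤-refl }
      ... | _ | _ | _ | full c≤ = record
        { fact-y = ≈-trans (scaleUp-cong qʳ 0<qʳ (y≈ e)) (≈-reflexive (cong ρ (ℕ.+-comm 1 (raises e))))
        ; fact-0 = ≤-refl ; fact-c = proj₁ (c-positive e)
        ; fact-cap = ≈-trans (distribˡ _ _ _) (≈-trans (+-cong a-def (congested e))
            (≈-trans (solve 3 (λ u r s → u :+ (r :+ s) := r :+ (s :+ u)) ≈-refl u (fromℕ (raises e) * c e) (used e))
              (≈-trans (+-congˡ (saturated e∈ c≤))
                (≈-trans (solve 2 (λ r c → r :* c :+ c := (:# 1 :+ r) :* c :+ :# 0) ≈-refl (fromℕ (raises e)) (c e))
                  (+-congʳ (*-congʳ (fromℕ-cong (ℕ.+-comm 1 (raises e)))))))))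
        ; fact-M = subst₂ ℕ._<_ (ℕ.+-comm 1 (raises e)) (ℕ.+-comm 2 (ql ℕ.+ phases))
            (s≤s (s≤s (ℕ.≤-trans (raises-bound e e∈) (ℕ.+-monoʳ-≤ ql level<))))
        ; fact-D = ≈-trans (solve 3 (λ q c Y → Y :* (q :* c :+ :# 0) := (q :* Y) :* c) ≈-refl qʳ (c e) (up (y e)))
            (≈-trans (*-congʳ (scaleUp-q qʳ 0<qʳ (y e)))
              (≈-trans (solve 3 (λ q c y → (q :+ :# 1) :* y :* c := y :* (q :* c :+ c)) ≈-refl qʳ (c e) (y e))
                (≈-trans (*-congˡ (+-congˡ (≈-sym (saturated e∈ c≤))))
                  (solve 5 (λ y q c s u → y :* (q :* c :+ (s :+ u)) := y :* (q :* c :+ s) :+ y :* u) ≈-refl (y e) qʳ (c e) (used e) u))))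
        ; fact-mono = ℕ.m≤m+n (raises e) 1 }

      module F e = Facts (facts e)

    good-routed : Good routed
    good-routed = record
      { level≤ = level≤ ; y≈ = F.fact-y ; used≥0 = F.fact-0 ; used≤c = F.fact-c ; α≈ = α≈
      ; congested = F.fact-cap ; raises< = F.fact-M ; amounts≥0 = 0≤a ∷ amounts≥0
      ; potential = λ x feasible →
          potential-cong qʳ 0<qʳ {D + u * Y} {D′} {F + u} {fromℕ congestion * (a + total entries)} {α} {α} {fromℕ level} {fromℕ level} {flowValue x}
            (≈-sym (dualValue-route qʳ 0<qʳ P u F.fact-D))
            (≈-trans (+-comm F u) (≈-trans (+-congʳ (≈-sym a-def)) (≈-sym (distribˡ _ _ _)))) ≈-refl ≈-refl
            (potential-route qʳ 0<qʳ {D} {F} {α} {fromℕ level} {flowValue x} u Y 0≤u cheap (potential x feasible)) }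
      where
      D = dualValue qʳ 0<qʳ y used
      D′ = dualValue qʳ 0<qʳ y′ used′
      F = fromℕ congestion * total entries
      Y = pathWeight y P

    raises-mono : ∀ e → raises e ℕ.≤ raises′ e
    raises-mono = F.fact-mono

    raises-bottleneck : ∀ e → e ∈ edges P → u ≡ c e - used e → raises e ℕ.< raises′ e
    raises-bottleneck e e∈ u≡ with y′ e | used′ e | raises′ e | stepped e e∈
    ... | _ | _ | _ | partial c≰ = contradiction (≤-reflexive (≈-trans (solve 2 (λ c s → c := s :+ (c :- s)) ≈-refl (c e) (used e))
            (+-congˡ (≈-reflexive (sym u≡))))) c≰
    ... | _ | _ | _ | full _ = ℕ.m<m+n (raises e) (s≤s z≤n)

  potentialRaises : (E → ℕ) → ℕ
  potentialRaises raises = ℕ.sum (map (λ e → congestion ℕ.∸ raises e) (allFin m))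

  sum-mono-ℕ : ∀ {A : Set} {f g : A → ℕ} xs → (∀ x → f x ℕ.≤ g x) → ℕ.sum (map f xs) ℕ.≤ ℕ.sum (map g xs)
  sum-mono-ℕ []       f≤g = z≤n
  sum-mono-ℕ (x ∷ xs) f≤g = ℕ.+-mono-≤ (f≤g x) (sum-mono-ℕ xs f≤g)

  sum-strict-ℕ : ∀ {A : Set} {f g : A → ℕ} {x} xs → (∀ x → f x ℕ.≤ g x) → x ∈ xs → f x ℕ.< g x →
    ℕ.sum (map f xs) ℕ.< ℕ.sum (map g xs)
  sum-strict-ℕ (x ∷ xs) f≤g (here refl) f<g = ℕ.+-mono-<-≤ f<g (sum-mono-ℕ xs f≤g)
  sum-strict-ℕ (x ∷ xs) f≤g (there x∈)    f<g = ℕ.+-mono-≤-< (f≤g x) (sum-strict-ℕ xs f≤g x∈ f<g)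

  potentialRaises-decreases : ∀ {raises raises′} e → (∀ e → raises e ℕ.≤ raises′ e) → raises e ℕ.< raises′ e → raises′ e ℕ.< congestion →
    potentialRaises raises′ ℕ.< potentialRaises raises
  potentialRaises-decreases {raises} {raises′} e mono e< e<M = sum-strict-ℕ (allFin m) (λ e → ℕ.∸-monoʳ-≤ congestion (mono e)) (∈-allFin e)
    (ℕ.∸-monoʳ-< e< (ℕ.<⇒≤ e<M))

  potentialRaises-initial : potentialRaises (λ _ → 0) ≡ m ℕ.* congestion
  potentialRaises-initial = trans (constant (allFin m)) (cong (ℕ._* congestion) (List.length-tabulate (λ (e : E) → e)))
    where
    constant : ∀ (es : List E) → ℕ.sum (map (λ _ → congestion) es) ≡ length es ℕ.* congestion
    constant []       = refl
    constant (e ∷ es) = cong (congestion ℕ.+_) (constant es)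

module Programs where
  open import Data.Nat using (ℕ; suc; _+_; _≡ᵇ_)

  -- Every loop body increments cell 0 of an integer array reserved for this purpose.

  clock : ℕ
  clock = 9

  tick : Program
  tick = clock [ lit 0 ]≔ⁿ clock [ lit 0 ]ⁿ ⊕ lit 1

  ticked : Program → Program
  ticked skip          = skip
  ticked (a [ i ]≔ⁿ v) = a [ i ]≔ⁿ v
  ticked (a [ i ]≔ʳ v) = a [ i ]≔ʳ v
  ticked (p ⨾ q)       = ticked p ⨾ ticked q
  ticked (ifᶜ b p q)   = ifᶜ b (ticked p) (ticked q)
  ticked (while b p)   = while b (tick ⨾ ticked p)

  writesⁿ writesʳ : ℕ → Program → Bool
  writesⁿ a skip          = false
  writesⁿ a (b [ _ ]≔ⁿ _) = a ≡ᵇ b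
  writesⁿ a (_ [ _ ]≔ʳ _) = false
  writesⁿ a (p ⨾ q)       = writesⁿ a p ∨ writesⁿ a q
  writesⁿ a (ifᶜ _ p q)   = writesⁿ a p ∨ writesⁿ a q
  writesⁿ a (while _ p)   = writesⁿ a p
  writesʳ a skip          = false
  writesʳ a (_ [ _ ]≔ⁿ _) = false
  writesʳ a (b [ _ ]≔ʳ _) = a ≡ᵇ b
  writesʳ a (p ⨾ q)       = writesʳ a p ∨ writesʳ a q
  writesʳ a (ifᶜ _ p q)   = writesʳ a p ∨ writesʳ a q
  writesʳ a (while _ p)   = writesʳ a p

  loopFree : Program → Bool
  loopFree skip          = true
  loopFree (_ [ _ ]≔ⁿ _) = true
  loopFree (_ [ _ ]≔ʳ _) = true
  loopFree (p ⨾ q)       = loopFree p ∧ loopFree q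
  loopFree (ifᶜ _ p q)   = loopFree p ∧ loopFree q
  loopFree (while _ _)   = false

  size : Program → ℕ
  size skip          = 1
  size (_ [ _ ]≔ⁿ _) = 1
  size (_ [ _ ]≔ʳ _) = 1
  size (p ⨾ q)       = size p + size q
  size (ifᶜ _ p q)   = suc (size p + size q)
  size (while _ p)   = suc (size p)

  var : ℕ → NatExp
  var a = a [ lit 0 ]ⁿ

  for : ℕ → NatExp → Program → Program
  for i bound body = i [ lit 0 ]≔ⁿ lit 0 ⨾ while (var i <ⁿ bound) (body ⨾ i [ lit 0 ]≔ⁿ var i ⊕ lit 1)

  writesInput : Program → Bool
  writesInput p = (writesⁿ 0 p ∨ writesⁿ 1 p) ∨ ((writesⁿ 2 p ∨ writesⁿ 3 p) ∨ (writesʳ 0 p ∨ writesʳ 1 p))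

  input-n input-m input-s input-t input-L : NatExp
  input-n = 0 [ lit 0 ]ⁿ
  input-m = 0 [ lit 1 ]ⁿ
  input-s = 0 [ lit 2 ]ⁿ
  input-t = 0 [ lit 3 ]ⁿ
  input-L = 0 [ lit 4 ]ⁿ

  aW aK aB aG aF aX aRow aEdge : ℕ
  aW    = 10   -- edge weights
  aK    = 11   -- weight bound
  aB    = 12   -- row offsets
  aG    = 13   -- distances
  aF    = 14   -- first edges
  aX    = 15   -- next cells
  aRow  = 16
  aEdge = 17

  thisRow nextRow : NatExp
  thisRow = aB [ var aRow ]ⁿ
  nextRow = aB [ var aRow ⊕ lit 1 ]ⁿ

  currentSrc currentTgt currentℓ currentW : NatExp
  currentSrc = 1 [ var aEdge ]ⁿ
  currentTgt = 2 [ var aEdge ]ⁿ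
  currentℓ   = 3 [ var aEdge ]ⁿ
  currentW   = aW [ var aEdge ]ⁿ

  setCell : NatExp → NatExp → NatExp → NatExp → Program
  setCell x d f y = aG [ x ]≔ⁿ d ⨾ aF [ x ]≔ⁿ f ⨾ aX [ x ]≔ⁿ y

  copyCell : NatExp → Program
  copyCell v = setCell (nextRow ⊕ v) (aG [ thisRow ⊕ v ]ⁿ) (aF [ thisRow ⊕ v ]ⁿ) (aX [ thisRow ⊕ v ]ⁿ)

  relaxTarget : NatExp
  relaxTarget = aB [ (var aRow ⊕ lit 1) ⊖ currentW ]ⁿ ⊕ currentTgt

  relax : Program
  relax = ifᶜ ((currentW <ⁿ var aRow ⊕ lit 2) and (currentℓ ⊕ aG [ relaxTarget ]ⁿ <ⁿ aG [ nextRow ⊕ currentSrc ]ⁿ))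
    (setCell (nextRow ⊕ currentSrc) (currentℓ ⊕ aG [ relaxTarget ]ⁿ) (var aEdge) relaxTarget)
    skip

  baseRow : Program
  baseRow = aB [ lit 0 ]≔ⁿ lit 0
    ⨾ for aEdge input-m (aG [ currentSrc ]≔ⁿ input-L ⊕ lit 1 ⨾ aG [ currentTgt ]≔ⁿ input-L ⊕ lit 1)
    ⨾ aG [ input-t ]≔ⁿ lit 0

  newRow : Program
  newRow = aB [ var aRow ⊕ lit 1 ]≔ⁿ thisRow ⊕ input-n
    ⨾ for aEdge input-m (copyCell currentSrc ⨾ copyCell currentTgt)
    ⨾ for aEdge input-m relax

  fillTable : Program
  fillTable = baseRow ⨾ for aRow (var aK) newRow

  aPos aPtr aI : ℕ
  aPos = 18
  aPtr = 19
  aI   = 20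

  followStep follow : Program
  followStep = 6 [ var aPos ]≔ⁿ aF [ var aPtr ]ⁿ ⨾ aPos [ lit 0 ]≔ⁿ var aPos ⊕ lit 1 ⨾ aPtr [ lit 0 ]≔ⁿ aX [ var aPtr ]ⁿ
  follow = while (lit 0 <ⁿ aG [ var aPtr ]ⁿ) followStep

  forPath : Program → Program
  forPath body = aI [ lit 0 ]≔ⁿ 5 [ 4 [ lit 0 ]ⁿ ]ⁿ
    ⨾ while (var aI <ⁿ var aPos) (aEdge [ lit 0 ]≔ⁿ 6 [ var aI ]ⁿ ⨾ body ⨾ aI [ lit 0 ]≔ⁿ var aI ⊕ lit 1)

  pathExists : Cond
  pathExists = aG [ aB [ var aK ]ⁿ ⊕ input-s ]ⁿ <ⁿ input-L ⊕ lit 1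

  writePath : Program
  writePath = aPos [ lit 0 ]≔ⁿ 5 [ 4 [ lit 0 ]ⁿ ]ⁿ ⨾ aPtr [ lit 0 ]≔ⁿ aB [ var aK ]ⁿ ⊕ input-s ⨾ follow

  search : Program → Program → Program
  search found notFound = fillTable ⨾ ifᶜ pathExists (writePath ⨾ found) notFound

  prefix : Program
  prefix = ticked (fillTable ⨾ writePath)

  addEntry : RealExp → Program
  addEntry amount = 2 [ 4 [ lit 0 ]ⁿ ]≔ʳ amount ⨾ 5 [ 4 [ lit 0 ]ⁿ ⊕ lit 1 ]≔ⁿ 18 [ lit 0 ]ⁿ ⨾ 4 [ lit 0 ]≔ⁿ 4 [ lit 0 ]ⁿ ⊕ lit 1

  aQ aQL aR aLevel aRaises aY aUsed aα aU : ℕ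
  aQ      = 21
  aQL     = 23
  aR      = 24
  aLevel  = 25
  aRaises = 26
  aY      = 3    -- real arrays from here on
  aUsed   = 4
  aα      = 5
  aU      = 6

  varʳ : ℕ → RealExp
  varʳ a = a [ lit 0 ]ʳ

  roundStep round weights : Program
  roundStep = aW [ var aEdge ]≔ⁿ currentW ⊕ lit 1
  round = aW [ var aEdge ]≔ⁿ lit 1
    ⨾ while ((currentW <ⁿ var aK ⊕ lit 1) and notᶜ (aY [ var aEdge ]ʳ *ʳ int input-n *ʳ int (var aQ) ≤ʳ int currentW *ʳ varʳ aα)) roundStep
  weights = for aEdge input-m round

  headroom : NatExp → RealExp
  headroom e = 1 [ e ]ʳ -ʳ aUsed [ e ]ʳ

  narrow send route raiseα iteration mainLoop : Program
  narrow = ifᶜ (headroom (var aEdge) ≤ʳ varʳ aU) (aU [ lit 0 ]≔ʳ headroom (var aEdge)) skip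
  send = aUsed [ var aEdge ]≔ʳ aUsed [ var aEdge ]ʳ +ʳ varʳ aU
    ⨾ ifᶜ (1 [ var aEdge ]ʳ ≤ʳ aUsed [ var aEdge ]ʳ)
        (aY [ var aEdge ]≔ʳ aY [ var aEdge ]ʳ +ʳ aY [ var aEdge ]ʳ /ʳ int (var aQ)
          ⨾ aUsed [ var aEdge ]≔ʳ int (lit 0)
          ⨾ aRaises [ var aEdge ]≔ⁿ aRaises [ var aEdge ]ⁿ ⊕ lit 1)
        skip
  scaledAmount : RealExp
  scaledAmount = varʳ aU /ʳ int (var aQL ⊕ var aR ⊕ lit 2)
  route = aU [ lit 0 ]≔ʳ headroom (6 [ 5 [ 4 [ lit 0 ]ⁿ ]ⁿ ]ⁿ)
    ⨾ forPath narrow ⨾ forPath send ⨾ addEntry scaledAmount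
  raiseα = aLevel [ lit 0 ]≔ⁿ var aLevel ⊕ lit 1 ⨾ aα [ lit 0 ]≔ʳ varʳ aα +ʳ varʳ aα /ʳ int (var aQ)
  iteration = weights ⨾ search route raiseα
  mainLoop = while (var aLevel <ⁿ var aR) iteration

  aP aI2 : ℕ
  aP  = 22
  aI2 = 27

  doubleStep doubleLoop scale sizes initEdge initialise approximate : Program
  doubleStep = aP [ lit 0 ]≔ⁿ var aP ⊕ var aP ⨾ aQL [ lit 0 ]≔ⁿ var aQL ⊕ var aQ
  doubleLoop = while (var aP <ⁿ input-L ⊕ lit 1) doubleStep
  scale = aQ [ lit 0 ]≔ⁿ var clock ⨾ aP [ lit 0 ]≔ⁿ lit 1 ⨾ aQL [ lit 0 ]≔ⁿ lit 0 ⨾ doubleLoop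
  sizes = aR [ lit 0 ]≔ⁿ var aQ ⊕ lit 1 ⨾ aK [ lit 0 ]≔ⁿ input-n
    ⨾ for aI2 (var aQ) (aR [ lit 0 ]≔ⁿ var aR ⊕ var aQL ⨾ aK [ lit 0 ]≔ⁿ var aK ⊕ input-n)
  initEdge = aY [ var aEdge ]≔ʳ int (lit 1) ⨾ aUsed [ var aEdge ]≔ʳ int (lit 0) ⨾ aRaises [ var aEdge ]≔ⁿ lit 0
  initialise = for aEdge input-m initEdge
    ⨾ aα [ lit 0 ]≔ʳ int input-L ⨾ aLevel [ lit 0 ]≔ⁿ lit 0 ⨾ 4 [ lit 0 ]≔ⁿ lit 0 ⨾ 5 [ lit 0 ]≔ⁿ lit 0
  approximate = scale ⨾ sizes ⨾ initialise ⨾ mainLoop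

  expired : Cond
  expired = int (lit 8) ≤ʳ int (var clock) *ʳ (0 [ lit 0 ]ʳ)

  guarded : Program → Program
  guarded skip          = skip
  guarded (a [ i ]≔ⁿ v) = a [ i ]≔ⁿ v
  guarded (a [ i ]≔ʳ v) = a [ i ]≔ʳ v
  guarded (p ⨾ q)       = guarded p ⨾ guarded q
  guarded (ifᶜ b p q)   = ifᶜ b (guarded p) (guarded q)
  guarded (while b p)   = while (b and notᶜ expired) (tick ⨾ guarded p)

  writesClock : Program → Bool
  writesClock p = writesⁿ clock p ∨ writesʳ 0 p

  cost : Program → ℕ
  cost skip          = 1
  cost (_ [ _ ]≔ⁿ _) = 1
  cost (_ [ _ ]≔ʳ _) = 1
  cost (p ⨾ q)       = cost p + cost q
  cost (ifᶜ _ p q)   = suc (cost p + cost q)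
  cost (while _ p)   = 2 + cost p

  aRem aHead aTail : ℕ
  aRem  = 30
  aHead = 31
  aTail = 32

  walkStep walk read : Program
  walkStep = aRem [ lit 0 ]≔ⁿ var aRem ⊖ lit 1
    ⨾ ifᶜ (lit 0 <ⁿ var aHead)
        (aHead [ lit 0 ]≔ⁿ var aHead ⊖ lit 1 ⨾ aTail [ lit 0 ]≔ⁿ var aTail ⊕ lit 1)
        (aHead [ lit 0 ]≔ⁿ var aTail ⊕ lit 1 ⨾ aTail [ lit 0 ]≔ⁿ lit 0)
  walk = while (lit 0 <ⁿ var aRem) walkStep
  read = aHead [ lit 0 ]≔ⁿ lit 0 ⨾ aTail [ lit 0 ]≔ⁿ lit 0 ⨾ walk ⨾ aRem [ lit 0 ]≔ⁿ var aTail

  aCode aOk aJ aT aTe aTa aTb aD aRes aTotal aAcc aCost : ℕ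
  aCode  = 33
  aOk    = 34
  aJ     = 35
  aT     = 36
  aTe    = 37
  aTa    = 38
  aTb    = 39
  aD     = 40
  aRes   = 7    -- real arrays from here on
  aTotal = 8
  aAcc   = 9
  aCost  = 10

  fail guessWeights termStep readTerms subtract finishEntry checkEntry checkEntries : Program
  fail = aOk [ lit 0 ]≔ⁿ lit 0
  guessWeights = for aEdge input-m (read ⨾ aW [ var aEdge ]≔ⁿ var aHead ⊕ lit 1)
  termStep = aT [ lit 0 ]≔ⁿ var aT ⊖ lit 1 ⨾ read ⨾ aTe [ lit 0 ]≔ⁿ var aHead ⨾ read ⨾ aTa [ lit 0 ]≔ⁿ var aHead
    ⨾ read ⨾ aTb [ lit 0 ]≔ⁿ var aHead ⨾ read
    ⨾ aAcc [ lit 0 ]≔ʳ (aAcc [ lit 0 ]ʳ) +ʳ (int (var aTa) -ʳ int (var aTb)) /ʳ int (lit 1 ⊕ var aHead) *ʳ (1 [ var aTe ]ʳ)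
  readTerms = aAcc [ lit 0 ]≔ʳ int (lit 0) ⨾ read ⨾ aT [ lit 0 ]≔ⁿ var aHead ⨾ while (lit 0 <ⁿ var aT) termStep
  subtract = aRes [ var aEdge ]≔ʳ (aRes [ var aEdge ]ʳ) -ʳ (aAcc [ lit 0 ]ʳ)
    ⨾ ifᶜ (int (lit 0) ≤ʳ (aRes [ var aEdge ]ʳ)) skip fail
  finishEntry = readTerms ⨾ ifᶜ (int (lit 0) ≤ʳ (aAcc [ lit 0 ]ʳ)) skip fail ⨾ forPath subtract
    ⨾ aTotal [ lit 0 ]≔ʳ (aTotal [ lit 0 ]ʳ) +ʳ (aAcc [ lit 0 ]ʳ) ⨾ addEntry (aAcc [ lit 0 ]ʳ)
  checkEntry = guessWeights ⨾ read ⨾ aK [ lit 0 ]≔ⁿ var aHead ⨾ search skip fail ⨾ ifᶜ (lit 0 <ⁿ var aOk) finishEntry skip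
  checkEntries = while ((lit 0 <ⁿ var aJ) and (lit 0 <ⁿ var aOk)) (aJ [ lit 0 ]≔ⁿ var aJ ⊖ lit 1 ⨾ checkEntry)

  aDual : ℕ
  aDual = 41

  addCost dualCost dualScale dualCheck attempt exact : Program
  addCost = read ⨾ aDual [ var aEdge ]≔ⁿ var aHead ⨾ aCost [ lit 0 ]≔ʳ (aCost [ lit 0 ]ʳ) +ʳ (1 [ var aEdge ]ʳ) *ʳ int (var aHead)
    ⨾ ifᶜ (int currentW ≤ʳ int input-n *ʳ int (var aHead) +ʳ int (lit 1)) skip fail
  dualCost = aCost [ lit 0 ]≔ʳ int (lit 0) ⨾ for aEdge input-m addCost
  dualScale = read ⨾ aD [ lit 0 ]≔ⁿ var aHead ⊕ lit 1 ⨾ read ⨾ aK [ lit 0 ]≔ⁿ var aHead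
    ⨾ ifᶜ (int (var aD) *ʳ int input-n ≤ʳ int (var aK ⊕ lit 1)) skip fail
    ⨾ ifᶜ (aCost [ lit 0 ]ʳ ≤ʳ int (var aD) *ʳ (aTotal [ lit 0 ]ʳ)) skip fail
  dualCheck = guessWeights ⨾ dualCost ⨾ dualScale ⨾ search fail skip
  attempt = aRem [ lit 0 ]≔ⁿ var aCode ⨾ aOk [ lit 0 ]≔ⁿ lit 1 ⨾ 4 [ lit 0 ]≔ⁿ lit 0 ⨾ 5 [ lit 0 ]≔ⁿ lit 0
    ⨾ aTotal [ lit 0 ]≔ʳ int (lit 0) ⨾ for aEdge input-m (aRes [ var aEdge ]≔ʳ (1 [ var aEdge ]ʳ))
    ⨾ read ⨾ aJ [ lit 0 ]≔ⁿ var aHead ⨾ checkEntries ⨾ ifᶜ (lit 0 <ⁿ var aOk) dualCheck skip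
  exact = aCode [ lit 0 ]≔ⁿ lit 0 ⨾ aOk [ lit 0 ]≔ⁿ lit 0
    ⨾ while (var aOk <ⁿ lit 1) (attempt ⨾ aCode [ lit 0 ]≔ⁿ var aCode ⊕ lit 1)

module Hoare (R : RealNumbers) where
  open Programs
  open import Data.Nat using (ℕ; zero; suc; _+_; _*_; _≤_; _<_; z≤n; s≤s; _≡ᵇ_; _<ᵇ_)
  open import Data.Nat.Properties
  open RealNumbers R using (ℝ; _≤?_) renaming (_≤_ to _≤ᵣ_)
  open Execution R public

  ≡ᵇ-refl : ∀ i → (i ≡ᵇ i) ≡ true
  ≡ᵇ-refl i = Equivalence.to T-≡ (≡⇒≡ᵇ i i refl)

  update-same : ∀ {A : Set} (f : ℕ → ℕ → A) a i v → update f a i v a i ≡ v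
  update-same f a i v rewrite ≡ᵇ-refl a | ≡ᵇ-refl i = refl

  ≢⇒≡ᵇ-false : ∀ {i j} → i ≢ j → (i ≡ᵇ j) ≡ false
  ≢⇒≡ᵇ-false {i} {j} i≢j with i ≡ᵇ j in eq
  ... | true  = contradiction (≡ᵇ⇒≡ i j (Equivalence.from T-≡ eq)) i≢j
  ... | false = refl

  ∧-false : ∀ b → b ∧ false ≡ false
  ∧-false true  = refl
  ∧-false false = refl

  update-array : ∀ {A : Set} (f : ℕ → ℕ → A) a i v b j → (b ≡ᵇ a) ≡ false → update f a i v b j ≡ f b j
  update-array f a i v b j eq rewrite eq = refl

  update-index : ∀ {A : Set} (f : ℕ → ℕ → A) a i v b {j} → j ≢ i → update f a i v b j ≡ f b j
  update-index f a i v b {j} j≢i rewrite ≢⇒≡ᵇ-false j≢i | ∧-false (b ≡ᵇ a) = refl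

  ∨-false : ∀ {b d} → b ∨ d ≡ false → b ≡ false × d ≡ false
  ∨-false {false} eq = refl , eq

  record Frame (p : Program) (σ τ : Store) : Set where
    constructor frame
    field
      keepⁿ : ∀ a → writesⁿ a p ≡ false → ∀ i → nats τ a i ≡ nats σ a i
      keepʳ : ∀ a → writesʳ a p ≡ false → ∀ i → reals τ a i ≡ reals σ a i

  open Frame public

  frame-refl : ∀ {p σ} → Frame p σ σ
  frame-refl = frame (λ _ _ _ → refl) (λ _ _ _ → refl)

  frame-trans : ∀ {p σ τ υ} → Frame p σ τ → Frame p τ υ → Frame p σ υ
  frame-trans (frame fn fr) (frame gn gr) =
    frame (λ a w i → trans (gn a w i) (fn a w i)) (λ a w i → trans (gr a w i) (fr a w i))

  run-frame : ∀ {p σ T τ} → Run p σ T τ → Frame p σ τ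
  run-frame skip = frame-refl
  run-frame {σ = σ} (assignⁿ {a = a} {i} {v}) = frame
    (λ b w j → update-array (nats σ) a (evalⁿ σ i) (evalⁿ σ v) b j w) (λ _ _ _ → refl)
  run-frame {σ = σ} (assignʳ {a = a} {i} {v}) = frame
    (λ _ _ _ → refl) (λ b w j → update-array (reals σ) a (evalⁿ σ i) (evalʳ σ v) b j w)
  run-frame {p ⨾ q} (seq r s) with run-frame r | run-frame s
  ... | frame fn fr | frame gn gr = frame
    (λ a w i → trans (gn a (proj₂ (∨-false w)) i) (fn a (proj₁ (∨-false w)) i))
    (λ a w i → trans (gr a (proj₂ (∨-false w)) i) (fr a (proj₁ (∨-false w)) i))
  run-frame (if-true _ r) with run-frame r
  ... | frame fn fr = frame (λ a w → fn a (proj₁ (∨-false w))) (λ a w → fr a (proj₁ (∨-false w)))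
  run-frame (if-false _ r) with run-frame r
  ... | frame fn fr = frame (λ a w → fn a (proj₂ (∨-false w))) (λ a w → fr a (proj₂ (∨-false w)))
  run-frame (while-true _ r s) with run-frame r | run-frame s
  ... | frame fn fr | frame gn gr = frame
    (λ a w i → trans (gn a w i) (fn a w i)) (λ a w i → trans (gr a w i) (fr a w i))
  run-frame (while-false _) = frame-refl

  -- Total correctness with a time bound

  record Exec (p : Program) (σ : Store) (c : ℕ) (Q : Store → Set) : Set where
    constructor exec
    field
      {time}  : ℕ
      {final} : Store
      runs    : Run p σ time final
      time≤   : time ≤ c
      post    : Q final

  open Exec public

  weaken : ∀ {p σ c d} {Q Q′ : Store → Set} → c ≤ d → (∀ τ → Frame p σ τ → Q τ → Q′ τ) → Exec p σ c Q → Exec p σ d Q′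
  weaken c≤d Q⇒Q′ (exec r t q) = exec r (≤-trans t c≤d) (Q⇒Q′ _ (run-frame r) q)

  slower : ∀ {p σ c d} {Q : Store → Set} → c ≤ d → Exec p σ c Q → Exec p σ d Q
  slower c≤d = weaken c≤d (λ _ _ q → q)

  infixr 4 _then_
  _then_ : ∀ {p q σ c d} {Q Q′ : Store → Set} → Exec p σ c Q → (∀ τ → Frame p σ τ → Q τ → Exec q τ d Q′) →
    Exec (p ⨾ q) σ (c + d) Q′
  exec r t q then k with k _ (run-frame r) q
  ... | exec r′ t′ q′ = exec (seq r r′) (+-mono-≤ t t′) q′

  ifᵉ : ∀ {b p q σ c} {Q : Store → Set} → (evalᶜ σ b ≡ true → Exec p σ c Q) → (evalᶜ σ b ≡ false → Exec q σ c Q) →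
    Exec (ifᶜ b p q) σ (suc c) Q
  ifᵉ {b} {σ = σ} yes-branch no-branch with evalᶜ σ b in eq
  ... | true  with yes-branch refl
  ...   | exec r t q = exec (if-true eq r) (s≤s t) q
  ifᵉ {b} {σ = σ} yes-branch no-branch | false with no-branch refl
  ...   | exec r t q = exec (if-false eq r) (s≤s t) q

  -- Loop-free programs are executed by computation.

  result : Program → Store → Store
  result skip          σ = σ
  result (a [ i ]≔ⁿ v) σ = store (update (nats σ) a (evalⁿ σ i) (evalⁿ σ v)) (reals σ)
  result (a [ i ]≔ʳ v) σ = store (nats σ) (update (reals σ) a (evalⁿ σ i) (evalʳ σ v))
  result (p ⨾ q)       σ = result q (result p σ)
  result (ifᶜ b p q)   σ = if evalᶜ σ b then result p σ else result q σ
  result (while _ _)   σ = σ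

  ∧-true : ∀ {b d} → b ∧ d ≡ true → b ≡ true × d ≡ true
  ∧-true {true} eq = refl , eq

  straight : ∀ p {σ} {Q : Store → Set} {ok : loopFree p ≡ true} → Q (result p σ) → Exec p σ (size p) Q
  straight p {σ} {Q} {ok} q with run p σ ok
    where
    run : ∀ p σ → loopFree p ≡ true → ∃[ T ] Run p σ T (result p σ) × T ≤ size p
    run skip          σ _ = 1 , skip , ≤-refl
    run (_ [ _ ]≔ⁿ _) σ _ = 1 , assignⁿ , ≤-refl
    run (_ [ _ ]≔ʳ _) σ _ = 1 , assignʳ , ≤-refl
    run (p ⨾ q)       σ ok with run p σ (proj₁ (∧-true ok)) | run q (result p σ) (proj₂ (∧-true {loopFree p} ok))
    ... | T , r , t | U , s , u = T + U , seq r s , +-mono-≤ t u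
    run (ifᶜ b p q)   σ ok with evalᶜ σ b in eq
    ... | true with run p σ (proj₁ (∧-true ok))
    ...   | T , r , t = suc T , if-true eq r , s≤s (≤-trans t (m≤m+n _ _))
    run (ifᶜ b p q)   σ ok | false with run q σ (proj₂ (∧-true {loopFree p} ok))
    ...   | T , r , t = suc T , if-false eq r , s≤s (≤-trans t (m≤n+m _ _))
  ... | T , r , t = exec r t q

  exit : ∀ {b p σ} {Q : Store → Set} → evalᶜ σ b ≡ false → Q σ → Exec (while b p) σ 1 Q
  exit eq q = exec (while-false eq) ≤-refl q

  unroll : ∀ {b p σ c d} {Q : Store → Set} → evalᶜ σ b ≡ true → Exec p σ c (λ τ → Exec (while b p) τ d Q) →
    Exec (while b p) σ (suc (c + d)) Q
  unroll eq (exec r t (exec r′ t′ q)) = exec (while-true eq r r′) (s≤s (+-mono-≤ t t′)) q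

  -- Inv k σ says that at most k iterations remain.
  whileᵉ : ∀ {b p c} (Inv : ℕ → Store → Set) {Q : Store → Set} {σ₀} →
    (∀ k σ → Frame (while b p) σ₀ σ → Inv k σ →
      (evalᶜ σ b ≡ false × Q σ) ⊎ (∃[ j ] k ≡ suc j × evalᶜ σ b ≡ true × Exec p σ c (Inv j))) →
    ∀ k → Inv k σ₀ → Exec (while b p) σ₀ (suc (k * suc c)) Q
  whileᵉ {b} {p} {c} Inv {Q} {σ₀} step k inv = go k σ₀ frame-refl inv
    where
    go : ∀ k σ → Frame (while b p) σ₀ σ → Inv k σ → Exec (while b p) σ (suc (k * suc c)) Q
    go k σ f inv with step k σ f inv
    ... | inj₁ (eq , q) = exec (while-false eq) (s≤s z≤n) q
    ... | inj₂ (j , refl , eq , exec {time} r t inv′)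
      with go j _ (frame-trans f (frame-body (run-frame r))) inv′
      where
      frame-body : ∀ {σ τ} → Frame p σ τ → Frame (while b p) σ τ
      frame-body (frame fn fr) = frame fn fr
    ...   | exec {T} r′ t′ q = exec (while-true eq r r′) bound q
      where
      bound : suc (time + T) ≤ suc (suc c + j * suc c)
      bound = s≤s (≤-trans (+-mono-≤ t t′) (≤-reflexive (+-suc c (j * suc c))))

  <ᵇ-true : ∀ {i j} → (i <ᵇ j) ≡ true → i < j
  <ᵇ-true {i} {j} eq = <ᵇ⇒< i j (Equivalence.from T-≡ eq)

  <ᵇ-false : ∀ {i j} → (i <ᵇ j) ≡ false → j ≤ i
  <ᵇ-false {i} {j} eq with i <? j
  ... | yes i<j with () ← trans (sym eq) (Equivalence.to T-≡ (<⇒<ᵇ i<j))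
  ... | no i≮j = ≮⇒≥ i≮j

  <⇒<ᵇ-true : ∀ {i j} → i < j → (i <ᵇ j) ≡ true
  <⇒<ᵇ-true i<j = Equivalence.to T-≡ (<⇒<ᵇ i<j)

  ≤⇒<ᵇ-false : ∀ {i j} → j ≤ i → (i <ᵇ j) ≡ false
  ≤⇒<ᵇ-false {i} {j} j≤i with i <ᵇ j in eq
  ... | true = contradiction (<ᵇ-true eq) (≤⇒≯ j≤i)
  ... | false = refl

  does-true : ∀ {P : Set} (P? : Dec P) → does P? ≡ true → P
  does-true (yes p) _ = p

  does-false : ∀ {P : Set} (P? : Dec P) → does P? ≡ false → ¬ P
  does-false (no ¬p) _ = ¬p

  true-does : ∀ {P : Set} (P? : Dec P) → P → does P? ≡ true
  true-does (yes _) _ = refl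
  true-does (no ¬p) p = contradiction p ¬p

  false-does : ∀ {P : Set} (P? : Dec P) → ¬ P → does P? ≡ false
  false-does (yes p) ¬p = contradiction p ¬p
  false-does (no _) _ = refl

  not-true : ∀ {b} → not b ≡ true → b ≡ false
  not-true {false} _ = refl

  not-false : ∀ {b} → not b ≡ false → b ≡ true
  not-false {true} _ = refl

  setⁿ : ℕ → ℕ → Store → Store
  setⁿ a w σ = store (update (nats σ) a 0 w) (reals σ)

  -- The last two hypotheses before the body say that Inv does not mention the loop variable or the clock.
  forᵉ : ∀ i bound body {σ₀ c} (k : ℕ) (Inv : ℕ → Store → Set) →
    {keeps : writesⁿ i (tick ⨾ ticked body) ≡ false} →
    (∀ σ → Frame (ticked (for i bound body)) σ₀ σ → evalⁿ σ bound ≡ k) →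
    Inv 0 σ₀ →
    (∀ {j w σ} → Inv j σ → Inv j (setⁿ i w σ)) →
    (∀ {j w σ} → Inv j σ → Inv j (setⁿ clock w σ)) →
    (∀ (j : Fin k) σ → Frame (ticked (for i bound body)) σ₀ σ → nats σ i 0 ≡ toℕ j → Inv (toℕ j) σ →
      Exec (ticked body) σ c (Inv (suc (toℕ j)))) →
    Exec (ticked (for i bound body)) σ₀ (2 + k * (3 + c)) (Inv k)
  forᵉ i bound body {σ₀} {c} k Inv {keeps} bound-value init stable-i stable-clock step =
    first then λ τ f (i≡0 , inv) →
      weaken (≤-reflexive (cong (λ c → suc (k * suc (suc c))) (+-comm c 1))) (λ _ _ q → q)
      (whileᵉ {c = 1 + (c + 1)} Progress
        (λ { j σ g (j′ , sum , i≡ , inv) → iterate j j′ σ (whole f g) sum i≡ inv })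
        k (0 , refl , i≡0 , inv))
    where
    Whole = ticked (for i bound body)
    Body = ticked (body ⨾ i [ lit 0 ]≔ⁿ var i ⊕ lit 1)
    Progress : ℕ → Store → Set
    Progress j σ = ∃[ j′ ] j′ + j ≡ k × nats σ i 0 ≡ j′ × Inv j′ σ
    first : Exec (i [ lit 0 ]≔ⁿ lit 0) σ₀ 1 (λ τ → nats τ i 0 ≡ 0 × Inv 0 τ)
    first = exec assignⁿ ≤-refl (update-same (nats σ₀) i 0 0 , stable-i init)
    whole : ∀ {τ σ} → Frame (i [ lit 0 ]≔ⁿ lit 0) σ₀ τ → Frame (while (var i <ⁿ bound) (tick ⨾ Body)) τ σ → Frame Whole σ₀ σ
    whole (frame fn fr) (frame gn gr) = frame
      (λ a w x → trans (gn a (proj₂ (∨-false {a ≡ᵇ i} w)) x) (fn a (proj₁ (∨-false {a ≡ᵇ i} w)) x))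
      (λ a w x → trans (gr a w x) (fr a refl x))
    tick-frame : ∀ {σ τ} → Frame tick σ τ → Frame Whole σ τ
    tick-frame (frame fn fr) = frame (λ a w x → fn a (proj₁ (∨-false {a ≡ᵇ clock} (proj₂ (∨-false {a ≡ᵇ i} w)))) x) (λ a w x → fr a refl x)
    iterate : ∀ j j′ σ → Frame Whole σ₀ σ → j′ + j ≡ k → nats σ i 0 ≡ j′ → Inv j′ σ →
      (evalᶜ σ (var i <ⁿ bound) ≡ false × Inv k σ) ⊎
      (∃[ j₁ ] j ≡ suc j₁ × evalᶜ σ (var i <ⁿ bound) ≡ true × Exec (tick ⨾ Body) σ (1 + (c + 1)) (Progress j₁))
    iterate zero j′ σ f sum i≡ inv = inj₁
      (trans (cong₂ _<ᵇ_ i≡ (bound-value σ f)) (≤⇒<ᵇ-false (≤-reflexive (sym j′≡k))) , subst (λ j → Inv j σ) j′≡k inv)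
      where
      j′≡k : j′ ≡ k
      j′≡k = trans (sym (+-identityʳ j′)) sum
    iterate (suc j) j′ σ f sum i≡ inv = inj₂ (j , refl , trans (cong₂ _<ᵇ_ i≡ (bound-value σ f)) (<⇒<ᵇ-true j′<k) ,
      (first-tick then λ { τ g refl → body-run g }))
      where
      j′<k : j′ < k
      j′<k = subst (j′ <_) sum (m<m+n j′ (s≤s z≤n))
      w = evalⁿ σ (var clock ⊕ lit 1)
      σ₁ = setⁿ clock w σ
      first-tick : Exec tick σ 1 (_≡ σ₁)
      first-tick = exec assignⁿ ≤-refl refl
      i-clock = proj₁ (∨-false {i ≡ᵇ clock} keeps)
      i-body = proj₂ (∨-false {i ≡ᵇ clock} keeps)
      body-run : Frame tick σ σ₁ → Exec Body σ₁ (c + 1) (Progress j)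
      body-run g = run-body then λ υ h inv′ → increment υ h inv′
        where
        i≡′ : nats σ₁ i 0 ≡ j′
        i≡′ = trans (keepⁿ g i i-clock 0) i≡
        run-body : Exec (ticked body) σ₁ c (Inv (suc j′))
        run-body = subst (λ j → Exec (ticked body) σ₁ c (Inv (suc j))) (Fin.toℕ-fromℕ< j′<k)
          (step (fromℕ< j′<k) σ₁ (frame-trans f (tick-frame g))
            (trans i≡′ (sym (Fin.toℕ-fromℕ< j′<k)))
            (subst (λ j → Inv j σ₁) (sym (Fin.toℕ-fromℕ< j′<k)) (stable-clock inv)))
        increment : ∀ υ → Frame (ticked body) σ₁ υ → Inv (suc j′) υ → Exec (i [ lit 0 ]≔ⁿ var i ⊕ lit 1) υ 1 (Progress j)
        increment υ h inv′ = exec assignⁿ ≤-refl (suc j′ , trans (sym (+-suc j′ j)) sum ,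
            trans (update-same (nats υ) i 0 _) (trans (cong (_+ 1) (trans (keepⁿ h i i-body 0) i≡′)) (+-comm j′ 1)) ,
            stable-i inv′)

module Halting (R : RealNumbers) where
  open Programs
  open import Data.Nat using (ℕ; zero; suc; _+_; _∸_; _≤_; _<_; z≤n; s≤s; _≡ᵇ_; _<ᵇ_)
  open import Data.Nat.Properties
  open Hoare R

  -- Total correctness without a time bound

  Halts : Program → Store → (Store → Set) → Set
  Halts p σ Q = ∃[ c ] Exec p σ c Q

  halts : ∀ {p σ c} {Q : Store → Set} → Exec p σ c Q → Halts p σ Q
  halts X = _ , X

  infixr 4 _thenʰ_
  _thenʰ_ : ∀ {p q σ} {Q Q′ : Store → Set} → Halts p σ Q → (∀ τ → Frame p σ τ → Q τ → Halts q τ Q′) → Halts (p ⨾ q) σ Q′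
  (_ , exec r t q) thenʰ k with k _ (run-frame r) q
  ... | _ , exec r′ t′ q′ = _ , exec (seq r r′) (+-mono-≤ t t′) q′

  weakenʰ : ∀ {p σ} {Q Q′ : Store → Set} → (∀ τ → Frame p σ τ → Q τ → Q′ τ) → Halts p σ Q → Halts p σ Q′
  weakenʰ f (_ , X) = _ , weaken ≤-refl f X

  ifʰ : ∀ {b p q σ} {Q : Store → Set} → (evalᶜ σ b ≡ true → Halts p σ Q) → (evalᶜ σ b ≡ false → Halts q σ Q) → Halts (ifᶜ b p q) σ Q
  ifʰ {b} {σ = σ} yes-branch no-branch with evalᶜ σ b in eq
  ... | true  with yes-branch refl
  ...   | _ , exec r t q = _ , exec (if-true eq r) (s≤s t) q
  ifʰ {b} {σ = σ} yes-branch no-branch | false with no-branch refl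
  ...   | _ , exec r t q = _ , exec (if-false eq r) (s≤s t) q

  unrollʰ : ∀ {b p σ} {Q : Store → Set} → evalᶜ σ b ≡ true → Halts p σ (λ τ → Halts (while b p) τ Q) → Halts (while b p) σ Q
  unrollʰ eq (_ , exec r t (_ , exec r′ t′ q)) = _ , exec (while-true eq r r′) (s≤s (+-mono-≤ t t′)) q

  forʰ : ∀ i bound body {σ₀} (k : ℕ) (Inv : ℕ → Store → Set) →
    {keeps : writesⁿ i (tick ⨾ ticked body) ≡ false} →
    (∀ σ → Frame (ticked (for i bound body)) σ₀ σ → evalⁿ σ bound ≡ k) →
    Inv 0 σ₀ →
    (∀ {j w σ} → Inv j σ → Inv j (setⁿ i w σ)) →
    (∀ {j w σ} → Inv j σ → Inv j (setⁿ clock w σ)) →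
    (∀ (j : Fin k) σ → Frame (ticked (for i bound body)) σ₀ σ → nats σ i 0 ≡ toℕ j → Inv (toℕ j) σ →
      Halts (ticked body) σ (Inv (suc (toℕ j)))) →
    Halts (ticked (for i bound body)) σ₀ (Inv k)
  forʰ i bound body {σ₀} k Inv {keeps} bound-value init stable-i stable-clock step =
    halts first thenʰ λ τ f (i≡0 , inv) → loop k 0 τ (first-frame f) refl i≡0 inv
    where
    Whole = ticked (for i bound body)
    Loop = ticked (while (var i <ⁿ bound) (body ⨾ i [ lit 0 ]≔ⁿ var i ⊕ lit 1))
    i-clock = proj₁ (∨-false {i ≡ᵇ clock} keeps)
    i-body = proj₂ (∨-false {i ≡ᵇ clock} keeps)
    first : Exec (i [ lit 0 ]≔ⁿ lit 0) σ₀ 1 (λ τ → nats τ i 0 ≡ 0 × Inv 0 τ)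
    first = exec assignⁿ ≤-refl (update-same (nats σ₀) i 0 0 , stable-i init)
    first-frame : ∀ {τ} → Frame (i [ lit 0 ]≔ⁿ lit 0) σ₀ τ → Frame Whole σ₀ τ
    first-frame (frame fn fr) = frame (λ a w x → fn a (proj₁ (∨-false {a ≡ᵇ i} w)) x) (λ a w x → fr a refl x)
    index-frame : ∀ {σ τ e} → Frame (i [ lit 0 ]≔ⁿ e) σ τ → Frame Whole σ τ
    index-frame (frame fn fr) = frame (λ a w x → fn a (proj₁ (∨-false {a ≡ᵇ i} w)) x) (λ a w x → fr a refl x)
    body-frame : ∀ {σ τ} → Frame (tick ⨾ ticked body) σ τ → Frame Whole σ τ
    body-frame (frame fn fr) = frame (λ a w x → fn a (shrink a w) x) (λ a w x → fr a (proj₁ (∨-false {writesʳ a (ticked body)} w)) x)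
      where
      shrink : ∀ a → writesⁿ a Whole ≡ false → writesⁿ a (tick ⨾ ticked body) ≡ false
      shrink a w with ∨-false {a ≡ᵇ clock} (proj₂ (∨-false {a ≡ᵇ i} w))
      ... | u , v rewrite u = proj₁ (∨-false {writesⁿ a (ticked body)} v)
    loop : ∀ rest j σ → Frame Whole σ₀ σ → j + rest ≡ k → nats σ i 0 ≡ j → Inv j σ → Halts Loop σ (Inv k)
    loop zero j σ f sum i≡ inv = halts (exit (trans (cong₂ _<ᵇ_ i≡ (bound-value σ f)) (≤⇒<ᵇ-false (≤-reflexive (sym j≡k)))) (subst (λ j → Inv j σ) j≡k inv))
      where
      j≡k : j ≡ k
      j≡k = trans (sym (+-identityʳ j)) sum
    loop (suc rest) j σ f sum i≡ inv = unrollʰ (trans (cong₂ _<ᵇ_ i≡ (bound-value σ f)) (<⇒<ᵇ-true j<k))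
      (halts first-tick thenʰ λ { τ g refl → run-body g thenʰ λ υ h inv′ → halts (increment υ
        (frame-trans f (body-frame (frame-seq g h))) h g inv′) })
      where
      j<k : j < k
      j<k = subst (j <_) sum (m<m+n j (s≤s z≤n))
      σ₁ = setⁿ clock (nats σ clock 0 + 1) σ
      first-tick : Exec tick σ 1 (_≡ σ₁)
      first-tick = exec assignⁿ ≤-refl refl
      frame-seq : ∀ {υ} → Frame tick σ σ₁ → Frame (ticked body) σ₁ υ → Frame (tick ⨾ ticked body) σ υ
      frame-seq (frame fn fr) (frame gn gr) = frame
        (λ a w x → trans (gn a (proj₂ (∨-false {a ≡ᵇ clock} w)) x) (fn a (proj₁ (∨-false {a ≡ᵇ clock} w)) x))
        (λ a w x → trans (gr a w x) (fr a refl x))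
      run-body : Frame tick σ σ₁ → Halts (ticked body) σ₁ (Inv (suc j))
      run-body g = subst (λ j → Halts (ticked body) σ₁ (Inv (suc j))) (Fin.toℕ-fromℕ< j<k)
        (step (fromℕ< j<k) σ₁ (frame-trans f (tick-frame g)) (trans (trans (keepⁿ g i i-clock 0) i≡) (sym (Fin.toℕ-fromℕ< j<k)))
          (subst (λ j → Inv j σ₁) (sym (Fin.toℕ-fromℕ< j<k)) (stable-clock inv)))
        where
        tick-frame : ∀ {σ τ} → Frame tick σ τ → Frame Whole σ τ
        tick-frame (frame fn fr) = frame (λ a w x → fn a (proj₁ (∨-false {a ≡ᵇ clock} (proj₂ (∨-false {a ≡ᵇ i} w)))) x) (λ a w x → fr a refl x)
      increment : ∀ υ → Frame Whole σ₀ υ → Frame (ticked body) σ₁ υ → Frame tick σ σ₁ → Inv (suc j) υ →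
        Exec (i [ lit 0 ]≔ⁿ var i ⊕ lit 1) υ 1 (λ τ → Halts Loop τ (Inv k))
      increment υ f′ h g inv′ = exec assignⁿ ≤-refl (loop rest (suc j) _
        (frame-trans f′ (index-frame {e = var i ⊕ lit 1} (run-frame assignⁿ)))
        (trans (sym (+-suc j rest)) sum)
        (trans (update-same (nats υ) i 0 _) (trans (cong (_+ 1) (trans (keepⁿ h i i-body 0) (trans (keepⁿ g i i-clock 0) i≡))) (+-comm j 1)))
        (stable-i inv′))

  -- Streams of numbers coded in a single number, by walking through ℕ × ℕ along the antidiagonals

  successor : ℕ × ℕ → ℕ × ℕ
  successor (zero  , b) = suc b , 0
  successor (suc a , b) = a , suc b

  unpair : ℕ → ℕ × ℕ
  unpair zero    = 0 , 0
  unpair (suc k) = successor (unpair k)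

  head tail : ℕ → ℕ
  head k = proj₁ (unpair k)
  tail k = proj₂ (unpair k)

  unpair-surjective : ∀ a b → ∃[ k ] unpair k ≡ (a , b)
  unpair-surjective a b = reach (a + b) b a refl
    where
    reach : ∀ s b a → a + b ≡ s → ∃[ k ] unpair k ≡ (a , b)
    reach s       (suc b) a       eq with reach s b (suc a) (trans (sym (+-suc a b)) eq)
    ... | k , k≡ = suc k , cong successor k≡
    reach s       zero    zero    eq = 0 , refl
    reach (suc s) zero    (suc a) eq with reach s a 0 (trans (sym (+-identityʳ a)) (suc-injective eq))
    ... | k , k≡ = suc k , cong successor k≡

  Codes : List ℕ → ℕ → Set
  Codes []       k = ⊤
  Codes (d ∷ ds) k = head k ≡ d × Codes ds (tail k)

  encode : ∀ ds → ∃[ k ] Codes ds k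
  encode []       = 0 , tt
  encode (d ∷ ds) with encode ds
  ... | k , codes with unpair-surjective d k
  ...   | k′ , eq = k′ , cong proj₁ eq , subst (Codes ds) (sym (cong proj₂ eq)) codes

  Read : ℕ → Store → Set
  Read k τ = nats τ aHead 0 ≡ head k × nats τ aRem 0 ≡ tail k

  readʰ : ∀ {σ k} → nats σ aRem 0 ≡ k → Halts (ticked read) σ (Read k)
  readʰ {σ} {k} rem≡ = halts clear-head thenʰ λ { _ _ refl → halts clear-tail thenʰ λ { _ _ refl →
    subst (λ j → Halts (ticked walk) σ₂ (Walked j)) (+-identityʳ k) (walking k 0 σ₂ rem≡ refl refl)
      thenʰ λ τ _ (head≡ , tail≡) → halts (move τ head≡ tail≡) } }
    where
    σ₁ = setⁿ aHead 0 σ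
    σ₂ = setⁿ aTail 0 σ₁
    clear-head : Exec (aHead [ lit 0 ]≔ⁿ lit 0) σ 1 (_≡ σ₁)
    clear-head = exec assignⁿ ≤-refl refl
    clear-tail : Exec (aTail [ lit 0 ]≔ⁿ lit 0) σ₁ 1 (_≡ σ₂)
    clear-tail = exec assignⁿ ≤-refl refl
    Walked : ℕ → Store → Set
    Walked k τ = nats τ aHead 0 ≡ head k × nats τ aTail 0 ≡ tail k
    move : ∀ τ → nats τ aHead 0 ≡ head k → nats τ aTail 0 ≡ tail k → Exec (aRem [ lit 0 ]≔ⁿ var aTail) τ 1 (Read k)
    move τ head≡ tail≡ = exec assignⁿ ≤-refl (head≡ , tail≡)
    walking : ∀ rest j τ → nats τ aRem 0 ≡ rest → nats τ aHead 0 ≡ head j → nats τ aTail 0 ≡ tail j → Halts (ticked walk) τ (Walked (rest + j))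
    walking zero       j τ rem≡ head≡ tail≡ = halts (exit (≤⇒<ᵇ-false (≤-reflexive rem≡)) (head≡ , tail≡))
    walking (suc rest) j τ rem≡ head≡ tail≡ = unrollʰ (<⇒<ᵇ-true (subst (0 <_) (sym rem≡) (s≤s z≤n)))
      (halts ticking thenʰ λ { _ _ refl → halts decrease thenʰ λ { _ _ refl → ifʰ
        (λ eq → halts (straight (aHead [ lit 0 ]≔ⁿ var aHead ⊖ lit 1 ⨾ aTail [ lit 0 ]≔ⁿ var aTail ⊕ lit 1) {ok = refl}
          (continue _ rem′ (descend head≡ tail≡ (<ᵇ-true eq)))))
        (λ eq → halts (straight (aHead [ lit 0 ]≔ⁿ var aTail ⊕ lit 1 ⨾ aTail [ lit 0 ]≔ⁿ lit 0) {ok = refl}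
          (continue _ rem′ (jump head≡ tail≡ (<ᵇ-false eq))))) } })
      where
      τ₁ = setⁿ clock (nats τ clock 0 + 1) τ
      τ₂ = setⁿ aRem (nats τ aRem 0 ∸ 1) τ₁
      ticking : Exec tick τ 1 (_≡ τ₁)
      ticking = exec assignⁿ ≤-refl refl
      decrease : Exec (aRem [ lit 0 ]≔ⁿ var aRem ⊖ lit 1) τ₁ 1 (_≡ τ₂)
      decrease = exec assignⁿ ≤-refl refl
      rem′ : nats τ aRem 0 ∸ 1 ≡ rest
      rem′ = cong (_∸ 1) rem≡
      descend : ∀ {a b p} → a ≡ proj₁ p → b ≡ proj₂ p → 0 < a → (a ∸ 1 , b + 1) ≡ successor p
      descend {p = suc a , b} refl refl _ = cong (a ,_) (+-comm b 1)
      jump : ∀ {a b p} → a ≡ proj₁ p → b ≡ proj₂ p → a ≤ 0 → (b + 1 , 0) ≡ successor p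
      jump {p = zero , b} refl refl _ = cong (_, 0) (+-comm b 1)
      continue : ∀ υ → nats υ aRem 0 ≡ rest → (nats υ aHead 0 , nats υ aTail 0) ≡ successor (unpair j) → Halts (ticked walk) υ (Walked (suc rest + j))
      continue υ rem≡ eq = subst (λ k → Halts (ticked walk) υ (Walked k)) (+-suc rest j)
        (walking rest (suc j) υ rem≡ (cong proj₁ eq) (cong proj₂ eq))

  read-codes : ∀ k τ d ds → Read k τ → Codes (d ∷ ds) k → nats τ aHead 0 ≡ d × Codes ds (nats τ aRem 0)
  read-codes k τ d ds (h , r) (head≡ , codes) = trans h head≡ , subst (Codes ds) (sym r) codes

module Dovetail (R : RealNumbers) where
  open Programs
  open import Data.Nat as ℕ using (ℕ; suc; z≤n; s≤s; _≡ᵇ_)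
  import Data.Nat.Properties as ℕ
  open RealArithmetic R
  open Hoare R

  private
    module _ (p q : Program) (clean : (writesⁿ clock p ∨ writesⁿ clock q) ∨ (writesʳ 0 p ∨ writesʳ 0 q) ≡ false) where
      split = ∨-false {writesⁿ clock p ∨ writesⁿ clock q} clean
      splitⁿ = ∨-false {writesⁿ clock p} (proj₁ split)
      splitʳ = ∨-false {writesʳ 0 p} (proj₂ split)
      left : writesClock p ≡ false
      left rewrite proj₁ splitⁿ = proj₁ splitʳ
      right : writesClock q ≡ false
      right rewrite proj₂ splitⁿ = proj₂ splitʳ

    now : Store → ℕ
    now σ = nats σ clock 0

    assign-nowⁿ : ∀ {σ a i v} → writesClock (a [ i ]≔ⁿ v) ≡ false → let τ = result (a [ i ]≔ⁿ v) σ in now τ ≡ now σ × reals τ 0 0 ≡ reals σ 0 0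
    assign-nowⁿ {σ} {a} {i} {v} clean = update-array (nats σ) a (evalⁿ σ i) (evalⁿ σ v) clock 0 (proj₁ (∨-false {clock ≡ᵇ a} clean)) , refl

    assign-nowʳ : ∀ {σ a i v} → writesClock (a [ i ]≔ʳ v) ≡ false → let τ = result (a [ i ]≔ʳ v) σ in now τ ≡ now σ × reals τ 0 0 ≡ reals σ 0 0
    assign-nowʳ {σ} {a} {i} {v} clean = refl , update-array (reals σ) a (evalⁿ σ i) (evalʳ σ v) 0 0 clean

  Expired : Store → Set
  Expired σ = fromℕ 8 ≤ fromℕ (nats σ clock 0) * reals σ 0 0

  expired-cond : ∀ {σ} → Expired σ → ∀ b → evalᶜ σ (b and notᶜ expired) ≡ false
  expired-cond {σ} e b = trans (cong (λ d → evalᶜ σ b ∧ not d) (true-does (fromℕ 8 ≤? fromℕ (nats σ clock 0) * reals σ 0 0) e)) (∧-false (evalᶜ σ b))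

  running : ∀ {σ b} → evalᶜ σ b ≡ true → ¬ Expired σ → evalᶜ σ (b and notᶜ expired) ≡ true
  running {σ} eq ¬e = cong₂ (λ c d → c ∧ not d) eq (false-does (fromℕ 8 ≤? fromℕ (nats σ clock 0) * reals σ 0 0) ¬e)

  private
    Expired-cong : ∀ {σ τ} → now τ ≡ now σ × reals τ 0 0 ≡ reals σ 0 0 → Expired σ → Expired τ
    Expired-cong (eq , eq′) = subst₂ (λ k x → fromℕ 8 ≤ fromℕ k * x) (sym eq) (sym eq′)

  halts-expired : ∀ p {σ} → writesClock p ≡ false → Expired σ → ∃[ T ] ∃[ τ ] Run (guarded p) σ T τ × Expired τ
  halts-expired skip          clean e = _ , _ , skip , e
  halts-expired (a [ i ]≔ⁿ v) {σ} clean e = _ , _ , assignⁿ , Expired-cong {σ} {result (a [ i ]≔ⁿ v) σ} (assign-nowⁿ {σ} {a} {i} {v} clean) e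
  halts-expired (a [ i ]≔ʳ v) {σ} clean e = _ , _ , assignʳ , Expired-cong {σ} {result (a [ i ]≔ʳ v) σ} (assign-nowʳ {σ} {a} {i} {v} clean) e
  halts-expired (p ⨾ q) clean e with halts-expired p (left p q clean) e
  ... | T , τ , r , e′ with halts-expired q (right p q clean) e′
  ...   | U , υ , r′ , e″ = _ , _ , seq r r′ , e″
  halts-expired (ifᶜ b p q) {σ} clean e with evalᶜ σ b in eq
  ... | true with halts-expired p (left p q clean) e
  ...   | T , τ , r , e′ = _ , _ , if-true eq r , e′
  halts-expired (ifᶜ b p q) {σ} clean e | false with halts-expired q (right p q clean) e
  ...   | T , τ , r , e′ = _ , _ , if-false eq r , e′
  halts-expired (while b p) {σ} clean e = _ , _ , while-false (expired-cond {σ} e b) , e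

  Outcome : Program → Store → Store → Set
  Outcome p σ τ = (∃[ T ] Run (guarded p) σ T τ) ⊎ (∃[ T ] ∃[ υ ] Run (guarded p) σ T υ × Expired υ)

  simulate : ∀ p {σ T τ} → writesClock p ≡ false → Run (ticked p) σ T τ → Outcome p σ τ
  simulate skip          clean skip    = inj₁ (_ , skip)
  simulate (a [ i ]≔ⁿ v) clean assignⁿ = inj₁ (_ , assignⁿ)
  simulate (a [ i ]≔ʳ v) clean assignʳ = inj₁ (_ , assignʳ)
  simulate (p ⨾ q) clean (seq r s) with simulate p (left p q clean) r
  ... | inj₂ (_ , υ , r′ , e) with halts-expired q (right p q clean) e
  ...   | _ , υ′ , s′ , e′ = inj₂ (_ , υ′ , seq r′ s′ , e′)
  simulate (p ⨾ q) clean (seq r s) | inj₁ (_ , r′) with simulate q (right p q clean) s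
  ...   | inj₁ (_ , s′) = inj₁ (_ , seq r′ s′)
  ...   | inj₂ (_ , υ , s′ , e) = inj₂ (_ , υ , seq r′ s′ , e)
  simulate (ifᶜ b p q) clean (if-true eq r) with simulate p (left p q clean) r
  ... | inj₁ (_ , r′) = inj₁ (_ , if-true eq r′)
  ... | inj₂ (_ , υ , r′ , e) = inj₂ (_ , υ , if-true eq r′ , e)
  simulate (ifᶜ b p q) clean (if-false eq r) with simulate q (right p q clean) r
  ... | inj₁ (_ , r′) = inj₁ (_ , if-false eq r′)
  ... | inj₂ (_ , υ , r′ , e) = inj₂ (_ , υ , if-false eq r′ , e)
  simulate (while b p) {σ} clean (while-false eq) = inj₁ (_ , while-false (cong (_∧ evalᶜ σ (notᶜ expired)) eq))
  simulate (while b p) {σ} clean (while-true eq (seq t r) s) with fromℕ 8 ≤? fromℕ (nats σ clock 0) * reals σ 0 0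
  ... | yes e = inj₂ (_ , σ , while-false (expired-cond {σ} e b) , e)
  ... | no ¬e with simulate p clean r
  ...   | inj₂ (_ , υ , r′ , e) = inj₂ (_ , υ , while-true (running {σ} {b} eq ¬e) (seq t r′) (while-false (expired-cond {υ} e b)) , e)
  ...   | inj₁ (_ , r′) with simulate (while b p) clean s
  ...     | inj₁ (_ , s′) = inj₁ (_ , while-true (running {σ} {b} eq ¬e) (seq t r′) s′)
  ...     | inj₂ (_ , υ , s′ , e) = inj₂ (_ , υ , while-true (running {σ} {b} eq ¬e) (seq t r′) s′ , e)

  -- The clock has not run past 8/ε by more than one.
  Tight : Store → Set
  Tight σ = fromℕ (ℕ.pred (nats σ clock 0)) * reals σ 0 0 ≤ fromℕ 8

  record Timed (c : ℕ) (σ : Store) (T : ℕ) (τ : Store) : Set where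
    field
      elapsed  : ℕ
      now≡     : nats τ clock 0 ≡ elapsed ℕ.+ nats σ clock 0
      cost≤    : T ℕ.≤ c ℕ.* suc elapsed
      tight    : Tight σ → Tight τ

  private
    unmoved : ∀ {σ τ} → now τ ≡ now σ × reals τ 0 0 ≡ reals σ 0 0 → Timed 1 σ 1 τ
    unmoved (eq , eq′) = record { elapsed = 0 ; now≡ = eq ; cost≤ = ℕ.≤-refl
      ; tight = subst₂ (λ k x → fromℕ (ℕ.pred k) * x ≤ fromℕ 8) (sym eq) (sym eq′) }

    enlarge : ∀ {c d σ T τ} → c ℕ.≤ d → Timed c σ T τ → Timed d σ T τ
    enlarge c≤d X = record { elapsed = elapsed ; now≡ = now≡ ; cost≤ = ℕ.≤-trans cost≤ (ℕ.*-monoˡ-≤ (suc elapsed) c≤d) ; tight = tight }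
      where open Timed X

    one-more : ∀ {c d σ T τ} → c ℕ.≤ d → Timed c σ T τ → Timed (suc d) σ (suc T) τ
    one-more c≤d X = record { elapsed = elapsed ; now≡ = now≡ ; tight = tight
      ; cost≤ = ℕ.+-mono-≤ (s≤s (z≤n {elapsed})) (ℕ.≤-trans cost≤ (ℕ.*-monoˡ-≤ (suc elapsed) c≤d)) }
      where open Timed X

  guarded-time : ∀ p {σ T τ} → writesClock p ≡ false → Run (guarded p) σ T τ → Timed (cost p) σ T τ
  guarded-time skip          clean skip    = unmoved (refl , refl)
  guarded-time (a [ i ]≔ⁿ v) {σ} clean assignⁿ = unmoved (assign-nowⁿ {σ} {a} {i} {v} clean)
  guarded-time (a [ i ]≔ʳ v) {σ} clean assignʳ = unmoved (assign-nowʳ {σ} {a} {i} {v} clean)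
  guarded-time (p ⨾ q) clean (seq r s) = record
    { elapsed = Y.elapsed ℕ.+ X.elapsed
    ; now≡ = trans Y.now≡ (trans (cong (Y.elapsed ℕ.+_) X.now≡) (sym (ℕ.+-assoc Y.elapsed X.elapsed _)))
    ; cost≤ = ℕ.≤-trans (ℕ.+-mono-≤ X.cost≤ Y.cost≤) (ℕ.≤-trans (ℕ.+-mono-≤
        (ℕ.*-monoʳ-≤ (cost p) (s≤s (ℕ.m≤n+m X.elapsed Y.elapsed))) (ℕ.*-monoʳ-≤ (cost q) (s≤s (ℕ.m≤m+n Y.elapsed X.elapsed))))
        (ℕ.≤-reflexive (sym (ℕ.*-distribʳ-+ (suc (Y.elapsed ℕ.+ X.elapsed)) (cost p) (cost q)))))
    ; tight = λ t → Y.tight (X.tight t) }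
    where
    module X = Timed (guarded-time p (left p q clean) r)
    module Y = Timed (guarded-time q (right p q clean) s)
  guarded-time (ifᶜ b p q) clean (if-true eq r)  = one-more (ℕ.m≤m+n (cost p) (cost q)) (guarded-time p (left p q clean) r)
  guarded-time (ifᶜ b p q) clean (if-false eq r) = one-more (ℕ.m≤n+m (cost q) (cost p)) (guarded-time q (right p q clean) r)
  guarded-time (while b p) clean (while-false eq) = enlarge (s≤s z≤n) (unmoved (refl , refl))
  guarded-time (while b p) {σ} clean (while-true eq (seq {T = .1} (assignⁿ) r) s) = record
    { elapsed = Y.elapsed ℕ.+ suc X.elapsed
    ; now≡ = trans Y.now≡ (trans (cong (Y.elapsed ℕ.+_) X.now≡) (shift Y.elapsed X.elapsed (nats σ clock 0)))
    ; cost≤ = ℕ.≤-trans (s≤s (ℕ.+-mono-≤ (s≤s X.cost≤) Y.cost≤)) (bound (cost p) X.elapsed Y.elapsed)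
    ; tight = λ _ → Y.tight (X.tight ticked-tight) }
    where
    module X = Timed (guarded-time p clean r)
    module Y = Timed (guarded-time (while b p) clean s)
    shift : ∀ y x k → y ℕ.+ (x ℕ.+ (k ℕ.+ 1)) ≡ y ℕ.+ suc x ℕ.+ k
    shift = solve-∀
    bound : ∀ c x y → suc (suc (c ℕ.* suc x) ℕ.+ (2 ℕ.+ c) ℕ.* suc y) ℕ.≤ (2 ℕ.+ c) ℕ.* suc (y ℕ.+ suc x)
    bound c x y = subst (suc (suc (c ℕ.* suc x) ℕ.+ (2 ℕ.+ c) ℕ.* suc y) ℕ.≤_) (identity c x y) (ℕ.m≤m+n _ (2 ℕ.* x))
      where
      identity : ∀ c x y → suc (suc (c ℕ.* suc x) ℕ.+ (2 ℕ.+ c) ℕ.* suc y) ℕ.+ 2 ℕ.* x ≡ (2 ℕ.+ c) ℕ.* suc (y ℕ.+ suc x)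
      identity = solve-∀
    ticked-tight : fromℕ (ℕ.pred (nats σ clock 0 ℕ.+ 1)) * reals σ 0 0 ≤ fromℕ 8
    ticked-tight = subst (λ k → fromℕ k * reals σ 0 0 ≤ fromℕ 8) (cong ℕ.pred (ℕ.+-comm 1 (nats σ clock 0)))
      (≰⇒≥ (does-false (_ ≤? _) (not-true (proj₂ (∧-true {evalᶜ σ b} eq)))))

module Machine {R : RealNumbers} (N : Network R) (ε : RealNumbers.ℝ R) where
  open Programs
  open Hoare R
  open Network N

  record Input (σ : Store) : Set where
    field
      n≡   : nats σ 0 0 ≡ n
      m≡   : nats σ 0 1 ≡ m
      s≡   : nats σ 0 2 ≡ toℕ s
      t≡   : nats σ 0 3 ≡ toℕ t
      L≡   : nats σ 0 4 ≡ L
      src≡ : ∀ e → nats σ 1 (toℕ e) ≡ toℕ (src e)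
      tgt≡ : ∀ e → nats σ 2 (toℕ e) ≡ toℕ (tgt e)
      ℓ≡   : ∀ e → nats σ 3 (toℕ e) ≡ ℓ e
      ε≡   : reals σ 0 0 ≡ ε
      c≡   : ∀ e → reals σ 1 (toℕ e) ≡ c e

  input-kept : ∀ {p σ τ} → writesInput p ≡ false → Frame p σ τ → Input σ → Input τ
  input-kept {p} eq (frame fn fr) I = record
    { n≡ = trans (fn 0 w0 0) n≡ ; m≡ = trans (fn 0 w0 1) m≡ ; s≡ = trans (fn 0 w0 2) s≡
    ; t≡ = trans (fn 0 w0 3) t≡ ; L≡ = trans (fn 0 w0 4) L≡
    ; src≡ = λ e → trans (fn 1 w1 _) (src≡ e) ; tgt≡ = λ e → trans (fn 2 w2 _) (tgt≡ e) ; ℓ≡ = λ e → trans (fn 3 w3 _) (ℓ≡ e)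
    ; ε≡ = trans (fr 0 r0 0) ε≡ ; c≡ = λ e → trans (fr 1 r1 _) (c≡ e) }
    where
    open Input I
    first = ∨-false {writesⁿ 0 p ∨ writesⁿ 1 p} eq
    w0 = proj₁ (∨-false {writesⁿ 0 p} (proj₁ first))
    w1 = proj₂ (∨-false {writesⁿ 0 p} (proj₁ first))
    second = ∨-false {writesⁿ 2 p ∨ writesⁿ 3 p} (proj₂ first)
    w2 = proj₁ (∨-false {writesⁿ 2 p} (proj₁ second))
    w3 = proj₂ (∨-false {writesⁿ 2 p} (proj₁ second))
    r0 = proj₁ (∨-false {writesʳ 0 p} (proj₂ second))
    r1 = proj₂ (∨-false {writesʳ 0 p} (proj₂ second))

module PathTable {R : RealNumbers} (N : Network R) (w : Network.E N → ℕ) (w-positive : ∀ e → 1 ℕ.≤ w e) where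
  open import Data.Nat as ℕ using (ℕ; zero; suc; _+_; _*_; _∸_; _≤_; _<_; z≤n; s≤s)
  open import Data.Nat.Properties
  open Network N
  open Flows N

  Touched : V → Set
  Touched v = ∃[ e ] (v ≡ src e ⊎ v ≡ tgt e)

  weight : List E → ℕ
  weight P = ℕ.sum (map w P)

  ix : ℕ → V → ℕ
  ix k v = k * n + toℕ v

  ix-below : ∀ k v {k′} → k < k′ → ix k v < k′ * n
  ix-below k v {k′} k<k′ = begin-strict
    k * n + toℕ v <⟨ +-monoʳ-< (k * n) (Fin.toℕ<n v) ⟩
    k * n + n     ≡⟨ +-comm (k * n) n ⟩
    suc k * n     ≤⟨ *-monoˡ-≤ n k<k′ ⟩
    k′ * n ∎
    where open ≤-Reasoning

  Cells : Set
  Cells = ℕ → ℕ × ℕ × ℕ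

  -- The cell for (k , v) holds the length of a shortest walk from v to t of weight at most k (some
  -- number exceeding L if there is none), its first edge, and the cell for the rest of the walk.
  module _ (cell : Cells) where
    dist first next : ℕ → ℕ
    dist x  = proj₁ (cell x)
    first x = proj₁ (proj₂ (cell x))
    next x  = proj₂ (proj₂ (cell x))

    data Valid (k : ℕ) (v : V) : Set where
      far  : L < dist (ix k v) → Valid k v
      sink : v ≡ t → dist (ix k v) ≡ 0 → Valid k v
      step : ∀ e k′ → src e ≡ v → k′ + w e ≤ k → first (ix k v) ≡ toℕ e → next (ix k v) ≡ ix k′ (tgt e) →
        dist (ix k v) ≡ ℓ e + dist (ix k′ (tgt e)) → Valid k v

    record Table (K : ℕ) : Set where
      field
        valid    : ∀ {k} → k ≤ K → ∀ {v} → Touched v → Valid k v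
        at-sink  : ∀ {k} → k ≤ K → dist (ix k t) ≡ 0
        edge     : ∀ {k} → k ≤ K → ∀ e → w e ≤ k → dist (ix k (src e)) ≤ ℓ e + dist (ix (k ∸ w e) (tgt e))
        antitone : ∀ {k} → k < K → ∀ {v} → Touched v → dist (ix (suc k) v) ≤ dist (ix k v)

    data Follows : ℕ → List E → Set where
      stop : ∀ {x} → dist x ≡ 0 → Follows x []
      go   : ∀ {x e P} → 0 < dist x → first x ≡ toℕ e → Follows (next x) P → Follows x (e ∷ P)

    module _ {K : ℕ} (T : Table K) where
      open Table T

      antitone-≤ : ∀ {j k} → j ≤ k → k ≤ K → ∀ {v} → Touched v → dist (ix k v) ≤ dist (ix j v)
      antitone-≤ {k = zero}  z≤n   k≤K _ = ≤-refl
      antitone-≤ {j} {suc k} j≤1+k k≤K touched with j ≤? k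
      ... | yes j≤k = ≤-trans (antitone k≤K touched) (antitone-≤ j≤k (<⇒≤ k≤K) touched)
      ... | no j≰k with refl ← ≤-antisym j≤1+k (≰⇒> j≰k) = ≤-refl

      dist-≤ : ∀ {k u} P → k ≤ K → IsWalk u t P → weight P ≤ k → dist (ix k u) ≤ len P
      dist-≤ []      k≤K refl          _  = ≤-reflexive (at-sink k≤K)
      dist-≤ {k} (e ∷ P) k≤K (refl , walk) W≤ = ≤-trans (edge k≤K e (≤-trans (m≤m+n (w e) _) W≤))
        (+-monoʳ-≤ (ℓ e) (dist-≤ P (≤-trans (m∸n≤m k (w e)) k≤K) walk
          (subst (_≤ k ∸ w e) (m+n∸m≡n (w e) (weight P)) (∸-monoˡ-≤ (w e) W≤))))

      record Extracted (k : ℕ) (v : V) (P : List E) : Set where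
        field
          follows : Follows (ix k v) P
          walk    : IsWalk v t P
          unique  : Unique (v ∷ map tgt P)
          length≡ : len P ≡ dist (ix k v)
          weight≤ : weight P ≤ k
          -- The distances strictly decrease along P; with antitonicity this makes P simple.
          closer  : All (λ u → Touched u × dist (ix k u) < dist (ix k v)) (map tgt P)

      extract : ∀ bound k v → k < bound → k ≤ K → Touched v → dist (ix k v) ≤ L → ∃[ P ] Extracted k v P
      extract (suc bound) k v (s≤s k≤bound) k≤K touched near with valid k≤K touched
      ... | far L< = contradiction near (<⇒≱ L<)
      ... | sink refl d≡0 = [] , record
        { follows = stop d≡0 ; walk = refl ; unique = [] ∷ [] ; length≡ = sym d≡0 ; weight≤ = z≤n ; closer = [] }
      ... | step e k′ refl k′+w≤k first≡ next≡ dist≡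
        with extract bound k′ (tgt e) (<-≤-trans k′<k k≤bound) k′≤K touched′ (≤-trans (m≤n+m _ (ℓ e)) (subst (_≤ L) dist≡ near))
        where
        k′<k : k′ < k
        k′<k = <-≤-trans (m<m+n k′ (w-positive e)) k′+w≤k
        k′≤K = ≤-trans (<⇒≤ k′<k) k≤K
        touched′ : Touched (tgt e)
        touched′ = e , inj₂ refl
      ... | P , X = e ∷ P , record
        { follows = go (subst (0 <_) (sym dist≡) (<-≤-trans (ℓ-positive e) (m≤m+n _ _))) first≡
                       (subst (λ x → Follows x P) (sym next≡) (Extracted.follows X))
        ; walk = refl , Extracted.walk X
        ; unique = All.map (λ (_ , d<) eq → <-irrefl (cong (λ u → dist (ix k u)) (sym eq)) d<) closer′ ∷ Extracted.unique X
        ; length≡ = trans (cong (ℓ e +_) (Extracted.length≡ X)) (sym dist≡)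
        ; weight≤ = ≤-trans (+-monoʳ-≤ (w e) (Extracted.weight≤ X)) (≤-trans (≤-reflexive (+-comm (w e) k′)) k′+w≤k)
        ; closer = closer′ }
        where
        k′≤k : k′ ≤ k
        k′≤k = ≤-trans (m≤m+n k′ (w e)) k′+w≤k
        tgt-closer : dist (ix k′ (tgt e)) < dist (ix k (src e))
        tgt-closer = subst (dist (ix k′ (tgt e)) <_) (sym dist≡) (m<n+m _ (ℓ-positive e))
        closer′ : All (λ u → Touched u × dist (ix k u) < dist (ix k (src e))) (tgt e ∷ map tgt P)
        closer′ = ((e , inj₂ refl) , ≤-<-trans (antitone-≤ k′≤k k≤K (e , inj₂ refl)) tgt-closer) ∷
          All.map (λ (touched , d<) → touched ,
            ≤-<-trans (antitone-≤ k′≤k k≤K touched) (<-trans d< tgt-closer)) (Extracted.closer X)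

  module _ {cell cell′ : Cells} {k : ℕ} (agree : ∀ {x} → x < suc k * n → cell′ x ≡ cell x) where
    private
      agree-at : ∀ {j} v → j ≤ k → cell′ (ix j v) ≡ cell (ix j v)
      agree-at v j≤k = agree (ix-below _ v (s≤s j≤k))
      dist-at : ∀ {j} v → j ≤ k → dist cell′ (ix j v) ≡ dist cell (ix j v)
      dist-at v j≤k = cong proj₁ (agree-at v j≤k)

    valid-transport : ∀ {j v} → j ≤ k → Valid cell j v → Valid cell′ j v
    valid-transport {v = v} j≤k (far L<)       = far (subst (L <_) (sym (dist-at v j≤k)) L<)
    valid-transport {v = v} j≤k (sink v≡t d≡0) = sink v≡t (trans (dist-at v j≤k) d≡0)
    valid-transport {v = v} j≤k (step e k′ src≡ k′≤ first≡ next≡ dist≡) = step e k′ src≡ k′≤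
      (trans (cong (λ z → proj₁ (proj₂ z)) (agree-at v j≤k)) first≡)
      (trans (cong (λ z → proj₂ (proj₂ z)) (agree-at v j≤k)) next≡)
      (trans (dist-at v j≤k) (trans dist≡ (cong (ℓ e +_) (sym (dist-at (tgt e) (≤-trans (≤-trans (m≤m+n k′ (w e)) k′≤) j≤k))))))

    table-transport : Table cell k → Table cell′ k
    table-transport T = record
      { valid    = λ j≤k touched → valid-transport j≤k (valid j≤k touched)
      ; at-sink  = λ j≤k → trans (dist-at t j≤k) (at-sink j≤k)
      ; edge     = λ {j} j≤k e w≤ → subst₂ _≤_ (sym (dist-at (src e) j≤k))
                     (cong (ℓ e +_) (sym (dist-at (tgt e) (≤-trans (m∸n≤m j (w e)) j≤k)))) (edge j≤k e w≤)
      ; antitone = λ j<k {v} touched → subst₂ _≤_ (sym (dist-at v j<k)) (sym (dist-at v (<⇒≤ j<k))) (antitone j<k touched) }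
      where open Table T

  module _ {cell : Cells} {k : ℕ} (T : Table cell k) where
    open Table T

    record NewRow : Set where
      field
        row-valid   : ∀ {v} → Touched v → Valid cell (suc k) v
        row-below   : ∀ {v} → Touched v → dist cell (ix (suc k) v) ≤ dist cell (ix k v)
        row-edge    : ∀ e → w e ≤ suc k → dist cell (ix (suc k) (src e)) ≤ ℓ e + dist cell (ix (suc k ∸ w e) (tgt e))

    extend-table : Touched t → NewRow → Table cell (suc k)
    extend-table touched-t row = record
      { valid    = λ j≤ touched → by-row (λ j → Valid cell j _) (λ j≤k → valid j≤k touched) (row-valid touched) j≤
      ; at-sink  = λ j≤ → by-row (λ j → dist cell (ix j t) ≡ 0) at-sink
          (n≤0⇒n≡0 (≤-trans (row-below touched-t) (≤-reflexive (at-sink ≤-refl)))) j≤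
      ; edge     = λ j≤ e → by-row (λ j → w e ≤ j → dist cell (ix j (src e)) ≤ ℓ e + dist cell (ix (j ∸ w e) (tgt e)))
          (λ j≤k → edge j≤k e) (row-edge e) j≤
      ; antitone = λ j<1+k {v} touched → by-row (λ j → dist cell (ix j v) ≤ dist cell (ix (ℕ.pred j) v))
          (λ { {zero} _ → ≤-refl ; {suc j} j≤k → antitone j≤k touched }) (row-below touched) j<1+k }
      where
      open NewRow row
      by-row : ∀ (Q : ℕ → Set) → (∀ {j} → j ≤ k → Q j) → Q (suc k) → ∀ {j} → j ≤ suc k → Q j
      by-row Q old new {j} j≤ with j ≤? k
      ... | yes j≤k = old j≤k
      ... | no j≰k with refl ← ≤-antisym j≤ (≰⇒> j≰k) = new

module ShortestPath {R : RealNumbers} (N : Network R) (ε : RealNumbers.ℝ R) where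
  open Programs
  open import Data.Nat using (ℕ; suc; _+_; _*_; _∸_; _≤_; _<_; z≤n; s≤s; _<ᵇ_)
  open import Data.Nat.Properties
  open Hoare R
  open Machine N ε
  open Network N
  open Flows N

  cells : Store → ℕ → ℕ × ℕ × ℕ
  cells σ x = nats σ aG x , nats σ aF x , nats σ aX x

  written : ℕ → ℕ × ℕ × ℕ → Store → Store
  written i (a , b , c) σ = store (update (update (update (nats σ) aG i a) aF i b) aX i c) (reals σ)

  written-same : ∀ i v σ → cells (written i v σ) i ≡ v
  written-same i (a , b , c) σ rewrite ≡ᵇ-refl i = refl

  written-other : ∀ i v σ {x} → x ≢ i → cells (written i v σ) x ≡ cells σ x
  written-other i (a , b , c) σ x≢i rewrite ≢⇒≡ᵇ-false x≢i = refl

  baseTime newTime : ℕ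
  baseTime = 1 + ((2 + m * (3 + 2)) + 1)
  newTime  = 1 + ((2 + m * (3 + 6)) + (2 + m * (3 + 4)))

  fillTime : ℕ → ℕ
  fillTime K = baseTime + (2 + K * (3 + newTime))

  module Filling (w : E → ℕ) (w-positive : ∀ e → 1 ≤ w e) where
    open PathTable N w w-positive

    ix-injective : ∀ k {u v} → ix k u ≡ ix k v → u ≡ v
    ix-injective k eq = Fin.toℕ-injective (+-cancelˡ-≡ (k * n) _ _ eq)

    record Weights (σ : Store) : Set where
      field w≡ : ∀ e → nats σ aW (toℕ e) ≡ w e

    Offsets : ℕ → (ℕ → ℕ) → Set
    Offsets k B = ∀ j → j ≤ k → B j ≡ j * n

    module _ (k : ℕ) (old : Cells) where

      record Copied (D : V → Set) (cell : Cells) : Set where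
        field
          below : ∀ {x} → x < suc k * n → cell x ≡ old x
          done  : ∀ {v} → D v → cell (ix (suc k) v) ≡ old (ix k v)

      copy-one : ∀ {D σ} u → Copied D (cells σ) →
        Copied (λ v → D v ⊎ v ≡ u) (cells (written (ix (suc k) u) (cells σ (ix k u)) σ))
      copy-one {D} {σ} u C = record { below = below′ ; done = done′ }
        where
        open Copied C
        i = ix (suc k) u
        v′ = cells σ (ix k u)
        below′ : ∀ {x} → x < suc k * n → cells (written i v′ σ) x ≡ old x
        below′ x< = trans (written-other i v′ σ (λ { refl → <⇒≱ x< (m≤m+n _ _) })) (below x<)
        done′ : ∀ {v} → D v ⊎ v ≡ u → cells (written i v′ σ) (ix (suc k) v) ≡ old (ix k v)
        done′ {v} d with v Fin.≟ u
        ... | yes refl = trans (written-same i v′ σ) (below (ix-below k v ≤-refl))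
        done′ {v} (inj₁ d) | no v≢u = trans (written-other i v′ σ (λ eq → v≢u (ix-injective (suc k) eq))) (done d)
        done′ {v} (inj₂ v≡u) | no v≢u = contradiction v≡u v≢u

      record Relaxed (j : ℕ) (cell : Cells) : Set where
        field
          below     : ∀ {x} → x < suc k * n → cell x ≡ old x
          valid     : ∀ {v} → Touched v → Valid cell (suc k) v
          row-below : ∀ {v} → Touched v → dist cell (ix (suc k) v) ≤ dist cell (ix k v)
          relaxed   : ∀ e → toℕ e < j → w e ≤ suc k → dist cell (ix (suc k) (src e)) ≤ ℓ e + dist cell (ix (suc k ∸ w e) (tgt e))

      relax-kept : ∀ {cell} e → Relaxed (toℕ e) cell →
        (w e ≤ suc k → dist cell (ix (suc k) (src e)) ≤ ℓ e + dist cell (ix (suc k ∸ w e) (tgt e))) →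
        Relaxed (suc (toℕ e)) cell
      relax-kept {cell} e Rx fine = record { below = below ; valid = valid ; row-below = row-below ; relaxed = relaxed′ }
        where
        open Relaxed Rx
        relaxed′ : ∀ e′ → toℕ e′ < suc (toℕ e) → w e′ ≤ suc k → _
        relaxed′ e′ e′<1+e with e′ Fin.≟ e
        ... | yes refl = fine
        ... | no e′≢e = relaxed e′ (≤∧≢⇒< (≤-pred e′<1+e) (λ eq → e′≢e (Fin.toℕ-injective eq)))

      relax-changed : ∀ {σ} e → Relaxed (toℕ e) (cells σ) → w e ≤ suc k →
        let x = ix (suc k ∸ w e) (tgt e) ; d = ℓ e + dist (cells σ) x in
        d < dist (cells σ) (ix (suc k) (src e)) →
        Relaxed (suc (toℕ e)) (cells (written (ix (suc k) (src e)) (d , toℕ e , x) σ))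
      relax-changed {σ} e Rx w≤ better = relax-kept e (record
        { below = λ x< → trans (low x<) (below x<)
        ; valid = valid′
        ; row-below = λ {v} touched → ≤-trans (decrease v)
            (≤-trans (row-below touched) (≤-reflexive (sym (cong proj₁ (low (ix-below k v ≤-refl))))))
        ; relaxed = λ e′ e′< w≤′ → ≤-trans (decrease (src e′)) (≤-trans (relaxed e′ e′< w≤′)
            (≤-reflexive (cong (ℓ e′ +_) (sym (cong proj₁ (low-row e′)))))) })
        (λ _ → ≤-reflexive (trans (cong proj₁ at-i) (cong (ℓ e +_) (sym (cong proj₁ (low-row e))))))
        where
        open Relaxed Rx
        i = ix (suc k) (src e)
        x = ix (suc k ∸ w e) (tgt e)
        d = ℓ e + dist (cells σ) x
        new = cells (written i (d , toℕ e , x) σ)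
        low : ∀ {y} → y < suc k * n → new y ≡ cells σ y
        low y< = written-other i (d , toℕ e , x) σ (λ { refl → <⇒≱ y< (m≤m+n _ _) })
        w-smaller : ∀ e′ → suc k ∸ w e′ < suc k
        w-smaller e′ = m∸n<m (suc k) (w e′) (s≤s z≤n) (w-positive e′)
          where
          m∸n<m : ∀ a b → 0 < a → 0 < b → a ∸ b < a
          m∸n<m (suc a) (suc b) _ _ = s≤s (m∸n≤m a b)
        low-row : ∀ e′ → new (ix (suc k ∸ w e′) (tgt e′)) ≡ cells σ (ix (suc k ∸ w e′) (tgt e′))
        low-row e′ = low (ix-below _ (tgt e′) (w-smaller e′))
        at-i : new i ≡ (d , toℕ e , x)
        at-i = written-same i (d , toℕ e , x) σ
        decrease : ∀ v → dist new (ix (suc k) v) ≤ dist (cells σ) (ix (suc k) v)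
        decrease v with v Fin.≟ src e
        ... | yes refl = ≤-trans (≤-reflexive (cong proj₁ at-i)) (<⇒≤ better)
        ... | no v≢ = ≤-reflexive (cong proj₁ (written-other i (d , toℕ e , x) σ (λ eq → v≢ (ix-injective (suc k) eq))))
        valid′ : ∀ {v} → Touched v → Valid new (suc k) v
        valid′ {v} touched with v Fin.≟ src e
        ... | yes refl = step e (suc k ∸ w e) refl (≤-reflexive (m∸n+n≡m w≤)) (cong (λ c → proj₁ (proj₂ c)) at-i)
                (cong (λ c → proj₂ (proj₂ c)) at-i) (trans (cong proj₁ at-i) (cong (ℓ e +_) (sym (cong proj₁ (low-row e)))))
        ... | no v≢ with valid touched
        ...   | far L< = far (subst (L <_) (sym (cong proj₁ same)) L<)
          where same = written-other i (d , toℕ e , x) σ (λ eq → v≢ (ix-injective (suc k) eq))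
        ...   | sink v≡t d≡0 = sink v≡t (trans (cong proj₁ same) d≡0)
          where same = written-other i (d , toℕ e , x) σ (λ eq → v≢ (ix-injective (suc k) eq))
        ...   | step e′ k′ src≡ k′≤ first≡ next≡ dist≡ = step e′ k′ src≡ k′≤
                (trans (cong (λ c → proj₁ (proj₂ c)) same) first≡) (trans (cong (λ c → proj₂ (proj₂ c)) same) next≡)
                (trans (cong proj₁ same) (trans dist≡ (cong (ℓ e′ +_)
                  (sym (cong proj₁ (low (ix-below k′ (tgt e′) (<-≤-trans (m<m+n k′ (w-positive e′)) k′≤))))))))
          where same = written-other i (d , toℕ e , x) σ (λ eq → v≢ (ix-injective (suc k) eq))

    Unreached : ℕ → (ℕ → ℕ) → Set
    Unreached j G = ∀ e → toℕ e < j → ∀ v → v ≡ src e ⊎ v ≡ tgt e → L < G (toℕ v)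

    mark-unreached : ∀ {σ} e → Input σ → nats σ aEdge 0 ≡ toℕ e → Unreached (toℕ e) (nats σ aG) →
      Exec (aG [ currentSrc ]≔ⁿ input-L ⊕ lit 1 ⨾ aG [ currentTgt ]≔ⁿ input-L ⊕ lit 1) σ 2
        (λ τ → Unreached (suc (toℕ e)) (nats τ aG))
    mark-unreached {σ} e I idx U = straight _ {ok = refl} unreached
      where
      open Input I
      infinite = nats σ 0 4 + 1
      L<infinite : L < infinite
      L<infinite = subst (λ l → L < l + 1) (sym L≡) (m<m+n L (s≤s z≤n))
      i₁ = nats σ 1 (nats σ aEdge 0)
      i₂ = nats σ 2 (nats σ aEdge 0)
      i₁≡ : i₁ ≡ toℕ (src e)
      i₁≡ = trans (cong (nats σ 1) idx) (src≡ e)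
      i₂≡ : i₂ ≡ toℕ (tgt e)
      i₂≡ = trans (cong (nats σ 2) idx) (tgt≡ e)
      f₁ = update (nats σ) aG i₁ infinite
      after : ∀ x → (L < nats σ aG x) ⊎ (x ≡ i₁ ⊎ x ≡ i₂) → L < update f₁ aG i₂ infinite aG x
      after x L< with x ≟ i₂
      ... | yes refl = subst (L <_) (sym (update-same f₁ aG i₂ infinite)) L<infinite
      ... | no x≢i₂ = subst (L <_) (sym (update-index f₁ aG i₂ infinite aG x≢i₂)) (after₁ L<)
        where
        after₁ : (L < nats σ aG x) ⊎ (x ≡ i₁ ⊎ x ≡ i₂) → L < f₁ aG x
        after₁ L< with x ≟ i₁
        ... | yes refl = subst (L <_) (sym (update-same (nats σ) aG i₁ infinite)) L<infinite
        after₁ (inj₁ L<)          | no x≢i₁ = subst (L <_) (sym (update-index (nats σ) aG i₁ infinite aG x≢i₁)) L<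
        after₁ (inj₂ (inj₁ x≡i₁)) | no x≢i₁ = contradiction x≡i₁ x≢i₁
        after₁ (inj₂ (inj₂ x≡i₂)) | no x≢i₁ = contradiction x≡i₂ x≢i₂
      unreached : Unreached (suc (toℕ e)) (λ x → update f₁ aG i₂ infinite aG x)
      unreached e′ e′<1+e v endpoint with e′ Fin.≟ e
      unreached e′ e′<1+e v (inj₁ refl) | yes refl = after (toℕ v) (inj₂ (inj₁ (sym i₁≡)))
      unreached e′ e′<1+e v (inj₂ refl) | yes refl = after (toℕ v) (inj₂ (inj₂ (sym i₂≡)))
      ... | no e′≢e = after (toℕ v) (inj₁ (U e′ (≤∧≢⇒< (≤-pred e′<1+e) (λ eq → e′≢e (Fin.toℕ-injective eq))) v endpoint))

    baseRowᵉ : ∀ {σ} → Input σ → Exec (ticked baseRow) σ baseTime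
      (λ τ → Offsets 0 (nats τ aB) × Table (cells τ) 0)
    baseRowᵉ {σ} I =
      offset then λ τ f B₀ →
      forᵉ aEdge input-m (aG [ currentSrc ]≔ⁿ input-L ⊕ lit 1 ⨾ aG [ currentTgt ]≔ⁿ input-L ⊕ lit 1)
        m (λ j υ → Unreached j (nats υ aG)) {refl}
        (λ υ g → Input.m≡ (input-kept refl g (input-kept refl f I)))
        (λ _ ()) (λ U → U) (λ U → U)
        (λ e υ g idx U → mark-unreached e (input-kept refl g (input-kept refl f I)) idx U)
      then λ υ g U → straight (aG [ input-t ]≔ⁿ lit 0) {ok = refl}
        ( (λ { .0 z≤n → trans (keepⁿ g aB refl 0) B₀ })
        , base {υ} (Input.t≡ (input-kept refl g (input-kept refl f I))) U )
      where
      offset : Exec (aB [ lit 0 ]≔ⁿ lit 0) σ 1 (λ τ → nats τ aB 0 ≡ 0)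
      offset = exec assignⁿ ≤-refl refl
      base : ∀ {υ} → nats υ 0 3 ≡ toℕ t → Unreached m (nats υ aG) →
        Table (cells (store (update (nats υ) aG (nats υ 0 3) 0) (reals υ))) 0
      base {υ} t≡ U = record
        { valid    = λ { z≤n (e , endpoint) → valid e endpoint }
        ; at-sink  = λ { z≤n → at-t }
        ; edge     = λ { z≤n e w≤0 → contradiction (≤-trans (w-positive e) w≤0) λ () }
        ; antitone = λ () }
        where
        new = cells (store (update (nats υ) aG (nats υ 0 3) 0) (reals υ))
        at-t : dist new (toℕ t) ≡ 0
        at-t = trans (cong (update (nats υ) aG (nats υ 0 3) 0 aG) (sym t≡)) (update-same (nats υ) aG (nats υ 0 3) 0)
        valid : ∀ e {v} → v ≡ src e ⊎ v ≡ tgt e → Valid new 0 v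
        valid e {v} endpoint with v Fin.≟ t
        ... | yes refl = sink refl at-t
        ... | no v≢t = far (subst (L <_) (sym (update-index (nats υ) aG (nats υ 0 3) 0 aG
                         (λ eq → v≢t (Fin.toℕ-injective (trans eq t≡))))) (U e (Fin.toℕ<n e) v endpoint))

    Located : ℕ → Store → Set
    Located k σ = nats σ aRow 0 ≡ k × Offsets (suc k) (nats σ aB)

    copy-vertex : ∀ {k old D σ} vᵉ v → Located k σ → evalⁿ σ vᵉ ≡ toℕ v →
      Copied k old D (cells σ) →
      Copied k old (λ u → D u ⊎ u ≡ v) (cells (written (evalⁿ σ (nextRow ⊕ vᵉ)) (cells σ (evalⁿ σ (thisRow ⊕ vᵉ))) σ))
    copy-vertex {k} {old} {D} {σ} vᵉ v (row , B≡) v≡ C =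
      subst₂ (λ i j → Copied k old (λ u → D u ⊎ u ≡ v) (cells (written i (cells σ j) σ)))
        (sym (cong₂ _+_ (trans (cong (nats σ aB) (trans (cong (_+ 1) row) (+-comm k 1))) (B≡ (suc k) ≤-refl)) v≡))
        (sym (cong₂ _+_ (trans (cong (nats σ aB) row) (B≡ k (n≤1+n k))) v≡))
        (copy-one k old {σ = σ} v C)

    copied-weaken : ∀ {k old cell} {D D′ : V → Set} → (∀ {v} → D′ v → D v) → Copied k old D cell → Copied k old D′ cell
    copied-weaken D′⇒D C = record { below = below ; done = λ d → done (D′⇒D d) }
      where open Copied C

    Before : ℕ → V → Set
    Before j v = ∃[ e ] toℕ e < j × (v ≡ src e ⊎ v ≡ tgt e)

    before-suc : ∀ {e v} → Before (suc (toℕ e)) v → (Before (toℕ e) v ⊎ v ≡ src e) ⊎ v ≡ tgt e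
    before-suc {e} (e′ , e′<1+e , endpoint) with e′ Fin.≟ e
    before-suc (e′ , e′<1+e , inj₁ v≡) | yes refl = inj₁ (inj₂ v≡)
    before-suc (e′ , e′<1+e , inj₂ v≡) | yes refl = inj₂ v≡
    ... | no e′≢e = inj₁ (inj₁ (e′ , ≤∧≢⇒< (≤-pred e′<1+e) (λ eq → e′≢e (Fin.toℕ-injective eq)) , endpoint))

    copy-edge : ∀ {k old σ} e → Input σ → Located k σ → nats σ aEdge 0 ≡ toℕ e →
      Copied k old (Before (toℕ e)) (cells σ) →
      Exec (copyCell currentSrc ⨾ copyCell currentTgt) σ 6 (λ τ → Copied k old (Before (suc (toℕ e))) (cells τ))
    copy-edge {k} {old} {σ} e I located idx C = straight (copyCell currentSrc ⨾ copyCell currentTgt) {ok = refl}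
      (copied-weaken before-suc
        (copy-vertex {σ = τ} currentTgt (tgt e) located (trans (cong (nats σ 2) idx) (tgt≡ e))
          (copy-vertex {σ = σ} currentSrc (src e) located (trans (cong (nats σ 1) idx) (src≡ e)) C)))
      where
      open Input I
      τ = written (evalⁿ σ (nextRow ⊕ currentSrc)) (cells σ (evalⁿ σ (thisRow ⊕ currentSrc))) σ

    relax-edge : ∀ {k old σ} e → Input σ → Weights σ → Located k σ → nats σ aEdge 0 ≡ toℕ e →
      Relaxed k old (toℕ e) (cells σ) →
      Exec relax σ 4 (λ τ → Relaxed k old (suc (toℕ e)) (cells τ))
    relax-edge {k} {old} {σ} e I W (row , B≡) idx Rx = ifᵉ
      (λ eq → straight (setCell (nextRow ⊕ currentSrc) (currentℓ ⊕ aG [ relaxTarget ]ⁿ) (var aEdge) relaxTarget) {ok = refl}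
        (subst₂ (λ i v → Relaxed k old (suc (toℕ e)) (cells (written i v σ))) (sym i≡) (sym (cong₂ _,_ d≡ (cong₂ _,_ idx x≡)))
          (relax-changed k old {σ} e Rx (w≤ (<ᵇ-true (proj₁ (∧-true eq))))
            (subst₂ _<_ d≡ (cong (nats σ aG) i≡) (<ᵇ-true (proj₂ (∧-true {evalᶜ σ (currentW <ⁿ var aRow ⊕ lit 2)} eq)))))))
      (λ eq → slower (s≤s z≤n) (straight skip {ok = refl} (relax-kept k old e Rx (λ w≤′ →
        subst₂ _≤_ (cong (nats σ aG) i≡) d≡ (<ᵇ-false (second eq w≤′))))))
      where
      open Input I
      open Weights W
      open import Data.Bool using (_∧_)
      w≡′ : evalⁿ σ currentW ≡ w e
      w≡′ = trans (cong (nats σ aW) idx) (w≡ e)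
      x≡ : evalⁿ σ relaxTarget ≡ ix (suc k ∸ w e) (tgt e)
      x≡ = cong₂ _+_ (trans (cong (nats σ aB) (cong₂ _∸_ (trans (cong (_+ 1) row) (+-comm k 1)) w≡′))
                            (B≡ (suc k ∸ w e) (m∸n≤m (suc k) (w e))))
                     (trans (cong (nats σ 2) idx) (tgt≡ e))
      i≡ : evalⁿ σ (nextRow ⊕ currentSrc) ≡ ix (suc k) (src e)
      i≡ = cong₂ _+_ (trans (cong (nats σ aB) (trans (cong (_+ 1) row) (+-comm k 1))) (B≡ (suc k) ≤-refl))
                     (trans (cong (nats σ 1) idx) (src≡ e))
      d≡ : evalⁿ σ (currentℓ ⊕ aG [ relaxTarget ]ⁿ) ≡ ℓ e + dist (cells σ) (ix (suc k ∸ w e) (tgt e))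
      d≡ = cong₂ _+_ (trans (cong (nats σ 3) idx) (ℓ≡ e)) (cong (nats σ aG) x≡)
      w≤ : evalⁿ σ currentW < evalⁿ σ (var aRow ⊕ lit 2) → w e ≤ suc k
      w≤ lt = ≤-pred (subst₂ _<_ w≡′ (trans (cong (_+ 2) row) (+-comm k 2)) lt)
      second : ∀ {b} → (evalⁿ σ currentW <ᵇ evalⁿ σ (var aRow ⊕ lit 2)) ∧ b ≡ false → w e ≤ suc k → b ≡ false
      second {b} eq w≤′ = trans (cong (_∧ b) (sym (<⇒<ᵇ-true (subst₂ _<_ (sym w≡′) (sym (trans (cong (_+ 2) row) (+-comm k 2))) (s≤s w≤′))))) eq

    newRowᵉ : ∀ {k σ} → Input σ → Weights σ → Touched t → nats σ aRow 0 ≡ k →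
      Offsets k (nats σ aB) × Table (cells σ) k →
      Exec (ticked newRow) σ newTime (λ τ → Offsets (suc k) (nats τ aB) × Table (cells τ) (suc k))
    newRowᵉ {k} {σ} I W touched-t row (B≡ , T) =
      offset then λ τ₁ f₁ (B₁ , same₁) →
      let I₁ = input-kept refl f₁ I
          copying = λ {υ} (g : Frame (ticked (for aEdge input-m (copyCell currentSrc ⨾ copyCell currentTgt))) τ₁ υ) →
            trans (keepⁿ g aRow refl 0) (trans (keepⁿ f₁ aRow refl 0) row) , λ j j≤ → trans (keepⁿ g aB refl j) (B₁ j j≤)
      in forᵉ aEdge input-m (copyCell currentSrc ⨾ copyCell currentTgt) m
           (λ j υ → Copied k (cells σ) (Before j) (cells υ)) {refl}
           (λ υ g → Input.m≡ (input-kept refl g I₁))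
           (record { below = λ {x} _ → same₁ x ; done = λ { (_ , () , _) } })
           (λ {_} {_} {υ} C → record { Copied C }) (λ C → record { Copied C })
           (λ e υ g idx C → copy-edge e (input-kept refl g I₁) (copying g) idx C)
      then λ τ₂ f₂ C →
      let I₂ = input-kept refl f₂ I₁
          located₂ = copying f₂
      in weaken ≤-refl (λ τ₃ f₃ Rx → (λ j j≤ → trans (keepⁿ f₃ aB refl j) (proj₂ located₂ j j≤)) , finish Rx)
         (forᵉ aEdge input-m relax m (λ j υ → Relaxed k (cells σ) j (cells υ)) {refl}
           (λ υ g → Input.m≡ (input-kept refl g I₂))
           (start C)
           (λ Rx → record { Relaxed Rx }) (λ Rx → record { Relaxed Rx })
           (λ e υ g idx Rx → relax-edge e (input-kept refl g I₂)
             (record { w≡ = λ e → trans (keepⁿ g aW refl _) (trans (keepⁿ f₂ aW refl _) (trans (keepⁿ f₁ aW refl _) (Weights.w≡ W e))) })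
             (trans (keepⁿ g aRow refl 0) (proj₁ located₂) , λ j j≤ → trans (keepⁿ g aB refl j) (proj₂ located₂ j j≤)) idx Rx))
      where
      offset : Exec (aB [ var aRow ⊕ lit 1 ]≔ⁿ thisRow ⊕ input-n) σ 1
        (λ τ → Offsets (suc k) (nats τ aB) × (∀ x → cells τ x ≡ cells σ x))
      offset = exec assignⁿ ≤-refl (offsets , λ _ → refl)
        where
        i = nats σ aRow 0 + 1
        v = nats σ aB (nats σ aRow 0) + nats σ 0 0
        i≡ : i ≡ suc k
        i≡ = trans (cong (_+ 1) row) (+-comm k 1)
        offsets : Offsets (suc k) (λ x → update (nats σ) aB i v aB x)
        offsets j j≤1+k with j ≟ i
        ... | yes refl = trans (update-same (nats σ) aB i v) (trans
                (cong₂ _+_ (trans (cong (nats σ aB) row) (B≡ k ≤-refl)) (Input.n≡ I))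
                (trans (+-comm (k * n) n) (cong (_* n) (sym i≡))))
        ... | no j≢i = trans (update-index (nats σ) aB i v aB j≢i) (B≡ j (≤-pred (≤∧≢⇒< j≤1+k (λ eq → j≢i (trans eq (sym i≡))))))
      start : ∀ {cell} → Copied k (cells σ) (Before m) cell → Relaxed k (cells σ) 0 cell
      start {cell} C = record { below = below ; valid = valid′ ; row-below = row-below′ ; relaxed = λ _ () }
        where
        open Copied C
        T′ : Table cell k
        T′ = table-transport below T
        copied : ∀ {v} → Touched v → cell (ix (suc k) v) ≡ cell (ix k v)
        copied {v} (e , endpoint) = trans (done (e , Fin.toℕ<n e , endpoint)) (sym (below (ix-below k v ≤-refl)))
        valid′ : ∀ {v} → Touched v → Valid cell (suc k) v
        valid′ {v} touched with Table.valid T′ ≤-refl touched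
        ... | far L< = far (subst (L <_) (sym (cong proj₁ (copied touched))) L<)
        ... | sink v≡t d≡0 = sink v≡t (trans (cong proj₁ (copied touched)) d≡0)
        ... | step e k′ src≡ k′≤ first≡ next≡ dist≡ = step e k′ src≡ (≤-trans k′≤ (n≤1+n k))
                (trans (cong (λ c → proj₁ (proj₂ c)) (copied touched)) first≡)
                (trans (cong (λ c → proj₂ (proj₂ c)) (copied touched)) next≡)
                (trans (cong proj₁ (copied touched)) dist≡)
        row-below′ : ∀ {v} → Touched v → dist cell (ix (suc k) v) ≤ dist cell (ix k v)
        row-below′ touched = ≤-reflexive (cong proj₁ (copied touched))
      finish : ∀ {cell} → Relaxed k (cells σ) m cell → Table cell (suc k)
      finish Rx = extend-table (table-transport below T) touched-t (record
        { row-valid = valid ; row-below = row-below ; row-edge = λ e → relaxed e (Fin.toℕ<n e) })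
        where open Relaxed Rx

    fillTableᵉ : ∀ {σ K} → Input σ → Weights σ → nats σ aK 0 ≡ K → Touched t →
      Exec (ticked fillTable) σ (fillTime K) (λ τ → Offsets K (nats τ aB) × Table (cells τ) K)
    fillTableᵉ {σ} {K} I W K≡ touched-t = baseRowᵉ I then λ τ f base →
      forᵉ aRow (var aK) newRow K (λ k υ → Offsets k (nats υ aB) × Table (cells υ) k) {refl}
        (λ υ g → trans (keepⁿ g aK refl 0) (trans (keepⁿ f aK refl 0) K≡))
        base
        (λ (B≡ , T) → B≡ , record { Table T }) (λ (B≡ , T) → B≡ , record { Table T })
        (λ k υ g row inv → newRowᵉ (input-kept refl g (input-kept refl f I))
          (record { w≡ = λ e → trans (keepⁿ g aW refl _) (trans (keepⁿ f aW refl _) (Weights.w≡ W e)) })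
          touched-t row inv)

module PathLoop {R : RealNumbers} (N : Network R) (ε : RealNumbers.ℝ R) where
  open Programs
  open import Data.Nat using (ℕ; zero; suc; _+_; _*_; _≤_; _<_; z≤n; s≤s; _≡ᵇ_)
  open import Data.Nat.Properties
  open Hoare R
  open Machine N ε
  open ShortestPath N ε
  open Network N
  open Flows N

  Segment : (ℕ → ℕ) → ℕ → List E → Set
  Segment f p []      = ⊤
  Segment f p (e ∷ P) = f p ≡ toℕ e × Segment f (suc p) P

  segment-cong : ∀ {f g} p P → (∀ i → i < p + length P → g i ≡ f i) → Segment f p P → Segment g p P
  segment-cong p []      same _        = tt
  segment-cong p (e ∷ P) same (f≡ , S) = trans (same p (m<m+n p (s≤s z≤n))) f≡ ,
    segment-cong (suc p) P (λ i i< → same i (subst (i <_) (sym (+-suc p (length P))) i<)) S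

  segment-list : ∀ {f} p P → Segment f p P → applyUpTo (λ i → f (p + i)) (length P) ≡ map toℕ P
  segment-list p []      _        = refl
  segment-list {f} p (e ∷ P) (f≡ , S) = cong₂ _∷_ (trans (cong f (+-identityʳ p)) f≡)
    (trans (applyUpTo-cong (length P) (λ i → cong f (+-suc p i))) (segment-list (suc p) P S))
    where
    applyUpTo-cong : ∀ {g h : ℕ → ℕ} k → (∀ i → g i ≡ h i) → applyUpTo g k ≡ applyUpTo h k
    applyUpTo-cong zero    eq = refl
    applyUpTo-cong (suc k) eq = cong₂ _∷_ (eq 0) (applyUpTo-cong k (λ i → eq (suc i)))

  module Following (w : E → ℕ) (w-positive : ∀ e → 1 ≤ w e) where
    open PathTable N w w-positive

    Copied-out : Store → ℕ → List E → Store → Set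
    Copied-out σ p P τ = Segment (nats τ 6) p P × nats τ aPos 0 ≡ p + length P × (∀ i → i < p → nats τ 6 i ≡ nats σ 6 i)

    followᵉ : ∀ P {σ p x} → nats σ aPos 0 ≡ p → nats σ aPtr 0 ≡ x → Follows (cells σ) x P →
      Exec (ticked follow) σ (length P * 5 + 1) (Copied-out σ p P)
    followᵉ [] {σ} {p} pos ptr (stop d≡0) =
      exit (≤⇒<ᵇ-false (≤-reflexive (trans (cong (nats σ aG) ptr) d≡0))) (tt , trans pos (sym (+-identityʳ p)) , λ _ _ → refl)
    followᵉ (e ∷ P) {σ} {p} {x} pos ptr (go 0<d first≡ F) =
      unroll (<⇒<ᵇ-true (subst (0 <_) (cong (nats σ aG) (sym ptr)) 0<d))
        (straight (tick ⨾ followStep) {ok = refl}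
          (weaken ≤-refl (λ υ _ → extend υ)
            (followᵉ P {τ} {suc p} {next (cells σ) x}
              (trans (cong (_+ 1) pos) (+-comm p 1)) (cong (nats σ aX) ptr) (transport F))))
      where
      τ = result (tick ⨾ followStep) σ
      transport : ∀ {x P} → Follows (cells σ) x P → Follows (cells τ) x P
      transport (stop d≡0)       = stop d≡0
      transport (go 0<d first≡ F) = go 0<d first≡ (transport F)
      extend : ∀ υ → Copied-out τ (suc p) P υ → Copied-out σ p (e ∷ P) υ
      extend υ (S , pos′ , below) =
        ( trans (below p ≤-refl) (trans (cong (nats τ 6) (sym pos)) (trans (update-same (nats σ) 6 (nats σ aPos 0) _) (trans (cong (nats σ aF) ptr) first≡))) , S )
        , trans pos′ (sym (+-suc p (length P)))
        , λ i i<p → trans (below i (m<n⇒m<1+n i<p)) (update-index (nats σ) 6 (nats σ aPos 0) _ 6 (λ eq → <-irrefl (trans eq pos) i<p))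

  -- Loops over the path stored from position start(count) on

  forPathᵉ : ∀ body {σ₀ c} p P (Inv : List E → Store → Set) →
    {keeps : writesⁿ aI (ticked body) ∨ (writesⁿ aPos (ticked (forPath body)) ∨ writesⁿ 6 (ticked (forPath body))) ≡ false} →
    nats σ₀ 5 (nats σ₀ 4 0) ≡ p → nats σ₀ aPos 0 ≡ p + length P → Segment (nats σ₀ 6) p P →
    Inv P σ₀ →
    (∀ {P i w σ} → i ≡ aI ⊎ i ≡ aEdge ⊎ i ≡ clock → Inv P σ → Inv P (setⁿ i w σ)) →
    (∀ e P σ → Frame (ticked (forPath body)) σ₀ σ → nats σ aEdge 0 ≡ toℕ e → Inv (e ∷ P) σ → Exec (ticked body) σ c (Inv P)) →
    Exec (ticked (forPath body)) σ₀ (1 + (length P * (4 + c) + 1)) (Inv [])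
  forPathᵉ body {σ₀} {c} p P Inv {keeps} start≡ pos≡ segment init stable step =
    first then λ τ f (i≡ , inv) →
      loop P τ p (whole f) i≡ pos≡ segment inv
    where
    Whole = ticked (forPath body)
    Loop = ticked (while (var aI <ⁿ var aPos) (aEdge [ lit 0 ]≔ⁿ 6 [ var aI ]ⁿ ⨾ body ⨾ aI [ lit 0 ]≔ⁿ var aI ⊕ lit 1))
    keep-aI = proj₁ (∨-false {writesⁿ aI (ticked body)} keeps)
    keep-aPos = proj₁ (∨-false {writesⁿ aPos Whole} (proj₂ (∨-false {writesⁿ aI (ticked body)} keeps)))
    keep-6 = proj₂ (∨-false {writesⁿ aPos Whole} (proj₂ (∨-false {writesⁿ aI (ticked body)} keeps)))
    first : Exec (aI [ lit 0 ]≔ⁿ 5 [ 4 [ lit 0 ]ⁿ ]ⁿ) σ₀ 1 (λ τ → nats τ aI 0 ≡ p × Inv P τ)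
    first = exec assignⁿ ≤-refl (start≡ , stable (inj₁ refl) init)
    whole : ∀ {τ} → Frame (aI [ lit 0 ]≔ⁿ 5 [ 4 [ lit 0 ]ⁿ ]ⁿ) σ₀ τ → Frame Whole σ₀ τ
    whole (frame fn fr) = frame (λ a w x → fn a (proj₁ (∨-false {a ≡ᵇ aI} w)) x) (λ a w x → fr a refl x)
    small : ∀ {σ τ} → Frame (tick ⨾ aEdge [ lit 0 ]≔ⁿ 6 [ var aI ]ⁿ) σ τ → Frame Whole σ τ
    small (frame fn fr) = frame (λ a w x → fn a (shrink a w) x) (λ a w x → fr a refl x)
      where
      shrink : ∀ a → writesⁿ a Whole ≡ false → (a ≡ᵇ clock) ∨ (a ≡ᵇ aEdge) ≡ false
      shrink a w with ∨-false {a ≡ᵇ clock} (proj₂ (∨-false {a ≡ᵇ aI} w))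
      ... | u , v rewrite u = proj₁ (∨-false {a ≡ᵇ aEdge} v)
    body-frame : ∀ {σ τ} → Frame (ticked body) σ τ → Frame Whole σ τ
    body-frame (frame fn fr) = frame (λ a w x → fn a (shrink a w) x) (λ a w x → fr a (proj₁ (∨-false {writesʳ a (ticked body)} w)) x)
      where
      shrink : ∀ a → writesⁿ a Whole ≡ false → writesⁿ a (ticked body) ≡ false
      shrink a w = proj₁ (∨-false {writesⁿ a (ticked body)} (proj₂ (∨-false {a ≡ᵇ aEdge}
        (proj₂ (∨-false {a ≡ᵇ clock} (proj₂ (∨-false {a ≡ᵇ aI} w)))))))
    step-frame : ∀ {σ τ} → Frame (aI [ lit 0 ]≔ⁿ var aI ⊕ lit 1) σ τ → Frame Whole σ τ
    step-frame (frame fn fr) = frame (λ a w x → fn a (proj₁ (∨-false {a ≡ᵇ aI} w)) x) (λ a w x → fr a refl x)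
    loop : ∀ P σ p → Frame Whole σ₀ σ → nats σ aI 0 ≡ p → nats σ₀ aPos 0 ≡ p + length P → Segment (nats σ₀ 6) p P → Inv P σ →
      Exec Loop σ (length P * (4 + c) + 1) (Inv [])
    loop [] σ p f i≡ pos≡ _ inv = exit
      (≤⇒<ᵇ-false (≤-reflexive (trans (keepⁿ f aPos keep-aPos 0) (trans pos≡ (trans (+-identityʳ p) (sym i≡)))))) inv
    loop (e ∷ P) σ p f i≡ pos≡ (e≡ , segment) inv = slower (≤-reflexive time-eq) (unroll {c = 2 + (c + 1)}
      (<⇒<ᵇ-true (subst₂ _<_ (sym i≡) (sym (trans (keepⁿ f aPos keep-aPos 0) pos≡)) (m<m+n p (s≤s z≤n))))
      (tick-exec then λ { τ g refl → edge-exec then λ { υ h refl → run-body (small (run-frame (seq (runs tick-exec) (runs edge-exec)))) } }))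
      where
      σ₁ = setⁿ clock (nats σ clock 0 + 1) σ
      σ₂ = setⁿ aEdge (nats σ 6 (nats σ aI 0)) σ₁
      time-eq : suc (2 + (c + 1) + (length P * (4 + c) + 1)) ≡ (4 + c) + length P * (4 + c) + 1
      time-eq = trans (cong (λ z → suc (2 + z + (length P * (4 + c) + 1))) (+-comm c 1)) (sym (+-assoc (4 + c) _ 1))
      tick-exec : Exec tick σ 1 (_≡ σ₁)
      tick-exec = exec assignⁿ ≤-refl refl
      edge-exec : Exec (aEdge [ lit 0 ]≔ⁿ 6 [ var aI ]ⁿ) σ₁ 1 (_≡ σ₂)
      edge-exec = exec assignⁿ ≤-refl refl
      run-body : Frame Whole σ σ₂ →
        Exec (ticked body ⨾ aI [ lit 0 ]≔ⁿ var aI ⊕ lit 1) σ₂ (c + 1) (λ τ → Exec Loop τ (length P * (4 + c) + 1) (Inv []))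
      run-body g = step e P σ₂ f₂ (trans (cong (nats σ 6) i≡) (trans (keepⁿ f 6 keep-6 p) e≡))
          (stable (inj₂ (inj₁ refl)) (stable (inj₂ (inj₂ refl)) inv))
        then λ υ h inv′ → straight (aI [ lit 0 ]≔ⁿ var aI ⊕ lit 1) {ok = refl}
          (loop P _ (suc p)
            (frame-trans (frame-trans f₂ (body-frame h)) (step-frame (run-frame assignⁿ)))
            (trans (cong (_+ 1) (trans (keepⁿ h aI keep-aI 0) i≡)) (+-comm p 1))
            (trans pos≡ (+-suc p (length P))) segment (stable (inj₁ refl) inv′))
        where f₂ = frame-trans f g

module PathSearch {R : RealNumbers} (N : Network R) (ε : RealNumbers.ℝ R) where
  open Programs
  open import Data.Nat using (ℕ; suc; _+_; _*_; _≤_; _<_; z≤n; s≤s; _<?_)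
  open import Data.Nat.Properties
  open Hoare R
  open Machine N ε
  open FlowTheory N using (bounded; length<n)
  open ShortestPath N ε
  open PathLoop N ε
  open Network N
  open Flows N

  record PathStored (p : ℕ) (P : List E) (σ : Store) : Set where
    field
      start≡  : nats σ 5 (nats σ 4 0) ≡ p
      pos≡    : nats σ aPos 0 ≡ p + length P
      segment : Segment (nats σ 6) p P

  searchTime : ℕ → ℕ → ℕ
  searchTime K c = fillTime K + suc ((1 + (1 + (n * 5 + 1))) + c)

  module Searching (w : E → ℕ) (w-positive : ∀ e → 1 ≤ w e) where
    open PathTable N w w-positive
    open Filling w w-positive using (Weights; fillTableᵉ; Offsets) public
    open Following w w-positive

    touched-endpoints : ∀ {u P} → IsWalk u t P → 1 ≤ length P → Touched u × Touched t
    touched-endpoints {P = e ∷ []}    (refl , refl) _ = (e , inj₁ refl) , (e , inj₂ refl)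
    touched-endpoints {P = e ∷ f ∷ P} (refl , walk) _ = (e , inj₁ refl) , proj₂ (touched-endpoints walk (s≤s z≤n))

    searchᵉ : ∀ {found notFound σ K c} {Q : Store → Set} → 𝒫 → Input σ → Weights σ → nats σ aK 0 ≡ K →
      (∀ P τ → weight (edges P) ≤ K → Frame prefix σ τ → PathStored (nats σ 5 (nats σ 4 0)) (edges P) τ →
        (∀ i → i < nats σ 5 (nats σ 4 0) → nats τ 6 i ≡ nats σ 6 i) → Exec (ticked found) τ c Q) →
      (∀ τ → Frame (ticked fillTable) σ τ → (∀ P → K < weight (edges P)) → Exec (ticked notFound) τ c Q) →
      Exec (ticked (search found notFound)) σ (searchTime K c) Q
    searchᵉ {found} {notFound} {σ} {K} {c} {Q} P₀ I W K≡ onFound onNotFound =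
      fillTableᵉ I W K≡ (proj₂ endpoints) then λ τ f (B≡ , T) →
        ifᵉ (λ eq → found-branch f B≡ T (≤-pred (subst₂ _<_ (dist≡ f B≡) (L+1 f) (<ᵇ-true eq))))
            (λ eq → slower (m≤n+m c _) (onNotFound τ f
              (λ P → too-far f B≡ T P (subst₂ _≤_ (L+1 f) (dist≡ f B≡) (<ᵇ-false eq)))))
      where
      endpoints : Touched s × Touched t
      endpoints with edges P₀ | bounded P₀
      ... | []    | (s≡t , _) , _ = contradiction s≡t s≢t
      ... | e ∷ P | (walk , _) , _ = touched-endpoints {P = e ∷ P} walk (s≤s z≤n)
      module _ {τ} (f : Frame (ticked fillTable) σ τ) where
        Iτ = input-kept refl f I
        L+1 : nats τ 0 4 + 1 ≡ suc L
        L+1 = trans (cong (_+ 1) (Input.L≡ Iτ)) (+-comm L 1)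
        K≡′ = trans (keepⁿ f aK refl 0) K≡
        module _ (B≡ : Offsets K (nats τ aB)) where
          pointer≡ : nats τ aB (nats τ aK 0) + nats τ 0 2 ≡ ix K s
          pointer≡ = cong₂ _+_ (trans (cong (nats τ aB) K≡′) (B≡ K ≤-refl)) (Input.s≡ Iτ)
          dist≡ : nats τ aG (nats τ aB (nats τ aK 0) + nats τ 0 2) ≡ dist (cells τ) (ix K s)
          dist≡ = cong (nats τ aG) pointer≡
          module _ (T : Table (cells τ) K) where
            too-far : ∀ P → L < dist (cells τ) (ix K s) → K < weight (edges P)
            too-far P L< with K <? weight (edges P)
            ... | yes K< = K<
            ... | no K≮ = contradiction (≤-trans (dist-≤ (cells τ) T (edges P) ≤-refl (proj₁ (proj₁ (bounded P))) (≮⇒≥ K≮)) (proj₂ (bounded P)))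
                            (<⇒≱ L<)
            found-branch : dist (cells τ) (ix K s) ≤ L → Exec (ticked (writePath ⨾ found)) τ ((1 + (1 + (n * 5 + 1))) + c) Q
            found-branch d≤L with extract (cells τ) T (suc K) K s ≤-refl ≤-refl (proj₁ endpoints) d≤L
            ... | Ps , X = write-path then λ υ g (stored , below) →
                onFound P υ (Extracted.weight≤ X) (frame-seq f g) stored (λ i i< → trans (below i (subst (i <_) (sym start≡τ) i<)) (keepⁿ f 6 refl i))
              where
              P : 𝒫
              P = Ps , [ ((Extracted.walk X , Extracted.unique X) , ≤-trans (≤-reflexive (Extracted.length≡ X)) d≤L) ]
              p = nats τ 5 (nats τ 4 0)
              start≡τ : p ≡ nats σ 5 (nats σ 4 0)
              start≡τ = trans (keepⁿ f 5 refl _) (cong (nats σ 5) (keepⁿ f 4 refl 0))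
              frame-seq : ∀ {υ} → Frame (ticked fillTable) σ τ → Frame (ticked writePath) τ υ → Frame prefix σ υ
              frame-seq (frame fn fr) (frame gn gr) = frame
                (λ a w i → trans (gn a (proj₂ (∨-false {writesⁿ a (ticked fillTable)} w)) i) (fn a (proj₁ (∨-false {writesⁿ a (ticked fillTable)} w)) i))
                (λ a w i → trans (gr a (proj₂ (∨-false {writesʳ a (ticked fillTable)} w)) i) (fr a (proj₁ (∨-false {writesʳ a (ticked fillTable)} w)) i))
              write-path : Exec (ticked writePath) τ (1 + (1 + (n * 5 + 1)))
                (λ υ → PathStored (nats σ 5 (nats σ 4 0)) Ps υ × (∀ i → i < p → nats υ 6 i ≡ nats τ 6 i))
              write-path = set-pos then λ { _ _ refl → set-ptr then λ { _ _ refl → weaken (+-monoˡ-≤ 1 (*-monoˡ-≤ 5 (<⇒≤ (length<n P)))) done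
                  (followᵉ Ps refl (trans pointer≡ refl) (Extracted.follows X)) } }
                where
                σ₁ = store (update (nats τ) aPos 0 p) (reals τ)
                σ₂ = store (update (nats σ₁) aPtr 0 (nats τ aB (nats τ aK 0) + nats τ 0 2)) (reals τ)
                set-pos : Exec (aPos [ lit 0 ]≔ⁿ 5 [ 4 [ lit 0 ]ⁿ ]ⁿ) τ 1 (_≡ σ₁)
                set-pos = exec assignⁿ ≤-refl refl
                set-ptr : Exec (aPtr [ lit 0 ]≔ⁿ aB [ var aK ]ⁿ ⊕ input-s) σ₁ 1 (_≡ σ₂)
                set-ptr = exec assignⁿ ≤-refl refl
                done : ∀ υ → Frame (ticked follow) σ₂ υ → Copied-out σ₂ p Ps υ →
                  PathStored (nats σ 5 (nats σ 4 0)) Ps υ × (∀ i → i < p → nats υ 6 i ≡ nats τ 6 i)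
                done υ h (S , pos≡ , below) = record
                  { start≡ = trans (trans (keepⁿ h 5 refl _) (cong (nats τ 5) (keepⁿ h 4 refl 0))) start≡τ
                  ; pos≡ = trans pos≡ (cong (_+ length Ps) start≡τ)
                  ; segment = subst (λ p → Segment (nats υ 6) p Ps) start≡τ S } , below

module Output {R : RealNumbers} (N : Network R) (ε : RealNumbers.ℝ R) where
  open Programs
  open import Data.Nat as ℕ using (ℕ; suc; z≤n; s≤s)
  import Data.Nat.Properties as ℕ
  open RealArithmetic R
  open Sums R
  open Hoare R
  open FlowTheory N
  open PathLoop N ε using (Segment; segment-cong; segment-list)
  open Network N
  open Flows N
  open InputOutput N using (Outputs; entryPath; entryAmount; edgeNumbers; entryCount)

  Stored : Store → Entries → Set
  Stored σ []             = nats σ 5 0 ≡ 0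
  Stored σ ((P , a) ∷ es) =
    nats σ 5 (suc (length es)) ≡ nats σ 5 (length es) ℕ.+ length (edges P) ×
    Segment (nats σ 6) (nats σ 5 (length es)) (edges P) ×
    reals σ 2 (length es) ≈ a ×
    Stored σ es

  stored-transport : ∀ {σ τ} es → (∀ j → j ℕ.≤ length es → nats τ 5 j ≡ nats σ 5 j) →
    (∀ i → i ℕ.< nats σ 5 (length es) → nats τ 6 i ≡ nats σ 6 i) →
    (∀ j → j ℕ.< length es → reals τ 2 j ≡ reals σ 2 j) → Stored σ es → Stored τ es
  stored-transport [] start cell amount start₀ = trans (start 0 z≤n) start₀
  stored-transport {σ} {τ} ((P , a) ∷ es) start cell amount (next , segment , a≈ , stored) =
    trans (start _ ℕ.≤-refl) (trans next (cong (ℕ._+ length (edges P)) (sym here≡))) ,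
    subst (λ p → Segment (nats τ 6) p (edges P)) (sym here≡)
      (segment-cong _ (edges P) (λ i i< → cell i (subst (i ℕ.<_) (sym next) i<)) segment) ,
    ≈-trans (≈-reflexive (amount _ ℕ.≤-refl)) a≈ ,
    stored-transport es (λ j j≤ → start j (ℕ.m≤n⇒m≤1+n j≤))
      (λ i i< → cell i (ℕ.<-≤-trans i< (subst (nats σ 5 (length es) ℕ.≤_) (sym next) (ℕ.m≤m+n _ _))))
      (λ j j< → amount j (ℕ.m<n⇒m<1+n j<)) stored
    where
    here≡ : nats τ 5 (length es) ≡ nats σ 5 (length es)
    here≡ = start _ (ℕ.n≤1+n _)

  entryPath-stored : ∀ {σ P a} es → Stored σ ((P , a) ∷ es) → entryPath σ (length es) ≡ edgeNumbers P
  entryPath-stored {σ} {P} es (next , segment , _) = trans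
    (cong (applyUpTo (λ i → nats σ 6 (nats σ 5 (length es) ℕ.+ i)))
      (trans (cong (ℕ._∸ nats σ 5 (length es)) next) (ℕ.m+n∸m≡n (nats σ 5 (length es)) (length (edges P)))))
    (segment-list _ (edges P) segment)

  edgeNumbers-injective : ∀ {P Q} → edgeNumbers P ≡ edgeNumbers Q → P ≡ Q
  edgeNumbers-injective {P , _} {Q , _} eq with List.map-injective Fin.toℕ-injective eq
  ... | refl = refl

  collected : ∀ {σ} es P → Stored σ es →
    sum (upTo (length es)) (λ j → when (List.≡-dec ℕ._≟_ (entryPath σ j) (edgeNumbers P)) (reals σ 2 j)) ≈ amountOf es P
  collected [] P _ = ≈-refl
  collected {σ} ((Q , a) ∷ es) P S@(_ , _ , a≈ , stored) = ≈-trans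
    (≈-reflexive (cong (λ js → sum js f) (sym (List.applyUpTo-∷ʳ id (length es)))))
    (≈-trans (sum-++ (upTo (length es)) (length es ∷ []) f)
      (≈-trans (+-cong (collected es P stored) (≈-trans (+-identityʳ _) last)) (+-comm _ _)))
    where
    f : ℕ → ℝ
    f j = when (List.≡-dec ℕ._≟_ (entryPath σ j) (edgeNumbers P)) (reals σ 2 j)
    path≡ : entryPath σ (length es) ≡ edgeNumbers Q
    path≡ = entryPath-stored {σ} {Q} es S
    last : f (length es) ≈ when (Q ≟ᴾ P) a
    last = ≈-trans (when-cong (List.≡-dec ℕ._≟_ (entryPath σ (length es)) (edgeNumbers P)) (Q ≟ᴾ P)
        (λ eq → edgeNumbers-injective (trans (sym path≡) eq)) (λ { refl → path≡ }))
      (when-value (Q ≟ᴾ P) (λ _ → a≈))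

  listed : ∀ {σ} es → Stored σ es → ∀ j → j ℕ.< length es → ∃[ P ] entryPath σ j ≡ edgeNumbers P
  listed {σ} ((Q , a) ∷ es) S@(_ , _ , _ , stored) j j< with j ℕ.≟ length es
  ... | yes refl = Q , entryPath-stored {σ} {Q} es S
  ... | no j≢ = listed es stored j (ℕ.≤∧≢⇒< (ℕ.≤-pred j<) j≢)

  stored-nonNeg : ∀ {σ} es → Stored σ es → AmountsNonNegative es → ∀ j → j ℕ.< length es → 0# ≤ reals σ 2 j
  stored-nonNeg ((Q , a) ∷ es) (_ , _ , a≈ , stored) (0≤a ∷ 0≤es) j j< with j ℕ.≟ length es
  ... | yes refl = ≤-respʳ (≈-sym a≈) 0≤a
  ... | no j≢ = stored-nonNeg es stored 0≤es j (ℕ.≤∧≢⇒< (ℕ.≤-pred j<) j≢)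

  record Solution (σ : Store) : Set where
    field
      entries     : Entries
      stored      : Stored σ entries
      counted     : nats σ 4 0 ≡ length entries
      amounts≥0   : AmountsNonNegative entries
      feasible    : ∀ e → load entries e ≤ c e

  module _ {σ} (X : Solution σ) where
    open Solution X

    outputFlow : Flow
    outputFlow = record { amount = amountOf entries ; nonNegative = λ P → sum-nonNeg entries
      (λ (Q , a) Qa∈ → when-nonNeg (Q ≟ᴾ P) (All.lookup amounts≥0 Qa∈)) }

    outputs : Outputs σ outputFlow
    outputs = (λ j j< → listed entries stored j (subst (j ℕ.<_) counted j<)) ,
      λ P → ≈-trans (≈-sym (collected entries P stored))
        (≈-trans (≈-reflexive (cong (λ k → sum (upTo k) _) (sym counted)))
          (≈-sym (sum-filter (λ j → List.≡-dec ℕ._≟_ (entryPath σ j) (edgeNumbers P)) (upTo (entryCount σ)) (entryAmount σ))))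

    outputs-feasible : Feasible outputFlow
    outputs-feasible e = ≤-respˡ (≈-sym (load-correct {outputFlow} {entries} (λ _ → ≈-refl) e)) (feasible e)

    outputs-value : flowValue outputFlow ≈ total entries
    outputs-value = total-correct {outputFlow} {entries} (λ _ → ≈-refl)

  addEntry-stored : ∀ {σ es P a} amount → nats σ 4 0 ≡ length es → Stored σ es →
    nats σ 18 0 ≡ nats σ 5 (length es) ℕ.+ length (edges P) → Segment (nats σ 6) (nats σ 5 (length es)) (edges P) →
    evalʳ σ amount ≈ a →
    let τ = result (addEntry amount) σ in Stored τ ((P , a) ∷ es) × nats τ 4 0 ≡ suc (length es)
  addEntry-stored {σ} {es} {P} {a} amount count stored pos segment a≈ =
    ( trans (cong (update (nats σ) 5 (nats σ 4 0 ℕ.+ 1) (nats σ 18 0) 5) (sym next≡))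
        (trans (update-same (nats σ) 5 (nats σ 4 0 ℕ.+ 1) (nats σ 18 0)) (trans pos (cong (ℕ._+ length (edges P)) (sym here≡))))
    , subst (λ p → Segment (nats τ 6) p (edges P)) (sym here≡) segment
    , ≈-trans (≈-reflexive (trans (cong (update (reals σ) 2 (nats σ 4 0) (evalʳ σ amount) 2) (sym count))
        (update-same (reals σ) 2 (nats σ 4 0) (evalʳ σ amount)))) a≈
    , stored-transport {σ} {τ} es (λ j j≤ → starts j j≤) (λ _ _ → refl)
        (λ j j< → update-index (reals σ) 2 (nats σ 4 0) (evalʳ σ amount) 2 (λ eq → ℕ.<-irrefl (trans eq count) j<)) stored )
    , next≡
    where
    τ = result (addEntry amount) σ
    next≡ : nats σ 4 0 ℕ.+ 1 ≡ suc (length es)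
    next≡ = trans (cong (ℕ._+ 1) count) (ℕ.+-comm (length es) 1)
    starts : ∀ j → j ℕ.≤ length es → nats τ 5 j ≡ nats σ 5 j
    starts j j≤ = update-index (nats σ) 5 (nats σ 4 0 ℕ.+ 1) (nats σ 18 0) 5
      (λ eq → ℕ.<-irrefl (trans eq next≡) (s≤s j≤))
    here≡ : nats τ 5 (length es) ≡ nats σ 5 (length es)
    here≡ = starts (length es) ℕ.≤-refl

module GargKonemann {R : RealNumbers} (N : Network R) (ε : RealNumbers.ℝ R) where
  open Programs
  open import Data.Nat as ℕ using (ℕ; zero; suc; z≤n; s≤s; _<ᵇ_)
  import Data.Nat.Properties as ℕ
  open RealArithmetic R
  open Hoare R
  open FlowTheory N
  open Machine N ε
  open ShortestPath N ε
  open PathLoop N ε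
  open PathSearch N ε
  open Output N ε
  open Potential N
  open Network N
  open Flows N

  routeTime : ℕ
  routeTime = 1 ℕ.+ ((1 ℕ.+ (n ℕ.* (4 ℕ.+ 2) ℕ.+ 1)) ℕ.+ ((1 ℕ.+ (n ℕ.* (4 ℕ.+ 5) ℕ.+ 1)) ℕ.+ 3))

  module Approximating (q : ℕ) (1≤q : 1 ℕ.≤ q) (log : ℕ) (L<2^log : L ℕ.< 2 ℕ.^ log) where
    open Iteration N q 1≤q log L<2^log

    record Constants (σ : Store) : Set where
      field
        q≡  : nats σ aQ 0 ≡ q
        ql≡ : nats σ aQL 0 ≡ ql
        r≡  : nats σ aR 0 ≡ phases
        K≡  : nats σ aK 0 ≡ weightBound

    writesConstants : Program → Bool
    writesConstants p = (writesⁿ aQ p ∨ writesⁿ aQL p) ∨ (writesⁿ aR p ∨ writesⁿ aK p)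

    constants-kept : ∀ {p σ τ} → writesConstants p ≡ false → Frame p σ τ → Constants σ → Constants τ
    constants-kept {p} w f K = record
      { q≡ = trans (keepⁿ f aQ (proj₁ w₁) 0) q≡ ; ql≡ = trans (keepⁿ f aQL (proj₂ w₁) 0) ql≡
      ; r≡ = trans (keepⁿ f aR (proj₁ w₂) 0) r≡ ; K≡ = trans (keepⁿ f aK (proj₂ w₂) 0) K≡ }
      where
      open Constants K
      w₁ = ∨-false {writesⁿ aQ p} (proj₁ (∨-false {writesⁿ aQ p ∨ writesⁿ aQL p} w))
      w₂ = ∨-false {writesⁿ aR p} (proj₂ (∨-false {writesⁿ aQ p ∨ writesⁿ aQL p} w))

    record Holds (G : Ghost) (σ : Store) : Set where
      open Ghost G
      field
        level≡  : nats σ aLevel 0 ≡ level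
        raises≡ : ∀ e → nats σ aRaises (toℕ e) ≡ raises e
        y≡      : ∀ e → reals σ aY (toℕ e) ≡ y e
        used≡   : ∀ e → reals σ aUsed (toℕ e) ≡ used e
        α≡      : reals σ aα 0 ≡ α
        stored  : Stored σ entries
        counted : nats σ 4 0 ≡ length entries

    RoundedBelow : Ghost → ℕ → (ℕ → ℕ) → Set
    RoundedBelow G j W = ∀ e → toℕ e ℕ.< j → Rounds (Ghost.α G) (Ghost.y G e) (W (toℕ e))

    roundTime : ℕ
    roundTime = 1 ℕ.+ suc (weightBound ℕ.* 3)

    roundᵉ : ∀ {G σ} e → Good G → Input σ → Constants σ → Holds G σ → nats σ aEdge 0 ≡ toℕ e →
      RoundedBelow G (toℕ e) (nats σ aW) → Exec (ticked round) σ roundTime (λ τ → RoundedBelow G (suc (toℕ e)) (nats τ aW))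
    roundᵉ {G} {σ} e g I C H idx below = first then λ τ f (w≡1 , others) →
      weaken ℕ.≤-refl (λ υ h done → done)
        (whileᵉ {c = 2} Inv (iterate τ f)
          weightBound (1 , refl , trans (cong (nats τ aW) (sym idx′)) w≡1 , ℕ.≤-refl ,
            ≤-respʳ (+-comm _ _) (≤-respˡ (solve 1 (λ a → a := (:# 1 :+ :# 0) :* a) ≈-refl α) (x≤x+y ynq≥0)) , others))
      where
      open Ghost G
      open Input I
      module H = Holds H
      module C = Constants C
      idx′ : nats σ aEdge 0 ≡ toℕ e
      idx′ = idx
      ynq = y e * fromℕ n * qʳ
      ynq≥0 : 0# ≤ ynq
      ynq≥0 = *-nonNeg (*-nonNeg (≤-trans 0≤1 (y≥1 g e)) (fromℕ-nonNeg n)) (proj₁ 0<qʳ)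
      Others : Store → Set
      Others τ = ∀ x → x ≢ toℕ e → nats τ aW x ≡ nats σ aW x
      Inv : ℕ → Store → Set
      Inv k τ = ∃[ w ] w ℕ.+ k ≡ suc weightBound × nats τ aW (toℕ e) ≡ w × 1 ℕ.≤ w × fromℕ w * α ≤ ynq + α × Others τ
      first : Exec (aW [ var aEdge ]≔ⁿ lit 1) σ 1 (λ τ → nats τ aW (nats σ aEdge 0) ≡ 1 × Others τ)
      first = exec assignⁿ ℕ.≤-refl (update-same (nats σ) aW (nats σ aEdge 0) 1 ,
        λ x x≢ → update-index (nats σ) aW (nats σ aEdge 0) 1 aW (λ eq → x≢ (trans eq idx)))
      module _ (τ : Store) (f : Frame (aW [ var aEdge ]≔ⁿ lit 1) σ τ) where
        Loop = ticked (while ((currentW <ⁿ var aK ⊕ lit 1) and notᶜ (aY [ var aEdge ]ʳ *ʳ int input-n *ʳ int (var aQ) ≤ʳ int currentW *ʳ varʳ aα)) roundStep)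
        condition = (currentW <ⁿ var aK ⊕ lit 1) and notᶜ (aY [ var aEdge ]ʳ *ʳ int input-n *ʳ int (var aQ) ≤ʳ int currentW *ʳ varʳ aα)
        module _ {υ} (h : Frame Loop τ υ) where
          edge≡ : nats υ aEdge 0 ≡ toℕ e
          edge≡ = trans (keepⁿ h aEdge refl 0) (trans (keepⁿ f aEdge refl 0) idx)
          bound≡ : evalⁿ υ (var aK ⊕ lit 1) ≡ suc weightBound
          bound≡ = trans (cong (ℕ._+ 1) (trans (keepⁿ h aK refl 0) (trans (keepⁿ f aK refl 0) C.K≡))) (ℕ.+-comm weightBound 1)
          lhs≡ : evalʳ υ (aY [ var aEdge ]ʳ *ʳ int input-n *ʳ int (var aQ)) ≡ ynq
          lhs≡ = cong₂ _*_ (cong₂ _*_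
            (trans (cong (reals υ aY) edge≡) (trans (keepʳ h aY refl _) (trans (keepʳ f aY refl _) (H.y≡ e))))
            (cong fromℕ (trans (keepⁿ h 0 refl 0) (trans (keepⁿ f 0 refl 0) n≡))))
            (cong fromℕ (trans (keepⁿ h aQ refl 0) (trans (keepⁿ f aQ refl 0) C.q≡)))
          rhs≡ : ∀ {w} → nats υ aW (toℕ e) ≡ w → evalʳ υ (int currentW *ʳ varʳ aα) ≡ fromℕ w * α
          rhs≡ w≡ = cong₂ _*_ (cong fromℕ (trans (cong (nats υ aW) edge≡) w≡))
            (trans (keepʳ h aα refl 0) (trans (keepʳ f aα refl 0) H.α≡))
        iterate : ∀ k υ → Frame Loop τ υ → Inv k υ →
          (evalᶜ υ condition ≡ false × RoundedBelow G (suc (toℕ e)) (nats υ aW)) ⊎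
          (∃[ j ] k ≡ suc j × evalᶜ υ condition ≡ true × Exec (tick ⨾ roundStep) υ 2 (Inv j))
        iterate k υ h (w , sum , w≡ , 1≤w , up≤ , others) with evalᶜ υ condition in eq
        ... | false = inj₁ (refl , done)
          where
          lower : w ℕ.≤ weightBound → ynq ≤ fromℕ w * α
          lower w≤ = subst₂ _≤_ (lhs≡ h) (rhs≡ h w≡) (does-true (_ ≤? _) (not-false (trans (cong (_∧ evalᶜ υ (notᶜ (aY [ var aEdge ]ʳ *ʳ int input-n *ʳ int (var aQ) ≤ʳ int currentW *ʳ varʳ aα)))
            (sym (<⇒<ᵇ-true (subst₂ ℕ._<_ (sym (trans (cong (nats υ aW) (edge≡ h)) w≡)) (sym (bound≡ h)) (s≤s w≤))))) eq)))
          done : RoundedBelow G (suc (toℕ e)) (nats υ aW)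
          done e′ e′< with e′ Fin.≟ e
          ... | yes refl = subst (Rounds α (y e)) (sym w≡) (record { w≥1 = 1≤w ; upper = up≤ ; lower = lower })
          ... | no e′≢e = subst (Rounds α (y e′)) (sym (others (toℕ e′) (λ eq → e′≢e (Fin.toℕ-injective eq))))
                  (below e′ (ℕ.≤∧≢⇒< (ℕ.≤-pred e′<) (λ eq → e′≢e (Fin.toℕ-injective eq))))
        ... | true with ∧-true {evalᶜ υ (currentW <ⁿ var aK ⊕ lit 1)} eq
        ...   | w< , y> with k
        ...     | zero = contradiction (trans (sym (ℕ.+-identityʳ w)) sum)
                    (ℕ.<⇒≢ (subst₂ ℕ._<_ (trans (cong (nats υ aW) (edge≡ h)) w≡) (bound≡ h) (<ᵇ-true w<)))
        ...     | suc j = inj₂ (j , refl , refl , straight (tick ⨾ roundStep) {ok = refl}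
                    ( suc w , trans (sym (ℕ.+-suc w j)) sum
                    , trans (cong (update (nats υ) aW x v aW) (sym (edge≡ h))) (trans (update-same (nats υ) aW x v) v≡)
                    , s≤s z≤n
                    , ≤-respˡ (≈-trans (+-comm _ _) (solve 2 (λ w a → a :+ w :* a := (:# 1 :+ w) :* a) ≈-refl (fromℕ w) α)) (+-mono-≤ not-yet ≤-refl)
                    , λ x′ x′≢ → trans (update-index (nats υ) aW x v aW (λ eq → x′≢ (trans eq (edge≡ h)))) (others x′ x′≢)))
          where
          x = nats υ aEdge 0
          v = nats υ aW x ℕ.+ 1
          v≡ : v ≡ suc w
          v≡ = trans (cong (ℕ._+ 1) (trans (cong (nats υ aW) (edge≡ h)) w≡)) (ℕ.+-comm w 1)
          not-yet : fromℕ w * α ≤ ynq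
          not-yet = ≰⇒≥ (λ le → does-false (_ ≤? _) (not-true y>) (subst₂ _≤_ (sym (lhs≡ h)) (sym (rhs≡ h w≡)) le))

    writesState : Program → Bool
    writesState p = ((writesⁿ aLevel p ∨ writesⁿ aRaises p) ∨ (writesⁿ 5 p ∨ writesⁿ 4 p)) ∨
                    ((writesʳ aY p ∨ writesʳ aUsed p) ∨ (writesʳ aα p ∨ writesʳ 2 p))

    holds-kept : ∀ {p G σ τ} → writesState p ≡ false → Frame p σ τ →
      (∀ i → i ℕ.< nats σ 5 (nats σ 4 0) → nats τ 6 i ≡ nats σ 6 i) → Holds G σ → Holds G τ
    holds-kept {p} {G} {σ} {τ} w f cell H = record
      { level≡ = trans (keepⁿ f aLevel (proj₁ wa) 0) level≡
      ; raises≡ = λ e → trans (keepⁿ f aRaises (proj₂ wa) _) (raises≡ e)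
      ; y≡ = λ e → trans (keepʳ f aY (proj₁ wc) _) (y≡ e)
      ; used≡ = λ e → trans (keepʳ f aUsed (proj₂ wc) _) (used≡ e)
      ; α≡ = trans (keepʳ f aα (proj₁ wd) 0) α≡
      ; stored = stored-transport {σ} {τ} (Ghost.entries G) (λ j _ → keepⁿ f 5 (proj₁ wb) j)
          (λ i i< → cell i (subst (λ k → i ℕ.< nats σ 5 k) (sym counted) i<)) (λ j _ → keepʳ f 2 (proj₂ wd) j) stored
      ; counted = trans (keepⁿ f 4 (proj₂ wb) 0) counted }
      where
      open Holds H
      wn = ∨-false {writesⁿ aLevel p ∨ writesⁿ aRaises p} (proj₁ (∨-false {(writesⁿ aLevel p ∨ writesⁿ aRaises p) ∨ (writesⁿ 5 p ∨ writesⁿ 4 p)} w))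
      wr = ∨-false {writesʳ aY p ∨ writesʳ aUsed p} (proj₂ (∨-false {(writesⁿ aLevel p ∨ writesⁿ aRaises p) ∨ (writesⁿ 5 p ∨ writesⁿ 4 p)} w))
      wa = ∨-false {writesⁿ aLevel p} (proj₁ wn)
      wb = ∨-false {writesⁿ 5 p} (proj₂ wn)
      wc = ∨-false {writesʳ aY p} (proj₁ wr)
      wd = ∨-false {writesʳ aα p} (proj₂ wr)

    weightsTime : ℕ
    weightsTime = 2 ℕ.+ m ℕ.* (3 ℕ.+ roundTime)

    weightsᵉ : ∀ {G σ} → Good G → Input σ → Constants σ → Holds G σ →
      Exec (ticked weights) σ weightsTime (λ τ → RoundedBelow G m (nats τ aW))
    weightsᵉ {G} {σ} g I C H = forᵉ aEdge input-m round m (λ j τ → RoundedBelow G j (nats τ aW)) {refl}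
      (λ τ f → Input.m≡ (input-kept refl f I)) (λ _ ()) (λ B → B) (λ B → B)
      (λ e τ f idx B → roundᵉ e g (input-kept refl f I) (constants-kept refl f C)
        (holds-kept refl f (λ i _ → keepⁿ f 6 refl i) H) idx B)

    module Routing {G : Ghost} (g : Good G) (P : 𝒫) (p : ℕ) where
      open Ghost G

      headroomOf : E → ℝ
      headroomOf e = c e - used e

      Bottleneck : List E → ℝ → Set
      Bottleneck rest u = (∃[ e ] e ∈ edges P × u ≡ headroomOf e) × (∀ e → e ∈ edges P → e ∉ rest → u ≤ headroomOf e)

      headroom≡ : ∀ {σ x} e → Input σ → Holds G σ → x ≡ toℕ e → reals σ 1 x - reals σ aUsed x ≡ headroomOf e
      headroom≡ {σ} e I H x≡ = cong₂ _-_ (trans (cong (reals σ 1) x≡) (Input.c≡ I e)) (trans (cong (reals σ aUsed) x≡) (Holds.used≡ H e))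

      narrowᵉ : ∀ {σ rest} e → Input σ → Holds G σ → nats σ aEdge 0 ≡ toℕ e → e ∈ edges P → Bottleneck (e ∷ rest) (reals σ aU 0) →
        Exec narrow σ 2 (λ τ → Bottleneck rest (reals τ aU 0))
      narrowᵉ {σ} {rest} e I H idx e∈ ((e₀ , e₀∈ , u≡) , below) = ifᵉ
        (λ eq → straight (aU [ lit 0 ]≔ʳ headroom (var aEdge)) {ok = refl}
          ( (e , e∈ , here≡)
          , λ e′ e′∈ e′∉ → smaller (does-true (_ ≤? _) eq) e′ e′∈ e′∉ ))
        (λ eq → straight skip {ok = refl} ((e₀ , e₀∈ , u≡) , larger (does-false (_ ≤? _) eq)))
        where
        here≡ = headroom≡ {σ} e I H idx
        v = reals σ 1 (nats σ aEdge 0) - reals σ aUsed (nats σ aEdge 0)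
        smaller : v ≤ reals σ aU 0 → ∀ e′ → e′ ∈ edges P → e′ ∉ rest → v ≤ headroomOf e′
        smaller le e′ e′∈ e′∉ with e′ Fin.≟ e
        ... | yes refl = ≤-reflexive (≈-reflexive here≡)
        ... | no e′≢e = ≤-trans le (below e′ e′∈ λ { (here eq) → e′≢e eq ; (there e′∈rest) → e′∉ e′∈rest })
        larger : ¬ (v ≤ reals σ aU 0) → ∀ e′ → e′ ∈ edges P → e′ ∉ rest → reals σ aU 0 ≤ headroomOf e′
        larger v≰ e′ e′∈ e′∉ with e′ Fin.≟ e
        ... | yes refl = ≤-respʳ (≈-reflexive here≡) (≰⇒≥ v≰)
        ... | no e′≢e = below e′ e′∈ λ { (here eq) → e′≢e eq ; (there e′∈rest) → e′∉ e′∈rest }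

      StepAt : ℝ → E → Store → Set
      StepAt u e τ = Step u (c e) (y e) (used e) (raises e) (reals τ aY (toℕ e)) (reals τ aUsed (toℕ e)) (nats τ aRaises (toℕ e))

      SameAt : E → Store → Set
      SameAt e τ = reals τ aY (toℕ e) ≡ y e × reals τ aUsed (toℕ e) ≡ used e × nats τ aRaises (toℕ e) ≡ raises e

      record Sending (u : ℝ) (rest : List E) (τ : Store) : Set where
        field
          unique  : Unique rest
          waiting : ∀ e → e ∈ rest ⊎ e ∉ edges P → SameAt e τ
          sent    : ∀ e → e ∈ edges P → e ∉ rest → StepAt u e τ

      step-partial : ∀ {u e Y U r} → ¬ (c e ≤ used e + u) → Y ≡ y e → U ≡ used e + u → r ≡ raises e →
        Step u (c e) (y e) (used e) (raises e) Y U r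
      step-partial c≰ refl refl refl = partial c≰

      step-full : ∀ {u e Y U r} → c e ≤ used e + u → Y ≡ up (y e) → U ≡ 0# → r ≡ raises e ℕ.+ 1 →
        Step u (c e) (y e) (used e) (raises e) Y U r
      step-full c≤ refl refl refl = full c≤

      sendᵉ : ∀ {u σ rest} e → Input σ → Constants σ → reals σ aU 0 ≡ u → nats σ aEdge 0 ≡ toℕ e → e ∈ edges P →
        Sending u (e ∷ rest) σ → Exec (ticked send) σ 5 (Sending u rest)
      sendᵉ {u} {σ} {rest} e I C u≡ idx e∈ S = add then λ { τ _ refl → ifᵉ
        (λ eq → straight saturate {ok = refl} (finish {result saturate σ₁}
          (λ e′ ≢x → trans (update-index (reals σ₁) aY x _ aY ≢x) refl
                   , trans (update-index (reals (result saturate-y σ₁)) aUsed x 0# aUsed ≢x) (update-index (reals σ) aUsed x v aUsed ≢x)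
                   , update-index (nats σ) aRaises x _ aRaises ≢x)
          (step-full (subst₂ _≤_ c≡ v≡ (does-true (_ ≤? _) eq))
            (trans (cong (update (reals σ₁) aY x new-y aY) (sym idx)) (trans (update-same (reals σ₁) aY x new-y)
              (cong₂ (λ a k → a + a * fromℕ k ⁻¹) (trans (cong (reals σ aY) idx) (proj₁ at-e)) (Constants.q≡ C))))
            (trans (cong (update (reals (result saturate-y σ₁)) aUsed x 0# aUsed) (sym idx)) (update-same (reals (result saturate-y σ₁)) aUsed x 0#))
            (trans (cong (update (nats σ) aRaises x (nats σ aRaises x ℕ.+ 1) aRaises) (sym idx)) (trans (update-same (nats σ) aRaises x _)
              (cong (ℕ._+ 1) (trans (cong (nats σ aRaises) idx) (proj₂ (proj₂ at-e)))))))))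
        (λ eq → slower {c = 1} (s≤s z≤n) (straight skip {ok = refl} (finish {σ₁}
          (λ e′ ≢x → refl , update-index (reals σ) aUsed x v aUsed ≢x , refl)
          (step-partial (λ c≤ → does-false (_ ≤? _) eq (subst₂ _≤_ (sym c≡) (sym v≡) c≤))
            (proj₁ at-e) (trans (cong (update (reals σ) aUsed x v aUsed) (sym idx)) v≡) (proj₂ (proj₂ at-e)))))) }
        where
        open Sending S
        x = nats σ aEdge 0
        v = reals σ aUsed x + reals σ aU 0
        saturate-y = aY [ var aEdge ]≔ʳ aY [ var aEdge ]ʳ +ʳ aY [ var aEdge ]ʳ /ʳ int (var aQ)
        saturate = saturate-y
          ⨾ aUsed [ var aEdge ]≔ʳ int (lit 0)
          ⨾ aRaises [ var aEdge ]≔ⁿ aRaises [ var aEdge ]ⁿ ⊕ lit 1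
        σ₁ = store (nats σ) (update (reals σ) aUsed x v)
        new-y = reals σ aY x + reals σ aY x * fromℕ (nats σ aQ 0) ⁻¹
        at-e : SameAt e σ
        at-e = waiting e (inj₁ (here refl))
        c≡ : reals σ 1 x ≡ c e
        c≡ = trans (cong (reals σ 1) idx) (Input.c≡ I e)
        v≡ : reals σ₁ aUsed x ≡ used e + u
        v≡ = trans (update-same (reals σ) aUsed x v) (cong₂ _+_ (trans (cong (reals σ aUsed) idx) (proj₁ (proj₂ at-e))) u≡)
        add : Exec (aUsed [ var aEdge ]≔ʳ aUsed [ var aEdge ]ʳ +ʳ varʳ aU) σ 1 (_≡ σ₁)
        add = exec assignʳ ℕ.≤-refl refl
        e∉rest : All (e ≢_) rest
        e∉rest with unique
        ... | e∉ ∷ _ = e∉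
        tail-unique : Unique rest
        tail-unique with unique
        ... | _ ∷ u = u
        finish : ∀ {τ} → (∀ e′ → toℕ e′ ≢ x → reals τ aY (toℕ e′) ≡ reals σ aY (toℕ e′) × reals τ aUsed (toℕ e′) ≡ reals σ aUsed (toℕ e′)
            × nats τ aRaises (toℕ e′) ≡ nats σ aRaises (toℕ e′)) → StepAt u e τ → Sending u rest τ
        finish {τ} others at = record { unique = tail-unique ; waiting = waiting′ ; sent = sent′ }
          where
          ≢x : ∀ {e′} → e′ ≢ e → toℕ e′ ≢ x
          ≢x e′≢e eq = e′≢e (Fin.toℕ-injective (trans eq idx))
          waiting′ : ∀ e′ → e′ ∈ rest ⊎ e′ ∉ edges P → SameAt e′ τ
          waiting′ e′ w with others e′ (≢x (apart w)) | waiting e′ (weaker w)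
            where
            apart : e′ ∈ rest ⊎ e′ ∉ edges P → e′ ≢ e
            apart (inj₁ e′∈) refl = All.lookup e∉rest e′∈ refl
            apart (inj₂ e′∉) refl = e′∉ e∈
            weaker : e′ ∈ rest ⊎ e′ ∉ edges P → e′ ∈ e ∷ rest ⊎ e′ ∉ edges P
            weaker (inj₁ e′∈) = inj₁ (there e′∈)
            weaker (inj₂ e′∉) = inj₂ e′∉
          ... | a , b , c | a′ , b′ , c′ = trans a a′ , trans b b′ , trans c c′
          sent′ : ∀ e′ → e′ ∈ edges P → e′ ∉ rest → StepAt u e′ τ
          sent′ e′ e′∈ e′∉ with e′ Fin.≟ e
          ... | yes refl = at
          ... | no e′≢e with others e′ (≢x e′≢e) | sent e′ e′∈ (λ { (here eq) → e′≢e eq ; (there e′∈rest) → e′∉ e′∈rest })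
          ...   | a , b , c | st rewrite a | b | c = st

      Advanced : Store → Set
      Advanced τ = ∃[ G′ ] Good G′ × Holds G′ τ × Ghost.level G′ ≡ level × potentialRaises (Ghost.raises G′) ℕ.< potentialRaises raises

      routeᵉ : ∀ {σ} → Input σ → Constants σ → Holds G σ → level ℕ.< phases →
        qʳ * pathWeight y P ≤ (qʳ + 1#) * α → PathStored p (edges P) σ →
        Exec (ticked route) σ routeTime Advanced
      routeᵉ {σ} I C H level< cheap stored-path′ =
        first then λ τ₁ f₁ bottleneck₁ →
        slower (path-time 2) (forPathᵉ narrow p (e₀ ∷ P₀) (λ rest τ → Bottleneck rest (reals τ aU 0) × (∀ e → e ∈ rest → e ∈ edges P)) {refl}
          (PathStored.start≡ (path-kept refl f₁ stored-path)) (PathStored.pos≡ (path-kept refl f₁ stored-path))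
          (PathStored.segment (path-kept refl f₁ stored-path))
          (bottleneck₁ , λ e e∈ → subst (e ∈_) (sym P≡) e∈)
          (λ { (inj₁ refl) inv → inv ; (inj₂ (inj₁ refl)) inv → inv ; (inj₂ (inj₂ refl)) inv → inv })
          (λ e rest τ f idx (b , inside) → weaken ℕ.≤-refl (λ _ _ b′ → b′ , λ e′ e′∈ → inside e′ (there e′∈))
            (narrowᵉ e (input-kept refl f (input-kept refl f₁ I)) (kept refl f (kept refl f₁ H)) idx (inside e (here refl)) b)))
        then λ τ₂ f₂ ((bottleneck , below) , _) →
        let I₂ = input-kept refl f₂ (input-kept refl f₁ I)
            C₂ = constants-kept refl f₂ (constants-kept refl f₁ C)
            H₂ = kept refl f₂ (kept refl f₁ H)
            u = reals τ₂ aU 0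
            path₂ = path-kept refl f₂ (path-kept refl f₁ stored-path)
        in slower (path-time 5) (forPathᵉ send p (e₀ ∷ P₀) (λ rest τ → Sending u rest τ × (∀ e → e ∈ rest → e ∈ edges P)) {refl}
          (PathStored.start≡ path₂) (PathStored.pos≡ path₂) (PathStored.segment path₂)
          (record { unique = subst Unique P≡ (edges-unique P)
                  ; waiting = λ e _ → Holds.y≡ H₂ e , Holds.used≡ H₂ e , Holds.raises≡ H₂ e
                  ; sent = λ e e∈ e∉ → contradiction (subst (e ∈_) P≡ e∈) e∉ }
            , λ e e∈ → subst (e ∈_) (sym P≡) e∈)
          (λ { (inj₁ refl) (S , i) → record { Sending S } , i ; (inj₂ (inj₁ refl)) (S , i) → record { Sending S } , i
             ; (inj₂ (inj₂ refl)) (S , i) → record { Sending S } , i })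
          (λ e rest τ f idx (S , inside) → weaken ℕ.≤-refl (λ _ _ S′ → S′ , λ e′ e′∈ → inside e′ (there e′∈))
            (sendᵉ e (input-kept refl f I₂) (constants-kept refl f C₂) (keepʳ f aU refl 0) idx (inside e (here refl)) S)))
        then λ τ₃ f₃ (S , _) → conclude τ₂ τ₃ bottleneck (λ e e∈ → below e e∈ λ ()) I₂ C₂ H₂ f₃ (path-kept refl f₃ path₂) S
        where
        decomposed : ∃[ e ] ∃[ es ] edges P ≡ e ∷ es
        decomposed with edges P | edges-nonempty P
        ... | e ∷ es | _ = e , es , refl
        e₀ = proj₁ decomposed
        P₀ = proj₁ (proj₂ decomposed)
        P≡ = proj₂ (proj₂ decomposed)
        stored-path : PathStored p (e₀ ∷ P₀) σ
        stored-path = subst (λ es → PathStored p es σ) P≡ stored-path′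
        path-time : ∀ k → 1 ℕ.+ (suc (length P₀) ℕ.* (4 ℕ.+ k) ℕ.+ 1) ℕ.≤ 1 ℕ.+ (n ℕ.* (4 ℕ.+ k) ℕ.+ 1)
        path-time k = s≤s (ℕ.+-monoˡ-≤ 1 (ℕ.*-monoˡ-≤ (4 ℕ.+ k) (ℕ.<⇒≤ (subst (λ es → length es ℕ.< n) P≡ (length<n P)))))
        kept : ∀ {p′ σ τ} → writesState p′ ∨ writesⁿ 6 p′ ≡ false → Frame p′ σ τ → Holds G σ → Holds G τ
        kept {p′} w f = holds-kept (proj₁ (∨-false {writesState p′} w)) f (λ i _ → keepⁿ f 6 (proj₂ (∨-false {writesState p′} w)) i)
        path-kept : ∀ {p′ σ τ} → (writesⁿ 5 p′ ∨ writesⁿ 4 p′) ∨ (writesⁿ aPos p′ ∨ writesⁿ 6 p′) ≡ false →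
          Frame p′ σ τ → PathStored p (e₀ ∷ P₀) σ → PathStored p (e₀ ∷ P₀) τ
        path-kept {p′} {σ} w f S = record
          { start≡ = trans (keepⁿ f 5 (proj₁ w₁) _) (trans (cong (nats σ 5) (keepⁿ f 4 (proj₂ w₁) 0)) (PathStored.start≡ S))
          ; pos≡ = trans (keepⁿ f aPos (proj₁ w₂) 0) (PathStored.pos≡ S)
          ; segment = segment-cong p (e₀ ∷ P₀) (λ i _ → keepⁿ f 6 (proj₂ w₂) i) (PathStored.segment S) }
          where
          w₁ = ∨-false {writesⁿ 5 p′} (proj₁ (∨-false {writesⁿ 5 p′ ∨ writesⁿ 4 p′} w))
          w₂ = ∨-false {writesⁿ aPos p′} (proj₂ (∨-false {writesⁿ 5 p′ ∨ writesⁿ 4 p′} w))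
        first : Exec (aU [ lit 0 ]≔ʳ headroom (6 [ 5 [ 4 [ lit 0 ]ⁿ ]ⁿ ]ⁿ)) σ 1 (λ τ → Bottleneck (e₀ ∷ P₀) (reals τ aU 0))
        first = exec assignʳ ℕ.≤-refl ((e₀ , subst (e₀ ∈_) (sym P≡) (here refl) ,
            headroom≡ {σ} e₀ I H (trans (cong (nats σ 6) (PathStored.start≡ stored-path)) (proj₁ (PathStored.segment stored-path)))) ,
          λ e e∈ e∉ → contradiction (subst (e ∈_) P≡ e∈) e∉)
        conclude : ∀ τ₂ τ₃ → let u = reals τ₂ aU 0 in (∃[ e ] e ∈ edges P × u ≡ headroomOf e) → (∀ e → e ∈ edges P → u ≤ headroomOf e) →
          Input τ₂ → Constants τ₂ → Holds G τ₂ → Frame (ticked (forPath send)) τ₂ τ₃ → PathStored p (e₀ ∷ P₀) τ₃ → Sending u [] τ₃ →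
          Exec (ticked (addEntry scaledAmount)) τ₃ 3 Advanced
        conclude τ₂ τ₃ (e* , e*∈ , u≡) u≤ I₂ C₂ H₂ f₃ path₃ S = straight (addEntry scaledAmount) {ok = refl}
          ( Rt.routed , Rt.good-routed , holds , refl
          , potentialRaises-decreases e* Rt.raises-mono (Rt.raises-bottleneck e* e*∈ u≡) (Good.raises< Rt.good-routed e*) )
          where
          open Sending S
          u = reals τ₂ aU 0
          M = ql ℕ.+ phases ℕ.+ 2
          a = u * fromℕ M ⁻¹
          0≤u : 0# ≤ u
          0≤u = ≤-respʳ (≈-reflexive (sym u≡)) (x≤y⇒0≤y-x (Good.used≤c g e*))
          module Rt = Route g level< P cheap {u} {a} 0≤u u≤
            (≈-trans (solve 3 (λ k u i → k :* (u :* i) := u :* (k :* i)) ≈-refl (fromℕ M) u (fromℕ M ⁻¹))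
              (≈-trans (*-congˡ (⁻¹-inverseʳ 0<congestion)) (*-identityʳ u)))
            (*-nonNeg 0≤u (⁻¹-nonNeg 0<congestion))
            {λ e → nats τ₃ aRaises (toℕ e)} {λ e → reals τ₃ aY (toℕ e)} {λ e → reals τ₃ aUsed (toℕ e)}
            (λ e e∈ → sent e e∈ λ ()) (λ e e∉ → waiting e (inj₂ e∉))
          stored₃ : Stored τ₃ entries
          stored₃ = stored-transport {τ₂} {τ₃} entries (λ j _ → keepⁿ f₃ 5 refl j) (λ i _ → keepⁿ f₃ 6 refl i) (λ j _ → keepʳ f₃ 2 refl j) (Holds.stored H₂)
          counted₃ : nats τ₃ 4 0 ≡ length entries
          counted₃ = trans (keepⁿ f₃ 4 refl 0) (Holds.counted H₂)
          start₃ : nats τ₃ 5 (length entries) ≡ p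
          start₃ = trans (cong (nats τ₃ 5) (sym counted₃)) (PathStored.start≡ path₃)
          amount≡ : evalʳ τ₃ scaledAmount ≡ a
          amount≡ = cong₂ (λ u k → u * fromℕ k ⁻¹) (keepʳ f₃ aU refl 0)
            (cong (ℕ._+ 2) (cong₂ ℕ._+_ (trans (keepⁿ f₃ aQL refl 0) (Constants.ql≡ C₂)) (trans (keepⁿ f₃ aR refl 0) (Constants.r≡ C₂))))
          appended = addEntry-stored {τ₃} {entries} {P} {a} scaledAmount counted₃ stored₃
            (trans (PathStored.pos≡ path₃) (cong₂ ℕ._+_ (sym start₃) (cong length (sym P≡))))
            (subst₂ (Segment (nats τ₃ 6)) (sym start₃) (sym P≡) (PathStored.segment path₃)) (≈-reflexive amount≡)
          holds : Holds Rt.routed (result (addEntry scaledAmount) τ₃)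
          holds = record
            { level≡ = trans (keepⁿ f₃ aLevel refl 0) (Holds.level≡ H₂)
            ; raises≡ = λ _ → refl ; y≡ = λ _ → refl ; used≡ = λ _ → refl
            ; α≡ = trans (keepʳ f₃ aα refl 0) (Holds.α≡ H₂)
            ; stored = proj₁ appended ; counted = proj₂ appended }

    record Finished (σ : Store) : Set where
      field
        state    : Ghost
        good     : Good state
        holds    : Holds state σ
        complete : Ghost.level state ≡ phases

    Remaining : ℕ → Store → Set
    Remaining k σ = ∃[ G ] Good G × Holds G σ × phases ℕ.∸ Ghost.level G ℕ.+ potentialRaises (Ghost.raises G) ℕ.≤ k

    iterationTime : ℕ
    iterationTime = 1 ℕ.+ (weightsTime ℕ.+ searchTime weightBound routeTime)

    iterationᵉ : ∀ {G k σ} → 𝒫 → Good G → Input σ → Constants σ → Holds G σ → Ghost.level G ℕ.< phases →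
      phases ℕ.∸ Ghost.level G ℕ.+ potentialRaises (Ghost.raises G) ℕ.≤ suc k →
      Exec (tick ⨾ ticked iteration) σ iterationTime (Remaining k)
    iterationᵉ {G} {k} {σ} P₀ g I C H level< measure = ticking then λ τ₀ f₀ _ →
      let I₀ = input-kept refl f₀ I
          C₀ = constants-kept refl f₀ C
          H₀ = holds-kept refl f₀ (λ i _ → keepⁿ f₀ 6 refl i) H
      in weightsᵉ g I₀ C₀ H₀ then λ τ f rounds →
      let I₁ = input-kept refl f I₀
          C₁ = constants-kept refl f C₀
          H₁ = holds-kept refl f (λ i _ → keepⁿ f 6 refl i) H₀
          w = λ e → nats τ aW (toℕ e)
          rounds′ = λ e → rounds e (Fin.toℕ<n e)
          open Searching w (λ e → Rounds.w≥1 (rounds′ e))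
      in searchᵉ P₀ I₁ (record { w≡ = λ _ → refl }) (Constants.K≡ C₁)
        (λ P υ W≤ h stored below → weaken ℕ.≤-refl (λ υ′ _ → progress {P} {nats τ 5 (nats τ 4 0)} {υ′})
          (Routing.routeᵉ g P (nats τ 5 (nats τ 4 0)) (input-kept refl h I₁) (constants-kept refl h C₁)
            (holds-kept refl h below H₁) level< (cheap (0<α g) rounds′ P W≤) stored))
        (λ υ h far → slower {c = 2} (s≤s (s≤s z≤n)) (raise υ (constants-kept refl h C₁) (holds-kept refl h (λ i _ → keepⁿ h 6 refl i) H₁)
          (λ P → expensive (0<α g) rounds′ P (far P))))
      where
      open import Data.Unit using (⊤; tt)
      open Ghost G
      ticking : Exec tick σ 1 (λ _ → ⊤)
      ticking = exec assignⁿ ℕ.≤-refl tt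
      progress : ∀ {P p τ} → Routing.Advanced g P p τ → Remaining k τ
      progress (G′ , g′ , H′ , level≡ , decreases) = G′ , g′ , H′ , ℕ.≤-pred (ℕ.≤-trans
        (subst (λ l → phases ℕ.∸ l ℕ.+ potentialRaises (Ghost.raises G′) ℕ.< phases ℕ.∸ level ℕ.+ potentialRaises raises) (sym level≡)
          (ℕ.+-monoʳ-< (phases ℕ.∸ level) decreases)) measure)
      raise : ∀ υ → Constants υ → Holds G υ → (∀ P → α ≤ pathWeight y P) → Exec raiseα υ 2 (Remaining k)
      raise υ C′ H′ short = straight raiseα {ok = refl} (advance G , good-advance g level< short ,
        record { level≡ = trans (ℕ.+-comm _ 1) (cong suc (Holds.level≡ H′)) ; raises≡ = Holds.raises≡ H′ ; y≡ = Holds.y≡ H′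
               ; used≡ = Holds.used≡ H′
               ; α≡ = cong₂ (λ a k → a + a * fromℕ k ⁻¹) (Holds.α≡ H′) (Constants.q≡ C′)
               ; stored = stored-transport {υ} {result raiseα υ} entries (λ _ _ → refl) (λ _ _ → refl) (λ _ _ → refl) (Holds.stored H′)
               ; counted = Holds.counted H′ } ,
        ℕ.≤-pred (ℕ.≤-trans (ℕ.+-monoˡ-< (potentialRaises raises) (ℕ.∸-monoʳ-< ℕ.≤-refl level<)) measure))

    mainLoopᵉ : ∀ {G σ} → 𝒫 → Good G → Input σ → Constants σ → Holds G σ →
      ∀ k → phases ℕ.∸ Ghost.level G ℕ.+ potentialRaises (Ghost.raises G) ℕ.≤ k →
      Exec (ticked mainLoop) σ (suc (k ℕ.* suc iterationTime)) Finished
    mainLoopᵉ {G} {σ} P₀ g I C H k measure = whileᵉ Remaining step k (G , g , H , measure)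
      where
      step : ∀ k τ → Frame (ticked mainLoop) σ τ → Remaining k τ →
        (evalᶜ τ (var aLevel <ⁿ var aR) ≡ false × Finished τ) ⊎
        (∃[ j ] k ≡ suc j × evalᶜ τ (var aLevel <ⁿ var aR) ≡ true × Exec (tick ⨾ ticked iteration) τ iterationTime (Remaining j))
      step k τ f (G , g , H , measure) with Ghost.level G ℕ.<? phases
      ... | no ≮ = inj₁ (trans (cong₂ _<ᵇ_ (Holds.level≡ H) (Constants.r≡ (constants-kept refl f C))) (≤⇒<ᵇ-false (ℕ.≮⇒≥ ≮)) ,
          record { state = G ; good = g ; holds = H ; complete = ℕ.≤-antisym (Good.level≤ g) (ℕ.≮⇒≥ ≮) })
      ... | yes level< with k | measure
      ...   | zero | le = contradiction (ℕ.≤-trans (ℕ.m≤m+n (phases ℕ.∸ Ghost.level G) _) le) (ℕ.<⇒≱ (ℕ.m<n⇒0<n∸m level<))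
      ...   | suc j | le = inj₂ (j , refl , trans (cong₂ _<ᵇ_ (Holds.level≡ H) (Constants.r≡ (constants-kept refl f C))) (<⇒<ᵇ-true level<) ,
          iterationᵉ P₀ g (input-kept refl f I) (constants-kept refl f C) H level< le)

module Approximation {R : RealNumbers} (N : Network R) (ε : RealNumbers.ℝ R) where
  open Programs
  open import Data.Nat as ℕ using (ℕ; zero; suc; z≤n; s≤s; _<ᵇ_; ⌈_/2⌉)
  import Data.Nat.Properties as ℕ
  open RealArithmetic R
  open Sums R
  open Hoare R
  open FlowTheory N
  open Machine N ε
  open ShortestPath N ε
  open PathSearch N ε using (searchTime)
  open Output N ε
  open Potential N
  open GargKonemann N ε
  open Network N
  open Flows N

  n≤2^⌈log2⌉n : ∀ n (a : Acc ℕ._<_ n) → n ℕ.≤ 2 ℕ.^ ⌈log2⌉ n a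
  n≤2^⌈log2⌉n 0 _ = z≤n
  n≤2^⌈log2⌉n 1 _ = s≤s z≤n
  n≤2^⌈log2⌉n (suc (suc n)) (acc rs) = ℕ.≤-trans (ℕ.≤-trans (s≤s (s≤s (half n))) (ℕ.≤-reflexive (double ⌈ n /2⌉)))
    (ℕ.*-monoʳ-≤ 2 (n≤2^⌈log2⌉n (suc ⌈ n /2⌉) _))
    where
    half : ∀ n → n ℕ.≤ ⌈ n /2⌉ ℕ.+ ⌈ n /2⌉
    half zero          = z≤n
    half (suc zero)    = s≤s z≤n
    half (suc (suc n)) = s≤s (ℕ.≤-trans (s≤s (half n)) (ℕ.≤-reflexive (sym (ℕ.+-suc ⌈ n /2⌉ ⌈ n /2⌉))))
    double : ∀ h → suc (suc (h ℕ.+ h)) ≡ 2 ℕ.* suc h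
    double = solve-∀

  n≤2^⌈log₂n⌉ : ∀ n → n ℕ.≤ 2 ℕ.^ ⌈log₂ n ⌉
  n≤2^⌈log₂n⌉ n = n≤2^⌈log2⌉n n (<-wellFounded n)

  logBound : ℕ
  logBound = ⌈log₂ (1 ℕ.+ L) ⌉

  phasesFor congestionFor iterationsFor mainTime approximationTime : ℕ → ℕ → ℕ
  phasesFor q log     = q ℕ.* (log ℕ.* q) ℕ.+ suc q
  congestionFor q log = log ℕ.* q ℕ.+ phasesFor q log ℕ.+ 2
  iterationsFor q log = phasesFor q log ℕ.+ m ℕ.* congestionFor q log
  iterationTimeFor : ℕ → ℕ
  iterationTimeFor q  = 1 ℕ.+ ((2 ℕ.+ m ℕ.* (3 ℕ.+ (1 ℕ.+ suc (suc q ℕ.* n ℕ.* 3)))) ℕ.+ searchTime (suc q ℕ.* n) routeTime)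
  mainTime q log      = suc (iterationsFor q log ℕ.* suc (iterationTimeFor q))
  approximationTime q log = (3 ℕ.+ suc (log ℕ.* 4)) ℕ.+ ((2 ℕ.+ (2 ℕ.+ q ℕ.* 5)) ℕ.+ (((2 ℕ.+ m ℕ.* 6) ℕ.+ 4) ℕ.+ mainTime q log))

  phasesFor-mono : ∀ q {j k} → j ℕ.≤ k → phasesFor q j ℕ.≤ phasesFor q k
  phasesFor-mono q j≤k = ℕ.+-monoˡ-≤ (suc q) (ℕ.*-monoʳ-≤ q (ℕ.*-monoˡ-≤ q j≤k))

  mainTime-mono : ∀ q {j k} → j ℕ.≤ k → mainTime q j ℕ.≤ mainTime q k
  mainTime-mono q j≤k = s≤s (ℕ.*-monoˡ-≤ (suc (iterationTimeFor q)) (ℕ.+-mono-≤ (phasesFor-mono q j≤k)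
    (ℕ.*-monoʳ-≤ m (ℕ.+-monoˡ-≤ 2 (ℕ.+-mono-≤ (ℕ.*-monoˡ-≤ q j≤k) (phasesFor-mono q j≤k))))))

  -- The factor lost to congestion and to the rounding of the weights is at most 1 + 8/q.
  congestion-small : ∀ {q log} → 8 ℕ.≤ q → 1 ℕ.≤ log →
    suc q ℕ.* suc q ℕ.* congestionFor q log ℕ.≤ q ℕ.* (q ℕ.* (log ℕ.* q)) ℕ.* (q ℕ.+ 8)
  congestion-small {q} 8≤q 1≤log with ℕ.m≤n⇒∃[o]m+o≡n 8≤q | ℕ.m≤n⇒∃[o]m+o≡n 1≤log
  ... | a , refl | b , refl = subst (suc q ℕ.* suc q ℕ.* congestionFor q (1 ℕ.+ b) ℕ.≤_) (identity a b) (ℕ.m≤m+n _ _)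
    where
    identity : ∀ a b → let q = 8 ℕ.+ a ; ql = (1 ℕ.+ b) ℕ.* q in
      suc q ℕ.* suc q ℕ.* (ql ℕ.+ (q ℕ.* ql ℕ.+ suc q) ℕ.+ 2) ℕ.+
        (1469 ℕ.+ 632 ℕ.* a ℕ.+ 88 ℕ.* (a ℕ.* a) ℕ.+ 4 ℕ.* (a ℕ.* a ℕ.* a)
          ℕ.+ b ℕ.* (2360 ℕ.+ 911 ℕ.* a ℕ.+ 117 ℕ.* (a ℕ.* a) ℕ.+ 5 ℕ.* (a ℕ.* a ℕ.* a)))
      ≡ q ℕ.* (q ℕ.* ql) ℕ.* (q ℕ.+ 8)
    identity = solve-∀

  record NearOptimal (τ : Store) : Set where
    field
      solution : Solution τ
      near     : ∀ x → Feasible x → flowValue x ≤ (1# + ε) * total (Solution.entries solution)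

  module _ (P₀ : 𝒫) {q : ℕ} (8≤q : 8 ℕ.≤ q) (8≤qε : fromℕ 8 ≤ fromℕ q * ε) where
    private
      1≤q : 1 ℕ.≤ q
      1≤q = ℕ.≤-trans (s≤s z≤n) 8≤q

    record Scaled (τ : Store) : Set where
      field
        log    : ℕ
        q≡     : nats τ aQ 0 ≡ q
        ql≡    : nats τ aQL 0 ≡ log ℕ.* q
        large  : L ℕ.< 2 ℕ.^ log
        log≤   : log ℕ.≤ logBound

    scaleᵉ : ∀ {σ} → Input σ → nats σ clock 0 ≡ q → Exec (ticked scale) σ (3 ℕ.+ suc (logBound ℕ.* 4)) Scaled
    scaleᵉ {σ} I clock≡ = slower (ℕ.≤-reflexive refl) (set-q then λ { _ _ refl → set-p then λ { _ _ refl → set-ql then λ { _ f₀ refl →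
      whileᵉ {c = 3} Inv step logBound (0 , refl , refl , refl) } } })
      where
      σ₁ = setⁿ aQ (nats σ clock 0) σ
      σ₂ = setⁿ aP 1 σ₁
      σ₃ = setⁿ aQL 0 σ₂
      set-q : Exec (aQ [ lit 0 ]≔ⁿ var clock) σ 1 (_≡ σ₁)
      set-q = exec assignⁿ ℕ.≤-refl refl
      set-p : Exec (aP [ lit 0 ]≔ⁿ lit 1) σ₁ 1 (_≡ σ₂)
      set-p = exec assignⁿ ℕ.≤-refl refl
      set-ql : Exec (aQL [ lit 0 ]≔ⁿ lit 0) σ₂ 1 (_≡ σ₃)
      set-ql = exec assignⁿ ℕ.≤-refl refl
      Inv : ℕ → Store → Set
      Inv k τ = ∃[ j ] j ℕ.+ k ≡ logBound × nats τ aP 0 ≡ 2 ℕ.^ j × nats τ aQL 0 ≡ j ℕ.* q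
      step : ∀ k τ → Frame (ticked doubleLoop) σ₃ τ → Inv k τ →
        (evalᶜ τ (var aP <ⁿ input-L ⊕ lit 1) ≡ false × Scaled τ) ⊎
        (∃[ j ] k ≡ suc j × evalᶜ τ (var aP <ⁿ input-L ⊕ lit 1) ≡ true × Exec (tick ⨾ doubleStep) τ 3 (Inv j))
      step k τ f (j , sum , p≡ , ql≡) with 2 ℕ.^ j ℕ.<? suc L
      ... | no ≮ = inj₁ (trans (cong₂ _<ᵇ_ p≡ L+1≡) (≤⇒<ᵇ-false (ℕ.≮⇒≥ ≮)) , record
          { log = j ; q≡ = q≡ ; ql≡ = ql≡ ; large = ℕ.≮⇒≥ ≮ ; log≤ = subst (j ℕ.≤_) sum (ℕ.m≤m+n j k) })
        where
        q≡ : nats τ aQ 0 ≡ q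
        q≡ = trans (keepⁿ f aQ refl 0) clock≡
        L+1≡ : nats τ 0 4 ℕ.+ 1 ≡ suc L
        L+1≡ = trans (cong (ℕ._+ 1) (trans (keepⁿ f 0 refl 4) (Input.L≡ I))) (ℕ.+-comm L 1)
      ... | yes p< with k
      ...   | zero = contradiction (n≤2^⌈log₂n⌉ (suc L)) (ℕ.<⇒≱ (subst (λ j → 2 ℕ.^ j ℕ.< suc L) (trans (sym (ℕ.+-identityʳ j)) sum) p<))
      ...   | suc k′ = inj₂ (k′ , refl , trans (cong₂ _<ᵇ_ p≡ L+1≡) (<⇒<ᵇ-true p<) , straight (tick ⨾ doubleStep) {ok = refl}
          (suc j , trans (sym (ℕ.+-suc j k′)) sum
            , trans (cong₂ ℕ._+_ p≡ p≡) (cong (2 ℕ.^ j ℕ.+_) (sym (ℕ.+-identityʳ (2 ℕ.^ j))))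
            , trans (cong₂ ℕ._+_ ql≡ q≡) (ℕ.+-comm (j ℕ.* q) q)))
        where
        q≡ : nats τ aQ 0 ≡ q
        q≡ = trans (keepⁿ f aQ refl 0) clock≡
        L+1≡ : nats τ 0 4 ℕ.+ 1 ≡ suc L
        L+1≡ = trans (cong (ℕ._+ 1) (trans (keepⁿ f 0 refl 4) (Input.L≡ I))) (ℕ.+-comm L 1)

    sizesᵉ : ∀ {σ} ql → Input σ → nats σ aQ 0 ≡ q → nats σ aQL 0 ≡ ql →
      Exec (ticked sizes) σ (2 ℕ.+ (2 ℕ.+ q ℕ.* 5)) (λ τ → nats τ aR 0 ≡ q ℕ.* ql ℕ.+ suc q × nats τ aK 0 ≡ suc q ℕ.* n)
    sizesᵉ {σ} ql I q≡ ql≡ = set-r then λ { _ f₁ refl → set-k then λ { _ f₂ refl →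
      forᵉ aI2 (var aQ) (aR [ lit 0 ]≔ⁿ var aR ⊕ var aQL ⨾ aK [ lit 0 ]≔ⁿ var aK ⊕ input-n) q
        (λ j τ → nats τ aR 0 ≡ j ℕ.* ql ℕ.+ suc q × nats τ aK 0 ≡ suc j ℕ.* n) {refl}
        (λ τ f → trans (keepⁿ f aQ refl 0) q≡)
        (trans (cong (ℕ._+ 1) q≡) (ℕ.+-comm q 1) , trans (Input.n≡ I) (sym (ℕ.+-identityʳ n)))
        (λ inv → inv) (λ inv → inv)
        (λ j τ f idx (r≡ , k≡) → straight (aR [ lit 0 ]≔ⁿ var aR ⊕ var aQL ⨾ aK [ lit 0 ]≔ⁿ var aK ⊕ input-n) {ok = refl}
          ( trans (cong₂ ℕ._+_ r≡ (trans (keepⁿ f aQL refl 0) ql≡)) (shift (toℕ j ℕ.* ql) (suc q) ql)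
          , trans (cong₂ ℕ._+_ k≡ (trans (keepⁿ f 0 refl 0) (Input.n≡ I))) (ℕ.+-comm (suc (toℕ j) ℕ.* n) n))) } }
      where
      σ₁ = setⁿ aR (nats σ aQ 0 ℕ.+ 1) σ
      σ₂ = setⁿ aK (nats σ 0 0) σ₁
      set-r : Exec (aR [ lit 0 ]≔ⁿ var aQ ⊕ lit 1) σ 1 (_≡ σ₁)
      set-r = exec assignⁿ ℕ.≤-refl refl
      set-k : Exec (aK [ lit 0 ]≔ⁿ input-n) σ₁ 1 (_≡ σ₂)
      set-k = exec assignⁿ ℕ.≤-refl refl
      shift : ∀ a b c → (a ℕ.+ b) ℕ.+ c ≡ (c ℕ.+ a) ℕ.+ b
      shift = solve-∀

    module _ {log : ℕ} (L<2^log : L ℕ.< 2 ℕ.^ log) where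
      open Iteration N q 1≤q log L<2^log
      open Approximating q 1≤q log L<2^log

      start : Ghost
      start = ghost 0 (λ _ → 0) (λ _ → fromℕ 1) (λ _ → 0#) (fromℕ L) []

      start-good : Good start
      start-good = record
        { level≤ = z≤n ; y≈ = λ _ → +-identityʳ 1# ; used≥0 = λ _ → ≤-refl ; used≤c = λ e → proj₁ (c-positive e)
        ; α≈ = ≈-sym (*-identityʳ _)
        ; congested = λ e → solve 2 (λ k c → k :* :# 0 := :# 0 :* c :+ :# 0) ≈-refl (fromℕ congestion) (c e)
        ; raises< = λ _ → ℕ.≤-trans (s≤s z≤n) (ℕ.m≤n+m 2 (ql ℕ.+ phases)) ; amounts≥0 = Data.List.Relation.Unary.All.[]
        ; potential = λ x _ → potential-cong qʳ 0<qʳ {qʳ * capacitySum} {dualValue qʳ 0<qʳ (λ _ → fromℕ 1) (λ _ → 0#)} {0#} {fromℕ congestion * 0#}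
            {fromℕ L} {fromℕ L} {0#} {0#} {flowValue x}
            (≈-sym (≈-trans (sum-cong (allFin m) (λ e _ → ≈-trans (*-congʳ (+-identityʳ 1#)) (solve 2 (λ q c → :# 1 :* (q :* c :+ :# 0) := q :* c) ≈-refl qʳ (c e)))) (sum-* (allFin m) qʳ c)))
            (≈-sym (zeroʳ _)) ≈-refl ≈-refl (potential-initial qʳ 0<qʳ (flowValue x)) }
        where import Data.List.Relation.Unary.All

      EdgesReset : ℕ → Store → Set
      EdgesReset j τ = ∀ (e : E) → toℕ e ℕ.< j → reals τ aY (toℕ e) ≡ fromℕ 1 × reals τ aUsed (toℕ e) ≡ 0# × nats τ aRaises (toℕ e) ≡ 0

      resetᵉ : ∀ {σ} (e : E) → nats σ aEdge 0 ≡ toℕ e → EdgesReset (toℕ e) σ → Exec initEdge σ 3 (EdgesReset (suc (toℕ e)))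
      resetᵉ {σ} e idx reset = straight initEdge {ok = refl} new
        where
        x = nats σ aEdge 0
        rs = update (reals σ) aY x (fromℕ 1)
        new : EdgesReset (suc (toℕ e)) (result initEdge σ)
        new e′ e′< with toℕ e′ ℕ.≟ x
        ... | yes eq = trans (cong (rs aY) eq) (update-same (reals σ) aY x (fromℕ 1))
                     , trans (cong (update rs aUsed x 0# aUsed) eq) (update-same rs aUsed x 0#)
                     , trans (cong (update (nats σ) aRaises x 0 aRaises) eq) (update-same (nats σ) aRaises x 0)
        ... | no ≢ with reset e′ (ℕ.≤∧≢⇒< (ℕ.≤-pred e′<) (λ eq → ≢ (trans eq (sym idx))))
        ...   | a , b , c = trans (update-index (reals σ) aY x (fromℕ 1) aY ≢) a
                          , trans (update-index rs aUsed x 0# aUsed ≢) b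
                          , trans (update-index (nats σ) aRaises x 0 aRaises ≢) c

      initialiseᵉ : ∀ {σ} → Input σ → Exec (ticked initialise) σ ((2 ℕ.+ m ℕ.* 6) ℕ.+ 4) (Holds start)
      initialiseᵉ {σ} I = forᵉ aEdge input-m initEdge m EdgesReset {refl} (λ τ f → Input.m≡ (input-kept refl f I)) (λ _ ())
          (λ r → r) (λ r → r) (λ e τ f idx r → resetᵉ e idx r)
        then λ τ f r → straight rest {ok = refl} (record
          { level≡ = refl ; raises≡ = λ e → proj₂ (proj₂ (r e (Fin.toℕ<n e))) ; y≡ = λ e → proj₁ (r e (Fin.toℕ<n e))
          ; used≡ = λ e → proj₁ (proj₂ (r e (Fin.toℕ<n e)))
          ; α≡ = cong fromℕ (trans (keepⁿ f 0 refl 4) (Input.L≡ I)) ; stored = refl ; counted = refl })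
        where
        rest = aα [ lit 0 ]≔ʳ int input-L ⨾ aLevel [ lit 0 ]≔ⁿ lit 0 ⨾ 4 [ lit 0 ]≔ⁿ lit 0 ⨾ 5 [ lit 0 ]≔ⁿ lit 0

      1≤log : 1 ℕ.≤ log
      1≤log = positive log L<2^log
        where
        positive : ∀ k → L ℕ.< 2 ℕ.^ k → 1 ℕ.≤ k
        positive zero    L<1 = contradiction L-positive (ℕ.<⇒≱ L<1)
        positive (suc k) _   = s≤s z≤n

      near-optimal : ∀ {τ} → Finished τ → NearOptimal τ
      near-optimal {τ} X = record
        { solution = record { entries = entries ; stored = stored ; counted = counted ; amounts≥0 = amounts≥0 ; feasible = good-feasible good }
        ; near = λ x feasible → *-cancelˡ-≤ scaleʳ 0<scale (≤-trans (≤-respˡ (regroup (flowValue x)) (*-monoʳ-≤ qʳ (proj₁ 0<qʳ) (good-value good complete x feasible))) rescaled) }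
        where
        open Finished X
        open Ghost state
        open Holds holds using (stored; counted)
        open Good good
        T = total entries
        scaleʳ = qʳ * (qʳ * qʳ * fromℕ (q ℕ.* ql))
        0<scale : 0# < scaleʳ
        0<scale = 0<* 0<qʳ (0<* (0<* 0<qʳ 0<qʳ) (fromℕ-pos (ℕ.*-mono-≤ 1≤q (ℕ.*-mono-≤ 1≤log 1≤q))))
        0≤T : 0# ≤ T
        0≤T = sum-nonNeg entries (λ _ ∈es → All.lookup amounts≥0 ∈es)
          where open import Data.List.Relation.Unary.All as All using ()
        regroup : ∀ v → qʳ * (qʳ * qʳ * fromℕ (q ℕ.* ql) * v) ≈ scaleʳ * v
        regroup v = solve 3 (λ q k v → q :* (q :* q :* k :* v) := q :* (q :* q :* k) :* v) ≈-refl qʳ (fromℕ (q ℕ.* ql)) v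
        rescaled : qʳ * ((qʳ + 1#) * (qʳ + 1#) * (fromℕ congestion * T)) ≤ scaleʳ * ((1# + ε) * T)
        rescaled = ≤-respˡ (solve 4 (λ q k T o → q :* ((o :+ q) :* (o :+ q) :* k :* T) := q :* ((q :+ o) :* (q :+ o) :* (k :* T))) ≈-refl qʳ (fromℕ congestion) T 1#)
          (≤-trans (*-monoʳ-≤ qʳ (proj₁ 0<qʳ) (≤-respˡ (*-comm _ _) (≤-respʳ (*-comm _ _) (*-monoʳ-≤ T 0≤T
              (≤-respˡ (≈-trans (fromℕ-* (suc q ℕ.* suc q) congestion) (*-congʳ (fromℕ-* (suc q) (suc q)))) (fromℕ-mono (congestion-small 8≤q 1≤log)))))))
            (≤-respˡ (*-congˡ (*-congʳ (≈-sym (≈-trans (fromℕ-* (q ℕ.* (q ℕ.* ql)) (q ℕ.+ 8)) (*-cong (fromℕ-* q (q ℕ.* ql)) (fromℕ-+ q 8))))))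
              (≤-respʳ (solve 4 (λ q k e T → q :* (q :* k :* (q :+ q :* e) :* T) := q :* (q :* q :* k) :* ((:# 1 :+ e) :* T)) ≈-refl qʳ (fromℕ (q ℕ.* ql)) ε T)
                (*-monoʳ-≤ qʳ (proj₁ 0<qʳ) (≤-respˡ (*-comm _ _) (≤-respʳ (*-comm _ _) (*-monoʳ-≤ T 0≤T
                  (*-monoʳ-≤ (qʳ * fromℕ (q ℕ.* ql)) (*-nonNeg (proj₁ 0<qʳ) (fromℕ-nonNeg (q ℕ.* ql))) (+-monoʳ-≤ qʳ 8≤qε)))))))))

      mainᵉ : ∀ {σ} → Input σ → Constants σ → Exec (ticked (initialise ⨾ mainLoop)) σ (((2 ℕ.+ m ℕ.* 6) ℕ.+ 4) ℕ.+ mainTime q log) NearOptimal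
      mainᵉ I C = initialiseᵉ I then λ τ f H → weaken ℕ.≤-refl (λ _ _ → near-optimal)
        (mainLoopᵉ P₀ start-good (input-kept refl f I) (constants-kept refl f C) H (iterationsFor q log)
          (ℕ.≤-reflexive (cong (phases ℕ.+_) potentialRaises-initial)))

    approximateᵉ : ∀ {σ} → Input σ → nats σ clock 0 ≡ q → Exec (ticked approximate) σ (approximationTime q logBound) NearOptimal
    approximateᵉ I clock≡ = scaleᵉ I clock≡ then λ τ f S →
      let open Scaled S ; I₁ = input-kept refl f I in
      sizesᵉ (log ℕ.* q) I₁ q≡ ql≡ then λ υ g (r≡ , k≡) →
      slower (ℕ.+-monoʳ-≤ ((2 ℕ.+ m ℕ.* 6) ℕ.+ 4) (mainTime-mono q log≤))
        (mainᵉ {log} large (input-kept refl g I₁) (record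
          { q≡ = trans (keepⁿ g aQ refl 0) q≡ ; ql≡ = trans (keepⁿ g aQL refl 0) ql≡ ; r≡ = r≡ ; K≡ = k≡ }))

module Exact {R : RealNumbers} (N : Network R) (ε : RealNumbers.ℝ R) where
  open Programs
  open import Data.Nat as ℕ using (ℕ; zero; suc; z≤n; s≤s; _<ᵇ_)
  import Data.Nat.Properties as ℕ
  open RealArithmetic R
  open Sums R
  open Hoare R
  open Halting R
  open FlowTheory N
  open StrongDuality N using (Term; term; termValue)
  open Machine N ε
  open ShortestPath N ε
  open PathLoop N ε
  open PathSearch N ε
  open Output N ε
  open Network N
  open Flows N

  setʳ : ℕ → ℝ → Store → Store
  setʳ a v σ = store (nats σ) (update (reals σ) a 0 v)

  setⁿʰ : ∀ a v {σ} → Halts (a [ lit 0 ]≔ⁿ v) σ (_≡ setⁿ a (evalⁿ σ v) σ)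
  setⁿʰ a v = halts (exec assignⁿ ℕ.≤-refl refl)

  setʳʰ : ∀ a v {σ} → Halts (a [ lit 0 ]≔ʳ v) σ (_≡ setʳ a (evalʳ σ v) σ)
  setʳʰ a v = halts (exec assignʳ ℕ.≤-refl refl)

  tickʰ : ∀ {σ} → Halts tick σ (_≡ setⁿ clock (nats σ clock 0 ℕ.+ 1) σ)
  tickʰ = halts (exec assignⁿ ℕ.≤-refl refl)

  values : (ℕ → ℕ) → ℕ → ℕ → List ℕ → List ℕ
  values f j zero    ds = ds
  values f j (suc k) ds = f j ∷ values f (suc j) k ds

  values-step : ∀ f {j ds} → j ℕ.< m → values f j (m ℕ.∸ j) ds ≡ f j ∷ values f (suc j) (m ℕ.∸ suc j) ds
  values-step f {j} {ds} j<m = cong (λ k → values f j k ds) (ℕ.+-∸-assoc 1 {m} {suc j} j<m)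

  values-end : ∀ f ds {k} → Codes (values f m (m ℕ.∸ m) ds) k → Codes ds k
  values-end f ds {k} = subst (λ j → Codes (values f m j ds) k) (ℕ.n∸n≡0 m)

  Guessed : ℕ → ℕ → Store → Set
  Guessed k j τ = (∀ (e : E) → toℕ e ℕ.< j → 1 ℕ.≤ nats τ aW (toℕ e)) ×
    (∀ f ds → Codes (values f 0 m ds) k → (∀ (e : E) → toℕ e ℕ.< j → nats τ aW (toℕ e) ≡ suc (f (toℕ e))) ×
      Codes (values f j (m ℕ.∸ j) ds) (nats τ aRem 0))

  guessWeightsʰ : ∀ {σ k} → Input σ → nats σ aRem 0 ≡ k → Halts (ticked guessWeights) σ (Guessed k m)
  guessWeightsʰ {σ} {k} I rem≡ = forʰ aEdge input-m (read ⨾ aW [ var aEdge ]≔ⁿ var aHead ⊕ lit 1) m (Guessed k) {refl}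
    (λ τ f → Input.m≡ (input-kept refl f I))
    ((λ _ ()) , λ f ds codes → (λ _ ()) , subst (Codes _) (sym rem≡) codes)
    (λ inv → inv) (λ inv → inv)
    (λ e τ f idx inv → readʰ refl thenʰ λ υ g r → halts (straight (aW [ var aEdge ]≔ⁿ var aHead ⊕ lit 1) {ok = refl}
      (assigned {τ} {υ} e (trans (keepⁿ g aEdge refl 0) idx) r (λ x → keepⁿ g aW refl x) inv)))
    where
    assigned : ∀ {τ υ} (e : E) → nats υ aEdge 0 ≡ toℕ e → Read (nats τ aRem 0) υ → (∀ x → nats υ aW x ≡ nats τ aW x) → Guessed k (toℕ e) τ →
      Guessed k (suc (toℕ e)) (result (aW [ var aEdge ]≔ⁿ var aHead ⊕ lit 1) υ)
    assigned {τ} {υ} e idx r same (pos , decoded) = pos′ , decoded′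
      where
      x = nats υ aEdge 0
      v = nats υ aHead 0 ℕ.+ 1
      at : nats (result (aW [ var aEdge ]≔ⁿ var aHead ⊕ lit 1) υ) aW (toℕ e) ≡ v
      at = trans (cong (update (nats υ) aW x v aW) (sym idx)) (update-same (nats υ) aW x v)
      other : ∀ e′ → e′ ≢ e → nats (result (aW [ var aEdge ]≔ⁿ var aHead ⊕ lit 1) υ) aW (toℕ e′) ≡ nats τ aW (toℕ e′)
      other e′ e′≢e = trans (update-index (nats υ) aW x v aW (λ eq → e′≢e (Fin.toℕ-injective (trans eq idx)))) (same _)
      before : ∀ {e′} → e′ ≢ e → toℕ e′ ℕ.< suc (toℕ e) → toℕ e′ ℕ.< toℕ e
      before e′≢e lt = ℕ.≤∧≢⇒< (ℕ.≤-pred lt) (λ eq → e′≢e (Fin.toℕ-injective eq))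
      pos′ : ∀ e′ → toℕ e′ ℕ.< suc (toℕ e) → 1 ℕ.≤ nats (result (aW [ var aEdge ]≔ⁿ var aHead ⊕ lit 1) υ) aW (toℕ e′)
      pos′ e′ lt with e′ Fin.≟ e
      ... | yes refl = subst (1 ℕ.≤_) (sym at) (ℕ.m≤n+m 1 _)
      ... | no e′≢e = subst (1 ℕ.≤_) (sym (other e′ e′≢e)) (pos e′ (before e′≢e lt))
      decoded′ : ∀ f ds → Codes (values f 0 m ds) k → _
      decoded′ f ds codes with decoded f ds codes
      ... | old , rest with read-codes (nats τ aRem 0) υ _ _ r (subst (λ xs → Codes xs (nats τ aRem 0)) (values-step f (Fin.toℕ<n e)) rest)
      ...   | head≡ , rest′ = new , rest′
        where
        new : ∀ e′ → toℕ e′ ℕ.< suc (toℕ e) → nats (result (aW [ var aEdge ]≔ⁿ var aHead ⊕ lit 1) υ) aW (toℕ e′) ≡ suc (f (toℕ e′))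
        new e′ lt with e′ Fin.≟ e
        ... | yes refl = trans at (trans (cong (ℕ._+ 1) head≡) (ℕ.+-comm _ 1))
        ... | no e′≢e = trans (other e′ e′≢e) (old e′ (before e′≢e lt))

  termCode : Term → List ℕ → List ℕ
  termCode (term e a b d) ds = toℕ e ∷ a ∷ b ∷ d ∷ ds

  termCodes : List Term → List ℕ → List ℕ
  termCodes []       ds = ds
  termCodes (τ ∷ ts) ds = termCode τ (termCodes ts ds)

  TermsRead : ℕ → Store → Store → Set
  TermsRead j σ τ = ∀ ts ds → length ts ≡ j → Codes (termCodes ts ds) (nats σ aRem 0) →
    reals τ aAcc 0 ≈ reals σ aAcc 0 + sum ts termValue × Codes ds (nats τ aRem 0)

  termsʰ : ∀ {σ k} → Input σ → nats σ aRem 0 ≡ k → Halts (ticked readTerms) σ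
    (λ τ → ∀ ts ds → Codes (length ts ∷ termCodes ts ds) k → reals τ aAcc 0 ≈ sum ts termValue × Codes ds (nats τ aRem 0))
  termsʰ {σ} {k} I rem≡ = setʳʰ aAcc (int (lit 0)) thenʰ λ { _ _ refl → readʰ rem≡ thenʰ λ τ f r → setⁿʰ aT (var aHead) thenʰ λ { _ _ refl →
    weakenʰ {Q = TermsRead (nats τ aHead 0) (setⁿ aT (nats τ aHead 0) τ)} (λ υ _ loop-post ts ds codes →
        let (head≡ , rest) = read-codes k τ (length ts) (termCodes ts ds) r codes
            (acc≈ , codes′) = loop-post ts ds (sym head≡) rest in
        ≈-trans acc≈ (≈-trans (+-congʳ (≈-reflexive (keepʳ f aAcc refl 0))) (+-identityˡ _)) , codes′)
      (loop (nats τ aHead 0) (setⁿ aT (nats τ aHead 0) τ) refl (input-kept refl (run-frame (assignⁿ {a = aT} {i = lit 0} {v = var aHead})) (input-kept refl f (initial I)))) } }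
    where
    initial : ∀ {σ v} → Input σ → Input (setʳ aAcc v σ)
    initial I = record { Input I }
    Loop = ticked (while (lit 0 <ⁿ var aT) termStep)
    loop : ∀ j σ → nats σ aT 0 ≡ j → Input σ →
      Halts Loop σ (TermsRead j σ)
    loop zero σ T≡ I = halts (exit (≤⇒<ᵇ-false (ℕ.≤-reflexive T≡)) λ { [] ds _ codes → ≈-sym (+-identityʳ _) , codes })
    loop (suc j) σ T≡ I = unrollʰ (<⇒<ᵇ-true (subst (0 ℕ.<_) (sym T≡) (s≤s z≤n)))
      (tickʰ thenʰ λ { _ f₀ refl → setⁿʰ aT (var aT ⊖ lit 1) thenʰ λ { _ f₁ refl →
       readʰ refl thenʰ λ τ₁ g₁ r₁ → setⁿʰ aTe (var aHead) thenʰ λ { _ h₁ refl →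
       readʰ refl thenʰ λ τ₂ g₂ r₂ → setⁿʰ aTa (var aHead) thenʰ λ { _ h₂ refl →
       readʰ refl thenʰ λ τ₃ g₃ r₃ → setⁿʰ aTb (var aHead) thenʰ λ { _ h₃ refl →
       readʰ refl thenʰ λ τ₄ g₄ r₄ →
       let I₄ = input-kept refl g₄ (input-kept refl h₃ (input-kept refl g₃ (input-kept refl h₂ (input-kept refl g₂
                  (input-kept refl h₁ (input-kept refl g₁ (input-kept refl f₁ (input-kept refl f₀ I))))))))
           T₄ : nats τ₄ aT 0 ≡ j
           T₄ = trans (keepⁿ g₄ aT refl 0) (trans (keepⁿ g₃ aT refl 0) (trans (keepⁿ g₂ aT refl 0) (trans (keepⁿ g₁ aT refl 0) (cong (ℕ._∸ 1) T≡))))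
           e≡ = trans (keepⁿ g₄ aTe refl 0) (trans (keepⁿ g₃ aTe refl 0) (keepⁿ g₂ aTe refl 0))
           a≡ = trans (keepⁿ g₄ aTa refl 0) (keepⁿ g₃ aTa refl 0)
           b≡ = keepⁿ g₄ aTb refl 0
           acc≡ = trans (keepʳ g₄ aAcc refl 0) (trans (keepʳ g₃ aAcc refl 0) (trans (keepʳ g₂ aAcc refl 0) (keepʳ g₁ aAcc refl 0)))
       in halts (exec assignʳ ℕ.≤-refl (weakenʰ
            (λ υ _ post → λ { (term e a b d ∷ ts) ds len codes →
              let rest₀ = termCodes ts ds
                  (e′ , codes₁) = read-codes (nats σ aRem 0) τ₁ (toℕ e) (a ∷ b ∷ d ∷ rest₀) r₁ codes
                  (a′ , codes₂) = read-codes (nats τ₁ aRem 0) τ₂ a (b ∷ d ∷ rest₀) r₂ codes₁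
                  (b′ , codes₃) = read-codes (nats τ₂ aRem 0) τ₃ b (d ∷ rest₀) r₃ codes₂
                  (d′ , codes₄) = read-codes (nats τ₃ aRem 0) τ₄ d rest₀ r₄ codes₃
                  (acc≈ , rest) = post ts ds (ℕ.suc-injective len) codes₄
              in ≈-trans acc≈ (≈-trans (+-congʳ (≈-reflexive (cong₂ _+_ acc≡ (value≡ {τ₄} I₄ (trans e≡ e′) (trans a≡ a′) (trans b≡ b′) d′)))) (+-assoc _ _ _)) , rest })
            (loop j _ T₄ (record { Input I₄ })))) } } } } })
      where
      value≡ : ∀ {τ e a b d} → Input τ → nats τ aTe 0 ≡ toℕ e → nats τ aTa 0 ≡ a → nats τ aTb 0 ≡ b → nats τ aHead 0 ≡ d →
        evalʳ τ ((int (var aTa) -ʳ int (var aTb)) /ʳ int (lit 1 ⊕ var aHead) *ʳ (1 [ var aTe ]ʳ)) ≡ termValue (term e a b d)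
      value≡ {τ} {e} I e≡ refl refl refl = cong ((fromℕ (nats τ aTa 0) - fromℕ (nats τ aTb 0)) * fromℕ (suc (nats τ aHead 0)) ⁻¹ *_)
        (trans (cong (reals τ 1) e≡) (Input.c≡ I e))

  residual : Store → E → ℝ
  residual σ e = reals σ aRes (toℕ e)

  record Sound (es : Entries) (σ : Store) : Set where
    field
      stored    : Stored σ es
      counted   : nats σ 4 0 ≡ length es
      amounts≥0 : AmountsNonNegative es
      residual≈ : ∀ e → residual σ e ≈ c e - load es e
      residual≥0 : ∀ e → 0# ≤ residual σ e
      total≈    : reals σ aTotal 0 ≈ total es

  sound-kept : ∀ {p es σ τ} → ((writesⁿ 4 p ∨ writesⁿ 5 p) ∨ (writesʳ 2 p ∨ (writesʳ aRes p ∨ writesʳ aTotal p))) ≡ false → Frame p σ τ →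
    (∀ i → i ℕ.< nats σ 5 (nats σ 4 0) → nats τ 6 i ≡ nats σ 6 i) → Sound es σ → Sound es τ
  sound-kept {p} {es} {σ} {τ} w f cell S = record
    { stored = stored-transport {σ} {τ} es (λ j _ → keepⁿ f 5 (proj₂ w₁) j) (λ i i< → cell i (subst (λ k → i ℕ.< nats σ 5 k) (sym counted) i<))
        (λ j _ → keepʳ f 2 (proj₁ w₂) j) stored
    ; counted = trans (keepⁿ f 4 (proj₁ w₁) 0) counted ; amounts≥0 = amounts≥0
    ; residual≈ = λ e → ≈-trans (≈-reflexive (keepʳ f aRes (proj₁ w₃) _)) (residual≈ e)
    ; residual≥0 = λ e → ≤-respʳ (≈-reflexive (sym (keepʳ f aRes (proj₁ w₃) _))) (residual≥0 e)
    ; total≈ = ≈-trans (≈-reflexive (keepʳ f aTotal (proj₂ w₃) 0)) total≈ }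
    where
    open Sound S
    w₀ = ∨-false {writesⁿ 4 p ∨ writesⁿ 5 p} w
    w₁ = ∨-false {writesⁿ 4 p} (proj₁ w₀)
    w₂ = ∨-false {writesʳ 2 p} (proj₂ w₀)
    w₃ = ∨-false {writesʳ aRes p} (proj₂ w₂)

  module Subtracting (P : 𝒫) (σ₀ : Store) where
    a = reals σ₀ aAcc 0

    record Progress (rest : List E) (τ : Store) : Set where
      field
        unique  : Unique rest
        inside  : ∀ e → e ∈ rest → e ∈ edges P
        waiting : ∀ e → e ∈ rest ⊎ e ∉ edges P → residual τ e ≡ residual σ₀ e
        done    : ∀ e → e ∈ edges P → e ∉ rest → residual τ e ≡ residual σ₀ e - a
        flag    : nats τ aOk 0 ≡ 0 ⊎ (nats τ aOk 0 ≡ 1 × nats σ₀ aOk 0 ≡ 1 × (∀ e → e ∈ edges P → e ∉ rest → 0# ≤ residual τ e))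
        success : nats σ₀ aOk 0 ≡ 1 → (∀ e → e ∈ edges P → 0# ≤ residual σ₀ e - a) → nats τ aOk 0 ≡ 1

    subtractᵉ : ∀ {rest σ} e → reals σ aAcc 0 ≡ a → nats σ aEdge 0 ≡ toℕ e → Progress (e ∷ rest) σ → Exec subtract σ 3 (Progress rest)
    subtractᵉ {rest} {σ} e a≡ idx Pr = sub then λ { _ _ refl → ifᵉ
        (λ eq → slower ℕ.≤-refl (straight skip {ok = refl} (kept (subst (0# ≤_) here≡ (does-true (_ ≤? _) eq)))))
        (λ eq → straight fail {ok = refl} (failed (λ le → does-false (_ ≤? _) eq (subst (0# ≤_) (sym here≡) le)))) }
      where
      open Progress Pr
      x = nats σ aEdge 0
      v = reals σ aRes x - reals σ aAcc 0
      σ₁ = store (nats σ) (update (reals σ) aRes x v)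
      sub : Exec (aRes [ var aEdge ]≔ʳ (aRes [ var aEdge ]ʳ) -ʳ (aAcc [ lit 0 ]ʳ)) σ 1 (_≡ σ₁)
      sub = exec assignʳ ℕ.≤-refl refl
      v≡ : v ≡ residual σ₀ e - a
      v≡ = cong₂ _-_ (trans (cong (reals σ aRes) idx) (waiting e (inj₁ (here refl)))) a≡
      here≡ : reals σ₁ aRes x ≡ residual σ₀ e - a
      here≡ = trans (update-same (reals σ) aRes x v) v≡
      at-e : residual σ₁ e ≡ residual σ₀ e - a
      at-e = trans (cong (reals σ₁ aRes) (sym idx)) here≡
      other : ∀ e′ → e′ ≢ e → residual σ₁ e′ ≡ residual σ e′
      other e′ e′≢e = update-index (reals σ) aRes x v aRes (λ eq → e′≢e (Fin.toℕ-injective (trans eq idx)))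
      head∉ : All (e ≢_) rest × Unique rest
      head∉ with unique
      ... | e∉ ∷ u = e∉ , u
      waiting′ : ∀ e′ → e′ ∈ rest ⊎ e′ ∉ edges P → residual σ₁ e′ ≡ residual σ₀ e′
      waiting′ e′ (inj₁ e′∈) = trans (other e′ (λ { refl → All.lookup (proj₁ head∉) e′∈ refl })) (waiting e′ (inj₁ (there e′∈)))
      waiting′ e′ (inj₂ e′∉) = trans (other e′ (λ { refl → e′∉ (inside e (here refl)) })) (waiting e′ (inj₂ e′∉))
      not-in : ∀ {e′} → e′ ≢ e → e′ ∉ rest → e′ ∉ e ∷ rest
      not-in e′≢e e′∉ (here eq)  = e′≢e eq
      not-in e′≢e e′∉ (there e′∈) = e′∉ e′∈
      done′ : ∀ e′ → e′ ∈ edges P → e′ ∉ rest → residual σ₁ e′ ≡ residual σ₀ e′ - a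
      done′ e′ e′∈ e′∉ with e′ Fin.≟ e
      ... | yes refl = at-e
      ... | no e′≢e = trans (other e′ e′≢e) (done e′ e′∈ (not-in e′≢e e′∉))
      kept : 0# ≤ residual σ₀ e - a → Progress rest σ₁
      kept 0≤ = record
        { unique = proj₂ head∉ ; inside = λ e′ e′∈ → inside e′ (there e′∈) ; waiting = waiting′ ; done = done′
        ; flag = flag′ flag ; success = success }
        where
        flag′ : _ → nats σ₁ aOk 0 ≡ 0 ⊎ (nats σ₁ aOk 0 ≡ 1 × nats σ₀ aOk 0 ≡ 1 × (∀ e → e ∈ edges P → e ∉ rest → 0# ≤ residual σ₁ e))
        flag′ (inj₁ ok≡0) = inj₁ ok≡0
        flag′ (inj₂ (ok≡1 , ok₀ , nonneg)) = inj₂ (ok≡1 , ok₀ , nonneg′)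
          where
          nonneg′ : ∀ e′ → e′ ∈ edges P → e′ ∉ rest → 0# ≤ residual σ₁ e′
          nonneg′ e′ e′∈ e′∉ with e′ Fin.≟ e
          ... | yes refl = subst (0# ≤_) (sym at-e) 0≤
          ... | no e′≢e = subst (0# ≤_) (sym (other e′ e′≢e)) (nonneg e′ e′∈ (not-in e′≢e e′∉))
      failed : ¬ (0# ≤ residual σ₀ e - a) → Progress rest (setⁿ aOk 0 σ₁)
      failed ≰ = record
        { unique = proj₂ head∉ ; inside = λ e′ e′∈ → inside e′ (there e′∈) ; waiting = waiting′ ; done = done′
        ; flag = inj₁ refl ; success = λ _ fits → contradiction (fits e (inside e (here refl))) ≰ }

  record Finished (P : 𝒫) (σ τ : Store) : Set where
    field
      sound    : nats τ aOk 0 ≡ 0 ⊎ (nats τ aOk 0 ≡ 1 × ∃[ es ] Sound es τ)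
      complete : ∀ ts ds → Codes (length ts ∷ termCodes ts ds) (nats σ aRem 0) → let a = sum ts termValue in
        0# ≤ a → (∀ e → e ∈ edges P → a ≤ residual σ e) →
        nats τ aOk 0 ≡ 1 × Codes ds (nats τ aRem 0) × (∀ e → residual τ e ≈ residual σ e - when (P ∋? e) a) × reals τ aTotal 0 ≈ reals σ aTotal 0 + a

  finishEntryʰ : ∀ {es σ p} P → Input σ → Sound es σ → nats σ aOk 0 ≡ 1 → PathStored p (edges P) σ →
    Halts (ticked finishEntry) σ (Finished P σ)
  finishEntryʰ {es} {σ} {p} P I S ok path = termsʰ I refl thenʰ λ τ₁ f₁ decoded →
    ifʰ {Q = λ τ → (nats τ aOk 0 ≡ 0 ⊎ (nats τ aOk 0 ≡ 1 × 0# ≤ reals τ aAcc 0)) × (0# ≤ reals τ aAcc 0 → nats τ aOk 0 ≡ 1)}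
      (λ eq → halts (straight skip {ok = refl} (inj₂ (trans (keepⁿ f₁ aOk refl 0) ok , does-true (_ ≤? _) eq) , λ _ → trans (keepⁿ f₁ aOk refl 0) ok)))
      (λ eq → halts (straight fail {ok = refl} (inj₁ refl , λ 0≤ → contradiction 0≤ (does-false (_ ≤? _) eq)))) thenʰ λ τ₂ f₂ (ok₂ , good₂) →
    let path₂ = path-kept refl f₂ (path-kept refl f₁ path)
        S₂ = sound-kept refl f₂ (λ i _ → keepⁿ f₂ 6 refl i) (sound-kept refl f₁ (λ i _ → keepⁿ f₁ 6 refl i) S)
        open Subtracting P τ₂
    in halts (forPathᵉ subtract p (edges P) Progress {refl} (PathStored.start≡ path₂) (PathStored.pos≡ path₂) (PathStored.segment path₂)
      (record { unique = edges-unique P ; inside = λ _ e∈ → e∈ ; waiting = λ _ _ → refl ; done = λ e e∈ e∉ → contradiction e∈ e∉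
              ; flag = start {τ₂} ok₂ ; success = λ ok _ → ok })
      (λ { (inj₁ refl) Pr → record { Progress Pr } ; (inj₂ (inj₁ refl)) Pr → record { Progress Pr } ; (inj₂ (inj₂ refl)) Pr → record { Progress Pr } })
      (λ e rest τ f idx Pr → subtractᵉ e (keepʳ f aAcc refl 0) idx Pr)) thenʰ λ τ₃ f₃ Pr →
    halts (straight (aTotal [ lit 0 ]≔ʳ (aTotal [ lit 0 ]ʳ) +ʳ (aAcc [ lit 0 ]ʳ) ⨾ addEntry (aAcc [ lit 0 ]ʳ)) {ok = refl}
      (conclude τ₁ τ₂ τ₃ f₁ f₂ f₃ decoded ok₂ good₂ (path-kept refl f₃ path₂) S₂ Pr))
    where
    path-kept : ∀ {p′ σ τ} → (writesⁿ 5 p′ ∨ writesⁿ 4 p′) ∨ (writesⁿ aPos p′ ∨ writesⁿ 6 p′) ≡ false →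
      Frame p′ σ τ → PathStored p (edges P) σ → PathStored p (edges P) τ
    path-kept {p′} {σ} w f S = record
      { start≡ = trans (keepⁿ f 5 (proj₁ w₁) _) (trans (cong (nats σ 5) (keepⁿ f 4 (proj₂ w₁) 0)) (PathStored.start≡ S))
      ; pos≡ = trans (keepⁿ f aPos (proj₁ w₂) 0) (PathStored.pos≡ S)
      ; segment = segment-cong p (edges P) (λ i _ → keepⁿ f 6 (proj₂ w₂) i) (PathStored.segment S) }
      where
      w₁ = ∨-false {writesⁿ 5 p′} (proj₁ (∨-false {writesⁿ 5 p′ ∨ writesⁿ 4 p′} w))
      w₂ = ∨-false {writesⁿ aPos p′} (proj₂ (∨-false {writesⁿ 5 p′ ∨ writesⁿ 4 p′} w))
    start : ∀ {τ} → nats τ aOk 0 ≡ 0 ⊎ (nats τ aOk 0 ≡ 1 × 0# ≤ reals τ aAcc 0) →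
      nats τ aOk 0 ≡ 0 ⊎ (nats τ aOk 0 ≡ 1 × nats τ aOk 0 ≡ 1 × (∀ e → e ∈ edges P → e ∉ edges P → 0# ≤ residual τ e))
    start (inj₁ ok≡0) = inj₁ ok≡0
    start (inj₂ (ok≡1 , _)) = inj₂ (ok≡1 , ok≡1 , λ e e∈ e∉ → contradiction e∈ e∉)
    conclude : ∀ τ₁ τ₂ τ₃ → Frame (ticked readTerms) σ τ₁ → Frame (ifᶜ (int (lit 0) ≤ʳ (aAcc [ lit 0 ]ʳ)) skip fail) τ₁ τ₂ → Frame (ticked (forPath subtract)) τ₂ τ₃ →
      (∀ ts ds → Codes (length ts ∷ termCodes ts ds) (nats σ aRem 0) → reals τ₁ aAcc 0 ≈ sum ts termValue × Codes ds (nats τ₁ aRem 0)) →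
      nats τ₂ aOk 0 ≡ 0 ⊎ (nats τ₂ aOk 0 ≡ 1 × 0# ≤ reals τ₂ aAcc 0) → (0# ≤ reals τ₂ aAcc 0 → nats τ₂ aOk 0 ≡ 1) →
      PathStored p (edges P) τ₃ → Sound es τ₂ → Subtracting.Progress P τ₂ [] τ₃ →
      Finished P σ (result (aTotal [ lit 0 ]≔ʳ (aTotal [ lit 0 ]ʳ) +ʳ (aAcc [ lit 0 ]ʳ) ⨾ addEntry (aAcc [ lit 0 ]ʳ)) τ₃)
    conclude τ₁ τ₂ τ₃ f₁ f₂ f₃ decoded ok₂ good₂ path₃ S₂ Pr = record
      { sound = sound flag ; complete = complete }
      where
      open Subtracting P τ₂ using (a)
      open Subtracting.Progress Pr
      τ₄ = setʳ aTotal (reals τ₃ aTotal 0 + reals τ₃ aAcc 0) τ₃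
      acc₃ : reals τ₃ aAcc 0 ≡ a
      acc₃ = keepʳ f₃ aAcc refl 0
      stored₄ : Stored τ₄ es
      stored₄ = stored-transport {τ₂} {τ₄} es (λ j _ → keepⁿ f₃ 5 refl j) (λ i _ → keepⁿ f₃ 6 refl i) (λ j _ → keepʳ f₃ 2 refl j) (Sound.stored S₂)
      counted₄ : nats τ₄ 4 0 ≡ length es
      counted₄ = trans (keepⁿ f₃ 4 refl 0) (Sound.counted S₂)
      start₄ : nats τ₄ 5 (length es) ≡ p
      start₄ = trans (cong (nats τ₃ 5) (sym counted₄)) (PathStored.start≡ path₃)
      appended = addEntry-stored {τ₄} {es} {P} {a} (aAcc [ lit 0 ]ʳ) counted₄ stored₄
        (trans (PathStored.pos≡ path₃) (cong (ℕ._+ length (edges P)) (sym start₄)))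
        (subst (λ p → Segment (nats τ₄ 6) p (edges P)) (sym start₄) (PathStored.segment path₃)) (≈-reflexive acc₃)
      residual₃ : ∀ e → residual τ₃ e ≈ residual τ₂ e - when (P ∋? e) a
      residual₃ e with P ∋? e
      ... | yes e∈ = ≈-reflexive (done e e∈ λ ())
      ... | no e∉ = ≈-trans (≈-reflexive (waiting e (inj₂ e∉))) (solve 1 (λ x → x := x :- :# 0) ≈-refl (residual τ₂ e))
      sound : _ → _
      sound (inj₁ ok≡0) = inj₁ ok≡0
      sound (inj₂ (ok≡1 , ok₂≡1 , nonneg)) = inj₂ (ok≡1 , (P , a) ∷ es , record
        { stored = proj₁ appended ; counted = proj₂ appended
        ; amounts≥0 = 0≤a ok₂ ∷ Sound.amounts≥0 S₂
        ; residual≈ = λ e → ≈-trans (residual₃ e) (≈-trans (+-congʳ (Sound.residual≈ S₂ e))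
            (solve 3 (λ c l w → c :- l :- w := c :- (w :+ l)) ≈-refl (c e) (load es e) (when (P ∋? e) a)))
        ; residual≥0 = residual≥0′
        ; total≈ = ≈-trans (≈-reflexive (cong₂ _+_ (keepʳ f₃ aTotal refl 0) acc₃)) (≈-trans (+-congʳ (Sound.total≈ S₂)) (+-comm _ _)) })
        where
        0≤a : nats τ₂ aOk 0 ≡ 0 ⊎ (nats τ₂ aOk 0 ≡ 1 × 0# ≤ reals τ₂ aAcc 0) → 0# ≤ a
        0≤a (inj₁ ok≡0) with () ← trans (sym ok≡0) ok₂≡1
        0≤a (inj₂ (_ , 0≤a)) = 0≤a
        residual≥0′ : ∀ e → 0# ≤ residual τ₃ e
        residual≥0′ e with P ∋? e
        ... | yes e∈ = nonneg e e∈ λ ()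
        ... | no e∉ = subst (0# ≤_) (sym (waiting e (inj₂ e∉))) (Sound.residual≥0 S₂ e)
      complete : ∀ ts ds → Codes (length ts ∷ termCodes ts ds) (nats σ aRem 0) → _
      complete ts ds codes 0≤sum fits with decoded ts ds codes
      ... | acc≈ , codes₁ =
        success (good₂ (≤-respʳ (≈-sym a≈) 0≤sum))
          (λ e e∈ → x≤y⇒0≤y-x (≤-respˡ (≈-sym a≈) (≤-respʳ (≈-reflexive (sym (residual₂ e))) (fits e e∈)))) ,
        subst (Codes ds) (sym (trans (keepⁿ f₃ aRem refl 0) (keepⁿ f₂ aRem refl 0))) codes₁ ,
        (λ e → ≈-trans (residual₃ e) (+-cong (≈-reflexive (residual₂ e)) (-‿cong (when-value (P ∋? e) (λ _ → a≈))))) ,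
        ≈-trans (≈-reflexive (cong₂ _+_ (trans (keepʳ f₃ aTotal refl 0) (trans (keepʳ f₂ aTotal refl 0) (keepʳ f₁ aTotal refl 0))) acc₃)) (+-congˡ a≈)
        where
        a≈ : a ≈ sum ts termValue
        a≈ = ≈-trans (≈-reflexive (keepʳ f₂ aAcc refl 0)) acc≈
        residual₂ : ∀ e → residual τ₂ e ≡ residual σ e
        residual₂ e = trans (keepʳ f₂ aRes refl _) (keepʳ f₁ aRes refl _)

  onEdges : (E → ℕ) → ℕ → ℕ
  onEdges f j with j ℕ.<? m
  ... | yes j<m = f (fromℕ< j<m)
  ... | no _    = 0

  onEdges-toℕ : ∀ f e → onEdges f (toℕ e) ≡ f e
  onEdges-toℕ f e with toℕ e ℕ.<? m
  ... | yes lt = cong f (Fin.fromℕ<-toℕ e lt)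
  ... | no ≮ = contradiction (Fin.toℕ<n e) ≮

  -- With one more than these as weights, a path of weight at most |P| uses only edges of P.
  offPath : 𝒫 → E → ℕ
  offPath P e with P ∋? e
  ... | yes _ = 0
  ... | no _  = length (edges P)

  offPath-∈ : ∀ P {e} → e ∈ edges P → offPath P e ≡ 0
  offPath-∈ P {e} e∈ with P ∋? e
  ... | yes _ = refl
  ... | no e∉ = contradiction e∈ e∉

  offPath-∉ : ∀ P {e} → e ∉ edges P → offPath P e ≡ length (edges P)
  offPath-∉ P {e} e∉ with P ∋? e
  ... | yes e∈ = contradiction e∈ e∉
  ... | no _ = refl

  entryCode : 𝒫 → List Term → List ℕ → List ℕ
  entryCode P ts ds = values (onEdges (offPath P)) 0 m (length (edges P) ∷ length ts ∷ termCodes ts ds)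

  module _ (P : 𝒫) {w : E → ℕ} (w≡ : ∀ e → w e ≡ suc (offPath P e)) where
    weight-self : ℕ.sum (map w (edges P)) ≡ length (edges P)
    weight-self = go (edges P) (λ _ e∈ → e∈)
      where
      go : ∀ es → (∀ e → e ∈ es → e ∈ edges P) → ℕ.sum (map w es) ≡ length es
      go []       _  = refl
      go (e ∷ es) in-P = cong₂ ℕ._+_ (trans (w≡ e) (cong suc (offPath-∈ P (in-P e (here refl))))) (go es (λ e e∈ → in-P e (there e∈)))

    light⇒⊆ : ∀ es → ℕ.sum (map w es) ℕ.≤ length (edges P) → ∀ e → e ∈ es → e ∈ edges P
    light⇒⊆ (e ∷ es) W≤ .e (here refl) with P ∋? e
    ... | yes e∈ = e∈
    ... | no e∉ = contradiction (ℕ.≤-trans (ℕ.m≤m+n (w e) _) W≤) (ℕ.<⇒≱ (subst (length (edges P) ℕ.<_) (sym (trans (w≡ e) (cong suc (offPath-∉ P e∉)))) ℕ.≤-refl))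
    light⇒⊆ (e ∷ es) W≤ e′ (there e′∈) = light⇒⊆ es (ℕ.≤-trans (ℕ.m≤n+m _ (w e)) W≤) e′ e′∈

  record EntryDone (σ τ : Store) : Set where
    field
      sound    : nats τ aOk 0 ≡ 0 ⊎ (nats τ aOk 0 ≡ 1 × ∃[ es ] Sound es τ)
      complete : ∀ P ts ds → Codes (entryCode P ts ds) (nats σ aRem 0) → let a = sum ts termValue in
        0# ≤ a → (∀ e → when (P ∋? e) a ≤ residual σ e) →
        nats τ aOk 0 ≡ 1 × Codes ds (nats τ aRem 0) × (∀ e → residual σ e - when (P ∋? e) a ≤ residual τ e) × reals τ aTotal 0 ≈ reals σ aTotal 0 + a

  SearchedPath : (w : E → ℕ) (K : ℕ) (σ τ : Store) → Set
  SearchedPath w K σ τ =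
    (nats τ aOk 0 ≡ nats σ aOk 0 × (∀ i → i ℕ.< nats σ 5 (nats σ 4 0) → nats τ 6 i ≡ nats σ 6 i) ×
      ∃[ P ] ℕ.sum (map w (edges P)) ℕ.≤ K × PathStored (nats σ 5 (nats σ 4 0)) (edges P) τ) ⊎
    (nats τ aOk 0 ≡ 0 × (∀ P → K ℕ.< ℕ.sum (map w (edges P))))

  weights-kept : ∀ {k σ τ p} → writesⁿ aW p ≡ false → Frame p σ τ → Guessed k m σ → ∀ e → 1 ℕ.≤ nats τ aW (toℕ e)
  weights-kept w f (pos , _) e = subst (1 ℕ.≤_) (sym (keepⁿ f aW w _)) (pos e (Fin.toℕ<n e))

  entryʰ : ∀ {es σ} → 𝒫 → Input σ → Sound es σ → nats σ aOk 0 ≡ 1 → Halts (ticked checkEntry) σ (EntryDone σ)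
  entryʰ {es} {σ} P₀ I S ok = guessWeightsʰ I refl thenʰ λ τ₁ f₁ guessed → readʰ refl thenʰ λ τ₂ f₂ r → setⁿʰ aK (var aHead) thenʰ λ { τ₃ f₃ refl →
    let I₃ = input-kept refl f₃ (input-kept refl f₂ (input-kept refl f₁ I))
        S₃ = sound-kept refl f₃ (λ i _ → keepⁿ f₃ 6 refl i) (sound-kept refl f₂ (λ i _ → keepⁿ f₂ 6 refl i) (sound-kept refl f₁ (λ i _ → keepⁿ f₁ 6 refl i) S))
        w = λ e → nats τ₃ aW (toℕ e)
        open Searching w (weights-kept {p = ticked read} refl f₂ guessed)
    in halts {Q = SearchedPath w (nats τ₂ aHead 0) τ₃} (searchᵉ {skip} {fail} P₀ I₃ (record { w≡ = λ _ → refl }) refl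
         (λ P υ W≤ g stored below → straight skip {ok = refl} (inj₁ (keepⁿ g aOk refl 0 , below , P , W≤ , stored)))
         (λ υ g far → straight fail {ok = refl} (inj₂ (refl , far))))
    thenʰ λ τ₄ f₄ searched → finish τ₁ τ₂ f₁ f₂ guessed r I₃ S₃ τ₄ f₄ searched }
    where
    finish : ∀ τ₁ τ₂ → Frame (ticked guessWeights) σ τ₁ → Frame (ticked read) τ₁ τ₂ → Guessed (nats σ aRem 0) m τ₁ → Read (nats τ₁ aRem 0) τ₂ →
      let τ₃ = setⁿ aK (nats τ₂ aHead 0) τ₂ in Input τ₃ → Sound es τ₃ →
      ∀ τ₄ → Frame (ticked (search skip fail)) τ₃ τ₄ → SearchedPath (λ e → nats τ₃ aW (toℕ e)) (nats τ₂ aHead 0) τ₃ τ₄ →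
      Halts (ticked (ifᶜ (lit 0 <ⁿ var aOk) finishEntry skip)) τ₄ (EntryDone σ)
    finish τ₁ τ₂ f₁ f₂ guessed r I₃ S₃ τ₄ f₄ (inj₂ (ok≡0 , far)) = ifʰ
      (λ eq → contradiction (<ᵇ-true eq) (λ lt → ℕ.<⇒≱ lt (ℕ.≤-reflexive ok≡0)))
      (λ _ → halts (straight skip {ok = refl} (record { sound = inj₁ ok≡0 ; complete = λ P ts ds codes _ _ →
        let (w₁≡ , codes₁) = proj₂ guessed (onEdges (offPath P)) _ codes
            (K≡ , _) = read-codes (nats τ₁ aRem 0) τ₂ (length (edges P)) (length ts ∷ termCodes ts ds) r
              (values-end (onEdges (offPath P)) (length (edges P) ∷ length ts ∷ termCodes ts ds) codes₁)
        in contradiction (far P) (ℕ.≤⇒≯ (ℕ.≤-reflexive (trans (weight-self P (decoded P w₁≡)) (sym K≡)))) })))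
      where
      decoded : ∀ P → (∀ (e : E) → toℕ e ℕ.< m → nats τ₁ aW (toℕ e) ≡ suc (onEdges (offPath P) (toℕ e))) → ∀ e → nats τ₂ aW (toℕ e) ≡ suc (offPath P e)
      decoded P w≡ e = trans (keepⁿ f₂ aW refl _) (trans (w≡ e (Fin.toℕ<n e)) (cong suc (onEdges-toℕ (offPath P) e)))
    finish τ₁ τ₂ f₁ f₂ guessed r I₃ S₃ τ₄ f₄ (inj₁ (ok≡ , below , P′ , W≤ , stored)) = ifʰ
      (λ eq → weakenʰ (λ υ _ F → record { sound = Finished.sound F ; complete = λ P ts ds codes 0≤a fits →
        let (w₁≡ , codes₁) = proj₂ guessed (onEdges (offPath P)) _ codes
            (K≡ , codes₂) = read-codes (nats τ₁ aRem 0) τ₂ (length (edges P)) (length ts ∷ termCodes ts ds) r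
              (values-end (onEdges (offPath P)) (length (edges P) ∷ length ts ∷ termCodes ts ds) codes₁)
            P′⊆P = light⇒⊆ P (decoded P w₁≡) (edges P′) (subst (ℕ.sum (map (λ e → nats τ₂ aW (toℕ e)) (edges P′)) ℕ.≤_) K≡ W≤)
            (ok′ , codes₃ , residual′ , total′) = Finished.complete F ts ds (subst (Codes _) (sym (keepⁿ f₄ aRem refl 0)) codes₂) 0≤a
              (λ e e∈ → ≤-respˡ (whenever (P ∋? e) (P′⊆P e e∈)) (≤-respʳ (≈-reflexive (sym (residual₄ e))) (fits e)))
        in ok′ , codes₃ ,
           (λ e → ≤-respʳ (≈-sym (residual′ e)) (≤-by _ (x≤y⇒0≤y-x (smaller (P′ ∋? e) (P ∋? e) (P′⊆P e) 0≤a))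
             (≈-trans (+-congʳ (≈-reflexive (residual₄ e))) (solve 3 (λ r w w′ → r :- w′ := r :- w :+ (w :- w′)) ≈-refl (residual σ e) (when (P ∋? e) (sum ts termValue)) (when (P′ ∋? e) (sum ts termValue)))))) ,
           ≈-trans total′ (+-congʳ (≈-reflexive total₄)) })
        (finishEntryʰ P′ (input-kept refl f₄ I₃) (sound-kept refl f₄ below S₃) ok₄ stored))
      (λ eq → contradiction (<ᵇ-false eq) (ℕ.<⇒≱ (subst (0 ℕ.<_) (sym ok₄) (s≤s z≤n))))
      where
      ok₄ : nats τ₄ aOk 0 ≡ 1
      ok₄ = trans ok≡ (trans (keepⁿ f₂ aOk refl 0) (trans (keepⁿ f₁ aOk refl 0) ok))
      residual₄ : ∀ e → residual τ₄ e ≡ residual σ e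
      residual₄ e = trans (keepʳ f₄ aRes refl _) (trans (keepʳ f₂ aRes refl _) (keepʳ f₁ aRes refl _))
      total₄ : reals τ₄ aTotal 0 ≡ reals σ aTotal 0
      total₄ = trans (keepʳ f₄ aTotal refl 0) (trans (keepʳ f₂ aTotal refl 0) (keepʳ f₁ aTotal refl 0))
      decoded : ∀ P → (∀ (e : E) → toℕ e ℕ.< m → nats τ₁ aW (toℕ e) ≡ suc (onEdges (offPath P) (toℕ e))) → ∀ e → nats τ₂ aW (toℕ e) ≡ suc (offPath P e)
      decoded P w≡ e = trans (keepⁿ f₂ aW refl _) (trans (w≡ e (Fin.toℕ<n e)) (cong suc (onEdges-toℕ (offPath P) e)))
      whenever : ∀ {A : Set} (A? : Dec A) {v} → A → when A? v ≈ v
      whenever (yes _) _ = ≈-refl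
      whenever (no ¬a) a = contradiction a ¬a
      smaller : ∀ {A B : Set} (A? : Dec A) (B? : Dec B) {v} → (A → B) → 0# ≤ v → when A? v ≤ when B? v
      smaller (yes a) (yes b) _ _   = ≤-refl
      smaller (yes a) (no ¬b) f _   = contradiction (f a) ¬b
      smaller (no _)  B?      _ 0≤v = when-nonNeg B? 0≤v

  Targets : Set
  Targets = List (𝒫 × List Term)

  valued : Targets → Entries
  valued = map (λ (P , ts) → P , sum ts termValue)

  entryCodes : Targets → List ℕ → List ℕ
  entryCodes []                 ds = ds
  entryCodes ((P , ts) ∷ targets) ds = entryCode P ts (entryCodes targets ds)

  record EntriesDone (j : ℕ) (σ τ : Store) : Set where
    field
      sound    : nats τ aOk 0 ≡ 0 ⊎ (nats τ aOk 0 ≡ 1 × ∃[ es ] Sound es τ)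
      complete : ∀ targets ds → length targets ≡ j → Codes (entryCodes targets ds) (nats σ aRem 0) →
        AmountsNonNegative (valued targets) → (∀ e → load (valued targets) e ≤ residual σ e) →
        nats τ aOk 0 ≡ 1 × Codes ds (nats τ aRem 0) × reals τ aTotal 0 ≈ reals σ aTotal 0 + total (valued targets)

  entriesʰ : ∀ j {es σ} → 𝒫 → Input σ → Sound es σ → nats σ aOk 0 ≡ 1 → nats σ aJ 0 ≡ j → Halts (ticked checkEntries) σ (EntriesDone j σ)
  entriesʰ zero {es} {σ} P₀ I S ok J≡ = halts (exit (cong (_∧ (0 <ᵇ nats σ aOk 0)) (≤⇒<ᵇ-false (ℕ.≤-reflexive J≡))) (record
    { sound = inj₂ (ok , es , S) ; complete = λ { [] ds _ codes _ _ → ok , codes , ≈-sym (+-identityʳ _) } }))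
  entriesʰ (suc j) {es} {σ} P₀ I S ok J≡ = unrollʰ
    (cong₂ _∧_ (<⇒<ᵇ-true (subst (0 ℕ.<_) (sym J≡) (s≤s z≤n))) (<⇒<ᵇ-true (subst (0 ℕ.<_) (sym ok) (s≤s z≤n))))
    (tickʰ thenʰ λ { τ₁ f₁ refl → setⁿʰ aJ (var aJ ⊖ lit 1) thenʰ λ { τ₂ f₂ refl →
     weakenʰ (λ τ f D → next τ f D)
       (entryʰ P₀ (input-kept refl f₂ (input-kept refl f₁ I))
         (sound-kept refl f₂ (λ i _ → keepⁿ f₂ 6 refl i) (sound-kept refl f₁ (λ i _ → keepⁿ f₁ 6 refl i) S)) ok) } })
    where
    σ₂ = setⁿ aJ (nats σ aJ 0 ℕ.∸ 1) (setⁿ clock (nats σ clock 0 ℕ.+ 1) σ)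
    next : ∀ τ → Frame (ticked checkEntry) σ₂ τ → EntryDone σ₂ τ → Halts (ticked checkEntries) τ (EntriesDone (suc j) σ)
    next τ f D with EntryDone.sound D
    ... | inj₁ ok≡0 = halts (exit (trans (cong ((0 <ᵇ nats τ aJ 0) ∧_) (≤⇒<ᵇ-false (ℕ.≤-reflexive ok≡0))) (∧-false _)) (record
        { sound = inj₁ ok≡0
        ; complete = λ { ((P , ts) ∷ targets) ds len codes (0≤a ∷ 0≤) fits →
            contradiction (trans (sym (proj₁ (EntryDone.complete D P ts (entryCodes targets ds) codes 0≤a
              (λ e → ≤-trans (x≤x+y (load-nonNeg (valued targets) e 0≤)) (fits e))))) ok≡0) λ () } }))
    ... | inj₂ (ok₁ , es′ , S′) = weakenʰ (λ υ _ X → record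
        { sound = EntriesDone.sound X
        ; complete = λ { ((P , ts) ∷ targets) ds len codes (0≤a ∷ 0≤) fits →
            let (_ , codes₁ , residual₁ , total₁) = EntryDone.complete D P ts (entryCodes targets ds) codes 0≤a
                  (λ e → ≤-trans (x≤x+y (load-nonNeg (valued targets) e 0≤)) (fits e))
                (ok′ , codes₂ , total₂) = EntriesDone.complete X targets ds (ℕ.suc-injective len) codes₁ 0≤
                  (λ e → ≤-trans (≤-by _ (x≤y⇒0≤y-x (fits e)) (solve 3 (λ w l r → r :- w := l :+ (r :- (w :+ l))) ≈-refl (when (P ∋? e) (sum ts termValue)) (load (valued targets) e) (residual σ e)))
                    (residual₁ e))
            in ok′ , codes₂ , ≈-trans total₂ (≈-trans (+-congʳ total₁) (+-assoc _ _ _)) } })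
        (entriesʰ j P₀ (input-kept refl f (record { Input I })) S′ ok₁
          (trans (keepⁿ f aJ refl 0) (cong (ℕ._∸ 1) J≡)))

module Certificate {R : RealNumbers} (N : Network R) (ε : RealNumbers.ℝ R) where
  open Programs
  open import Data.Nat as ℕ using (ℕ; zero; suc; z≤n; s≤s)
  import Data.Nat.Properties as ℕ
  open RealArithmetic R
  open Sums R
  open Hoare R
  open Halting R
  open FlowTheory N
  open StrongDuality N using (Optimum; strong-duality; RationalAmounts)
  open Machine N ε
  open ShortestPath N ε
  open PathLoop N ε
  open PathSearch N ε
  open Output N ε
  open Exact N ε
  open Network N
  open Flows N

  costBelow : ℕ → (ℕ → ℕ) → ℝ
  costBelow j Y = sum (allFin m) (λ e → when (toℕ e ℕ.<? j) (c e * fromℕ (Y (toℕ e))))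

  costBelow-0 : ∀ Y → costBelow 0 Y ≈ 0#
  costBelow-0 Y = sum-zero (allFin m)

  costBelow-m : ∀ Y → costBelow m Y ≈ totalCapacity (λ e → fromℕ (Y (toℕ e)))
  costBelow-m Y = sum-cong (allFin m) (λ e _ → inside (toℕ e ℕ.<? m) (Fin.toℕ<n e))
    where
    inside : ∀ {A : Set} (A? : Dec A) {v} → A → when A? v ≈ v
    inside (yes _) _ = ≈-refl
    inside (no ¬a) a = contradiction a ¬a

  costBelow-step : ∀ e {Y Y′} → (∀ e′ → e′ ≢ e → Y′ (toℕ e′) ≡ Y (toℕ e′)) →
    costBelow (suc (toℕ e)) Y′ ≈ costBelow (toℕ e) Y + c e * fromℕ (Y′ (toℕ e))
  costBelow-step e {Y} {Y′} same = ≈-trans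
    (sum-cong (allFin m) (λ e′ _ → split e′ (toℕ e′ ℕ.<? suc (toℕ e)) (toℕ e′ ℕ.<? toℕ e) (e′ Fin.≟ e)))
    (≈-trans (sum-+ (allFin m) _ _) (+-congˡ (sum-point-∈ Fin._≟_ (Unique.allFin⁺ m) (∈-allFin e))))
    where
    split : ∀ e′ (a : Dec (toℕ e′ ℕ.< suc (toℕ e))) (b : Dec (toℕ e′ ℕ.< toℕ e)) (d : Dec (e′ ≡ e)) →
      when a (c e′ * fromℕ (Y′ (toℕ e′))) ≈ when b (c e′ * fromℕ (Y (toℕ e′))) + when d (c e * fromℕ (Y′ (toℕ e)))
    split e′ (yes a) (yes b) (yes refl) = contradiction b (ℕ.<-irrefl refl)
    split e′ (yes a) (yes b) (no d) = ≈-trans (≈-reflexive (cong (λ k → c e′ * fromℕ k) (same e′ d))) (≈-sym (+-identityʳ _))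
    split e′ (yes a) (no b) (yes refl) = ≈-sym (+-identityˡ _)
    split e′ (yes a) (no b) (no d) = contradiction (ℕ.≤∧≢⇒< (ℕ.≤-pred a) (λ eq → d (Fin.toℕ-injective eq))) b
    split e′ (no a) (yes b) d = contradiction (ℕ.m<n⇒m<1+n b) a
    split e′ (no a) (no b) (yes refl) = contradiction ℕ.≤-refl a
    split e′ (no a) (no b) (no d) = ≈-sym (+-identityˡ _)

  record Costed (k j : ℕ) (σ₀ τ : Store) : Set where
    field
      cost≈   : reals τ aCost 0 ≈ costBelow j (nats τ aDual)
      flag    : nats τ aOk 0 ≡ 0 ⊎ (nats τ aOk 0 ≡ 1 × (∀ (e : E) → toℕ e ℕ.< j → nats σ₀ aW (toℕ e) ℕ.≤ n ℕ.* nats τ aDual (toℕ e) ℕ.+ 1))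
      decoded : ∀ f ds → Codes (values f 0 m ds) k →
        (∀ (e : E) → toℕ e ℕ.< j → nats τ aDual (toℕ e) ≡ f (toℕ e)) × Codes (values f j (m ℕ.∸ j) ds) (nats τ aRem 0) ×
        ((∀ (e : E) → nats σ₀ aW (toℕ e) ℕ.≤ n ℕ.* f (toℕ e) ℕ.+ 1) → nats τ aOk 0 ≡ 1)

  addCostʰ : ∀ {k σ₀ σ} e → Input σ → nats σ aEdge 0 ≡ toℕ e → (∀ x → nats σ aW x ≡ nats σ₀ aW x) → Costed k (toℕ e) σ₀ σ →
    Halts (ticked addCost) σ (Costed k (suc (toℕ e)) σ₀)
  addCostʰ {k} {σ₀} {σ} e I idx W≡ X = readʰ refl thenʰ λ τ f r →
    halts (store-dual τ) thenʰ λ { _ _ refl → halts (add-cost τ) thenʰ λ { _ _ refl → ifʰ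
      (λ eq → halts (straight skip {ok = refl} (accept τ f r (nat-bound τ f (does-true (_ ≤? _) eq)))))
      (λ eq → halts (straight fail {ok = refl} (reject τ f r (λ le → does-false (_ ≤? _) eq (real-bound τ f le))))) } }
    where
    open Costed X
    module _ (τ : Store) where
      x = nats τ aEdge 0
      y = nats τ aHead 0
      τ₁ = store (update (nats τ) aDual x y) (reals τ)
      v = reals τ aCost 0 + reals τ 1 x * fromℕ y
      τ₂ = setʳ aCost v τ₁
      store-dual : Exec (aDual [ var aEdge ]≔ⁿ var aHead) τ 1 (_≡ τ₁)
      store-dual = exec assignⁿ ℕ.≤-refl refl
      add-cost : Exec (aCost [ lit 0 ]≔ʳ (aCost [ lit 0 ]ʳ) +ʳ (1 [ var aEdge ]ʳ) *ʳ int (var aHead)) τ₁ 1 (_≡ τ₂)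
      add-cost = exec assignʳ ℕ.≤-refl refl
      module _ (f : Frame (ticked read) σ τ) where
        x≡ : x ≡ toℕ e
        x≡ = trans (keepⁿ f aEdge refl 0) idx
        w≡ : nats τ aW x ≡ nats σ₀ aW (toℕ e)
        w≡ = trans (cong (nats τ aW) x≡) (trans (keepⁿ f aW refl _) (W≡ _))
        n≡ : nats τ 0 0 ≡ n
        n≡ = trans (keepⁿ f 0 refl 0) (Input.n≡ I)
        bound≈ : fromℕ (nats τ 0 0) * fromℕ y + fromℕ 1 ≈ fromℕ (n ℕ.* y ℕ.+ 1)
        bound≈ = ≈-trans (+-congʳ (≈-trans (*-congʳ (fromℕ-cong n≡)) (≈-sym (fromℕ-* n y)))) (≈-sym (fromℕ-+ (n ℕ.* y) 1))
        nat-bound : fromℕ (nats τ aW x) ≤ fromℕ (nats τ 0 0) * fromℕ y + fromℕ 1 → nats σ₀ aW (toℕ e) ℕ.≤ n ℕ.* y ℕ.+ 1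
        nat-bound le = subst (ℕ._≤ n ℕ.* y ℕ.+ 1) w≡ (fromℕ-cancel-≤ (≤-respʳ bound≈ le))
        real-bound : nats σ₀ aW (toℕ e) ℕ.≤ n ℕ.* y ℕ.+ 1 → fromℕ (nats τ aW x) ≤ fromℕ (nats τ 0 0) * fromℕ y + fromℕ 1
        real-bound le = ≤-respʳ (≈-sym bound≈) (fromℕ-mono (subst (ℕ._≤ n ℕ.* y ℕ.+ 1) (sym w≡) le))
        dual-here : nats τ₁ aDual (toℕ e) ≡ y
        dual-here = trans (cong (nats τ₁ aDual) (sym x≡)) (update-same (nats τ) aDual x y)
        dual-other : ∀ (e′ : E) → e′ ≢ e → nats τ₁ aDual (toℕ e′) ≡ nats σ aDual (toℕ e′)
        dual-other e′ e′≢e = trans (update-index (nats τ) aDual x y aDual (λ eq → e′≢e (Fin.toℕ-injective (trans eq x≡)))) (keepⁿ f aDual refl _)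
        before : ∀ {e′ : E} → e′ ≢ e → toℕ e′ ℕ.< suc (toℕ e) → toℕ e′ ℕ.< toℕ e
        before e′≢e lt = ℕ.≤∧≢⇒< (ℕ.≤-pred lt) (λ eq → e′≢e (Fin.toℕ-injective eq))
        cost′ : v ≈ costBelow (suc (toℕ e)) (nats τ₁ aDual)
        cost′ = ≈-trans (+-cong (≈-trans (≈-reflexive (keepʳ f aCost refl 0)) cost≈)
            (≈-reflexive (cong₂ (λ a b → a * fromℕ b) (trans (cong (reals τ 1) x≡) (trans (keepʳ f 1 refl _) (Input.c≡ I e))) (sym dual-here))))
          (≈-sym (costBelow-step e {nats σ aDual} {nats τ₁ aDual} dual-other))
        module _ (r : Read (nats σ aRem 0) τ) where
          read-dual : ∀ g ds → Codes (values g 0 m ds) k →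
            (∀ (e′ : E) → toℕ e′ ℕ.< suc (toℕ e) → nats τ₁ aDual (toℕ e′) ≡ g (toℕ e′)) × Codes (values g (suc (toℕ e)) (m ℕ.∸ suc (toℕ e)) ds) (nats τ aRem 0) × y ≡ g (toℕ e)
          read-dual g ds codes with decoded g ds codes
          ... | old , rest , _ with read-codes (nats σ aRem 0) τ (g (toℕ e)) (values g (suc (toℕ e)) (m ℕ.∸ suc (toℕ e)) ds) r
                                      (subst (λ xs → Codes xs (nats σ aRem 0)) (values-step g (Fin.toℕ<n e)) rest)
          ...   | y≡ , rest′ = new , rest′ , y≡
            where
            new : ∀ (e′ : E) → toℕ e′ ℕ.< suc (toℕ e) → nats τ₁ aDual (toℕ e′) ≡ g (toℕ e′)
            new e′ lt with e′ Fin.≟ e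
            ... | yes refl = trans dual-here y≡
            ... | no e′≢e = trans (dual-other e′ e′≢e) (old e′ (before e′≢e lt))
          accept : nats σ₀ aW (toℕ e) ℕ.≤ n ℕ.* y ℕ.+ 1 → Costed k (suc (toℕ e)) σ₀ τ₂
          accept le = record { cost≈ = cost′ ; flag = flag′ flag ; decoded = λ g ds codes → let (new , rest , _) = read-dual g ds codes in
            new , rest , λ fits → trans (keepⁿ f aOk refl 0) (proj₂ (proj₂ (decoded g ds codes)) fits) }
            where
            flag′ : _ → _
            flag′ (inj₁ ok≡0) = inj₁ (trans (keepⁿ f aOk refl 0) ok≡0)
            flag′ (inj₂ (ok≡1 , below)) = inj₂ (trans (keepⁿ f aOk refl 0) ok≡1 , below′)
              where
              below′ : ∀ (e′ : E) → toℕ e′ ℕ.< suc (toℕ e) → nats σ₀ aW (toℕ e′) ℕ.≤ n ℕ.* nats τ₁ aDual (toℕ e′) ℕ.+ 1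
              below′ e′ lt with e′ Fin.≟ e
              ... | yes refl = subst (λ y → nats σ₀ aW (toℕ e) ℕ.≤ n ℕ.* y ℕ.+ 1) (sym dual-here) le
              ... | no e′≢e = subst (λ y → nats σ₀ aW (toℕ e′) ℕ.≤ n ℕ.* y ℕ.+ 1) (sym (dual-other e′ e′≢e)) (below e′ (before e′≢e lt))
          reject : ¬ (nats σ₀ aW (toℕ e) ℕ.≤ n ℕ.* y ℕ.+ 1) → Costed k (suc (toℕ e)) σ₀ (setⁿ aOk 0 τ₂)
          reject ≰ = record { cost≈ = cost′ ; flag = inj₁ refl ; decoded = λ g ds codes → let (new , rest , y≡) = read-dual g ds codes in
            new , rest , λ fits → contradiction (subst (λ y → nats σ₀ aW (toℕ e) ℕ.≤ n ℕ.* y ℕ.+ 1) (sym y≡) (fits e)) ≰ }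

  dualCostʰ : ∀ {k σ} → Input σ → nats σ aRem 0 ≡ k → nats σ aOk 0 ≡ 1 → Halts (ticked dualCost) σ (Costed k m σ)
  dualCostʰ {k} {σ} I rem≡ ok = setʳʰ aCost (int (lit 0)) thenʰ λ { _ f₀ refl →
    forʰ aEdge input-m addCost m (λ j τ → Costed k j σ τ) {refl} (λ τ f → Input.m≡ (input-kept refl f (input-kept refl f₀ I)))
      (record { cost≈ = ≈-sym (costBelow-0 (nats σ aDual)) ; flag = inj₂ (ok , λ _ ())
              ; decoded = λ f ds codes → (λ _ ()) , subst (Codes (values f 0 m ds)) (sym rem≡) codes , λ _ → ok })
      (λ X → record { Costed X }) (λ X → record { Costed X })
      (λ e τ f idx X → addCostʰ e (input-kept refl f (input-kept refl f₀ I)) idx (λ x → keepⁿ f aW refl x) X) }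

  record DualScaled (σ τ : Store) : Set where
    field
      flag    : nats τ aOk 0 ≡ 0 ⊎ (nats τ aOk 0 ≡ 1 × nats σ aOk 0 ≡ 1 × nats τ aD 0 ℕ.* n ℕ.≤ nats τ aK 0 ℕ.+ 1 ×
                  1 ℕ.≤ nats τ aD 0 × reals σ aCost 0 ≤ fromℕ (nats τ aD 0) * reals σ aTotal 0)
      decoded : ∀ d k ds → Codes (d ∷ k ∷ ds) (nats σ aRem 0) → nats σ aOk 0 ≡ 1 → suc d ℕ.* n ℕ.≤ k ℕ.+ 1 →
        reals σ aCost 0 ≤ fromℕ (suc d) * reals σ aTotal 0 → nats τ aOk 0 ≡ 1 × nats τ aK 0 ≡ k

  dualScaleʰ : ∀ {σ} → Input σ → nats σ aOk 0 ≡ 0 ⊎ nats σ aOk 0 ≡ 1 → Halts (ticked dualScale) σ (DualScaled σ)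
  dualScaleʰ {σ} I bit = readʰ refl thenʰ λ τ₁ f₁ r₁ → setⁿʰ aD (var aHead ⊕ lit 1) thenʰ λ { _ f₂ refl →
    readʰ refl thenʰ λ τ₂ f₃ r₂ → setⁿʰ aK (var aHead) thenʰ λ { _ f₄ refl →
    let n≡ = trans (keepⁿ f₃ 0 refl 0) (trans (keepⁿ f₁ 0 refl 0) (Input.n≡ I))
        D≡ = keepⁿ f₃ aD refl 0
        ok≡ = trans (keepⁿ f₃ aOk refl 0) (keepⁿ f₁ aOk refl 0)
        cost≡ = trans (keepʳ f₃ aCost refl 0) (keepʳ f₁ aCost refl 0)
        total≡ = trans (keepʳ f₃ aTotal refl 0) (keepʳ f₁ aTotal refl 0)
    in checks τ₁ τ₂ (setⁿ aK (nats τ₂ aHead 0) τ₂) n≡ D≡ refl ok≡ cost≡ total≡ r₁ r₂ } }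
    where
    checks : ∀ τ₁ τ₂ τ → nats τ 0 0 ≡ n → nats τ aD 0 ≡ nats τ₁ aHead 0 ℕ.+ 1 → nats τ aK 0 ≡ nats τ₂ aHead 0 → nats τ aOk 0 ≡ nats σ aOk 0 →
      reals τ aCost 0 ≡ reals σ aCost 0 → reals τ aTotal 0 ≡ reals σ aTotal 0 → Read (nats σ aRem 0) τ₁ → Read (nats τ₁ aRem 0) τ₂ →
      Halts (ifᶜ (int (var aD) *ʳ int input-n ≤ʳ int (var aK ⊕ lit 1)) skip fail ⨾ ifᶜ (aCost [ lit 0 ]ʳ ≤ʳ int (var aD) *ʳ (aTotal [ lit 0 ]ʳ)) skip fail) τ (DualScaled σ)
    checks τ₁ τ₂ τ n≡ D≡ K≡ ok≡ cost≡ total≡ r₁ r₂ =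
      ifʰ {Q = λ υ → AfterFirst υ}
        (λ eq → halts (straight skip {ok = refl} (inj₂ (refl , nat-first (does-true (_ ≤? _) eq)))))
        (λ eq → halts (straight fail {ok = refl} (inj₁ (refl , λ le → does-false (_ ≤? _) eq (real-first le)))))
      thenʰ λ υ f first → ifʰ
        (λ eq → halts (straight skip {ok = refl} (accept υ f first (does-true (_ ≤? _) eq))))
        (λ eq → halts (straight fail {ok = refl} (reject υ f first (does-false (_ ≤? _) eq))))
      where
      D = nats τ aD 0
      K = nats τ aK 0
      First = ifᶜ (int (var aD) *ʳ int input-n ≤ʳ int (var aK ⊕ lit 1)) skip fail
      AfterFirst : Store → Set
      AfterFirst υ = (nats υ aOk 0 ≡ 0 × ¬ (D ℕ.* n ℕ.≤ K ℕ.+ 1)) ⊎ (nats υ aOk 0 ≡ nats τ aOk 0 × D ℕ.* n ℕ.≤ K ℕ.+ 1)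
      first≈ : fromℕ D * fromℕ (nats τ 0 0) ≈ fromℕ (D ℕ.* n)
      first≈ = ≈-trans (*-congˡ (fromℕ-cong n≡)) (≈-sym (fromℕ-* D n))
      nat-first : fromℕ D * fromℕ (nats τ 0 0) ≤ fromℕ (K ℕ.+ 1) → D ℕ.* n ℕ.≤ K ℕ.+ 1
      nat-first le = fromℕ-cancel-≤ (≤-respˡ first≈ le)
      real-first : D ℕ.* n ℕ.≤ K ℕ.+ 1 → fromℕ D * fromℕ (nats τ 0 0) ≤ fromℕ (K ℕ.+ 1)
      real-first le = ≤-respˡ (≈-sym first≈) (fromℕ-mono le)
      1≤D : 1 ℕ.≤ D
      1≤D = subst (1 ℕ.≤_) (sym D≡) (ℕ.m≤n+m 1 _)
      codes-D : ∀ d k ds → Codes (d ∷ k ∷ ds) (nats σ aRem 0) → D ≡ suc d × K ≡ k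
      codes-D d k ds codes with read-codes (nats σ aRem 0) τ₁ d (k ∷ ds) r₁ codes
      ... | d≡ , codes′ with read-codes (nats τ₁ aRem 0) τ₂ k ds r₂ codes′
      ...   | k≡ , _ = trans D≡ (trans (cong (ℕ._+ 1) d≡) (ℕ.+-comm d 1)) , trans K≡ k≡
      module _ (υ : Store) (f : Frame First τ υ) where
        D′ = keepⁿ f aD refl 0
        K′ = keepⁿ f aK refl 0
        cost′ = trans (keepʳ f aCost refl 0) cost≡
        total′ = trans (keepʳ f aTotal refl 0) total≡
        Cheap : Set
        Cheap = reals υ aCost 0 ≤ fromℕ (nats υ aD 0) * reals υ aTotal 0
        cheap⇒ : Cheap → reals σ aCost 0 ≤ fromℕ (nats υ aD 0) * reals σ aTotal 0
        cheap⇒ = subst₂ (λ a b → a ≤ fromℕ (nats υ aD 0) * b) cost′ total′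
        cheap⇐ : ∀ d → D ≡ suc d → reals σ aCost 0 ≤ fromℕ (suc d) * reals σ aTotal 0 → Cheap
        cheap⇐ d d≡ le = subst (λ k → reals υ aCost 0 ≤ fromℕ k * reals υ aTotal 0) (sym (trans D′ d≡))
          (subst₂ (λ a b → a ≤ fromℕ (suc d) * b) (sym cost′) (sym total′) le)
        accept : AfterFirst υ → Cheap → DualScaled σ υ
        accept first cheap = record { flag = flag′ bit first ; decoded = decoded′ first }
          where
          flag′ : nats σ aOk 0 ≡ 0 ⊎ nats σ aOk 0 ≡ 1 → AfterFirst υ → _
          flag′ _ (inj₁ (ok≡0 , _)) = inj₁ ok≡0
          flag′ (inj₁ zero-bit) (inj₂ (ok′ , le)) = inj₁ (trans ok′ (trans ok≡ zero-bit))
          flag′ (inj₂ one-bit) (inj₂ (ok′ , le)) = inj₂ (trans ok′ (trans ok≡ one-bit) , one-bit ,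
                  subst₂ (λ d k → d ℕ.* n ℕ.≤ k ℕ.+ 1) (sym D′) (sym K′) le , subst (1 ℕ.≤_) (sym D′) 1≤D , cheap⇒ cheap)
          decoded′ : AfterFirst υ → ∀ d k ds → Codes (d ∷ k ∷ ds) (nats σ aRem 0) → nats σ aOk 0 ≡ 1 → suc d ℕ.* n ℕ.≤ k ℕ.+ 1 →
            reals σ aCost 0 ≤ fromℕ (suc d) * reals σ aTotal 0 → nats υ aOk 0 ≡ 1 × nats υ aK 0 ≡ k
          decoded′ (inj₁ (_ , ≰)) d k ds codes ok le _ with codes-D d k ds codes
          ... | d≡ , k≡ = contradiction (subst₂ (λ d k → d ℕ.* n ℕ.≤ k ℕ.+ 1) (sym d≡) (sym k≡) le) ≰
          decoded′ (inj₂ (ok′ , _)) d k ds codes ok le _ with codes-D d k ds codes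
          ... | d≡ , k≡ = trans ok′ (trans ok≡ ok) , trans K′ k≡
        reject : AfterFirst υ → ¬ Cheap → DualScaled σ (setⁿ aOk 0 υ)
        reject first ≰ = record { flag = inj₁ refl ; decoded = λ d k ds codes ok le cheap → contradiction (cheap⇐ d (proj₁ (codes-D d k ds codes)) cheap) ≰ }

  Optimal : Entries → Set
  Optimal es = ∀ x → Feasible x → flowValue x ≤ total es

  record DualDone (es : Entries) (σ τ : Store) : Set where
    field
      sound    : nats τ aOk 0 ≡ 0 ⊎ (nats τ aOk 0 ≡ 1 × Sound es τ × Optimal es)
      complete : ∀ y d k ds → suc k ≡ suc d ℕ.* n → Codes (values (onEdges (λ e → n ℕ.* y e)) 0 m (values (onEdges y) 0 m (d ∷ k ∷ ds))) (nats σ aRem 0) →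
        (∀ P → suc d ℕ.≤ ℕ.sum (map y (edges P))) → totalCapacity (fromℕ ∘ y) ≤ fromℕ (suc d) * reals σ aTotal 0 → nats τ aOk 0 ≡ 1

  SearchedDual : (w : E → ℕ) (K : ℕ) (σ τ : Store) → Set
  SearchedDual w K σ τ =
    (nats τ aOk 0 ≡ 0 × ∃[ P ] ℕ.sum (map w (edges P)) ℕ.≤ K) ⊎
    (nats τ aOk 0 ≡ nats σ aOk 0 × (∀ i → nats τ 6 i ≡ nats σ 6 i) × (∀ P → K ℕ.< ℕ.sum (map w (edges P))))

  -- Since |P| < n, weights n y + 1 tell apart y(P) < d and y(P) ≥ d by comparison with d n − 1.
  module _ {w y : E → ℕ} where
    sum-≤ : ∀ P → (∀ e → w e ℕ.≤ n ℕ.* y e ℕ.+ 1) → ℕ.sum (map w P) ℕ.≤ n ℕ.* ℕ.sum (map y P) ℕ.+ length P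
    sum-≤ []      w≤ = z≤n
    sum-≤ (e ∷ P) w≤ = ℕ.≤-trans (ℕ.+-mono-≤ (w≤ e) (sum-≤ P w≤)) (ℕ.≤-reflexive (regroup n (y e) (ℕ.sum (map y P)) (length P)))
      where
      regroup : ∀ n a b l → (n ℕ.* a ℕ.+ 1) ℕ.+ (n ℕ.* b ℕ.+ l) ≡ n ℕ.* (a ℕ.+ b) ℕ.+ suc l
      regroup = solve-∀

    sum-≥ : ∀ P → (∀ e → w e ≡ suc (n ℕ.* y e)) → n ℕ.* ℕ.sum (map y P) ℕ.+ length P ℕ.≤ ℕ.sum (map w P)
    sum-≥ []      w≡ = ℕ.≤-reflexive (trans (ℕ.+-identityʳ _) (ℕ.*-zeroʳ n))
    sum-≥ (e ∷ P) w≡ = ℕ.≤-trans (ℕ.≤-reflexive (regroup n (y e) (ℕ.sum (map y P)) (length P))) (ℕ.+-mono-≤ (ℕ.≤-reflexive (sym (w≡ e))) (sum-≥ P w≡))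
      where
      regroup : ∀ n a b l → n ℕ.* (a ℕ.+ b) ℕ.+ suc l ≡ suc (n ℕ.* a) ℕ.+ (n ℕ.* b ℕ.+ l)
      regroup = solve-∀

    heavy⇒dual : ∀ {D K} P → (∀ e → w e ℕ.≤ n ℕ.* y e ℕ.+ 1) → D ℕ.* n ℕ.≤ K ℕ.+ 1 → K ℕ.< ℕ.sum (map w (edges P)) → D ℕ.≤ ℕ.sum (map y (edges P))
    heavy⇒dual {D} {K} P w≤ D≤ K< = ℕ.≤-pred (ℕ.*-cancelˡ-< n D (suc (ℕ.sum (map y (edges P)))) (begin-strict
      n ℕ.* D                                       ≡⟨ ℕ.*-comm n D ⟩
      D ℕ.* n                                       ≤⟨ D≤ ⟩
      K ℕ.+ 1                                       ≡⟨ ℕ.+-comm K 1 ⟩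
      suc K                                         ≤⟨ K< ⟩
      ℕ.sum (map w (edges P))                       ≤⟨ sum-≤ (edges P) w≤ ⟩
      n ℕ.* ℕ.sum (map y (edges P)) ℕ.+ length (edges P) <⟨ ℕ.+-monoʳ-< (n ℕ.* ℕ.sum (map y (edges P))) (length<n P) ⟩
      n ℕ.* ℕ.sum (map y (edges P)) ℕ.+ n           ≡⟨ trans (ℕ.+-comm _ n) (sym (ℕ.*-suc n _)) ⟩
      n ℕ.* suc (ℕ.sum (map y (edges P))) ∎))
      where open ℕ.≤-Reasoning

    dual⇒heavy : ∀ {d k} P → (∀ e → w e ≡ suc (n ℕ.* y e)) → suc k ≡ suc d ℕ.* n → suc d ℕ.≤ ℕ.sum (map y (edges P)) → k ℕ.< ℕ.sum (map w (edges P))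
    dual⇒heavy {d} {k} P w≡ k≡ d≤ = begin
      suc k                                              ≡⟨ k≡ ⟩
      suc d ℕ.* n                                        ≡⟨ ℕ.*-comm (suc d) n ⟩
      n ℕ.* suc d                                        ≤⟨ ℕ.*-monoʳ-≤ n d≤ ⟩
      n ℕ.* ℕ.sum (map y (edges P))                      ≤⟨ ℕ.m≤m+n _ _ ⟩
      n ℕ.* ℕ.sum (map y (edges P)) ℕ.+ length (edges P) ≤⟨ sum-≥ (edges P) w≡ ⟩
      ℕ.sum (map w (edges P)) ∎
      where open ℕ.≤-Reasoning

  dual⇒optimal : ∀ {es y D} → 1 ℕ.≤ D → (∀ P → D ℕ.≤ ℕ.sum (map y (edges P))) → totalCapacity (fromℕ ∘ y) ≤ fromℕ D * total es → Optimal es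
  dual⇒optimal {es} {y} {D} 1≤D covers cost x feasible = *-cancelˡ-≤ (fromℕ D) (fromℕ-pos 1≤D) (≤-trans
    (≤-respˡ (≈-trans (sum-cong allPaths (λ P _ → *-comm (amount x P) (fromℕ D))) (sum-* allPaths (fromℕ D) (amount x)))
      (sum-mono allPaths (λ P _ → *-monoʳ-≤ (amount x P) (nonNegative x P) (≤-respʳ (sum-fromℕ (edges P) y) (fromℕ-mono (covers P))))))
    (≤-trans (weak-duality x feasible (fromℕ ∘ y) (λ e → fromℕ-nonNeg (y e))) cost))

  dualCheckʰ : ∀ {es σ} → 𝒫 → Input σ → Sound es σ → nats σ aOk 0 ≡ 1 → Halts (ticked dualCheck) σ (DualDone es σ)
  dualCheckʰ {es} {σ} P₀ I S ok = guessWeightsʰ I refl thenʰ λ τ₁ f₁ guessed →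
    dualCostʰ (input-kept refl f₁ I) refl (trans (keepⁿ f₁ aOk refl 0) ok) thenʰ λ τ₂ f₂ costed →
    dualScaleʰ (input-kept refl f₂ (input-kept refl f₁ I)) (bit (Costed.flag costed)) thenʰ λ τ₃ f₃ scaled →
    let I₃ = input-kept refl f₃ (input-kept refl f₂ (input-kept refl f₁ I))
        w = λ e → nats τ₃ aW (toℕ e)
        w-same = λ x → trans (keepⁿ f₃ aW refl x) (keepⁿ f₂ aW refl x)
        open Searching w (λ e → subst (1 ℕ.≤_) (sym (w-same _)) (proj₁ guessed e (Fin.toℕ<n e)))
    in weakenʰ (λ υ h searched → finish τ₁ τ₂ τ₃ υ f₁ f₂ f₃ guessed costed scaled w-same h searched)
      (halts {Q = SearchedDual w (nats τ₃ aK 0) τ₃} (searchᵉ {fail} {skip} P₀ I₃ (record { w≡ = λ _ → refl }) refl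
        (λ P υ W≤ g stored below → straight fail {ok = refl} (inj₁ (refl , P , W≤)))
        (λ υ g far → straight skip {ok = refl} (inj₂ (keepⁿ g aOk refl 0 , (λ i → keepⁿ g 6 refl i) , far)))))
    where
    bit : ∀ {a} {A : Set} → a ≡ 0 ⊎ (a ≡ 1 × A) → a ≡ 0 ⊎ a ≡ 1
    bit (inj₁ eq) = inj₁ eq
    bit (inj₂ (eq , _)) = inj₂ eq
    finish : ∀ τ₁ τ₂ τ₃ υ → Frame (ticked guessWeights) σ τ₁ → Frame (ticked dualCost) τ₁ τ₂ → Frame (ticked dualScale) τ₂ τ₃ →
      Guessed (nats σ aRem 0) m τ₁ → Costed (nats τ₁ aRem 0) m τ₁ τ₂ → DualScaled τ₂ τ₃ → (∀ x → nats τ₃ aW x ≡ nats τ₁ aW x) →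
      Frame (ticked (search fail skip)) τ₃ υ → SearchedDual (λ e → nats τ₃ aW (toℕ e)) (nats τ₃ aK 0) τ₃ υ → DualDone es σ υ
    finish τ₁ τ₂ τ₃ υ f₁ f₂ f₃ guessed costed scaled w-same h searched = record { sound = sound searched ; complete = complete searched }
      where
      y₂ : E → ℕ
      y₂ e = nats τ₂ aDual (toℕ e)
      total₂ : reals τ₂ aTotal 0 ≡ reals σ aTotal 0
      total₂ = trans (keepʳ f₂ aTotal refl 0) (keepʳ f₁ aTotal refl 0)
      cost₂ : reals τ₂ aCost 0 ≈ totalCapacity (fromℕ ∘ y₂)
      cost₂ = ≈-trans (Costed.cost≈ costed) (costBelow-m (nats τ₂ aDual))
      sound : SearchedDual (λ e → nats τ₃ aW (toℕ e)) (nats τ₃ aK 0) τ₃ υ → _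
      sound (inj₁ (ok≡0 , _)) = inj₁ ok≡0
      sound (inj₂ (ok≡ , cells , far)) with DualScaled.flag scaled | Costed.flag costed
      ... | inj₁ ok≡0 | _ = inj₁ (trans ok≡ ok≡0)
      ... | inj₂ (_ , ok₂ , _) | inj₁ ok≡0 = contradiction (trans (sym ok₂) ok≡0) λ ()
      ... | inj₂ (ok₃ , _ , D≤ , 1≤D , cheap) | inj₂ (_ , w≤) = inj₂ (trans ok≡ ok₃ ,
          sound-kept refl h (λ i _ → cells i) (sound-kept refl f₃ (λ i _ → keepⁿ f₃ 6 refl i) (sound-kept refl f₂ (λ i _ → keepⁿ f₂ 6 refl i)
            (sound-kept refl f₁ (λ i _ → keepⁿ f₁ 6 refl i) S))) ,
          dual⇒optimal {es} {y₂} 1≤D (λ P → heavy⇒dual {λ e → nats τ₃ aW (toℕ e)} {y₂} P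
              (λ e → subst (ℕ._≤ n ℕ.* y₂ e ℕ.+ 1) (sym (w-same (toℕ e))) (w≤ e (Fin.toℕ<n e))) D≤ (far P))
            (≤-respˡ cost₂ (≤-respʳ (*-congˡ (≈-trans (≈-reflexive total₂) (Sound.total≈ S))) cheap)))
      complete : SearchedDual (λ e → nats τ₃ aW (toℕ e)) (nats τ₃ aK 0) τ₃ υ → ∀ y d k ds → suc k ≡ suc d ℕ.* n → _ →
        (∀ P → suc d ℕ.≤ ℕ.sum (map y (edges P))) → totalCapacity (fromℕ ∘ y) ≤ fromℕ (suc d) * reals σ aTotal 0 → nats υ aOk 0 ≡ 1
      complete searched y d k ds k≡ codes covers cheap = conclude searched
        where
        first = proj₂ guessed (onEdges (λ e → n ℕ.* y e)) (values (onEdges y) 0 m (d ∷ k ∷ ds)) codes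
        w≡ : ∀ e → nats τ₁ aW (toℕ e) ≡ suc (n ℕ.* y e)
        w≡ e = trans (proj₁ first e (Fin.toℕ<n e)) (cong suc (onEdges-toℕ (λ e → n ℕ.* y e) e))
        second = Costed.decoded costed (onEdges y) (d ∷ k ∷ ds) (values-end (onEdges (λ e → n ℕ.* y e)) _ (proj₂ first))
        y≡ : ∀ e → y₂ e ≡ y e
        y≡ e = trans (proj₁ second e (Fin.toℕ<n e)) (onEdges-toℕ y e)
        ok₂ : nats τ₂ aOk 0 ≡ 1
        ok₂ = proj₂ (proj₂ second) (λ e → ℕ.≤-reflexive (trans (w≡ e) (trans (ℕ.+-comm 1 _) (cong (λ y → n ℕ.* y ℕ.+ 1) (sym (onEdges-toℕ y e))))))
        third = DualScaled.decoded scaled d k ds (values-end (onEdges y) (d ∷ k ∷ ds) (proj₁ (proj₂ second))) ok₂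
          (ℕ.≤-reflexive (trans (sym k≡) (ℕ.+-comm 1 k)))
          (≤-respˡ (≈-sym (≈-trans cost₂ (sum-cong (allFin m) (λ e _ → *-congˡ (fromℕ-cong (y≡ e)))))) (≤-respʳ (*-congˡ (≈-reflexive (sym total₂))) cheap))
        conclude : SearchedDual (λ e → nats τ₃ aW (toℕ e)) (nats τ₃ aK 0) τ₃ υ → nats υ aOk 0 ≡ 1
        conclude (inj₁ (_ , P , W≤)) = contradiction (subst (ℕ.sum (map (λ e → nats τ₃ aW (toℕ e)) (edges P)) ℕ.≤_) (proj₂ third) W≤)
          (ℕ.<⇒≱ (dual⇒heavy {λ e → nats τ₃ aW (toℕ e)} {y} P (λ e → trans (w-same _) (w≡ e)) k≡ (covers P)))
        conclude (inj₂ (ok≡ , _)) = trans ok≡ (proj₁ third)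

  record AttemptDone (σ τ : Store) : Set where
    field
      sound    : nats τ aOk 0 ≡ 0 ⊎ (nats τ aOk 0 ≡ 1 × ∃[ es ] Sound es τ × Optimal es)
      complete : ∀ targets y d k → suc k ≡ suc d ℕ.* n →
        Codes (length targets ∷ entryCodes targets (values (onEdges (λ e → n ℕ.* y e)) 0 m (values (onEdges y) 0 m (d ∷ k ∷ [])))) (nats σ aCode 0) →
        AmountsNonNegative (valued targets) → (∀ e → load (valued targets) e ≤ c e) →
        (∀ P → suc d ℕ.≤ ℕ.sum (map y (edges P))) → totalCapacity (fromℕ ∘ y) ≤ fromℕ (suc d) * total (valued targets) → nats τ aOk 0 ≡ 1

  Unused : ℕ → Store → Set
  Unused j τ = ∀ (e : E) → toℕ e ℕ.< j → residual τ e ≡ c e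

  attemptʰ : ∀ {σ} → 𝒫 → Input σ → Halts (ticked attempt) σ (AttemptDone σ)
  attemptʰ {σ} P₀ I = setⁿʰ aRem (var aCode) thenʰ λ { _ f₁ refl → setⁿʰ aOk (lit 1) thenʰ λ { _ f₂ refl →
    setⁿʰ 4 (lit 0) thenʰ λ { _ f₃ refl → setⁿʰ 5 (lit 0) thenʰ λ { _ f₄ refl → setʳʰ aTotal (int (lit 0)) thenʰ λ { _ f₅ refl →
    let I₅ = input-kept refl f₅ (input-kept refl f₄ (input-kept refl f₃ (input-kept refl f₂ (input-kept refl f₁ I)))) in
    forʰ aEdge input-m (aRes [ var aEdge ]≔ʳ (1 [ var aEdge ]ʳ)) m Unused {refl} (λ τ f → Input.m≡ (input-kept refl f I₅)) (λ _ ()) (λ U → U) (λ U → U)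
      (λ e τ f idx U → halts (straight (aRes [ var aEdge ]≔ʳ (1 [ var aEdge ]ʳ)) {ok = refl} (reset {τ} e (input-kept refl f I₅) idx U)))
    thenʰ λ τ₁ g₁ unused → readʰ (keepⁿ g₁ aRem refl 0) thenʰ λ τ₂ g₂ r → setⁿʰ aJ (var aHead) thenʰ λ { _ g₃ refl →
    let τ₃ = setⁿ aJ (nats τ₂ aHead 0) τ₂
        I₃ = input-kept refl g₃ (input-kept refl g₂ (input-kept refl g₁ I₅))
        residual₃ = λ e → trans (keepʳ g₂ aRes refl _) (unused e (Fin.toℕ<n e))
        total₃ = trans (keepʳ g₂ aTotal refl 0) (keepʳ g₁ aTotal refl 0)
        S₃ : Sound [] τ₃
        S₃ = record
          { stored = trans (keepⁿ g₂ 5 refl 0) (keepⁿ g₁ 5 refl 0) ; counted = trans (keepⁿ g₂ 4 refl 0) (keepⁿ g₁ 4 refl 0)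
          ; amounts≥0 = [] ; residual≈ = λ e → ≈-trans (≈-reflexive (residual₃ e)) (solve 1 (λ x → x := x :- :# 0) ≈-refl (c e))
          ; residual≥0 = λ e → ≤-respʳ (≈-reflexive (sym (residual₃ e))) (proj₁ (c-positive e)) ; total≈ = ≈-reflexive total₃ }
    in entriesʰ (nats τ₂ aHead 0) P₀ I₃ S₃ (trans (keepⁿ g₂ aOk refl 0) (keepⁿ g₁ aOk refl 0)) refl
    thenʰ λ τ₄ g₄ E → finish τ₂ r residual₃ total₃ τ₄ (input-kept refl g₄ I₃) E } } } } } }
    where
    reset : ∀ {τ} e → Input τ → nats τ aEdge 0 ≡ toℕ e → Unused (toℕ e) τ → Unused (suc (toℕ e)) (result (aRes [ var aEdge ]≔ʳ (1 [ var aEdge ]ʳ)) τ)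
    reset {τ} e Iτ idx U e′ lt with e′ Fin.≟ e
    ... | yes refl = trans (cong (update (reals τ) aRes x (reals τ 1 x) aRes) (sym idx)) (trans (update-same (reals τ) aRes x (reals τ 1 x))
        (trans (cong (reals τ 1) idx) (Input.c≡ Iτ e)))
      where x = nats τ aEdge 0
    ... | no e′≢e = trans (update-index (reals τ) aRes x (reals τ 1 x) aRes (λ eq → e′≢e (Fin.toℕ-injective (trans eq idx))))
        (U e′ (ℕ.≤∧≢⇒< (ℕ.≤-pred lt) (λ eq → e′≢e (Fin.toℕ-injective eq))))
      where x = nats τ aEdge 0
    finish : ∀ τ₂ → let τ₃ = setⁿ aJ (nats τ₂ aHead 0) τ₂ in Read (nats σ aCode 0) τ₂ → (∀ e → residual τ₃ e ≡ c e) → reals τ₃ aTotal 0 ≡ 0# →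
      ∀ τ₄ → Input τ₄ → EntriesDone (nats τ₂ aHead 0) τ₃ τ₄ → Halts (ticked (ifᶜ (lit 0 <ⁿ var aOk) dualCheck skip)) τ₄ (AttemptDone σ)
    finish τ₂ r residual₃ total₃ τ₄ I₄ E = branch (EntriesDone.sound E)
      where
      all-entries : ∀ targets ds → Codes (length targets ∷ entryCodes targets ds) (nats σ aCode 0) →
        AmountsNonNegative (valued targets) → (∀ e → load (valued targets) e ≤ c e) →
        nats τ₄ aOk 0 ≡ 1 × Codes ds (nats τ₄ aRem 0) × reals τ₄ aTotal 0 ≈ total (valued targets)
      all-entries targets ds codes 0≤ fits with read-codes (nats σ aCode 0) τ₂ (length targets) (entryCodes targets ds) r codes
      ... | len , codes′ with EntriesDone.complete E targets ds (sym len) codes′ 0≤ (λ e → ≤-respʳ (≈-reflexive (sym (residual₃ e))) (fits e))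
      ...   | ok₄ , codes″ , total₄ = ok₄ , codes″ , ≈-trans total₄ (≈-trans (+-congʳ (≈-reflexive total₃)) (+-identityˡ _))
      branch : nats τ₄ aOk 0 ≡ 0 ⊎ (nats τ₄ aOk 0 ≡ 1 × ∃[ es ] Sound es τ₄) → Halts (ticked (ifᶜ (lit 0 <ⁿ var aOk) dualCheck skip)) τ₄ (AttemptDone σ)
      branch (inj₁ ok≡0) = ifʰ (λ eq → contradiction (<ᵇ-true eq) (λ lt → ℕ.<⇒≱ lt (ℕ.≤-reflexive ok≡0)))
        (λ _ → halts (straight skip {ok = refl} (record { sound = inj₁ ok≡0
          ; complete = λ targets y d k k≡ codes 0≤ fits _ _ → proj₁ (all-entries targets _ codes 0≤ fits) })))
      branch (inj₂ (ok≡1 , es , S)) = ifʰ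
        (λ _ → weakenʰ (λ υ _ D → record { sound = sound (DualDone.sound D)
          ; complete = λ targets y d k k≡ codes 0≤ fits covers cheap →
              let (_ , codes′ , total≈) = all-entries targets _ codes 0≤ fits
              in DualDone.complete D y d k [] k≡ codes′ covers (≤-respʳ (*-congˡ (≈-sym total≈)) cheap) })
          (dualCheckʰ P₀ I₄ S ok≡1))
        (λ eq → contradiction (<ᵇ-false eq) (ℕ.<⇒≱ (subst (0 ℕ.<_) (sym ok≡1) (s≤s z≤n))))
        where
        sound : ∀ {υ} → nats υ aOk 0 ≡ 0 ⊎ (nats υ aOk 0 ≡ 1 × Sound es υ × Optimal es) → nats υ aOk 0 ≡ 0 ⊎ (nats υ aOk 0 ≡ 1 × ∃[ es ] Sound es υ × Optimal es)
        sound (inj₁ ok≡0) = inj₁ ok≡0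
        sound (inj₂ (ok≡1 , S , O)) = inj₂ (ok≡1 , es , S , O)

  -- The search for a certificate ends because of strong duality.

  targets-of : ∀ es → RationalAmounts es → ∃[ targets ] (∀ e → load (valued targets) e ≈ load es e) × total (valued targets) ≈ total es ×
    (AmountsNonNegative es → AmountsNonNegative (valued targets))
  targets-of [] [] = [] , (λ _ → ≈-refl) , ≈-refl , λ _ → []
  targets-of ((P , a) ∷ es) ((ts , a≈) ∷ rs) with targets-of es rs
  ... | targets , load≈ , total≈ , 0≤ = (P , ts) ∷ targets ,
    (λ e → +-cong (when-value (P ∋? e) (λ _ → ≈-sym a≈)) (load≈ e)) , +-cong (≈-sym a≈) total≈ ,
    λ { (0≤a ∷ 0≤es) → ≤-respʳ a≈ 0≤a ∷ 0≤ 0≤es }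

  1≤n : 1 ℕ.≤ n
  1≤n = ℕ.≤-trans (s≤s z≤n) (Fin.toℕ<n s)

  Certifies : ℕ → Set
  Certifies code = ∀ {σ τ} → nats σ aCode 0 ≡ code → AttemptDone σ τ → nats τ aOk 0 ≡ 1

  certifying : Optimum → ∃[ code ] Certifies code
  certifying O with targets-of (Optimum.entries O) (Optimum.rational O)
  ... | targets , load≈ , total≈ , 0≤ = proj₁ coded , λ {σ} {τ} → check {σ} {τ}
    where
    open Optimum O
    k = ℕ.pred (suc scale-1 ℕ.* n)
    k≡ : suc k ≡ suc scale-1 ℕ.* n
    k≡ = ℕ.suc-pred (suc scale-1 ℕ.* n) ⦃ ℕ.>-nonZero (ℕ.≤-trans 1≤n (ℕ.m≤m+n n _)) ⦄
    digits = length targets ∷ entryCodes targets (values (onEdges (λ e → n ℕ.* dual e)) 0 m (values (onEdges dual) 0 m (scale-1 ∷ k ∷ [])))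
    coded = encode digits
    check : Certifies (proj₁ coded)
    check code≡ A = AttemptDone.complete A targets dual scale-1 k k≡
      (subst (Codes digits) (sym code≡) (proj₂ coded)) (0≤ amounts≥0) (λ e → ≤-respˡ (≈-sym (load≈ e)) (feasible e))
      dual-feasible (≤-respʳ (*-congˡ (≈-sym total≈)) no-gap)

  abstract
    certificate : ∃[ code ] Certifies code
    certificate = certifying strong-duality

  ExactlySolved : Store → Set
  ExactlySolved τ = ∃[ X ] Optimal (Solution.entries {τ} X)

  exactʰ : ∀ {σ} → 𝒫 → Input σ → Halts (ticked exact) σ ExactlySolved
  exactʰ {σ} P₀ I = setⁿʰ aCode (lit 0) thenʰ λ { _ f₁ refl → setⁿʰ aOk (lit 0) thenʰ λ { _ f₂ refl →
    loop code* 0 _ (input-kept refl f₂ (input-kept refl f₁ I)) refl refl (ℕ.+-identityʳ code*) } }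
    where
    code* = proj₁ certificate
    Step = attempt ⨾ aCode [ lit 0 ]≔ⁿ var aCode ⊕ lit 1
    Loop = ticked (while (var aOk <ⁿ lit 1) Step)
    finished : ∀ {τ es} → Sound es τ → Optimal es → ExactlySolved τ
    finished {τ} {es} S O = record { entries = es ; stored = stored ; counted = counted ; amounts≥0 = amounts≥0
      ; feasible = λ e → ≤-by (residual τ e) (residual≥0 e) (≈-trans (solve 2 (λ c l → c := l :+ (c :- l)) ≈-refl (c e) (load es e)) (+-congˡ (≈-sym (residual≈ e)))) } , O
      where open Sound S
    loop : ∀ left j τ → Input τ → nats τ aCode 0 ≡ j → nats τ aOk 0 ≡ 0 → left ℕ.+ j ≡ code* → Halts Loop τ ExactlySolved
    loop left j τ I code≡ ok≡0 sum = unrollʰ (<⇒<ᵇ-true (subst (ℕ._< 1) (sym ok≡0) (s≤s z≤n)))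
      (tickʰ thenʰ λ { _ f₁ refl → attemptʰ P₀ (input-kept refl f₁ I) thenʰ λ υ f₂ A →
        halts (exec assignⁿ ℕ.≤-refl (next left j υ sum (input-kept refl f₂ (input-kept refl f₁ I)) (trans (keepⁿ f₂ aCode refl 0) code≡)
          (AttemptDone.sound A) (λ j≡ → proj₂ certificate {setⁿ clock (nats τ clock 0 ℕ.+ 1) τ} {υ} (trans code≡ j≡) A))) })
      where
      next : ∀ left j υ → left ℕ.+ j ≡ code* → Input υ → nats υ aCode 0 ≡ j →
        nats υ aOk 0 ≡ 0 ⊎ (nats υ aOk 0 ≡ 1 × ∃[ es ] Sound es υ × Optimal es) → (j ≡ code* → nats υ aOk 0 ≡ 1) →
        Halts Loop (setⁿ aCode (nats υ aCode 0 ℕ.+ 1) υ) ExactlySolved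
      next left j υ sum I code≡ (inj₂ (ok≡1 , es , S , O)) _ =
        halts (exit (≤⇒<ᵇ-false (ℕ.≤-reflexive (sym ok≡1))) (finished (sound-kept {p = aCode [ lit 0 ]≔ⁿ var aCode ⊕ lit 1} refl (run-frame assignⁿ) (λ _ _ → refl) S) O))
      next zero j υ sum I code≡ (inj₁ ok≡0) done = contradiction (trans (sym (done sum)) ok≡0) λ ()
      next (suc left) j υ sum I code≡ (inj₁ ok≡0) _ = loop left (suc j) _ (record { Input I }) (trans (cong (ℕ._+ 1) code≡) (ℕ.+-comm j 1))
        ok≡0 (trans (ℕ.+-suc left j) sum)

open Programs
open import Data.Nat as ℕ using (ℕ; zero; suc; z≤n; s≤s)
import Data.Nat.Properties as ℕ

module TimeBound {R : RealNumbers} (N : Network R) (ε : RealNumbers.ℝ R) where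
  open Network N
  open Approximation N ε

  iteration-bound : ∀ q → 1 ℕ.≤ m → 1 ℕ.≤ n → suc (iterationTimeFor q) ℕ.≤ 79 ℕ.* (m ℕ.* (suc q ℕ.* n))
  iteration-bound q 1≤m 1≤n = begin
    suc (iterationTimeFor q)                      ≡⟨ expand m n (suc q ℕ.* n) ⟩
    22 ℕ.+ 10 ℕ.* m ℕ.+ 8 ℕ.* K ℕ.+ 19 ℕ.* (m ℕ.* K) ℕ.+ 20 ℕ.* n ≤⟨ ℕ.+-mono-≤ (ℕ.+-monoˡ-≤ (19 ℕ.* (m ℕ.* K)) (ℕ.+-mono-≤ (ℕ.+-mono-≤
        (ℕ.*-monoʳ-≤ 22 (ℕ.*-mono-≤ 1≤m 1≤K)) (ℕ.*-monoʳ-≤ 10 m≤)) (ℕ.*-monoʳ-≤ 8 K≤))) (ℕ.*-monoʳ-≤ 20 (ℕ.≤-trans n≤K K≤)) ⟩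
    22 ℕ.* (m ℕ.* K) ℕ.+ 10 ℕ.* (m ℕ.* K) ℕ.+ 8 ℕ.* (m ℕ.* K) ℕ.+ 19 ℕ.* (m ℕ.* K) ℕ.+ 20 ℕ.* (m ℕ.* K) ≡⟨ collect (m ℕ.* K) ⟩
    79 ℕ.* (m ℕ.* K) ∎
    where
    open ℕ.≤-Reasoning
    K = suc q ℕ.* n
    n≤K : n ℕ.≤ K
    n≤K = ℕ.m≤m+n n (q ℕ.* n)
    1≤K : 1 ℕ.≤ K
    1≤K = ℕ.≤-trans 1≤n n≤K
    m≤ : m ℕ.≤ m ℕ.* K
    m≤ = ℕ.≤-trans (ℕ.≤-reflexive (sym (ℕ.*-identityʳ m))) (ℕ.*-monoʳ-≤ m 1≤K)
    K≤ : K ℕ.≤ m ℕ.* K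
    K≤ = ℕ.≤-trans (ℕ.≤-reflexive (sym (ℕ.*-identityˡ K))) (ℕ.*-monoˡ-≤ K 1≤m)
    expand : ∀ m n K → suc (1 ℕ.+ ((2 ℕ.+ m ℕ.* (3 ℕ.+ (1 ℕ.+ suc (K ℕ.* 3)))) ℕ.+
      ((1 ℕ.+ ((2 ℕ.+ m ℕ.* (3 ℕ.+ 2)) ℕ.+ 1)) ℕ.+ (2 ℕ.+ K ℕ.* (3 ℕ.+ (1 ℕ.+ ((2 ℕ.+ m ℕ.* (3 ℕ.+ 6)) ℕ.+ (2 ℕ.+ m ℕ.* (3 ℕ.+ 4)))))) ℕ.+
        suc ((1 ℕ.+ (1 ℕ.+ (n ℕ.* 5 ℕ.+ 1))) ℕ.+ (1 ℕ.+ ((1 ℕ.+ (n ℕ.* (4 ℕ.+ 2) ℕ.+ 1)) ℕ.+ ((1 ℕ.+ (n ℕ.* (4 ℕ.+ 5) ℕ.+ 1)) ℕ.+ 3)))))))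
      ≡ 22 ℕ.+ 10 ℕ.* m ℕ.+ 8 ℕ.* K ℕ.+ 19 ℕ.* (m ℕ.* K) ℕ.+ 20 ℕ.* n
    expand = solve-∀
    collect : ∀ k → 22 ℕ.* k ℕ.+ 10 ℕ.* k ℕ.+ 8 ℕ.* k ℕ.+ 19 ℕ.* k ℕ.+ 20 ℕ.* k ≡ 79 ℕ.* k
    collect = solve-∀

  x≤x*y : ∀ x {y} → 1 ℕ.≤ y → x ℕ.≤ x ℕ.* y
  x≤x*y x 1≤y = ℕ.≤-trans (ℕ.≤-reflexive (sym (ℕ.*-identityʳ x))) (ℕ.*-monoʳ-≤ x 1≤y)

  x≤y*x : ∀ x {y} → 1 ℕ.≤ y → x ℕ.≤ y ℕ.* x
  x≤y*x x {y} 1≤y = ℕ.≤-trans (x≤x*y x 1≤y) (ℕ.≤-reflexive (ℕ.*-comm x y))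

  square : ℕ → ℕ → ℕ
  square Λ q = Λ ℕ.* (suc q ℕ.* suc q)

  1≤square : ∀ {Λ} q → 1 ℕ.≤ Λ → 1 ℕ.≤ square Λ q
  1≤square q 1≤Λ = ℕ.*-mono-≤ 1≤Λ (s≤s (z≤n {q ℕ.+ q ℕ.* suc q}))

  iterations-bound : ∀ q Λ → 1 ℕ.≤ m → 1 ℕ.≤ Λ → iterationsFor q Λ ℕ.≤ 7 ℕ.* (m ℕ.* square Λ q)
  iterations-bound q Λ 1≤m 1≤Λ = begin
    phasesFor q Λ ℕ.+ m ℕ.* (Λ ℕ.* q ℕ.+ phasesFor q Λ ℕ.+ 2)
      ≤⟨ ℕ.+-mono-≤ phases≤ (ℕ.*-monoʳ-≤ m (ℕ.+-mono-≤ (ℕ.+-mono-≤ Λq≤ phases≤) (ℕ.*-monoʳ-≤ 2 (1≤square q 1≤Λ)))) ⟩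
    2 ℕ.* A ℕ.+ m ℕ.* (A ℕ.+ 2 ℕ.* A ℕ.+ 2 ℕ.* A)
      ≤⟨ ℕ.+-monoˡ-≤ _ (ℕ.*-monoʳ-≤ 2 (x≤y*x A 1≤m)) ⟩
    2 ℕ.* (m ℕ.* A) ℕ.+ m ℕ.* (A ℕ.+ 2 ℕ.* A ℕ.+ 2 ℕ.* A) ≡⟨ collect m A ⟩
    7 ℕ.* (m ℕ.* A) ∎
    where
    open ℕ.≤-Reasoning
    A = square Λ q
    collect : ∀ m a → 2 ℕ.* (m ℕ.* a) ℕ.+ m ℕ.* (a ℕ.+ 2 ℕ.* a ℕ.+ 2 ℕ.* a) ≡ 7 ℕ.* (m ℕ.* a)
    collect = solve-∀
    q≤ : q ℕ.≤ suc q
    q≤ = ℕ.n≤1+n q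
    Λq≤ : Λ ℕ.* q ℕ.≤ A
    Λq≤ = ℕ.*-monoʳ-≤ Λ (ℕ.≤-trans q≤ (x≤x*y (suc q) (s≤s z≤n)))
    phases≤ : phasesFor q Λ ℕ.≤ 2 ℕ.* A
    phases≤ = ℕ.≤-trans (ℕ.+-mono-≤
        (ℕ.≤-trans (ℕ.*-mono-≤ q≤ (ℕ.*-monoʳ-≤ Λ q≤)) (ℕ.≤-reflexive (swap (suc q) Λ)))
        (ℕ.≤-trans (x≤x*y (suc q) (s≤s (z≤n {q}))) (x≤y*x (suc q ℕ.* suc q) 1≤Λ)))
      (ℕ.≤-reflexive (cong (A ℕ.+_) (sym (ℕ.+-identityʳ A))))
      where
      swap : ∀ u Λ → u ℕ.* (Λ ℕ.* u) ≡ Λ ℕ.* (u ℕ.* u)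
      swap = solve-∀

  unit : ℕ → ℕ → ℕ
  unit q Λ = (m ℕ.* square Λ q) ℕ.* (m ℕ.* (suc q ℕ.* n))

  module _ (q Λ : ℕ) (1≤m : 1 ℕ.≤ m) (1≤n : 1 ℕ.≤ n) (1≤Λ : 1 ℕ.≤ Λ) where
    private
      X = unit q Λ
      left≥1 : 1 ℕ.≤ m ℕ.* square Λ q
      left≥1 = ℕ.*-mono-≤ 1≤m (1≤square q 1≤Λ)
      right≥1 : 1 ℕ.≤ m ℕ.* (suc q ℕ.* n)
      right≥1 = ℕ.*-mono-≤ 1≤m (ℕ.*-mono-≤ (s≤s (z≤n {q})) 1≤n)

    1≤unit : 1 ℕ.≤ X
    1≤unit = ℕ.*-mono-≤ left≥1 right≥1

    suc-q≤unit : suc q ℕ.≤ X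
    suc-q≤unit = ℕ.≤-trans (x≤x*y (suc q) 1≤n) (ℕ.≤-trans (x≤y*x (suc q ℕ.* n) 1≤m) (x≤y*x _ left≥1))

    approximation-bound : approximationTime q Λ ℕ.≤ 583 ℕ.* X
    approximation-bound = begin
      approximationTime q Λ ≡⟨ expand Λ q m (iterationsFor q Λ ℕ.* suc (iterationTimeFor q)) ⟩
      15 ℕ.+ 4 ℕ.* Λ ℕ.+ 5 ℕ.* q ℕ.+ 6 ℕ.* m ℕ.+ iterationsFor q Λ ℕ.* suc (iterationTimeFor q)
        ≤⟨ ℕ.+-mono-≤ (ℕ.+-mono-≤ (ℕ.+-mono-≤ (ℕ.+-mono-≤ (ℕ.*-monoʳ-≤ 15 1≤unit) (ℕ.*-monoʳ-≤ 4 Λ≤)) (ℕ.*-monoʳ-≤ 5 (ℕ.≤-trans (ℕ.n≤1+n q) suc-q≤unit)))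
             (ℕ.*-monoʳ-≤ 6 m≤)) (ℕ.*-mono-≤ (iterations-bound q Λ 1≤m 1≤Λ) (iteration-bound q 1≤m 1≤n)) ⟩
      15 ℕ.* X ℕ.+ 4 ℕ.* X ℕ.+ 5 ℕ.* X ℕ.+ 6 ℕ.* X ℕ.+ (7 ℕ.* (m ℕ.* square Λ q)) ℕ.* (79 ℕ.* (m ℕ.* (suc q ℕ.* n)))
        ≡⟨ collect (m ℕ.* square Λ q) (m ℕ.* (suc q ℕ.* n)) ⟩
      583 ℕ.* X ∎
      where
      open ℕ.≤-Reasoning
      Λ≤ : Λ ℕ.≤ X
      Λ≤ = ℕ.≤-trans (x≤x*y Λ (s≤s (z≤n {q ℕ.+ q ℕ.* suc q}))) (ℕ.≤-trans (x≤y*x (square Λ q) 1≤m) (x≤x*y _ right≥1))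
      m≤ : m ℕ.≤ X
      m≤ = ℕ.≤-trans (x≤x*y m (1≤square q 1≤Λ)) (x≤x*y _ right≥1)
      expand : ∀ Λ q m z → (3 ℕ.+ suc (Λ ℕ.* 4)) ℕ.+ ((2 ℕ.+ (2 ℕ.+ q ℕ.* 5)) ℕ.+ (((2 ℕ.+ m ℕ.* 6) ℕ.+ 4) ℕ.+ suc z))
        ≡ 15 ℕ.+ 4 ℕ.* Λ ℕ.+ 5 ℕ.* q ℕ.+ 6 ℕ.* m ℕ.+ z
      expand = solve-∀
      collect : ∀ a b → 15 ℕ.* (a ℕ.* b) ℕ.+ 4 ℕ.* (a ℕ.* b) ℕ.+ 5 ℕ.* (a ℕ.* b) ℕ.+ 6 ℕ.* (a ℕ.* b) ℕ.+ (7 ℕ.* a) ℕ.* (79 ℕ.* b) ≡ 583 ℕ.* (a ℕ.* b)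
      collect = solve-∀

module Assembly (R : RealNumbers) where
  open RealArithmetic R
  open Hoare R
  open Dovetail R
  open Halting R

  module _ (N : Network R) (ε : ℝ) where
    open Network N
    open Flows N
    open InputOutput N
    open Machine N ε
    open FlowTheory N
    open Output N ε
    open Approximation N ε
    open Certificate N ε
    open TimeBound N ε

    input : Input (inputStore ε)
    input = record
      { n≡ = refl ; m≡ = refl ; s≡ = refl ; t≡ = refl ; L≡ = refl
      ; src≡ = λ e → at-allFin (λ e → toℕ (src e)) e ; tgt≡ = λ e → at-allFin (λ e → toℕ (tgt e)) e ; ℓ≡ = at-allFin ℓ ; ε≡ = refl ; c≡ = at-allFin c }
      where
      at-tabulate : ∀ {A : Set} {d : A} {B : Set} {k} (f : B → A) (g : Fin k → B) i → at d (map f (tabulate g)) (toℕ i) ≡ f (g i)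
      at-tabulate f g zero    = refl
      at-tabulate f g (suc i) = at-tabulate f (λ i → g (suc i)) i
      at-allFin : ∀ {A : Set} {d : A} (f : E → A) e → at d (map f (allFin m)) (toℕ e) ≡ f e
      at-allFin f e = at-tabulate f (λ e → e) e

    cube : ℝ
    cube = fromℕ 10 * (fromℕ 10 * fromℕ 10)

    0≤cube : 0# ≤ cube
    0≤cube = *-nonNeg (fromℕ-nonNeg 10) (*-nonNeg (fromℕ-nonNeg 10) (fromℕ-nonNeg 10))

    1≤n′ : 1 ℕ.≤ n
    1≤n′ = ℕ.≤-trans (s≤s z≤n) (Fin.toℕ<n s)

    1≤m : 𝒫 → 1 ℕ.≤ m
    1≤m P with edges P | edges-nonempty P
    ... | e ∷ _ | _ = ℕ.≤-trans (s≤s z≤n) (Fin.toℕ<n e)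

    1≤logBound : 1 ℕ.≤ logBound
    1≤logBound = ⌈log₂⌉-mono-≤ (s≤s L-positive)

    module _ (0<ε : 0# < ε) (ε≤1 : ε ≤ 1#) where

      private
        i = ε ⁻¹
        0≤i : 0# ≤ i
        0≤i = ⁻¹-nonNeg 0<ε

        1≤i : 1# ≤ i
        1≤i = *-cancelˡ-≤ ε 0<ε (≤-respˡ (≈-sym (*-identityʳ ε)) (≤-respʳ (≈-sym (⁻¹-inverseʳ 0<ε)) ε≤1))

        [εε]⁻¹ : (ε * ε) ⁻¹ ≈ i * i
        [εε]⁻¹ = begin
          (ε * ε) ⁻¹                       ≈⟨ solve 1 (λ x → x := x :* (:# 1 :* :# 1)) ≈-refl ((ε * ε) ⁻¹) ⟩
          (ε * ε) ⁻¹ * (1# * 1#)           ≈⟨ *-congˡ (*-cong (≈-sym (⁻¹-inverseʳ 0<ε)) (≈-sym (⁻¹-inverseʳ 0<ε))) ⟩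
          (ε * ε) ⁻¹ * ((ε * i) * (ε * i)) ≈⟨ solve 3 (λ x e i → x :* ((e :* i) :* (e :* i)) := (x :* (e :* e)) :* (i :* i)) ≈-refl ((ε * ε) ⁻¹) ε i ⟩
          ((ε * ε) ⁻¹ * (ε * ε)) * (i * i) ≈⟨ *-congʳ (⁻¹-inverseˡ (0<* 0<ε 0<ε)) ⟩
          1# * (i * i)                     ≈⟨ *-identityˡ _ ⟩
          i * i ∎
          where open import Relation.Binary.Reasoning.Setoid setoid

      clock-bound : ∀ q → fromℕ (ℕ.pred q) * ε ≤ fromℕ 8 → fromℕ (suc q) ≤ fromℕ 10 * i
      clock-bound q tight = ≤-trans (fromℕ-mono (s≤s (q≤ q)))
        (≤-respˡ (+-assoc 1# 1# _) (≤-trans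
          (+-mono-≤ (≤-trans (≤-reflexive (+-congˡ (≈-sym (+-identityʳ 1#)))) (≤-respˡ (*-identityʳ _) (*-monoʳ-≤ (fromℕ 2) (fromℕ-nonNeg 2) 1≤i)))
            (≤-respˡ (≈-trans (*-assoc _ _ _) (≈-trans (*-congˡ (⁻¹-inverseʳ 0<ε)) (*-identityʳ _)))
              (≤-respˡ (*-comm _ _) (≤-respʳ (*-comm _ _) (*-monoʳ-≤ i 0≤i tight)))))
          (≤-reflexive (solve 1 (λ i → :# 2 :* i :+ :# 8 :* i := :# 10 :* i) ≈-refl i))))
        where
        q≤ : ∀ q → q ℕ.≤ suc (ℕ.pred q)
        q≤ zero    = z≤n
        q≤ (suc q) = ℕ.≤-refl

      unit-bound : ∀ q → fromℕ (ℕ.pred q) * ε ≤ fromℕ 8 → fromℕ (unit q logBound) ≤ cube * runningTimeBound ε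
      unit-bound q tight = ≤-respˡ (≈-sym unit≈) (≤-trans
        (*-monoʳ-≤ (M * M * Nr * Λ) 0≤MMNΛ (*-mono-≤ (*-nonNeg 0≤U 0≤U) 0≤U (*-mono-≤ 0≤U 0≤U U≤ U≤) U≤))
        (≤-respʳ (*-congˡ (*-congʳ (*-congʳ (*-congˡ (≈-sym [εε]⁻¹)))))
          (≤-by (cube * (M * M * Nr * (i * i) * Λ * loglog))
            (*-nonNeg 0≤cube (*-nonNeg (*-nonNeg (*-nonNeg 0≤MMN (*-nonNeg 0≤i 0≤i)) (fromℕ-nonNeg logBound)) (fromℕ-nonNeg ⌈log₂ ⌈log₂ n ⌉ ⌉)))
            (solve 6 (λ m n l i g t →
               (t :* (t :* t)) :* (m :* m :* n :* (i :* i) :* l :* (g :+ i)) :=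
               (m :* m :* n :* l) :* (((t :* i) :* (t :* i)) :* (t :* i)) :+ (t :* (t :* t)) :* (m :* m :* n :* (i :* i) :* l :* g))
             ≈-refl M Nr Λ i loglog (fromℕ 10)))))
        where
        M = fromℕ m
        Nr = fromℕ n
        Λ = fromℕ logBound
        loglog = fromℕ ⌈log₂ ⌈log₂ n ⌉ ⌉
        U = fromℕ (suc q)
        0≤U : 0# ≤ U
        0≤U = fromℕ-nonNeg (suc q)
        U≤ = clock-bound q tight
        0≤MMN : 0# ≤ M * M * Nr
        0≤MMN = *-nonNeg (*-nonNeg (fromℕ-nonNeg m) (fromℕ-nonNeg m)) (fromℕ-nonNeg n)
        0≤MMNΛ : 0# ≤ M * M * Nr * Λ
        0≤MMNΛ = *-nonNeg 0≤MMN (fromℕ-nonNeg logBound)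
        unit≈ : fromℕ (unit q logBound) ≈ (M * M * Nr * Λ) * ((U * U) * U)
        unit≈ = ≈-trans (fromℕ-* (m ℕ.* square logBound q) (m ℕ.* (suc q ℕ.* n))) (≈-trans
          (*-cong (≈-trans (fromℕ-* m (square logBound q)) (*-congˡ (≈-trans (fromℕ-* logBound (suc q ℕ.* suc q)) (*-congˡ (fromℕ-* (suc q) (suc q))))))
                  (≈-trans (fromℕ-* m (suc q ℕ.* n)) (*-congˡ (fromℕ-* (suc q) n))))
          (solve 4 (λ m n l u → (m :* (l :* (u :* u))) :* (m :* (u :* n)) := (m :* m :* n :* l) :* ((u :* u) :* u)) ≈-refl M Nr Λ U))

  algorithm : Program
  algorithm = guarded exact ⨾ ifᶜ expired (ticked approximate) skip

  scaled-bound : ∀ k t {K T X B} → K ≡ k ℕ.* (t ℕ.* (t ℕ.* t)) → T ℕ.≤ k ℕ.* X →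
    fromℕ X ≤ (fromℕ t * (fromℕ t * fromℕ t)) * B → fromℕ T ≤ fromℕ K * B
  scaled-bound k t {K} {T} {X} {B} refl T≤ X≤ = ≤-trans (fromℕ-mono T≤) (≤-respˡ (≈-sym (fromℕ-* k X))
    (≤-respʳ (≈-trans (≈-sym (*-assoc _ _ _)) (*-congʳ (≈-sym (≈-trans (fromℕ-* k (t ℕ.* (t ℕ.* t)))
        (*-congˡ (≈-trans (fromℕ-* t (t ℕ.* t)) (*-congˡ (fromℕ-* t t))))))))
      (*-monoʳ-≤ (fromℕ k) (fromℕ-nonNeg k) X≤)))

  total-bound : ∀ k {u X T₁ T₂} → 1 ℕ.≤ X → u ℕ.≤ X → T₁ ℕ.≤ k ℕ.* u → T₂ ℕ.≤ 583 ℕ.* X → T₁ ℕ.+ suc T₂ ℕ.≤ (k ℕ.+ 584) ℕ.* X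
  total-bound k {X = X} 1≤X u≤ T₁≤ T₂≤ = ℕ.≤-trans (ℕ.+-mono-≤ (ℕ.≤-trans T₁≤ (ℕ.*-monoʳ-≤ k u≤)) (ℕ.+-mono-≤ 1≤X T₂≤))
    (ℕ.≤-reflexive (sym (ℕ.*-distribʳ-+ X k 584)))

  -- Abstract, since comparing fromℕ of large numerals is slow.
  abstract
    factor : ℕ
    factor = cost exact ℕ.+ 584

    factor≡ : factor ≡ cost exact ℕ.+ 584
    factor≡ = refl

    constant : ℕ
    constant = factor ℕ.* (10 ℕ.* (10 ℕ.* 10))

    constant≡ : constant ≡ factor ℕ.* (10 ℕ.* (10 ℕ.* 10))
    constant≡ = refl

  module _ (N : Network R) (P₀ : Flows.𝒫 N) (ε : ℝ) (ε-range : 0< ε ≤1) where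
    open Network N
    open Flows N
    open InputOutput N
    open Machine N ε
    open FlowTheory N
    open Output N ε
    open Approximation N ε
    open Certificate N ε
    open TimeBound N ε

    private
      0<ε = proj₁ ε-range
      ε≤1 = proj₂ ε-range

    Goal : Set
    Goal = ∃[ T ] ∃[ σ ] ∃[ x ]
      ( Run algorithm (inputStore ε) T σ × Outputs σ x × Feasible x × ValueAtLeastOPT/1+ ε x × StepsWithin constant ε T )

    conclude : ∀ {T σ} (X : Solution σ) → Run algorithm (inputStore ε) T σ →
      (∀ x → Feasible x → flowValue x ≤ (1# + ε) * total (Solution.entries X)) →
      StepsWithin constant ε T → Goal
    conclude {T} {σ} X run near steps = T , σ , outputFlow X , run , outputs X , outputs-feasible X , guaranteed , steps
      where
      0<1+ε : 0# < 1# + ε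
      0<1+ε = <-+-nonNeg 0<1 (proj₁ 0<ε)
      guaranteed : ValueAtLeastOPT/1+ ε (outputFlow X)
      guaranteed opt ((x , feasible , x≈opt) , _) = *-cancelˡ-≤ (1# + ε) 0<1+ε
        (≤-respˡ (≈-sym (≈-trans (solve 3 (λ e o j → e :* (o :* j) := (e :* j) :* o) ≈-refl (1# + ε) opt ((1# + ε) ⁻¹))
            (≈-trans (*-congʳ (⁻¹-inverseʳ 0<1+ε)) (*-identityˡ opt))))
          (≤-respˡ x≈opt (≤-respʳ (*-congˡ (≈-sym (outputs-value X))) (near x feasible))))

    within : ∀ {T} q → fromℕ (ℕ.pred q) * ε ≤ fromℕ 8 → T ℕ.≤ factor ℕ.* unit q logBound → StepsWithin constant ε T
    within {T} q tight T≤ = scaled-bound factor 10 {constant} {T} {unit q logBound} {runningTimeBound ε} constant≡ T≤ (unit-bound N ε 0<ε ε≤1 q tight)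

    module _ {T₁ σ₁} (run₁ : Run (guarded exact) (inputStore ε) T₁ σ₁) where
      private
        timed = guarded-time exact refl run₁
        module Timing = Timed timed
        q = nats σ₁ clock 0
        q≡ : q ≡ Timing.elapsed
        q≡ = trans Timing.now≡ (ℕ.+-identityʳ _)
        T₁≤ : T₁ ℕ.≤ cost exact ℕ.* suc q
        T₁≤ = subst (λ k → T₁ ℕ.≤ cost exact ℕ.* suc k) (sym q≡) Timing.cost≤
        I₁ : Input σ₁
        I₁ = input-kept refl (run-frame run₁) (input N ε)
        tight : fromℕ (ℕ.pred q) * ε ≤ fromℕ 8
        tight = subst (λ x → fromℕ (ℕ.pred q) * x ≤ fromℕ 8) (Input.ε≡ I₁)
          (Timing.tight (≤-respˡ (≈-sym (zeroˡ _)) (fromℕ-nonNeg 8)))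
        X = unit q logBound
        total≤ : ∀ {T₂} → T₂ ℕ.≤ 583 ℕ.* X → T₁ ℕ.+ suc T₂ ℕ.≤ factor ℕ.* X
        total≤ {T₂} T₂≤ = subst (λ k → T₁ ℕ.+ suc T₂ ℕ.≤ k ℕ.* X) (sym factor≡) (total-bound (cost exact) {suc q} {X}
          (1≤unit q logBound (1≤m N ε P₀) (1≤n′ N ε) (1≤logBound N ε)) (suc-q≤unit q logBound (1≤m N ε P₀) (1≤n′ N ε) (1≤logBound N ε)) T₁≤ T₂≤)

      after-expiry : Expired σ₁ → Goal
      after-expiry e = conclude (NearOptimal.solution (post A)) (seq run₁ (if-true (true-does (_ ≤? _) e) (runs A))) (NearOptimal.near (post A))
          (within q tight (total≤ (ℕ.≤-trans (time≤ A) (approximation-bound q logBound (1≤m N ε P₀) (1≤n′ N ε) (1≤logBound N ε)))))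
        where
        8≤qε : fromℕ 8 ≤ fromℕ q * ε
        8≤qε = subst (λ x → fromℕ 8 ≤ fromℕ q * x) (Input.ε≡ I₁) e
        8≤q : 8 ℕ.≤ q
        8≤q = fromℕ-cancel-≤ {8} {q} (≤-trans 8≤qε (≤-respʳ (*-identityʳ _) (*-monoʳ-≤ (fromℕ q) (fromℕ-nonNeg q) ε≤1)))
        A = approximateᵉ P₀ 8≤q 8≤qε I₁ refl

      in-time : ExactlySolved σ₁ → Goal
      in-time (S , optimal) = branch (fromℕ 8 ≤? fromℕ (nats σ₁ clock 0) * reals σ₁ 0 0)
        where
        open import Data.List.Relation.Unary.All as All using ()
        open Sums R using (sum-nonNeg)
        total≥0 : 0# ≤ total (Solution.entries S)
        total≥0 = sum-nonNeg (Solution.entries S) (λ _ ∈es → All.lookup (Solution.amounts≥0 S) ∈es)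
        branch : Dec (Expired σ₁) → Goal
        branch (yes e) = after-expiry e
        branch (no ¬e) = conclude S (seq run₁ (if-false (false-does (_ ≤? _) ¬e) skip))
          (λ x feasible → ≤-trans (optimal x feasible) (≤-by (ε * total (Solution.entries S)) (*-nonNeg (proj₁ 0<ε) total≥0)
            (solve 2 (λ e t → (:# 1 :+ e) :* t := t :+ e :* t) ≈-refl ε (total (Solution.entries S)))))
          (within q tight (total≤ (ℕ.*-mono-≤ (s≤s (z≤n {582})) (1≤unit q logBound (1≤m N ε P₀) (1≤n′ N ε) (1≤logBound N ε)))))

    resolve : ∀ {τ} → ExactlySolved τ → Outcome exact (inputStore ε) τ → Goal
    resolve optimal (inj₁ (_ , run₁))        = in-time run₁ optimal
    resolve optimal (inj₂ (_ , _ , run₁ , e)) = after-expiry run₁ e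

    solved : Goal
    solved = let (_ , X) = exactʰ P₀ (input N ε) in resolve (post X) (simulate exact refl (runs X))

mainTheorem5 : (R : RealNumbers) →
    ∃[ algorithm ] ∃[ C ]
    ((N : Network R) → Flows.𝒫 N →
    (ε : RealNumbers.ℝ R) → RealNumbers.0<_≤1 R ε →
    ∃[ T ] ∃[ σ ] ∃[ x ]
    ( Execution.Run R algorithm (InputOutput.inputStore N ε) T σ
    × InputOutput.Outputs N σ x
    × Flows.Feasible N x
    × Flows.ValueAtLeastOPT/1+ N ε x
    × InputOutput.StepsWithin N C ε T ))
mainTheorem5 R = Assembly.algorithm R , Assembly.constant R , Assembly.solved R
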